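{- For integers $n\ge 2$ and $H\ge 2$ there are constants $c_n,C_n>0$ depending only on $n$ such that: $c_2 H\log H\le R^*_2(H)\le C_2 H\log H$; $c_3 H^2\log H\le R^*_3(H)\le C_3 H^2\log H$; and for $n\ge 4$, $c_n H^{n-1}\le R^*_n(H)\le C_n H^{n-1}$.
   Context: A polynomial $f\in\mathbb{C}[X]$ is degenerate if it has two distinct roots whose quotient is a root of unity. $S^*_n(H)$ is the set of polynomials $a_0X^n+\dots+a_n\in\mathbb{Z}[X]$ with $a_0\ne0$, degenerate, and $|a_j|\le H$ for $j=0,\dots,n$. A polynomial in $\mathbb{Z}[X]$ is called reducible if it is reducible in $\mathbb{Q}[X]$. $R^*_n(H)$ is the number of reducible polynomials in $S^*_n(H)$. -}

module Defs where

open import Level using (0ℓ)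
open import Algebra.Bundles using (CommutativeRing)
open import Data.Nat as ℕ using (ℕ; zero; suc; _≤_; NonZero)
open import Data.Nat.Logarithm using (⌊log₂_⌋)
open import Data.Integer as ℤ using (ℤ; +_; -[1+_])
open import Data.Rational as ℚ using (ℚ)
open import Data.List using (List; []; _∷_; length; map)
open import Data.List.Membership.Propositional using (_∈_)
open import Data.List.Relation.Unary.Unique.Propositional using (Unique)
open import Data.Vec as Vec using (Vec; toList; head)
open import Data.Vec.Relation.Unary.All as VAll using ()
open import Data.Product using (Σ; ∃; _×_; _,_)
open import Relation.Nullary using (¬_)
open import Relation.Binary.PropositionalEquality using (_≡_)
open import Function.Bundles using (_⇔_)

-- Integer polynomials of degree n are coefficient vectors
--   a = (a₀ , a₁ , … , aₙ)  representing  a₀ Xⁿ + a₁ Xⁿ⁻¹ + … + aₙ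
-- (highest degree first, exactly as in the paper).

IntPoly : ℕ → Set
IntPoly n = Vec ℤ (suc n)

module _ (K : CommutativeRing 0ℓ 0ℓ) where
  open CommutativeRing K

  ιℕ : ℕ → Carrier
  ιℕ zero    = 0#
  ιℕ (suc n) = 1# + ιℕ n

  ιℤ : ℤ → Carrier
  ιℤ (+ n)     = ιℕ n
  ιℤ -[1+ n ]  = - (ιℕ (suc n))

  record IsChar0Field : Set where
    field
      1≉0      : ¬ (1# ≈ 0#)
      inverse  : ∀ x → ¬ (x ≈ 0#) → ∃ λ y → x * y ≈ 1#
      char0    : ∀ n → ¬ (ιℕ (suc n) ≈ 0#)

  evalList : List ℤ → Carrier → Carrier → Carrier
  evalList []       acc x = acc
  evalList (c ∷ cs) acc x = evalList cs (acc * x + ιℤ c) x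

  eval : ∀ {n} → IntPoly n → Carrier → Carrier
  eval a x = evalList (toList a) 0# x

  IsRoot : ∀ {n} → IntPoly n → Carrier → Set
  IsRoot a x = eval a x ≈ 0#

  pow : Carrier → ℕ → Carrier
  pow x zero    = 1#
  pow x (suc k) = x * pow x k

  IsRootOfUnity : Carrier → Set
  IsRootOfUnity z = Σ ℕ λ k → (1 ℕ.≤ k) × (pow z k ≈ 1#)

  DegenerateIn : ∀ {n} → IntPoly n → Set
  DegenerateIn a =
    Σ Carrier λ α → Σ Carrier λ β → Σ Carrier λ βinv →
      IsRoot a α × IsRoot a β × ¬ (α ≈ β) ×
      (β * βinv ≈ 1#) × IsRootOfUnity (α * βinv)

-- f is degenerate: it has two distinct roots (in an algebraically closed
-- field of characteristic 0, i.e. in some field of characteristic 0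
-- containing them) whose quotient is a root of unity.
Degenerate : ∀ {n} → IntPoly n → Set₁
Degenerate a = Σ (CommutativeRing 0ℓ 0ℓ) λ K →
  IsChar0Field K × DegenerateIn K a

-- Polynomials over ℚ as coefficient lists, LOWEST degree first.

QPoly : Set
QPoly = List ℚ

coeff : QPoly → ℕ → ℚ
coeff []       _       = ℚ.0ℚ
coeff (c ∷ _)  zero    = c
coeff (_ ∷ cs) (suc i) = coeff cs i

addQ : QPoly → QPoly → QPoly
addQ []       q        = q
addQ p        []       = p
addQ (a ∷ p)  (b ∷ q)  = (a ℚ.+ b) ∷ addQ p q

mulQ : QPoly → QPoly → QPoly
mulQ []      q = []
mulQ (a ∷ p) q = addQ (map (a ℚ.*_) q) (ℚ.0ℚ ∷ mulQ p q)

_≈P_ : QPoly → QPoly → Set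
p ≈P q = ∀ i → coeff p i ≡ coeff q i

NonConstant : QPoly → Set
NonConstant p = Σ ℕ λ i → (1 ℕ.≤ i) × ¬ (coeff p i ≡ ℚ.0ℚ)

toQPoly : ∀ {n} → IntPoly n → QPoly
toQPoly a = Data.List.reverse (map (λ z → z ℚ./ 1) (toList a))
  where import Data.List

-- reducible in ℚ[X]: product of two non-units of ℚ[X], i.e. of two
-- non-constant polynomials (f has degree n ≥ 1 here, so f is a nonzero non-unit)
Reducible : ∀ {n} → IntPoly n → Set
Reducible a = Σ QPoly λ g → Σ QPoly λ h →
  NonConstant g × NonConstant h × (toQPoly a ≈P mulQ g h)

InBox : ∀ {n} → ℕ → IntPoly n → Set
InBox H a = ¬ (head a ≡ ℤ.0ℤ) × VAll.All (λ c → ℤ.∣ c ∣ ℕ.≤ H) a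

InRStar : (n H : ℕ) → IntPoly n → Set₁
InRStar n H a = InBox H a × Degenerate a × Reducible a

IsCount : ∀ {A : Set} → (A → Set₁) → ℕ → Set₁
IsCount {A} P N = Σ (List A) λ L →
  Unique L × (length L ≡ N) × (∀ x → (x ∈ L) ⇔ P x)

RStarIs : (n H N : ℕ) → Set₁
RStarIs n H N = IsCount (InRStar n H) N

-- the growth functions of the theorem (log H replaced by ⌊log₂ H⌋,
-- which is the same up to constant factors for H ≥ 2)
growth : ℕ → ℕ → ℕ
growth 2 H = H ℕ.* ⌊log₂ H ⌋
growth 3 H = H ℕ.^ 2 ℕ.* ⌊log₂ H ⌋
growth n H = H ℕ.^ (n ℕ.∸ 1)

{-# OPTIONS --safe #-}
-- Upper bound.  Write a reducible f of degree n ≥ 3 as g h over ℤ (Gauss).  Interpolation gives |g| |h| ≪ |f| ≤ H for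
-- the heights.  Let α and β = ζ α be distinct roots of f with ζ a root of unity.  The order of ζ is bounded in terms
-- of n: up to denominators prime to 3, two of its bounded powers agree modulo 3, and a root of unity congruent to 1
-- modulo 3 is 1 (Serre).  Now fix g and all coefficients of h but the constant term.  If α and β are roots of
-- different factors, or both roots of h and the linear coefficient of h is not 0, then the constant term is
-- algebraic, in a uniformly bounded way, over data which take boundedly many values; all such constant terms are
-- roots of one integer polynomial of bounded degree, found by linear dependence in the product of all the fields
-- that occur.  If instead the linear coefficient of h is 0, a coefficient is saved anyway.  Summing over the dyadic
-- size of g gives H^(n - 1), with an additional log H exactly when all the dyadic pieces have the same size, that is
-- for n = 3.  For n = 2, f is E (x² X² - y²), and one sums H / max(x, y)² over x and y.
--
-- Lower bound.  The polynomials (a X² + b) (c X + d) for n = 3 and c (a² X² - b²) for n = 2, with a and b coprime and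
-- max(a, b) in dyadic layers, are pairwise distinct; for n ≥ 4 the multiples of X² + 1 are enough.
--
-- The number R*_n(H) exists because membership is decidable.  The fields in which degeneracy is tested are obtained
-- as F[X] modulo a maximal ideal, and running through an enumeration of F[X] and taking gcds along the way produces
-- such an ideal without factorisation.
module Submission where

open import Defs
open import Algebra.Bundles using (CommutativeRing)
import Algebra.Properties.Ring as RingProperties
import Algebra.Solver.Ring as RingSolver
open import Algebra.Solver.Ring.AlmostCommutativeRing using (fromCommutativeRing; _-Raw-AlmostCommutative⟶_)
open import Algebra.Structures using (IsCommutativeRing)
open import Data.Empty using (⊥; ⊥-elim)
open import Data.Fin using (Fin; zero; suc; toℕ)
import Data.Fin.Properties as Finₚ
open import Data.Integer as ℤ using (ℤ; +_; -[1+_])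
import Data.Integer.DivMod as ℤDivMod
open import Data.Integer.Divisibility.Signed as ℤ∣ using ()
import Data.Integer.Properties as ℤₚ
import Data.Integer.Solver as ℤSolvers
open import Data.List using (List; []; _∷_; _++_; length; map; replicate; concatMap; upTo; drop; filter)
open import Data.List.Membership.Propositional using (_∈_; find; lose)
import Data.List.Membership.Propositional.Properties as ∈ₚ
import Data.List.Properties as Listₚ
open import Data.List.Relation.Unary.All as All using (All; []; _∷_)
import Data.List.Relation.Unary.All.Properties as Allₚ
open import Data.List.Relation.Unary.Any as Any using (Any; here; there)
open import Data.List.Relation.Unary.Unique.Propositional using (Unique; []; _∷_)
import Data.List.Relation.Unary.Unique.Propositional.Properties as Uniqueₚ
open import Data.Maybe using (Maybe; just; nothing)
open import Data.Nat as ℕ using (ℕ; zero; suc; _+_; _*_; _∸_; _^_; _⊔_; _≤_; _<_; z≤n; s≤s; NonZero)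
open import Data.Nat.Coprimality as Coprimality using (Coprime; coprime-divisor; coprime-/gcd)
import Data.Nat.DivMod as ℕDivMod
import Data.Nat.Divisibility as ℕ∣
import Data.Nat.GCD as GCD
open import Data.Nat.ListAction using (product)
open import Data.Nat.Logarithm using (⌊log₂_⌋; ⌊log₂⌋-mono-≤; ⌊log₂[2^n]⌋≡n; ⌊log₂⌊n/2⌋⌋≡⌊log₂n⌋∸1)
open import Data.Nat.Primality using (Prime; euclidsLemma; prime⇒nonZero)
open import Data.Nat.Primality.Factorisation using (factorise; PrimeFactorisation)
import Data.Nat.Properties as ℕₚ
import Data.Nat.Solver as ℕSolvers
open import Data.Product using (Σ; ∃; ∃₂; _×_; _,_; proj₁; proj₂)
open import Data.Rational as ℚ using (ℚ)
import Data.Rational.Properties as ℚₚ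
import Data.Rational.Unnormalised as ℚᵘ
import Data.Rational.Unnormalised.Properties as ℚᵘₚ
open import Data.Sum using (_⊎_; inj₁; inj₂; [_,_]′)
open import Data.Unit using (tt)
open import Data.Vec as Vec using (Vec; []; _∷_)
import Data.Vec.Properties as Vecₚ
import Data.Vec.Relation.Unary.All as VecAll
open import Function using (_∘_; id; case_of_)
open import Function.Bundles using (mk⇔)
open import Level using (0ℓ)
open import Relation.Binary.PropositionalEquality using (_≡_; _≢_; refl; sym; trans; cong; cong₂; subst; subst₂; module ≡-Reasoning)
import Relation.Binary.Reasoning.Setoid as SetoidReasoning
open import Relation.Binary.Structures using (IsEquivalence)
open import Relation.Nullary using (¬_; Dec; yes; no; contradiction)
import Relation.Nullary.Decidable as Dec

-- `Degenerate` lets every polynomial bring its own field of characteristic 0; there is no common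
-- algebraic closure and no test for equality in the given field. Integrality is therefore witnessed
-- by a finitely generated ℤ-module that the element maps into itself: relations of known length
-- come from counting generators, and the argument survives in a product of fields, which has zero
-- divisors. Which factor vanishes at a given root is known only up to double negation; this is
-- harmless, because the bounds are decidable inequalities.
--
-- The prime 3 is the smallest that works: -1 is congruent to 1 modulo 2.
--
-- The balance behind the upper bound: let `2 ^ l` be about `H`, let `g` have degree `d + 1` and
-- height about `2 ^ i`, and save one coefficient of `h`. This leaves about
-- `2 ^ (i (d + 2) + (l - i) (n - d - 1))` choices. The exponent is at most `l (n - 1)` for all `i`
-- exactly when `d + 2 ≤ n - 1`, that is, when `h` is not linear. A linear factor must therefore
-- always play the role of `g`.

module ℕSolver = ℕSolvers.+-*-Solver
module ℤSolver = ℤSolvers.+-*-Solver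

-- Commutative rings: the image of ℤ, homomorphisms, ideals, quotients, products

module RingFacts (R : CommutativeRing 0ℓ 0ℓ) where
  open CommutativeRing R public
    using (_≈_; setoid; isEquivalence)
    renaming ( Carrier to A; _+_ to _⊕_; _*_ to _⊗_; -_ to ⊖_; _-_ to _⊝_; 0# to 𝟘; 1# to 𝟙
             ; refl to ≈-refl; sym to ≈-sym; trans to ≈-trans; reflexive to ≈-reflexive
             ; +-cong to ⊕-cong; *-cong to ⊗-cong; -‿cong to ⊖-cong
             ; +-congˡ to ⊕-congˡ; +-congʳ to ⊕-congʳ; *-congˡ to ⊗-congˡ; *-congʳ to ⊗-congʳ
             ; +-assoc to ⊕-assoc; +-comm to ⊕-comm; *-assoc to ⊗-assoc; *-comm to ⊗-comm
             ; +-identityˡ to ⊕-identityˡ; +-identityʳ to ⊕-identityʳ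
             ; *-identityˡ to ⊗-identityˡ; *-identityʳ to ⊗-identityʳ
             ; -‿inverseˡ to ⊖-inverseˡ; -‿inverseʳ to ⊖-inverseʳ
             ; distribˡ to ⊗-distribˡ; distribʳ to ⊗-distribʳ; zeroˡ to ⊗-zeroˡ; zeroʳ to ⊗-zeroʳ)
  open RingProperties (CommutativeRing.ring R) public
    using ()
    renaming (-0#≈0# to ⊖𝟘; -‿involutive to ⊖-involutive; -‿+-comm to ⊖-⊕-comm;
              -‿distribˡ-* to ⊖-distribˡ; -‿distribʳ-* to ⊖-distribʳ;
              x≈y⇒x∙y⁻¹≈ε to ≈⇒⊝≈𝟘; x∙y⁻¹≈ε⇒x≈y to ⊝≈𝟘⇒≈)
  module ≈-Reasoning = SetoidReasoning setoid
  open ≈-Reasoning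

  ι : ℤ → A
  ι = ιℤ R

  _^^_ : A → ℕ → A
  _^^_ = pow R

  ιℕ-+ : ∀ m n → ιℕ R (m + n) ≈ ιℕ R m ⊕ ιℕ R n
  ιℕ-+ zero n = ≈-sym (⊕-identityˡ _)
  ιℕ-+ (suc m) n = ≈-trans (⊕-congˡ (ιℕ-+ m n)) (≈-sym (⊕-assoc _ _ _))

  ιℕ-* : ∀ m n → ιℕ R (m * n) ≈ ιℕ R m ⊗ ιℕ R n
  ιℕ-* zero n = ≈-sym (⊗-zeroˡ _)
  ιℕ-* (suc m) n = begin
    ιℕ R (n + m * n)                    ≈⟨ ιℕ-+ n (m * n) ⟩
    ιℕ R n ⊕ ιℕ R (m * n)               ≈⟨ ⊕-cong (≈-sym (⊗-identityˡ _)) (ιℕ-* m n) ⟩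
    𝟙 ⊗ ιℕ R n ⊕ ιℕ R m ⊗ ιℕ R n        ≈⟨ ⊗-distribʳ _ _ _ ⟨
    (𝟙 ⊕ ιℕ R m) ⊗ ιℕ R n               ∎

  ι-neg : ∀ a → ι (ℤ.- a) ≈ ⊖ ι a
  ι-neg (+ zero) = ≈-sym ⊖𝟘
  ι-neg (+ suc n) = ≈-refl
  ι-neg -[1+ n ] = ≈-sym (⊖-involutive _)

  cancel-𝟙 : ∀ x y → (𝟙 ⊕ x) ⊝ (𝟙 ⊕ y) ≈ x ⊝ y
  cancel-𝟙 x y = begin
    (𝟙 ⊕ x) ⊕ ⊖ (𝟙 ⊕ y)       ≈⟨ ⊕-cong (⊕-comm _ _) (≈-sym (⊖-⊕-comm _ _)) ⟩
    (x ⊕ 𝟙) ⊕ (⊖ 𝟙 ⊕ ⊖ y)     ≈⟨ ⊕-assoc _ _ _ ⟩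
    x ⊕ (𝟙 ⊕ (⊖ 𝟙 ⊕ ⊖ y))     ≈⟨ ⊕-congˡ (⊕-assoc _ _ _) ⟨
    x ⊕ ((𝟙 ⊕ ⊖ 𝟙) ⊕ ⊖ y)     ≈⟨ ⊕-congˡ (⊕-congʳ (⊖-inverseʳ _)) ⟩
    x ⊕ (𝟘 ⊕ ⊖ y)             ≈⟨ ⊕-congˡ (⊕-identityˡ _) ⟩
    x ⊝ y                     ∎

  ι-⊖ : ∀ m n → ι (m ℤ.⊖ n) ≈ ιℕ R m ⊝ ιℕ R n
  ι-⊖ m zero = ≈-trans (≈-sym (⊕-identityʳ _)) (⊕-congˡ (≈-sym ⊖𝟘))
  ι-⊖ zero (suc n) = ≈-sym (⊕-identityˡ _)
  ι-⊖ (suc m) (suc n) = begin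
    ι (suc m ℤ.⊖ suc n)         ≡⟨ cong ι (ℤₚ.[1+m]⊖[1+n]≡m⊖n m n) ⟩
    ι (m ℤ.⊖ n)                 ≈⟨ ι-⊖ m n ⟩
    ιℕ R m ⊝ ιℕ R n             ≈⟨ cancel-𝟙 _ _ ⟨
    ιℕ R (suc m) ⊝ ιℕ R (suc n) ∎

  ι-+ : ∀ a b → ι (a ℤ.+ b) ≈ ι a ⊕ ι b
  ι-+ (+ m) (+ n) = ιℕ-+ m n
  ι-+ (+ m) -[1+ n ] = ι-⊖ m (suc n)
  ι-+ -[1+ m ] (+ n) = ≈-trans (ι-⊖ n (suc m)) (⊕-comm _ _)
  ι-+ -[1+ m ] -[1+ n ] = ≈-trans
    (⊖-cong (≈-trans (≈-reflexive (cong (ιℕ R) (cong suc (sym (ℕₚ.+-suc m n))))) (ιℕ-+ (suc m) (suc n))))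
    (≈-sym (⊖-⊕-comm _ _))

  ι-* : ∀ a b → ι (a ℤ.* b) ≈ ι a ⊗ ι b
  ι-* (+ m) (+ n) = ≈-trans (≈-reflexive (cong ι (sym (ℤₚ.pos-* m n)))) (ιℕ-* m n)
  ι-* (+ m) -[1+ n ] = begin
    ι (+ m ℤ.* -[1+ n ])       ≡⟨ cong ι (sym (ℤₚ.neg-distribʳ-* (+ m) (+ suc n))) ⟩
    ι (ℤ.- (+ m ℤ.* + suc n))  ≈⟨ ι-neg (+ m ℤ.* + suc n) ⟩
    ⊖ ι (+ m ℤ.* + suc n)      ≈⟨ ⊖-cong (ι-* (+ m) (+ suc n)) ⟩
    ⊖ (ι (+ m) ⊗ ι (+ suc n))  ≈⟨ ⊖-distribʳ _ _ ⟩
    ι (+ m) ⊗ ι -[1+ n ]       ∎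
  ι-* -[1+ m ] (+ n) = begin
    ι (-[1+ m ] ℤ.* + n)       ≡⟨ cong ι (sym (ℤₚ.neg-distribˡ-* (+ suc m) (+ n))) ⟩
    ι (ℤ.- (+ suc m ℤ.* + n))  ≈⟨ ι-neg (+ suc m ℤ.* + n) ⟩
    ⊖ ι (+ suc m ℤ.* + n)      ≈⟨ ⊖-cong (ι-* (+ suc m) (+ n)) ⟩
    ⊖ (ι (+ suc m) ⊗ ι (+ n))  ≈⟨ ⊖-distribˡ _ _ ⟩
    ι -[1+ m ] ⊗ ι (+ n)       ∎
  ι-* -[1+ m ] -[1+ n ] = begin
    ιℕ R (suc m * suc n)       ≈⟨ ιℕ-* (suc m) (suc n) ⟩
    x ⊗ y                      ≈⟨ ⊖-involutive _ ⟨
    ⊖ (⊖ (x ⊗ y))              ≈⟨ ⊖-cong (⊖-distribʳ _ _) ⟩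
    ⊖ (x ⊗ ⊖ y)                ≈⟨ ⊖-distribˡ _ _ ⟩
    ⊖ x ⊗ ⊖ y                  ∎
    where x = ιℕ R (suc m)
          y = ιℕ R (suc n)

  ι-1 : ι (+ 1) ≈ 𝟙
  ι-1 = ⊕-identityʳ 𝟙

  -- Agrees with ι up to ≈, but sends 0, 1 and -1 to 𝟘, 𝟙 and ⊖ 𝟙 definitionally.
  coefficient : ℤ → A
  coefficient (+ 0) = 𝟘
  coefficient (+ 1) = 𝟙
  coefficient -[1+ 0 ] = ⊖ 𝟙
  coefficient a = ι a

  coefficient-ι : ∀ a → coefficient a ≈ ι a
  coefficient-ι (+ 0) = ≈-refl
  coefficient-ι (+ 1) = ≈-sym ι-1
  coefficient-ι (+ suc (suc n)) = ≈-refl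
  coefficient-ι -[1+ 0 ] = ⊖-cong (≈-sym ι-1)
  coefficient-ι -[1+ suc n ] = ≈-refl

  module Solver where
    morphism : CommutativeRing.rawRing ℤₚ.+-*-commutativeRing -Raw-AlmostCommutative⟶ fromCommutativeRing R
    morphism = record
      { ⟦_⟧ = coefficient
      ; +-homo = λ a b → ≈-trans (coefficient-ι (a ℤ.+ b))
          (≈-trans (ι-+ a b) (⊕-cong (≈-sym (coefficient-ι a)) (≈-sym (coefficient-ι b))))
      ; *-homo = λ a b → ≈-trans (coefficient-ι (a ℤ.* b))
          (≈-trans (ι-* a b) (⊗-cong (≈-sym (coefficient-ι a)) (≈-sym (coefficient-ι b))))
      ; -‿homo = λ a → ≈-trans (coefficient-ι (ℤ.- a)) (≈-trans (ι-neg a) (⊖-cong (≈-sym (coefficient-ι a))))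
      ; 0-homo = ≈-refl
      ; 1-homo = ≈-refl }

    equal? : ∀ a b → Maybe (coefficient a ≈ coefficient b)
    equal? a b with a ℤ.≟ b
    ... | yes refl = just ≈-refl
    ... | no _ = nothing

    open RingSolver (CommutativeRing.rawRing ℤₚ.+-*-commutativeRing) (fromCommutativeRing R) morphism equal? public
      using (solve; _:+_; _:*_; _:-_; :-_; _:=_; con)

  open Solver public using (solve; _:+_; _:*_; _:-_; :-_; _:=_)

  :0 :1 : ∀ {n} → RingSolver.Polynomial (CommutativeRing.rawRing ℤₚ.+-*-commutativeRing) (fromCommutativeRing R) Solver.morphism Solver.equal? n
  :0 = Solver.con (+ 0)
  :1 = Solver.con (+ 1)

  ^^-cong : ∀ {x y} k → x ≈ y → x ^^ k ≈ y ^^ k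
  ^^-cong zero e = ≈-refl
  ^^-cong (suc k) e = ⊗-cong e (^^-cong k e)

  ^^-+ : ∀ x j k → x ^^ (j + k) ≈ x ^^ j ⊗ x ^^ k
  ^^-+ x zero k = ≈-sym (⊗-identityˡ _)
  ^^-+ x (suc j) k = ≈-trans (⊗-congˡ (^^-+ x j k)) (≈-sym (⊗-assoc _ _ _))

  ⊗-^^ : ∀ x y k → (x ⊗ y) ^^ k ≈ x ^^ k ⊗ y ^^ k
  ⊗-^^ x y zero = ≈-sym (⊗-identityˡ _)
  ⊗-^^ x y (suc k) = ≈-trans (⊗-congˡ (⊗-^^ x y k))
    (solve 4 (λ a b c d → (a :* b) :* (c :* d) := (a :* c) :* (b :* d)) ≈-refl x y (x ^^ k) (y ^^ k))

  𝟙^^ : ∀ k → 𝟙 ^^ k ≈ 𝟙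
  𝟙^^ zero = ≈-refl
  𝟙^^ (suc k) = ≈-trans (⊗-identityˡ _) (𝟙^^ k)

  ^^-* : ∀ x j k → x ^^ (j * k) ≈ (x ^^ k) ^^ j
  ^^-* x zero k = ≈-refl
  ^^-* x (suc j) k = ≈-trans (^^-+ x k (j * k)) (⊗-congˡ (^^-* x j k))

  ι-^ : ∀ a k → ι (a ℤ.^ k) ≈ ι a ^^ k
  ι-^ a zero = ι-1
  ι-^ a (suc k) = ≈-trans (ι-* a (a ℤ.^ k)) (⊗-congˡ (ι-^ a k))

module _ {A : Set} {_≈_ : A → A → Set} {_+_ _*_ : A → A → A} { -_ : A → A} {0# 1# : A} where

  isCommutativeRing : IsEquivalence _≈_ →
    (∀ {x y u v} → x ≈ y → u ≈ v → (x + u) ≈ (y + v)) →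
    (∀ {x y u v} → x ≈ y → u ≈ v → (x * u) ≈ (y * v)) →
    (∀ {x y} → x ≈ y → (- x) ≈ (- y)) →
    (∀ x y z → ((x + y) + z) ≈ (x + (y + z))) →
    (∀ x y → (x + y) ≈ (y + x)) →
    (∀ x → (0# + x) ≈ x) →
    (∀ x → ((- x) + x) ≈ 0#) →
    (∀ x y z → ((x * y) * z) ≈ (x * (y * z))) →
    (∀ x y → (x * y) ≈ (y * x)) →
    (∀ x → (1# * x) ≈ x) →
    (∀ x y z → (x * (y + z)) ≈ ((x * y) + (x * z))) →
    IsCommutativeRing _≈_ _+_ _*_ -_ 0# 1#
  isCommutativeRing eq +-cong *-cong neg-cong +-assoc +-comm +-idˡ neg-invˡ *-assoc *-comm *-idˡ distribˡ = record
    { isRing = record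
      { +-isAbelianGroup = record
        { isGroup = record
          { isMonoid = record
            { isSemigroup = record
              { isMagma = record { isEquivalence = eq ; ∙-cong = +-cong }
              ; assoc = +-assoc }
            ; identity = +-idˡ , λ x → tr (+-comm x 0#) (+-idˡ x) }
          ; inverse = neg-invˡ , λ x → tr (+-comm x (- x)) (neg-invˡ x)
          ; ⁻¹-cong = neg-cong }
        ; comm = +-comm }
      ; *-cong = *-cong
      ; *-assoc = *-assoc
      ; *-identity = *-idˡ , λ x → tr (*-comm x 1#) (*-idˡ x)
      ; distrib = distribˡ , λ x y z →
          tr (*-comm (y + z) x) (tr (distribˡ x y z) (+-cong (*-comm x y) (*-comm x z))) }
    ; *-comm = *-comm }
    where tr = IsEquivalence.trans eq

record Hom (R S : CommutativeRing 0ℓ 0ℓ) : Set where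
  private
    module R = RingFacts R
    module S = RingFacts S
  field
    ⟦_⟧    : R.A → S.A
    ⟦⟧-cong : ∀ {x y} → x R.≈ y → ⟦ x ⟧ S.≈ ⟦ y ⟧
    ⟦⟧-+    : ∀ x y → ⟦ x R.⊕ y ⟧ S.≈ ⟦ x ⟧ S.⊕ ⟦ y ⟧
    ⟦⟧-*    : ∀ x y → ⟦ x R.⊗ y ⟧ S.≈ ⟦ x ⟧ S.⊗ ⟦ y ⟧
    ⟦⟧-1    : ⟦ R.𝟙 ⟧ S.≈ S.𝟙

  ⟦⟧-0 : ⟦ R.𝟘 ⟧ S.≈ S.𝟘
  ⟦⟧-0 = begin
    ⟦ R.𝟘 ⟧                              ≈⟨ S.solve 1 (λ z → z S.:= (z S.:+ z) S.:- z) S.≈-refl _ ⟩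
    (⟦ R.𝟘 ⟧ S.⊕ ⟦ R.𝟘 ⟧) S.⊝ ⟦ R.𝟘 ⟧    ≈⟨ S.⊕-congʳ (⟦⟧-+ R.𝟘 R.𝟘) ⟨
    ⟦ R.𝟘 R.⊕ R.𝟘 ⟧ S.⊝ ⟦ R.𝟘 ⟧          ≈⟨ S.⊕-congʳ (⟦⟧-cong (R.⊕-identityˡ _)) ⟩
    ⟦ R.𝟘 ⟧ S.⊝ ⟦ R.𝟘 ⟧                  ≈⟨ S.⊖-inverseʳ _ ⟩
    S.𝟘                                  ∎
    where open S.≈-Reasoning

  ⟦⟧-neg : ∀ x → ⟦ R.⊖ x ⟧ S.≈ S.⊖ ⟦ x ⟧
  ⟦⟧-neg x = begin
    ⟦ R.⊖ x ⟧                            ≈⟨ S.solve 2 (λ n z → n S.:= (n S.:+ z) S.:- z) S.≈-refl _ _ ⟩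
    (⟦ R.⊖ x ⟧ S.⊕ ⟦ x ⟧) S.⊝ ⟦ x ⟧      ≈⟨ S.⊕-congʳ (⟦⟧-+ _ _) ⟨
    ⟦ R.⊖ x R.⊕ x ⟧ S.⊝ ⟦ x ⟧            ≈⟨ S.⊕-congʳ (S.≈-trans (⟦⟧-cong (R.⊖-inverseˡ x)) ⟦⟧-0) ⟩
    S.𝟘 S.⊝ ⟦ x ⟧                        ≈⟨ S.⊕-identityˡ _ ⟩
    S.⊖ ⟦ x ⟧                            ∎
    where open S.≈-Reasoning

  ⟦⟧-ιℕ : ∀ n → ⟦ ιℕ R n ⟧ S.≈ ιℕ S n
  ⟦⟧-ιℕ zero = ⟦⟧-0
  ⟦⟧-ιℕ (suc n) = S.≈-trans (⟦⟧-+ _ _) (S.⊕-cong ⟦⟧-1 (⟦⟧-ιℕ n))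

  ⟦⟧-ι : ∀ a → ⟦ R.ι a ⟧ S.≈ S.ι a
  ⟦⟧-ι (+ n) = ⟦⟧-ιℕ n
  ⟦⟧-ι -[1+ n ] = S.≈-trans (⟦⟧-neg _) (S.⊖-cong (⟦⟧-ιℕ (suc n)))

  ⟦⟧-^ : ∀ x k → ⟦ x R.^^ k ⟧ S.≈ ⟦ x ⟧ S.^^ k
  ⟦⟧-^ x zero = ⟦⟧-1
  ⟦⟧-^ x (suc k) = S.≈-trans (⟦⟧-* _ _) (S.⊗-congˡ (⟦⟧-^ x k))

identityHom : (R : CommutativeRing 0ℓ 0ℓ) → Hom R R
identityHom R = record
  { ⟦_⟧ = id ; ⟦⟧-cong = id ; ⟦⟧-+ = λ _ _ → ≈-refl ; ⟦⟧-* = λ _ _ → ≈-refl ; ⟦⟧-1 = ≈-refl }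
  where open RingFacts R

composeHom : ∀ {R S T} → Hom S T → Hom R S → Hom R T
composeHom {T = T} g f = record
  { ⟦_⟧ = g.⟦_⟧ ∘ f.⟦_⟧
  ; ⟦⟧-cong = g.⟦⟧-cong ∘ f.⟦⟧-cong
  ; ⟦⟧-+ = λ x y → ≈-trans (g.⟦⟧-cong (f.⟦⟧-+ x y)) (g.⟦⟧-+ _ _)
  ; ⟦⟧-* = λ x y → ≈-trans (g.⟦⟧-cong (f.⟦⟧-* x y)) (g.⟦⟧-* _ _)
  ; ⟦⟧-1 = ≈-trans (g.⟦⟧-cong f.⟦⟧-1) g.⟦⟧-1 }
  where
  module g = Hom g
  module f = Hom f
  open RingFacts T

ℤ-ring : CommutativeRing 0ℓ 0ℓ
ℤ-ring = ℤₚ.+-*-commutativeRing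

ιHom : (R : CommutativeRing 0ℓ 0ℓ) → Hom ℤ-ring R
ιHom R = record
  { ⟦_⟧ = ι ; ⟦⟧-cong = λ { refl → ≈-refl } ; ⟦⟧-+ = ι-+ ; ⟦⟧-* = ι-* ; ⟦⟧-1 = ι-1 }
  where open RingFacts R

record Ideal (R : CommutativeRing 0ℓ 0ℓ) : Set₁ where
  open RingFacts R
  field
    member   : A → Set
    resp     : ∀ {x y} → x ≈ y → member x → member y
    0-closed : member 𝟘
    +-closed : ∀ {x y} → member x → member y → member (x ⊕ y)
    *-closed : ∀ r {x} → member x → member (r ⊗ x)

  neg-closed : ∀ {x} → member x → member (⊖ x)
  neg-closed {x} m = resp (solve 1 (λ x → :- :1 :* x := :- x) ≈-refl x) (*-closed (⊖ 𝟙) m)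

  *-closedˡ : ∀ r {x} → member x → member (x ⊗ r)
  *-closedˡ r m = resp (⊗-comm _ _) (*-closed r m)

zeroIdeal : (R : CommutativeRing 0ℓ 0ℓ) → Ideal R
zeroIdeal R = record
  { member = _≈ 𝟘
  ; resp = λ e m → ≈-trans (≈-sym e) m
  ; 0-closed = ≈-refl
  ; +-closed = λ m n → ≈-trans (⊕-cong m n) (⊕-identityˡ _)
  ; *-closed = λ r m → ≈-trans (⊗-congˡ m) (⊗-zeroʳ r) }
  where open RingFacts R

module Quotient (R : CommutativeRing 0ℓ 0ℓ) (I : Ideal R) where
  open RingFacts R
  open Ideal I

  -- A record, so that the two sides can be inferred from the type of a proof.
  record _~_ (x y : A) : Set where
    constructor ⟨_⟩
    field difference : member (x ⊝ y)
  open _~_ public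

  ≈⇒~ : ∀ {x y} → x ≈ y → x ~ y
  ≈⇒~ e = ⟨ resp (≈-sym (≈⇒⊝≈𝟘 e)) 0-closed ⟩

  abstract
    -- Abstract, so that comparing two rings never unfolds the proofs of their laws.
    quotientLaws : IsCommutativeRing _~_ _⊕_ _⊗_ ⊖_ 𝟘 𝟙
    quotientLaws = isCommutativeRing
      (record
        { refl = ≈⇒~ ≈-refl
        ; sym = λ {x} {y} e → ⟨ resp (solve 2 (λ x y → :- (x :- y) := y :- x) ≈-refl x y) (neg-closed (difference e)) ⟩
        ; trans = λ {x} {y} {z} e f → ⟨ resp (solve 3 (λ x y z → (x :- y) :+ (y :- z) := x :- z) ≈-refl x y z)
                                        (+-closed (difference e) (difference f)) ⟩ })
      (λ {x} {y} {u} {v} e f → ⟨ resp (solve 4 (λ x y u v → (x :- y) :+ (u :- v) := (x :+ u) :- (y :+ v)) ≈-refl x y u v)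
                                 (+-closed (difference e) (difference f)) ⟩)
      (λ {x} {y} {u} {v} e f → ⟨ resp (solve 4 (λ x y u v → u :* (x :- y) :+ y :* (u :- v) := x :* u :- y :* v) ≈-refl x y u v)
                                 (+-closed (*-closed u (difference e)) (*-closed y (difference f))) ⟩)
      (λ {x} {y} e → ⟨ resp (solve 2 (λ x y → :- (x :- y) := :- x :- :- y) ≈-refl x y) (neg-closed (difference e)) ⟩)
      (λ x y z → ≈⇒~ (⊕-assoc x y z))
      (λ x y → ≈⇒~ (⊕-comm x y))
      (λ x → ≈⇒~ (⊕-identityˡ x))
      (λ x → ≈⇒~ (⊖-inverseˡ x))
      (λ x y z → ≈⇒~ (⊗-assoc x y z))
      (λ x y → ≈⇒~ (⊗-comm x y))
      (λ x → ≈⇒~ (⊗-identityˡ x))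
      (λ x y z → ≈⇒~ (⊗-distribˡ x y z))

  quotientRing : CommutativeRing 0ℓ 0ℓ
  quotientRing = record { isCommutativeRing = quotientLaws }

  projection : Hom R quotientRing
  projection = record
    { ⟦_⟧ = id
    ; ⟦⟧-cong = ≈⇒~
    ; ⟦⟧-+ = λ _ _ → ≈⇒~ ≈-refl
    ; ⟦⟧-* = λ _ _ → ≈⇒~ ≈-refl
    ; ⟦⟧-1 = ≈⇒~ ≈-refl }

  ~𝟘⇒member : ∀ {x} → x ~ 𝟘 → member x
  ~𝟘⇒member {x} e = resp (solve 1 (λ x → x :- :0 := x) ≈-refl x) (difference e)

  member⇒~𝟘 : ∀ {x} → member x → x ~ 𝟘
  member⇒~𝟘 {x} m = ⟨ resp (solve 1 (λ x → x := x :- :0) ≈-refl x) m ⟩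

module Product {I : Set} (R : I → CommutativeRing 0ℓ 0ℓ) where
  private module R i = RingFacts (R i)

  abstract
    productLaws : IsCommutativeRing {A = (i : I) → R.A i} (λ x y → ∀ i → R._≈_ i (x i) (y i))
      (λ x y i → R._⊕_ i (x i) (y i)) (λ x y i → R._⊗_ i (x i) (y i)) (λ x i → R.⊖_ i (x i)) (λ i → R.𝟘 i) (λ i → R.𝟙 i)
    productLaws = isCommutativeRing
      (record
        { refl = λ i → R.≈-refl i
        ; sym = λ e i → R.≈-sym i (e i)
        ; trans = λ e f i → R.≈-trans i (e i) (f i) })
      (λ e f i → R.⊕-cong i (e i) (f i))
      (λ e f i → R.⊗-cong i (e i) (f i))
      (λ e i → R.⊖-cong i (e i))
      (λ x y z i → R.⊕-assoc i (x i) (y i) (z i))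
      (λ x y i → R.⊕-comm i (x i) (y i))
      (λ x i → R.⊕-identityˡ i (x i))
      (λ x i → R.⊖-inverseˡ i (x i))
      (λ x y z i → R.⊗-assoc i (x i) (y i) (z i))
      (λ x y i → R.⊗-comm i (x i) (y i))
      (λ x i → R.⊗-identityˡ i (x i))
      (λ x y z i → R.⊗-distribˡ i (x i) (y i) (z i))

  productRing : CommutativeRing 0ℓ 0ℓ
  productRing = record { isCommutativeRing = productLaws }

  component : ∀ i → Hom productRing (R i)
  component i = record
    { ⟦_⟧ = λ x → x i
    ; ⟦⟧-cong = λ e → e i
    ; ⟦⟧-+ = λ _ _ → R.≈-refl i
    ; ⟦⟧-* = λ _ _ → R.≈-refl i
    ; ⟦⟧-1 = R.≈-refl i }

-- Polynomials over a commutative ring and their evaluation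

module Polynomials (R : CommutativeRing 0ℓ 0ℓ) where
  open RingFacts R

  Poly : Set
  Poly = List A

  coef : Poly → ℕ → A
  coef [] i = 𝟘
  coef (a ∷ p) zero = a
  coef (a ∷ p) (suc i) = coef p i

  -- Lists may end in zeros, so that sums and products are computed without any test for zero. The
  -- price is that the length of a list only bounds the degree.
  record _≋_ (p q : Poly) : Set where
    constructor pointwise
    field at : ∀ i → coef p i ≈ coef q i
  open _≋_ public

  infix 4 _≋_
  infixl 6 _⊞_
  infixl 7 _⊠_

  _⊞_ : Poly → Poly → Poly
  [] ⊞ q = q
  p ⊞ [] = p
  (a ∷ p) ⊞ (b ∷ q) = (a ⊕ b) ∷ (p ⊞ q)

  scale : A → Poly → Poly
  scale c = map (c ⊗_)

  _⊠_ : Poly → Poly → Poly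
  [] ⊠ q = []
  (a ∷ p) ⊠ q = scale a q ⊞ (𝟘 ∷ p ⊠ q)

  neg : Poly → Poly
  neg = map ⊖_

  X : Poly
  X = 𝟘 ∷ 𝟙 ∷ []

  coef-⊞ : ∀ p q i → coef (p ⊞ q) i ≈ coef p i ⊕ coef q i
  coef-⊞ [] q i = ≈-sym (⊕-identityˡ _)
  coef-⊞ (a ∷ p) [] i = ≈-sym (⊕-identityʳ _)
  coef-⊞ (a ∷ p) (b ∷ q) zero = ≈-refl
  coef-⊞ (a ∷ p) (b ∷ q) (suc i) = coef-⊞ p q i

  coef-scale : ∀ c p i → coef (scale c p) i ≈ c ⊗ coef p i
  coef-scale c [] i = ≈-sym (⊗-zeroʳ c)
  coef-scale c (a ∷ p) zero = ≈-refl
  coef-scale c (a ∷ p) (suc i) = coef-scale c p i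

  coef-neg : ∀ p i → coef (neg p) i ≈ ⊖ coef p i
  coef-neg [] i = ≈-sym ⊖𝟘
  coef-neg (a ∷ p) zero = ≈-refl
  coef-neg (a ∷ p) (suc i) = coef-neg p i

  coef-⊠ : ∀ a p q i → coef ((a ∷ p) ⊠ q) i ≈ a ⊗ coef q i ⊕ coef (𝟘 ∷ p ⊠ q) i
  coef-⊠ a p q i = ≈-trans (coef-⊞ (scale a q) (𝟘 ∷ p ⊠ q) i) (⊕-congʳ (coef-scale a q i))

  coef-beyond : ∀ p i → length p ≤ i → coef p i ≈ 𝟘
  coef-beyond [] i l = ≈-refl
  coef-beyond (a ∷ p) (suc i) (s≤s l) = coef-beyond p i l

  ≋-refl : ∀ {p} → p ≋ p
  ≋-refl = pointwise λ i → ≈-refl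

  ≋-sym : ∀ {p q} → p ≋ q → q ≋ p
  ≋-sym e = pointwise λ i → ≈-sym (at e i)

  ≋-trans : ∀ {p q r} → p ≋ q → q ≋ r → p ≋ r
  ≋-trans e f = pointwise λ i → ≈-trans (at e i) (at f i)

  ≋-equiv : IsEquivalence _≋_
  ≋-equiv = record { refl = ≋-refl ; sym = ≋-sym ; trans = ≋-trans }

  ∷-cong : ∀ {a b p q} → a ≈ b → p ≋ q → (a ∷ p) ≋ (b ∷ q)
  ∷-cong e f = pointwise λ { zero → e ; (suc i) → at f i }

  tail-≋ : ∀ {a b p q} → (a ∷ p) ≋ (b ∷ q) → p ≋ q
  tail-≋ e = pointwise λ i → at e (suc i)

  ⊞-cong : ∀ {p q r s} → p ≋ q → r ≋ s → p ⊞ r ≋ q ⊞ s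
  ⊞-cong {p} {q} {r} {s} e f = pointwise λ i →
    ≈-trans (coef-⊞ p r i) (≈-trans (⊕-cong (at e i) (at f i)) (≈-sym (coef-⊞ q s i)))

  scale-cong : ∀ {a b p q} → a ≈ b → p ≋ q → scale a p ≋ scale b q
  scale-cong {a} {b} {p} {q} e f = pointwise λ i →
    ≈-trans (coef-scale a p i) (≈-trans (⊗-cong e (at f i)) (≈-sym (coef-scale b q i)))

  neg-cong : ∀ {p q} → p ≋ q → neg p ≋ neg q
  neg-cong {p} {q} e = pointwise λ i →
    ≈-trans (coef-neg p i) (≈-trans (⊖-cong (at e i)) (≈-sym (coef-neg q i)))

  ⊞-assoc : ∀ p q r → (p ⊞ q) ⊞ r ≋ p ⊞ (q ⊞ r)
  ⊞-assoc p q r = pointwise λ i → begin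
    coef ((p ⊞ q) ⊞ r) i                ≈⟨ coef-⊞ (p ⊞ q) r i ⟩
    coef (p ⊞ q) i ⊕ coef r i           ≈⟨ ⊕-congʳ (coef-⊞ p q i) ⟩
    (coef p i ⊕ coef q i) ⊕ coef r i    ≈⟨ ⊕-assoc _ _ _ ⟩
    coef p i ⊕ (coef q i ⊕ coef r i)    ≈⟨ ⊕-congˡ (coef-⊞ q r i) ⟨
    coef p i ⊕ coef (q ⊞ r) i           ≈⟨ coef-⊞ p (q ⊞ r) i ⟨
    coef (p ⊞ (q ⊞ r)) i                ∎
    where open ≈-Reasoning

  ⊞-comm : ∀ p q → p ⊞ q ≋ q ⊞ p
  ⊞-comm p q = pointwise λ i → ≈-trans (coef-⊞ p q i) (≈-trans (⊕-comm _ _) (≈-sym (coef-⊞ q p i)))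

  neg-inverse : ∀ p → neg p ⊞ p ≋ []
  neg-inverse p = pointwise λ i →
    ≈-trans (coef-⊞ (neg p) p i) (≈-trans (⊕-congʳ (coef-neg p i)) (⊖-inverseˡ _))

  ⊠-congˡ : ∀ p {q r} → q ≋ r → p ⊠ q ≋ p ⊠ r
  ⊠-congˡ [] e = ≋-refl
  ⊠-congˡ (a ∷ p) e = ⊞-cong (scale-cong ≈-refl e) (∷-cong ≈-refl (⊠-congˡ p e))

  ⊠-distribˡ : ∀ p q r → p ⊠ (q ⊞ r) ≋ p ⊠ q ⊞ p ⊠ r
  ⊠-distribˡ [] q r = ≋-refl
  ⊠-distribˡ (a ∷ p) q r = pointwise λ i → begin
    coef ((a ∷ p) ⊠ (q ⊞ r)) i                                       ≈⟨ coef-⊠ a p (q ⊞ r) i ⟩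
    a ⊗ coef (q ⊞ r) i ⊕ coef (𝟘 ∷ p ⊠ (q ⊞ r)) i                    ≈⟨ ⊕-cong (⊗-congˡ (coef-⊞ q r i)) (shifted i) ⟩
    a ⊗ (coef q i ⊕ coef r i) ⊕ (coef (𝟘 ∷ p ⊠ q) i ⊕ coef (𝟘 ∷ p ⊠ r) i)
      ≈⟨ solve 5 (λ a x y u v → a :* (x :+ y) :+ (u :+ v) := (a :* x :+ u) :+ (a :* y :+ v)) ≈-refl _ _ _ _ _ ⟩
    (a ⊗ coef q i ⊕ coef (𝟘 ∷ p ⊠ q) i) ⊕ (a ⊗ coef r i ⊕ coef (𝟘 ∷ p ⊠ r) i)
      ≈⟨ ⊕-cong (coef-⊠ a p q i) (coef-⊠ a p r i) ⟨
    coef ((a ∷ p) ⊠ q) i ⊕ coef ((a ∷ p) ⊠ r) i                      ≈⟨ coef-⊞ ((a ∷ p) ⊠ q) ((a ∷ p) ⊠ r) i ⟨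
    coef ((a ∷ p) ⊠ q ⊞ (a ∷ p) ⊠ r) i                               ∎
    where
    open ≈-Reasoning
    shifted : ∀ i → coef (𝟘 ∷ p ⊠ (q ⊞ r)) i ≈ coef (𝟘 ∷ p ⊠ q) i ⊕ coef (𝟘 ∷ p ⊠ r) i
    shifted zero = ≈-sym (⊕-identityˡ _)
    shifted (suc i) = ≈-trans (at (⊠-distribˡ p q r) i) (coef-⊞ (p ⊠ q) (p ⊠ r) i)

  ⊠-[] : ∀ p → p ⊠ [] ≋ []
  ⊠-[] [] = ≋-refl
  ⊠-[] (a ∷ p) = pointwise λ { zero → ≈-refl ; (suc i) → at (⊠-[] p) i }

  ⊠-∷ : ∀ p b q → p ⊠ (b ∷ q) ≋ scale b p ⊞ (𝟘 ∷ p ⊠ q)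
  ⊠-∷ [] b q = pointwise λ { zero → ≈-refl ; (suc i) → ≈-refl }
  ⊠-∷ (a ∷ p) b q = pointwise λ
    { zero → ⊕-congʳ (⊗-comm a b)
    ; (suc i) → begin
        coef (scale a q ⊞ p ⊠ (b ∷ q)) i                       ≈⟨ coef-⊞ (scale a q) (p ⊠ (b ∷ q)) i ⟩
        coef (scale a q) i ⊕ coef (p ⊠ (b ∷ q)) i              ≈⟨ ⊕-congˡ (≈-trans (at (⊠-∷ p b q) i) (coef-⊞ (scale b p) (𝟘 ∷ p ⊠ q) i)) ⟩
        coef (scale a q) i ⊕ (coef (scale b p) i ⊕ coef (𝟘 ∷ p ⊠ q) i)
          ≈⟨ solve 3 (λ x y z → x :+ (y :+ z) := y :+ (x :+ z)) ≈-refl _ _ _ ⟩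
        coef (scale b p) i ⊕ (coef (scale a q) i ⊕ coef (𝟘 ∷ p ⊠ q) i) ≈⟨ ⊕-congˡ (coef-⊞ (scale a q) (𝟘 ∷ p ⊠ q) i) ⟨
        coef (scale b p) i ⊕ coef ((a ∷ p) ⊠ q) i              ≈⟨ coef-⊞ (scale b p) ((a ∷ p) ⊠ q) i ⟨
        coef (scale b p ⊞ (a ∷ p) ⊠ q) i                       ∎ }
    where open ≈-Reasoning

  ⊠-comm : ∀ p q → p ⊠ q ≋ q ⊠ p
  ⊠-comm [] q = ≋-sym (⊠-[] q)
  ⊠-comm (a ∷ p) q = ≋-trans (⊞-cong {scale a q} ≋-refl (∷-cong ≈-refl (⊠-comm p q))) (≋-sym (⊠-∷ q a p))

  ⊠-cong : ∀ {p q r s} → p ≋ q → r ≋ s → p ⊠ r ≋ q ⊠ s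
  ⊠-cong {p} {q} {r} {s} e f = ≋-trans (⊠-congˡ p f) (≋-trans (⊠-comm p s) (≋-trans (⊠-congˡ s e) (⊠-comm s q)))

  ⊠-distribʳ : ∀ p q r → (q ⊞ r) ⊠ p ≋ q ⊠ p ⊞ r ⊠ p
  ⊠-distribʳ p q r = ≋-trans (⊠-comm (q ⊞ r) p) (≋-trans (⊠-distribˡ p q r) (⊞-cong (⊠-comm p q) (⊠-comm p r)))

  scale-⊞ : ∀ c p q → scale c (p ⊞ q) ≋ scale c p ⊞ scale c q
  scale-⊞ c p q = pointwise λ i → ≈-trans (coef-scale c (p ⊞ q) i)
    (≈-trans (⊗-congˡ (coef-⊞ p q i)) (≈-trans (⊗-distribˡ _ _ _)
    (≈-trans (⊕-cong (≈-sym (coef-scale c p i)) (≈-sym (coef-scale c q i))) (≈-sym (coef-⊞ (scale c p) (scale c q) i)))))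

  scale-scale : ∀ c d p → scale (c ⊗ d) p ≋ scale c (scale d p)
  scale-scale c d p = pointwise λ i → ≈-trans (coef-scale (c ⊗ d) p i) (≈-trans (⊗-assoc _ _ _)
    (≈-trans (⊗-congˡ (≈-sym (coef-scale d p i))) (≈-sym (coef-scale c (scale d p) i))))

  scale-⊠ : ∀ c p q → scale c p ⊠ q ≋ scale c (p ⊠ q)
  scale-⊠ c [] q = ≋-refl
  scale-⊠ c (a ∷ p) q = ≋-trans
    (⊞-cong {scale (c ⊗ a) q} (scale-scale c a q) (∷-cong (≈-sym (⊗-zeroʳ c)) (scale-⊠ c p q)))
    (≋-sym (scale-⊞ c (scale a q) (𝟘 ∷ p ⊠ q)))

  scale-𝟘 : ∀ p → scale 𝟘 p ≋ []
  scale-𝟘 p = pointwise λ i → ≈-trans (coef-scale 𝟘 p i) (⊗-zeroˡ _)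

  shift-⊠ : ∀ p q → (𝟘 ∷ p) ⊠ q ≋ 𝟘 ∷ p ⊠ q
  shift-⊠ p q = ⊞-cong {scale 𝟘 q} (scale-𝟘 q) ≋-refl

  ⊠-assoc : ∀ p q r → (p ⊠ q) ⊠ r ≋ p ⊠ (q ⊠ r)
  ⊠-assoc [] q r = ≋-refl
  ⊠-assoc (a ∷ p) q r = ≋-trans (⊠-distribʳ r (scale a q) (𝟘 ∷ p ⊠ q))
    (⊞-cong {scale a q ⊠ r} (scale-⊠ a q r) (≋-trans (shift-⊠ (p ⊠ q) r) (∷-cong ≈-refl (⊠-assoc p q r))))

  const-⊠ : ∀ c p → (c ∷ []) ⊠ p ≋ scale c p
  const-⊠ c p = pointwise λ i → ≈-trans (coef-⊞ (scale c p) (𝟘 ∷ []) i)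
    (≈-trans (⊕-congˡ (zeros i)) (⊕-identityʳ _))
    where
    zeros : ∀ i → coef (𝟘 ∷ []) i ≈ 𝟘
    zeros zero = ≈-refl
    zeros (suc i) = ≈-refl

  ⊠-identityˡ : ∀ p → (𝟙 ∷ []) ⊠ p ≋ p
  ⊠-identityˡ p = ≋-trans (const-⊠ 𝟙 p) (pointwise λ i → ≈-trans (coef-scale 𝟙 p i) (⊗-identityˡ _))

  abstract
    polynomialLaws : IsCommutativeRing _≋_ _⊞_ _⊠_ neg [] (𝟙 ∷ [])
    polynomialLaws = isCommutativeRing ≋-equiv ⊞-cong ⊠-cong neg-cong ⊞-assoc ⊞-comm (λ p → ≋-refl) neg-inverse ⊠-assoc ⊠-comm ⊠-identityˡ ⊠-distribˡ

  polynomialRing : CommutativeRing 0ℓ 0ℓ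
  polynomialRing = record { isCommutativeRing = polynomialLaws }

  constantHom : Hom R polynomialRing
  constantHom = record
    { ⟦_⟧ = λ c → c ∷ []
    ; ⟦⟧-cong = λ e → ∷-cong e ≋-refl
    ; ⟦⟧-+ = λ _ _ → ≋-refl
    ; ⟦⟧-* = λ a b → pointwise λ { zero → ≈-sym (⊕-identityʳ _) ; (suc i) → ≈-refl }
    ; ⟦⟧-1 = ≋-refl }

  module _ (I : Ideal R) where
    open Ideal I

    coef-⊠-member : ∀ p q → (∀ i → member (coef p i)) → ∀ i → member (coef (p ⊠ q) i)
    coef-⊠-member [] q m i = 0-closed
    coef-⊠-member (a ∷ p) q m i = resp (≈-sym (coef-⊠ a p q i)) (+-closed (*-closedˡ _ (m 0)) (rest i))
      where
      rest : ∀ i → member (coef (𝟘 ∷ p ⊠ q) i)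
      rest zero = 0-closed
      rest (suc i) = coef-⊠-member p q (m ∘ suc) i

    coef-⊠-above : ∀ p q d e → (∀ i → d < i → member (coef p i)) → (∀ j → e < j → member (coef q j)) →
      ∀ k → d + e < k → member (coef (p ⊠ q) k)
    coef-⊠-above [] q d e mp mq k l = 0-closed
    coef-⊠-above (a ∷ p) q d e mp mq (suc k) l = resp (≈-sym (coef-⊠ a p q (suc k)))
      (+-closed (*-closed a (mq (suc k) (ℕₚ.≤-trans (s≤s (ℕₚ.m≤n+m e d)) l))) (rest d mp l))
      where
      rest : ∀ d → (∀ i → d < i → member (coef (a ∷ p) i)) → d + e < suc k → member (coef (p ⊠ q) k)
      rest zero mp l = coef-⊠-member p q (λ i → mp (suc i) (s≤s z≤n)) k
      rest (suc d) mp (s≤s l) = coef-⊠-above p q d e (λ i l → mp (suc i) (s≤s l)) mq k l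

    -- Working modulo an ideal serves two purposes: `zeroIdeal` gives the leading coefficient of a
    -- product, and `multiples p` gives the decisive step of Gauss's lemma.
    coef-⊠-top : ∀ p q d e → (∀ i → d < i → member (coef p i)) → (∀ j → e < j → member (coef q j)) →
      member (coef (p ⊠ q) (d + e) ⊝ coef p d ⊗ coef q e)
    coef-⊠-top [] q d e mp mq = resp (solve 1 (λ x → :0 := :0 :- :0 :* x) ≈-refl _) 0-closed
    coef-⊠-top (a ∷ p) q zero e mp mq = resp
      (≈-trans (solve 2 (λ x y → y := (x :+ y) :- x) ≈-refl (a ⊗ coef q e) _) (⊕-congʳ (≈-sym (coef-⊠ a p q e))))
      (rest e)
      where
      rest : ∀ i → member (coef (𝟘 ∷ p ⊠ q) i)
      rest zero = 0-closed
      rest (suc i) = coef-⊠-member p q (λ i → mp (suc i) (s≤s z≤n)) i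
    coef-⊠-top (a ∷ p) q (suc d) e mp mq = resp
      (≈-trans (solve 3 (λ x y z → x :+ (y :- z) := (x :+ y) :- z) ≈-refl _ _ _) (⊕-congʳ (≈-sym (coef-⊠ a p q (suc d + e)))))
      (+-closed (*-closed a (mq (suc d + e) (s≤s (ℕₚ.m≤n+m e d))))
                (coef-⊠-top p q d e (λ i l → mp (suc i) (s≤s l)) mq))

    leading? : (∀ x → Dec (member x)) → ∀ p →
      (∀ i → member (coef p i)) ⊎ ∃ λ d → ¬ member (coef p d) × (∀ i → d < i → member (coef p i))
    leading? dec [] = inj₁ λ i → 0-closed
    leading? dec (a ∷ p) with leading? dec p
    ... | inj₂ (d , nonmember , above) = inj₂ (suc d , nonmember , λ { (suc i) (s≤s l) → above i l })
    ... | inj₁ all with dec a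
    ... | yes m = inj₁ λ { zero → m ; (suc i) → all i }
    ... | no nm = inj₂ (0 , nm , λ { (suc i) l → all i })

module Evaluation {R S : CommutativeRing 0ℓ 0ℓ} (φ : Hom R S) (s : RingFacts.A S) where
  open Hom φ
  open Polynomials R
  open RingFacts S
  private module R = RingFacts R

  evalAt : Poly → A
  evalAt [] = 𝟘
  evalAt (a ∷ p) = ⟦ a ⟧ ⊕ s ⊗ evalAt p

  evalAt-zero : ∀ p → p ≋ [] → evalAt p ≈ 𝟘
  evalAt-zero [] e = ≈-refl
  evalAt-zero (a ∷ p) e = ≈-trans
    (⊕-cong (≈-trans (⟦⟧-cong (at e 0)) ⟦⟧-0) (⊗-congˡ (evalAt-zero p (pointwise λ i → at e (suc i)))))
    (solve 1 (λ s → :0 :+ s :* :0 := :0) ≈-refl s)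

  evalAt-cong : ∀ {p q} → p ≋ q → evalAt p ≈ evalAt q
  evalAt-cong {[]} {q} e = ≈-sym (evalAt-zero q (≋-sym e))
  evalAt-cong {a ∷ p} {[]} e = evalAt-zero (a ∷ p) e
  evalAt-cong {a ∷ p} {b ∷ q} e = ⊕-cong (⟦⟧-cong (at e 0)) (⊗-congˡ (evalAt-cong (tail-≋ e)))

  evalAt-⊞ : ∀ p q → evalAt (p ⊞ q) ≈ evalAt p ⊕ evalAt q
  evalAt-⊞ [] q = ≈-sym (⊕-identityˡ _)
  evalAt-⊞ (a ∷ p) [] = ≈-sym (⊕-identityʳ _)
  evalAt-⊞ (a ∷ p) (b ∷ q) = ≈-trans (⊕-cong (⟦⟧-+ a b) (⊗-congˡ (evalAt-⊞ p q)))
    (solve 5 (λ a b s x y → (a :+ b) :+ s :* (x :+ y) := (a :+ s :* x) :+ (b :+ s :* y)) ≈-refl _ _ _ _ _)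

  evalAt-scale : ∀ c p → evalAt (scale c p) ≈ ⟦ c ⟧ ⊗ evalAt p
  evalAt-scale c [] = ≈-sym (⊗-zeroʳ _)
  evalAt-scale c (a ∷ p) = ≈-trans (⊕-cong (⟦⟧-* c a) (⊗-congˡ (evalAt-scale c p)))
    (solve 4 (λ c a s x → c :* a :+ s :* (c :* x) := c :* (a :+ s :* x)) ≈-refl _ _ _ _)

  evalAt-⊠ : ∀ p q → evalAt (p ⊠ q) ≈ evalAt p ⊗ evalAt q
  evalAt-⊠ [] q = ≈-sym (⊗-zeroˡ _)
  evalAt-⊠ (a ∷ p) q = ≈-trans (evalAt-⊞ (scale a q) (R.𝟘 ∷ p ⊠ q))
    (≈-trans (⊕-cong (evalAt-scale a q) (⊕-cong ⟦⟧-0 (⊗-congˡ (evalAt-⊠ p q))))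
    (solve 4 (λ a q s x → a :* q :+ (:0 :+ s :* (x :* q)) := (a :+ s :* x) :* q) ≈-refl _ _ _ _))

  evaluation : Hom polynomialRing S
  evaluation = record
    { ⟦_⟧ = evalAt
    ; ⟦⟧-cong = evalAt-cong
    ; ⟦⟧-+ = evalAt-⊞
    ; ⟦⟧-* = evalAt-⊠
    ; ⟦⟧-1 = ≈-trans (⊕-cong ⟦⟧-1 (⊗-zeroʳ s)) (⊕-identityʳ 𝟙) }

  evalAt-X : evalAt X ≈ s
  evalAt-X = ≈-trans (⊕-cong ⟦⟧-0 (⊗-congˡ (≈-trans (⊕-cong ⟦⟧-1 (⊗-zeroʳ s)) (⊕-identityʳ 𝟙))))
    (≈-trans (⊕-identityˡ _) (≈-trans (⊗-comm s 𝟙) (⊗-identityˡ s)))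

  evalAt-constant : ∀ c → evalAt (c ∷ []) ≈ ⟦ c ⟧
  evalAt-constant c = ≈-trans (⊕-congˡ (⊗-zeroʳ s)) (⊕-identityʳ _)

module _ {R S T : CommutativeRing 0ℓ 0ℓ} (φ : Hom R S) (ψ : Hom S T) (s : RingFacts.A S) where
  open RingFacts T

  hom-evalAt : ∀ p → Hom.⟦ ψ ⟧ (Evaluation.evalAt φ s p) ≈ Evaluation.evalAt (composeHom ψ φ) (Hom.⟦ ψ ⟧ s) p
  hom-evalAt [] = Hom.⟦⟧-0 ψ
  hom-evalAt (a ∷ p) = ≈-trans (Hom.⟦⟧-+ ψ _ _) (⊕-congˡ (≈-trans (Hom.⟦⟧-* ψ _ _) (⊗-congˡ (hom-evalAt p))))

module _ (R : CommutativeRing 0ℓ 0ℓ) where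
  open Polynomials R
  open RingFacts R
  private module P = RingFacts polynomialRing

  constant-X : ∀ a p → (a ∷ []) ⊞ X ⊠ p ≋ a ∷ p
  constant-X a p = P.≈-trans (P.⊕-congˡ {a ∷ []} X-⊠) (∷-cong (⊕-identityʳ a) ≋-refl)
    where
    X-⊠ : X ⊠ p ≋ 𝟘 ∷ p
    X-⊠ = P.≈-trans (shift-⊠ (𝟙 ∷ []) p) (∷-cong ≈-refl (⊠-identityˡ p))

  -- In a quotient of the polynomial ring this says that a polynomial takes its own residue class as
  -- value at the class of `X`; so the class of `X` is a root of the modulus.
  evalAt-generic : ∀ p → Evaluation.evalAt constantHom X p ≋ p
  evalAt-generic [] = ≋-refl
  evalAt-generic (a ∷ p) = P.≈-trans (P.⊕-congˡ {a ∷ []} (P.⊗-congˡ {X} (evalAt-generic p))) (constant-X a p)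

-- Finitely generated ℤ-modules: integral elements, linear dependence, Nakayama modulo 3

OneMod3 : ℤ → Set
OneMod3 c = ∃ λ k → c ≡ + 1 ℤ.+ + 3 ℤ.* k

oneMod3-1 : OneMod3 (+ 1)
oneMod3-1 = + 0 , refl

oneMod3-* : ∀ {a b} → OneMod3 a → OneMod3 b → OneMod3 (a ℤ.* b)
oneMod3-* (k , refl) (l , refl) = k ℤ.+ l ℤ.+ + 3 ℤ.* (k ℤ.* l) ,
  ℤSolver.solve 2 (λ k l → (con (+ 1) :+ con (+ 3) :* k) :* (con (+ 1) :+ con (+ 3) :* l)
    := con (+ 1) :+ con (+ 3) :* (k :+ l :+ con (+ 3) :* (k :* l))) refl k l
  where open ℤSolver

oneMod3-minus : ∀ {a} b → OneMod3 a → OneMod3 (a ℤ.- + 3 ℤ.* b)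
oneMod3-minus b (k , refl) = k ℤ.- b ,
  ℤSolver.solve 2 (λ k b → (con (+ 1) :+ con (+ 3) :* k) :- con (+ 3) :* b := con (+ 1) :+ con (+ 3) :* (k :- b)) refl k b
  where open ℤSolver

-- The purpose of this class of integers: `nakayama` produces one of them that annihilates a module,
-- and no nonzero integer annihilates a module containing 1 in characteristic 0.
oneMod3-≢0 : ∀ {a} → OneMod3 a → a ≢ + 0
oneMod3-≢0 (k , e) z = contradiction (ℕₚ.m*n≡1⇒m≡1 3 ℤ.∣ k ∣ (trans (sym (ℤₚ.abs-* (+ 3) k)) (cong ℤ.∣_∣ three-k))) (λ ())
  where
  three-k : + 3 ℤ.* k ≡ ℤ.- + 1
  three-k = trans (ℤSolver.solve 1 (λ x → x := con (+ 1) :+ x :- con (+ 1)) refl (+ 3 ℤ.* k)) (cong (ℤ._- + 1) (trans (sym e) z))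
    where open ℤSolver

module Spans (R : CommutativeRing 0ℓ 0ℓ) where
  open RingFacts R
  open ≈-Reasoning

  -- The coefficients are peeled off one generator at a time, and the generators may be dependent.
  -- In this form the elimination arguments below are recursions on the list of generators.
  data Span : List A → A → Set where
    nil : ∀ {y} → y ≈ 𝟘 → Span [] y
    _▹_ : ∀ {e es y} a → Span es (y ⊝ ι a ⊗ e) → Span (e ∷ es) y

  infixr 5 _▹_

  span-resp : ∀ es {x y} → x ≈ y → Span es x → Span es y
  span-resp [] e (nil s) = nil (≈-trans (≈-sym e) s)
  span-resp (_ ∷ es) e (a ▹ s) = a ▹ span-resp es (⊕-congʳ e) s

  span-+ : ∀ es {x y} → Span es x → Span es y → Span es (x ⊕ y)
  span-+ [] (nil s) (nil t) = nil (≈-trans (⊕-cong s t) (⊕-identityˡ _))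
  span-+ (e ∷ es) {x} {y} (a ▹ s) (b ▹ t) = (a ℤ.+ b) ▹ span-resp es
    (begin
      (x ⊝ ι a ⊗ e) ⊕ (y ⊝ ι b ⊗ e)
        ≈⟨ solve 5 (λ x y a b e → (x :- a :* e) :+ (y :- b :* e) := (x :+ y) :- (a :+ b) :* e) ≈-refl x y (ι a) (ι b) e ⟩
      (x ⊕ y) ⊝ (ι a ⊕ ι b) ⊗ e        ≈⟨ ⊕-congˡ (⊖-cong (⊗-congʳ (ι-+ a b))) ⟨
      (x ⊕ y) ⊝ ι (a ℤ.+ b) ⊗ e        ∎)
    (span-+ es s t)

  span-ι : ∀ es c {x} → Span es x → Span es (ι c ⊗ x)
  span-ι [] c (nil s) = nil (≈-trans (⊗-congˡ s) (⊗-zeroʳ _))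
  span-ι (e ∷ es) c {x} (a ▹ s) = (c ℤ.* a) ▹ span-resp es
    (begin
      ι c ⊗ (x ⊝ ι a ⊗ e)              ≈⟨ solve 4 (λ c a x e → c :* (x :- a :* e) := c :* x :- (c :* a) :* e) ≈-refl (ι c) (ι a) x e ⟩
      ι c ⊗ x ⊝ (ι c ⊗ ι a) ⊗ e        ≈⟨ ⊕-congˡ (⊖-cong (⊗-congʳ (ι-* c a))) ⟨
      ι c ⊗ x ⊝ ι (c ℤ.* a) ⊗ e        ∎)
    (span-ι es c s)

  span-𝟘 : ∀ es → Span es 𝟘
  span-𝟘 [] = nil ≈-refl
  span-𝟘 (e ∷ es) = + 0 ▹ span-resp es (solve 1 (λ e → :0 := :0 :- :0 :* e) ≈-refl e) (span-𝟘 es)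

  span-∷ : ∀ e es {y} → Span es y → Span (e ∷ es) y
  span-∷ e es {y} s = + 0 ▹ span-resp es (solve 2 (λ y e → y := y :- :0 :* e) ≈-refl y e) s

  span-∈ : ∀ {es e} → e ∈ es → Span es e
  span-∈ {e ∷ es} (here refl) = + 1 ▹ span-resp es
    (≈-trans (≈-sym (⊖-inverseʳ e)) (⊕-congˡ (⊖-cong (≈-trans (≈-sym (⊗-identityˡ e)) (⊗-congʳ (≈-sym ι-1))))))
    (span-𝟘 es)
  span-∈ {d ∷ es} (there m) = span-∷ d es (span-∈ m)

  span-map : ∀ {es fs} x → (∀ {e} → e ∈ es → Span fs (x ⊗ e)) → ∀ {y} → Span es y → Span fs (x ⊗ y)
  span-map {[]} {fs} x f (nil s) = span-resp fs (≈-sym (≈-trans (⊗-congˡ s) (⊗-zeroʳ x))) (span-𝟘 fs)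
  span-map {e ∷ es} {fs} x f {y} (a ▹ s) = span-resp fs
    (solve 4 (λ x y a e → x :* (y :- a :* e) :+ a :* (x :* e) := x :* y) ≈-refl x y (ι a) e)
    (span-+ fs (span-map x (f ∘ there) s) (span-ι fs a (f (here refl))))

  -- Integrality over ℤ, expressed by a stable finitely generated module instead of a monic
  -- equation. Sums and products of such elements keep the same module, so nothing has to be
  -- computed for them and the number of generators stays known.
  record Multiplier (es : List A) (x : A) : Set where
    constructor multiplier
    field apply : ∀ {e} → e ∈ es → Span es (x ⊗ e)
  open Multiplier public

  multiplier-span : ∀ {es x y} → Multiplier es x → Span es y → Span es (x ⊗ y)
  multiplier-span {x = x} m = span-map x (apply m)

  multiplier-resp : ∀ {es x y} → x ≈ y → Multiplier es x → Multiplier es y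
  multiplier-resp {es} e m = multiplier λ i → span-resp es (⊗-congʳ e) (apply m i)

  multiplier-+ : ∀ {es x y} → Multiplier es x → Multiplier es y → Multiplier es (x ⊕ y)
  multiplier-+ {es} {x} {y} m n = multiplier λ {e} i → span-resp es (≈-sym (⊗-distribʳ e x y)) (span-+ es (apply m i) (apply n i))

  multiplier-* : ∀ {es x y} → Multiplier es x → Multiplier es y → Multiplier es (x ⊗ y)
  multiplier-* {es} {x} {y} m n = multiplier λ {e} i → span-resp es (≈-sym (⊗-assoc x y e)) (multiplier-span m (apply n i))

  multiplier-ι : ∀ {es} c → Multiplier es (ι c)
  multiplier-ι {es} c = multiplier λ i → span-ι es c (span-∈ i)

  multiplier-^ : ∀ {es x} k → Multiplier es x → Multiplier es (x ^^ k)
  multiplier-^ zero m = multiplier-resp ι-1 (multiplier-ι (+ 1))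
  multiplier-^ (suc k) m = multiplier-* m (multiplier-^ k m)

  multiplier⇒span : ∀ {es x} → Span es 𝟙 → Multiplier es x → Span es x
  multiplier⇒span {es} {x} s m = span-resp es (≈-trans (⊗-comm x 𝟙) (⊗-identityˡ x)) (multiplier-span m s)

  powers : A → ℕ → List A
  powers x d = map (x ^^_) (upTo d)

  length-powers : ∀ x d → length (powers x d) ≡ d
  length-powers x d = trans (Listₚ.length-map (x ^^_) (upTo d)) (Listₚ.length-upTo d)

  power-∈ : ∀ x {d i} → i < d → x ^^ i ∈ powers x d
  power-∈ x l = ∈ₚ.∈-map⁺ (x ^^_) (∈ₚ.∈-upTo⁺ l)

  ∈-powers : ∀ x {d e} → e ∈ powers x d → ∃ λ i → i < d × e ≡ x ^^ i
  ∈-powers x m with ∈ₚ.∈-map⁻ (x ^^_) m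
  ... | i , j , eq = i , ∈ₚ.∈-upTo⁻ j , eq

  -- Multiplication by `x` shifts the list of powers, so only the last power can leave it.
  powers-multiplier : ∀ x d → Span (powers x d) (x ^^ d) → Multiplier (powers x d) x
  powers-multiplier x d s = multiplier λ m → step (∈-powers x m)
    where
    step : ∀ {e} → (∃ λ i → i < d × e ≡ x ^^ i) → Span (powers x d) (x ⊗ e)
    step (i , l , refl) with ℕₚ.m≤n⇒m<n∨m≡n l
    ... | inj₁ l′ = span-∈ (power-∈ x l′)
    ... | inj₂ refl = s

  products : List A → List A → List A
  products [] fs = []
  products (e ∷ es) fs = map (e ⊗_) fs ++ products es fs

  length-products : ∀ es fs → length (products es fs) ≡ length es * length fs
  length-products [] fs = refl
  length-products (e ∷ es) fs = trans (Listₚ.length-++ (map (e ⊗_) fs))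
    (cong₂ _+_ (Listₚ.length-map (e ⊗_) fs) (length-products es fs))

  ∈-products : ∀ {es fs g} → g ∈ products es fs → ∃₂ λ e f → e ∈ es × f ∈ fs × g ≡ e ⊗ f
  ∈-products {e ∷ es} {fs} m with ∈ₚ.∈-++⁻ (map (e ⊗_) fs) m
  ... | inj₁ k with ∈ₚ.∈-map⁻ (e ⊗_) k
  ... | f , j , eq = e , f , here refl , j , eq
  ∈-products {e ∷ es} {fs} m | inj₂ k with ∈-products {es} k
  ... | e′ , f , i , j , eq = e′ , f , there i , j , eq

  product-∈ : ∀ {es fs e f} → e ∈ es → f ∈ fs → (e ⊗ f) ∈ products es fs
  product-∈ (here refl) j = ∈ₚ.∈-++⁺ˡ (∈ₚ.∈-map⁺ _ j)
  product-∈ {e′ ∷ es} {fs} (there i) j = ∈ₚ.∈-++⁺ʳ (map (e′ ⊗_) fs) (product-∈ i j)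

  span-products : ∀ {es fs a b} → Span es a → Span fs b → Span (products es fs) (a ⊗ b)
  span-products {es} {fs} {a} {b} s t = span-map a
    (λ {f} j → span-resp (products es fs) (⊗-comm f a)
      (span-map f (λ {e} i → span-resp (products es fs) (⊗-comm e f) (span-∈ (product-∈ i j))) s)) t

  multiplier-productsˡ : ∀ {es fs x} → Multiplier es x → Multiplier (products es fs) x
  multiplier-productsˡ {es} {fs} {x} m = multiplier λ i → case ∈-products {es} {fs} i of λ where
    (e , f , j , k , refl) → span-resp (products es fs) (⊗-assoc x e f) (span-products (apply m j) (span-∈ k))

  multiplier-productsʳ : ∀ {es fs x} → Multiplier fs x → Multiplier (products es fs) x
  multiplier-productsʳ {es} {fs} {x} m = multiplier λ i → case ∈-products {es} {fs} i of λ where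
    (e , f , j , k , refl) → span-resp (products es fs)
      (solve 3 (λ e x f → e :* (x :* f) := x :* (e :* f)) ≈-refl e x f) (span-products (span-∈ j) (apply m k))

  combination : List ℤ → List A → A
  combination [] ys = 𝟘
  combination (c ∷ cs) [] = 𝟘
  combination (c ∷ cs) (y ∷ ys) = ι c ⊗ y ⊕ combination cs ys

  NonzeroList : List ℤ → Set
  NonzeroList = Any (_≢ + 0)

  Relation : List A → Set
  Relation ys = ∃ λ cs → length cs ≡ length ys × NonzeroList cs × combination cs ys ≈ 𝟘

  combination-scale : ∀ cs u ys → combination cs (map (u ⊗_) ys) ≈ u ⊗ combination cs ys
  combination-scale [] u ys = ≈-sym (⊗-zeroʳ u)
  combination-scale (c ∷ cs) u [] = ≈-sym (⊗-zeroʳ u)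
  combination-scale (c ∷ cs) u (y ∷ ys) = ≈-trans (⊕-congˡ (combination-scale cs u ys))
    (solve 4 (λ c u y r → c :* (u :* y) :+ u :* r := u :* (c :* y :+ r)) ≈-refl (ι c) u y _)

  private
    zeros : ∀ ys → ∃ λ cs → length cs ≡ length ys × combination cs ys ≈ 𝟘
    zeros [] = [] , refl , ≈-refl
    zeros (y ∷ ys) with zeros ys
    ... | cs , l , e = + 0 ∷ cs , cong suc l ,
      ≈-trans (⊕-congˡ e) (solve 1 (λ y → :0 :* y :+ :0 := :0) ≈-refl y)

    split : ∀ zs {ys} cs → length cs ≡ length (zs ++ ys) →
      ∃₂ λ as bs → cs ≡ as ++ bs × length as ≡ length zs × length bs ≡ length ys ×
        combination cs (zs ++ ys) ≈ combination as zs ⊕ combination bs ys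
    split [] cs l = [] , cs , refl , refl , l , ≈-sym (⊕-identityˡ _)
    split (z ∷ zs) (c ∷ cs) l with split zs cs (ℕₚ.suc-injective l)
    ... | as , bs , eq , la , lb , e = c ∷ as , bs , cong (c ∷_) eq , cong suc la , lb ,
      ≈-trans (⊕-congˡ e) (≈-sym (⊕-assoc _ _ _))

    combination-++ : ∀ as zs {bs ys} → length as ≡ length zs →
      combination (as ++ bs) (zs ++ ys) ≈ combination as zs ⊕ combination bs ys
    combination-++ [] [] l = ≈-sym (⊕-identityˡ _)
    combination-++ (a ∷ as) (z ∷ zs) l =
      ≈-trans (⊕-congˡ (combination-++ as zs (ℕₚ.suc-injective l))) (≈-sym (⊕-assoc _ _ _))

    nonzero-scale : ∀ {a} → a ≢ + 0 → ∀ {cs} → NonzeroList cs → NonzeroList (map (ℤ._* a) cs)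
    nonzero-scale {a} na (here {c} nc) = here λ e → [ nc , na ]′ (ℤₚ.i*j≡0⇒i≡0∨j≡0 c e)
    nonzero-scale na (there m) = there (nonzero-scale na m)

    -- Clearing the e-component of each element of ys with the help of y = a e + ….
    eliminate : ∀ e es a y → Span es (y ⊝ ι a ⊗ e) → ∀ ys → All (Span (e ∷ es)) ys →
      ∃ λ ys′ → length ys′ ≡ length ys × All (Span es) ys′ ×
        (∀ cs → length cs ≡ length ys → ∃ λ c →
          combination cs ys′ ≈ ι c ⊗ y ⊕ combination (map (ℤ._* a) cs) ys)
    eliminate e es a y s [] [] = [] , refl , [] , λ { [] _ → + 0 , solve 1 (λ y → :0 := :0 :* y :+ :0) ≈-refl y }
    eliminate e es a y s (z ∷ ys) ((b ▹ t) ∷ ss) with eliminate e es a y s ys ss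
    ... | ys′ , l , ss′ , f = z′ ∷ ys′ , cong suc l , s′ ∷ ss′ , g
      where
      z′ = ι a ⊗ z ⊝ ι b ⊗ y
      s′ : Span es z′
      s′ = span-resp es
        (≈-trans (⊕-congˡ (⊗-congʳ (ι-neg b)))
          (solve 5 (λ a b z y e → a :* (z :- b :* e) :+ :- b :* (y :- a :* e) := a :* z :- b :* y) ≈-refl (ι a) (ι b) z y e))
        (span-+ es (span-ι es a t) (span-ι es (ℤ.- b) s))
      g : ∀ cs → length cs ≡ suc (length ys) → ∃ λ c →
          combination cs (z′ ∷ ys′) ≈ ι c ⊗ y ⊕ combination (map (ℤ._* a) cs) (z ∷ ys)
      g (c ∷ cs) lc with f cs (ℕₚ.suc-injective lc)
      ... | d , eq = d ℤ.- c ℤ.* b , (begin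
        ι c ⊗ z′ ⊕ combination cs ys′     ≈⟨ ⊕-congˡ eq ⟩
        ι c ⊗ z′ ⊕ (ι d ⊗ y ⊕ r)
          ≈⟨ solve 7 (λ a b c d y z r → c :* (a :* z :- b :* y) :+ (d :* y :+ r) := (d :- c :* b) :* y :+ ((c :* a) :* z :+ r)) ≈-refl (ι a) (ι b) (ι c) (ι d) y z r ⟩
        (ι d ⊝ ι c ⊗ ι b) ⊗ y ⊕ ((ι c ⊗ ι a) ⊗ z ⊕ r)
          ≈⟨ ⊕-cong (⊗-congʳ (≈-trans (ι-+ d (ℤ.- (c ℤ.* b))) (⊕-congˡ (≈-trans (ι-neg (c ℤ.* b)) (⊖-cong (ι-* c b))))))
                    (⊕-congʳ (⊗-congʳ (ι-* c a))) ⟨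
        ι (d ℤ.- c ℤ.* b) ⊗ y ⊕ (ι (c ℤ.* a) ⊗ z ⊕ r) ∎)
        where r = combination (map (ℤ._* a) cs) ys

  -- Gaussian elimination without division. `pivot` moves past the elements whose coefficient of `e`
  -- is 0. The first nonzero coefficient `a` is used to clear `e` from the elements behind it, and a
  -- relation for the cleared elements is pulled back by multiplying its coefficients by `a`. As `a`
  -- is nonzero, the relation stays nontrivial. If no such coefficient exists, `e` is dropped.
  dependent : ∀ es ys → All (Span es) ys → length es < length ys → Relation ys
  dependent [] (y ∷ ys) (nil s ∷ ss) l with zeros ys
  ... | cs , lc , e = + 1 ∷ cs , cong suc lc , here (λ ()) ,
    ≈-trans (⊕-cong (≈-trans (⊗-congˡ s) (⊗-zeroʳ _)) e) (⊕-identityˡ _)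
  dependent (e ∷ es) ys ss l = pivot [] ys [] ss l
    where
    pivot : ∀ zs ys → All (Span es) zs → All (Span (e ∷ es)) ys → suc (length es) < length (zs ++ ys) → Relation (zs ++ ys)
    pivot zs [] sz [] l = subst Relation (sym (Listₚ.++-identityʳ zs))
      (dependent es zs sz (ℕₚ.<-trans (ℕₚ.n<1+n _) (subst (λ l → _ < length l) (Listₚ.++-identityʳ zs) l)))
    pivot zs (y ∷ ys) sz ((a ▹ s) ∷ sy) l with a ℤ.≟ + 0
    ... | yes refl = subst Relation (Listₚ.++-assoc zs (y ∷ []) ys)
      (pivot (zs ++ y ∷ []) ys
        (Allₚ.++⁺ sz (span-resp es (solve 2 (λ y e → y :- :0 :* e := y) ≈-refl y e) s ∷ [])) sy
        (subst (λ l → _ < length l) (sym (Listₚ.++-assoc zs (y ∷ []) ys)) l))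
    ... | no na with eliminate e es a y s ys sy
    ... | ys′ , ly , ss′ , f with dependent es (zs ++ ys′) (Allₚ.++⁺ sz ss′) (ℕₚ.≤-pred (ℕₚ.≤-trans l (ℕₚ.≤-reflexive lengths)))
      where
      lengths : length (zs ++ y ∷ ys) ≡ suc (length (zs ++ ys′))
      lengths = trans (Listₚ.length-++ zs) (trans (ℕₚ.+-suc _ _) (cong suc (trans (cong (λ k → length zs + k) (sym ly)) (sym (Listₚ.length-++ zs)))))
    ... | cs , lc , nz , eq with split zs cs lc
    ... | as , bs , refl , la , lb , eq₂ with f bs (trans lb ly)
    ... | c , eq₃ = as ++ c ∷ map (ℤ._* a) bs ,
      trans (Listₚ.length-++ as) (trans (cong₂ _+_ la (cong suc (trans (Listₚ.length-map _ bs) (trans lb ly)))) (sym (Listₚ.length-++ zs))) ,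
      nonzero as nz ,
      (begin
        combination (as ++ c ∷ map (ℤ._* a) bs) (zs ++ y ∷ ys)             ≈⟨ combination-++ as zs la ⟩
        combination as zs ⊕ combination (c ∷ map (ℤ._* a) bs) (y ∷ ys)     ≈⟨ ⊕-congˡ eq₃ ⟨
        combination as zs ⊕ combination bs ys′                             ≈⟨ eq₂ ⟨
        combination (as ++ bs) (zs ++ ys′)                                 ≈⟨ eq ⟩
        𝟘                                                                  ∎)
      where
      nonzero : ∀ as → NonzeroList (as ++ bs) → NonzeroList (as ++ c ∷ map (ℤ._* a) bs)
      nonzero [] m = there (nonzero-scale na m)
      nonzero (_ ∷ as) (here n) = here n
      nonzero (_ ∷ as) (there m) = there (nonzero as m)

  open Evaluation (ιHom R) public using () renaming (evalAt to evalℤ)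

  private
    monomials : A → A → ℕ → List A
    monomials u v zero = 𝟙 ∷ []
    monomials u v (suc m) = v ^^ suc m ∷ map (u ⊗_) (monomials u v m)

    length-monomials : ∀ u v m → length (monomials u v m) ≡ suc m
    length-monomials u v zero = refl
    length-monomials u v (suc m) = cong suc (trans (Listₚ.length-map (u ⊗_) (monomials u v m)) (length-monomials u v m))

    monomials-multiplier : ∀ {es u v} m → Multiplier es u → Multiplier es v → All (Multiplier es) (monomials u v m)
    monomials-multiplier zero mu mv = multiplier-resp ι-1 (multiplier-ι (+ 1)) ∷ []
    monomials-multiplier (suc m) mu mv = multiplier-^ (suc m) mv ∷
      Allₚ.map⁺ (All.map (multiplier-* mu) (monomials-multiplier m mu mv))

    -- The polynomial relation for `t` appears multiplied by `v ^^ m`, so nothing is divided by `v`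
    -- here. In a product of fields the factor is cancelled afterwards, in each component.
    monomials-evaluate : ∀ t {u v} → u ≈ t ⊗ v → ∀ m cs → length cs ≡ suc m →
      combination cs (monomials u v m) ≈ evalℤ t cs ⊗ v ^^ m
    monomials-evaluate t e zero (c ∷ []) l = solve 2 (λ c t → c :* :1 :+ :0 := (c :+ t :* :0) :* :1) ≈-refl (ι c) t
    monomials-evaluate t {u} {v} e (suc m) (c ∷ cs) l = begin
      ι c ⊗ (v ⊗ v ^^ m) ⊕ combination cs (map (u ⊗_) (monomials u v m))  ≈⟨ ⊕-congˡ (combination-scale cs u _) ⟩
      ι c ⊗ (v ⊗ v ^^ m) ⊕ u ⊗ combination cs (monomials u v m)           ≈⟨ ⊕-congˡ (⊗-cong e (monomials-evaluate t e m cs (ℕₚ.suc-injective l))) ⟩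
      ι c ⊗ (v ⊗ v ^^ m) ⊕ (t ⊗ v) ⊗ (evalℤ t cs ⊗ v ^^ m)
        ≈⟨ solve 5 (λ c v w t x → c :* (v :* w) :+ (t :* v) :* (x :* w) := (c :+ t :* x) :* (v :* w)) ≈-refl (ι c) v (v ^^ m) t (evalℤ t cs) ⟩
      (ι c ⊕ t ⊗ evalℤ t cs) ⊗ (v ⊗ v ^^ m)                               ∎

  -- The m + 1 monomials of degree m in u and v lie in a ℤ-module with m generators, so they are dependent.
  ratio-algebraic : ∀ es t u v → Span es 𝟙 → Multiplier es u → Multiplier es v → u ≈ t ⊗ v →
    ∃ λ cs → length cs ≡ suc (length es) × NonzeroList cs × evalℤ t cs ⊗ v ^^ length es ≈ 𝟘
  ratio-algebraic es t u v s mu mv e with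
    dependent es (monomials u v m) (All.map (multiplier⇒span s) (monomials-multiplier m mu mv))
      (ℕₚ.≤-reflexive (sym (length-monomials u v m)))
    where m = length es
  ... | cs , l , nz , eq = cs , trans l (length-monomials u v (length es)) , nz ,
    ≈-trans (≈-sym (monomials-evaluate t e (length es) cs (trans l (length-monomials u v (length es))))) eq

  span-annihilated : ∀ {es N y} → (∀ {e} → e ∈ es → ι N ⊗ e ≈ 𝟘) → Span es y → ι N ⊗ y ≈ 𝟘
  span-annihilated {es} {N} f s = annihilated (span-map {es} {[]} (ι N) (nil ∘ f) s)
    where
    annihilated : ∀ {y} → Span [] y → y ≈ 𝟘
    annihilated (nil e) = e

  -- The determinant trick, carried out as an elimination.
  nakayama : ∀ es c → OneMod3 c → (∀ {e} → e ∈ es → ∃ λ t → Span es t × ι c ⊗ e ≈ ι (+ 3) ⊗ t) →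
    ∃ λ N → OneMod3 N × (∀ {e} → e ∈ es → ι N ⊗ e ≈ 𝟘)
  nakayama [] c o f = + 1 , oneMod3-1 , λ ()
  nakayama (e ∷ es) c o f with f (here refl)
  ... | t , (a ▹ s) , eq with nakayama es (c′ ℤ.* c) (oneMod3-* o′ o) g
    where
    three = ι (+ 3)
    -- The first relation reads `c e = 3 (a e + r)`. Moving `a e` to the left leaves the coefficient
    -- `c - 3 a`, which is still 1 modulo 3; after multiplication by it, the other relations can be
    -- rid of `e`.
    c′ = c ℤ.- + 3 ℤ.* a
    o′ = oneMod3-minus a o
    c′-value : ι c′ ≈ ι c ⊝ three ⊗ ι a
    c′-value = ≈-trans (ι-+ c (ℤ.- (+ 3 ℤ.* a))) (⊕-congˡ (≈-trans (ι-neg (+ 3 ℤ.* a)) (⊖-cong (ι-* (+ 3) a))))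
    r = t ⊝ ι a ⊗ e
    head′ : ι c′ ⊗ e ≈ three ⊗ r
    head′ = begin
      ι c′ ⊗ e                       ≈⟨ ⊗-congʳ c′-value ⟩
      (ι c ⊝ three ⊗ ι a) ⊗ e        ≈⟨ solve 4 (λ c d a e → (c :- d :* a) :* e := c :* e :- d :* (a :* e)) ≈-refl (ι c) three (ι a) e ⟩
      ι c ⊗ e ⊝ three ⊗ (ι a ⊗ e)    ≈⟨ ⊕-congʳ eq ⟩
      three ⊗ t ⊝ three ⊗ (ι a ⊗ e)  ≈⟨ solve 3 (λ d t x → d :* t :- d :* x := d :* (t :- x)) ≈-refl three t (ι a ⊗ e) ⟩
      three ⊗ r                      ∎
    g : ∀ {x} → x ∈ es → ∃ λ t → Span es t × ι (c′ ℤ.* c) ⊗ x ≈ three ⊗ t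
    g {x} i with f (there i)
    ... | u , (b ▹ s′) , eq′ = ι (+ 3 ℤ.* b) ⊗ r ⊕ ι c′ ⊗ (u ⊝ ι b ⊗ e) , span-+ es (span-ι es (+ 3 ℤ.* b) s) (span-ι es c′ s′) , (begin
      ι (c′ ℤ.* c) ⊗ x                             ≈⟨ ⊗-congʳ (ι-* c′ c) ⟩
      (ι c′ ⊗ ι c) ⊗ x                             ≈⟨ ⊗-assoc _ _ _ ⟩
      ι c′ ⊗ (ι c ⊗ x)                             ≈⟨ ⊗-congˡ eq′ ⟩
      ι c′ ⊗ (three ⊗ u)
        ≈⟨ solve 5 (λ c d u b e → c :* (d :* u) := d :* (b :* (c :* e) :+ c :* (u :- b :* e))) ≈-refl (ι c′) three u (ι b) e ⟩
      three ⊗ (ι b ⊗ (ι c′ ⊗ e) ⊕ ι c′ ⊗ (u ⊝ ι b ⊗ e))   ≈⟨ ⊗-congˡ (⊕-congʳ (⊗-congˡ head′)) ⟩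
      three ⊗ (ι b ⊗ (three ⊗ r) ⊕ ι c′ ⊗ (u ⊝ ι b ⊗ e))
        ≈⟨ ⊗-congˡ (⊕-congʳ (≈-trans (solve 3 (λ b d r → b :* (d :* r) := (d :* b) :* r) ≈-refl (ι b) three r) (⊗-congʳ (≈-sym (ι-* (+ 3) b))))) ⟩
      three ⊗ (ι (+ 3 ℤ.* b) ⊗ r ⊕ ι c′ ⊗ (u ⊝ ι b ⊗ e)) ∎)
  ... | N , oN , kills = N ℤ.* c′ , oneMod3-* oN (oneMod3-minus a o) , λ { (here refl) → kill-head ; (there i) → kill-tail i }
    where
    three = ι (+ 3)
    c′ = c ℤ.- + 3 ℤ.* a
    kill-head : ι (N ℤ.* c′) ⊗ e ≈ 𝟘
    kill-head = begin
      ι (N ℤ.* c′) ⊗ e                      ≈⟨ ⊗-congʳ (≈-trans (ι-* N c′) (⊗-congˡ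
                                                 (≈-trans (ι-+ c (ℤ.- (+ 3 ℤ.* a))) (⊕-congˡ (≈-trans (ι-neg (+ 3 ℤ.* a)) (⊖-cong (ι-* (+ 3) a))))))) ⟩
      (ι N ⊗ (ι c ⊝ three ⊗ ι a)) ⊗ e       ≈⟨ solve 5 (λ n c d a e → (n :* (c :- d :* a)) :* e := n :* (c :* e) :- n :* (d :* (a :* e))) ≈-refl (ι N) (ι c) three (ι a) e ⟩
      ι N ⊗ (ι c ⊗ e) ⊝ ι N ⊗ (three ⊗ (ι a ⊗ e)) ≈⟨ ⊕-congʳ (⊗-congˡ eq) ⟩
      ι N ⊗ (three ⊗ t) ⊝ ι N ⊗ (three ⊗ (ι a ⊗ e)) ≈⟨ solve 4 (λ n d t x → n :* (d :* t) :- n :* (d :* x) := d :* (n :* (t :- x))) ≈-refl (ι N) three t (ι a ⊗ e) ⟩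
      three ⊗ (ι N ⊗ (t ⊝ ι a ⊗ e))         ≈⟨ ⊗-congˡ (span-annihilated {es} {N} kills s) ⟩
      three ⊗ 𝟘                             ≈⟨ ⊗-zeroʳ three ⟩
      𝟘                                     ∎
    kill-tail : ∀ {x} → x ∈ es → ι (N ℤ.* c′) ⊗ x ≈ 𝟘
    kill-tail {x} i = begin
      ι (N ℤ.* c′) ⊗ x       ≈⟨ ⊗-congʳ (ι-* N c′) ⟩
      (ι N ⊗ ι c′) ⊗ x       ≈⟨ solve 3 (λ n c x → (n :* c) :* x := c :* (n :* x)) ≈-refl (ι N) (ι c′) x ⟩
      ι c′ ⊗ (ι N ⊗ x)       ≈⟨ ⊗-congˡ (kills i) ⟩
      ι c′ ⊗ 𝟘               ≈⟨ ⊗-zeroʳ _ ⟩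
      𝟘                      ∎

-- Discrete fields, the Euclidean algorithm, and extension fields

CharZero : CommutativeRing 0ℓ 0ℓ → Set
CharZero R = ∀ n → ¬ (ιℕ R (suc n) ≈ 𝟘)
  where open RingFacts R

-- The enumeration drives the construction of maximal ideals in F[X].
record DiscreteField : Set₁ where
  field
    ring : CommutativeRing 0ℓ 0ℓ
  open RingFacts ring public
  field
    equal?   : ∀ x y → Dec (x ≈ y)
    𝟙≉𝟘      : ¬ (𝟙 ≈ 𝟘)
    inverse  : ∀ x → ¬ (x ≈ 𝟘) → ∃ λ y → x ⊗ y ≈ 𝟙
    elements : ℕ → List A
    monotone : ∀ {m n x} → m ≤ n → x ∈ elements m → x ∈ elements n
    covers   : ∀ x → ∃ λ n → x ∈ elements n

char0Field : (F : DiscreteField) → CharZero (DiscreteField.ring F) → IsChar0Field (DiscreteField.ring F)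
char0Field F c = record { 1≉0 = 𝟙≉𝟘 ; inverse = inverse ; char0 = c }
  where open DiscreteField F

hom-charZero : (F : DiscreteField) {S : CommutativeRing 0ℓ 0ℓ} → Hom (DiscreteField.ring F) S →
  ¬ (RingFacts._≈_ S (RingFacts.𝟙 S) (RingFacts.𝟘 S)) → CharZero (DiscreteField.ring F) → CharZero S
hom-charZero F {S} φ 1≉0 char0 n e with DiscreteField.inverse F _ (char0 n)
... | y , eq = 1≉0 (begin
    𝟙                                    ≈⟨ ⟦⟧-1 ⟨
    ⟦ DiscreteField.𝟙 F ⟧                ≈⟨ ⟦⟧-cong eq ⟨
    ⟦ DiscreteField._⊗_ F (ιℕ (DiscreteField.ring F) (suc n)) y ⟧ ≈⟨ ⟦⟧-* _ _ ⟩
    ⟦ ιℕ (DiscreteField.ring F) (suc n) ⟧ ⊗ ⟦ y ⟧ ≈⟨ ⊗-congʳ (≈-trans (⟦⟧-ιℕ (suc n)) e) ⟩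
    𝟘 ⊗ ⟦ y ⟧                            ≈⟨ ⊗-zeroˡ _ ⟩
    𝟘                                    ∎)
  where
  open Hom φ
  open RingFacts S
  open ≈-Reasoning

module FieldPolynomials (F : DiscreteField) where
  open DiscreteField F
  open Polynomials ring public
  module P = RingFacts polynomialRing

  zeroDegree? : ∀ p → p ≋ [] ⊎ ∃ λ d → ¬ (coef p d ≈ 𝟘) × (∀ i → d < i → coef p i ≈ 𝟘)
  zeroDegree? p with leading? (zeroIdeal ring) (λ x → equal? x 𝟘) p
  ... | inj₁ z = inj₁ (pointwise z)
  ... | inj₂ d = inj₂ d

  nonzero-product : ∀ {x y} → ¬ (x ≈ 𝟘) → ¬ (y ≈ 𝟘) → ¬ (x ⊗ y ≈ 𝟘)
  nonzero-product {x} {y} nx ny e with inverse x nx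
  ... | z , eq = ny (begin
    y               ≈⟨ ⊗-identityˡ y ⟨
    𝟙 ⊗ y           ≈⟨ ⊗-congʳ eq ⟨
    (x ⊗ z) ⊗ y     ≈⟨ solve 3 (λ x z y → (x :* z) :* y := z :* (x :* y)) ≈-refl x z y ⟩
    z ⊗ (x ⊗ y)     ≈⟨ ⊗-congˡ e ⟩
    z ⊗ 𝟘           ≈⟨ ⊗-zeroʳ z ⟩
    𝟘               ∎)
    where open ≈-Reasoning

  monomial : A → ℕ → Poly
  monomial c zero = c ∷ []
  monomial c (suc k) = 𝟘 ∷ monomial c k

  monomial-top : ∀ c k → coef (monomial c k) k ≡ c
  monomial-top c zero = refl
  monomial-top c (suc k) = monomial-top c k

  monomial-above : ∀ c k i → k < i → coef (monomial c k) i ≈ 𝟘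
  monomial-above c zero (suc i) l = ≈-refl
  monomial-above c (suc k) (suc i) (s≤s l) = monomial-above c k i l

  Below : ℕ → Poly → Set
  Below N p = ∀ i → N ≤ i → coef p i ≈ 𝟘

  record _∣ₚ_ (p q : Poly) : Set where
    constructor quotient
    field
      factor : Poly
      equality : q ≋ p ⊠ factor

  Unit : Poly → Set
  Unit p = ∃ λ h → p ⊠ h ≋ 𝟙 ∷ []

  ∣-trans : ∀ {p q r} → p ∣ₚ q → q ∣ₚ r → p ∣ₚ r
  ∣-trans {p} (quotient s e) (quotient t f) = quotient (s ⊠ t) (P.≈-trans f (P.≈-trans (P.⊗-congʳ e) (P.⊗-assoc p s t)))

  ∣-refl : ∀ {p} → p ∣ₚ p
  ∣-refl {p} = quotient (𝟙 ∷ []) (P.≈-sym (P.≈-trans (P.⊗-comm p _) (P.⊗-identityˡ p)))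

  divide : ∀ q d → ¬ (coef q d ≈ 𝟘) → (∀ i → d < i → coef q i ≈ 𝟘) → ∀ N p → Below N p →
    ∃₂ λ s r → p ≋ s ⊠ q ⊞ r × Below d r
  divide q d nz above zero p b = [] , p , ≋-refl , λ i l → b i z≤n
  divide q d nz above (suc N) p b with d ℕₚ.≤? N
  ... | no d≰N = [] , p , ≋-refl , λ i l → b i (ℕₚ.≤-trans (ℕₚ.≰⇒> d≰N) l)
  ... | yes d≤N with inverse (coef q d) nz
  ... | l , ql≈1 with divide q d nz above N p′ below
    where
    c = coef p N ⊗ l
    m = monomial c (N ∸ d)
    p′ = p ⊞ neg (m ⊠ q)
    index : N ∸ d + d ≡ N
    index = ℕₚ.m∸n+n≡m d≤N
    top : coef (m ⊠ q) N ≈ coef p N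
    top = begin
      coef (m ⊠ q) N                ≡⟨ cong (coef (m ⊠ q)) index ⟨
      coef (m ⊠ q) (N ∸ d + d)      ≈⟨ ⊝≈𝟘⇒≈ _ _ (coef-⊠-top (zeroIdeal ring) m q (N ∸ d) d (monomial-above c (N ∸ d)) above) ⟩
      coef m (N ∸ d) ⊗ coef q d     ≡⟨ cong (_⊗ coef q d) (monomial-top c (N ∸ d)) ⟩
      (coef p N ⊗ l) ⊗ coef q d     ≈⟨ solve 3 (λ x l y → (x :* l) :* y := x :* (y :* l)) ≈-refl (coef p N) l (coef q d) ⟩
      coef p N ⊗ (coef q d ⊗ l)     ≈⟨ ⊗-congˡ ql≈1 ⟩
      coef p N ⊗ 𝟙                  ≈⟨ ≈-trans (⊗-comm _ _) (⊗-identityˡ _) ⟩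
      coef p N                      ∎
      where open ≈-Reasoning
    below : Below N p′
    below i N≤i with ℕₚ.m≤n⇒m<n∨m≡n N≤i
    ... | inj₂ refl = ≈-trans (coef-⊞ p (neg (m ⊠ q)) N)
      (≈-trans (⊕-congˡ (≈-trans (coef-neg (m ⊠ q) N) (⊖-cong top))) (⊖-inverseʳ _))
    ... | inj₁ N<i = ≈-trans (coef-⊞ p (neg (m ⊠ q)) i)
      (≈-trans (⊕-cong (b i N<i) (≈-trans (coef-neg (m ⊠ q) i) (⊖-cong
        (coef-⊠-above (zeroIdeal ring) m q (N ∸ d) d (monomial-above c (N ∸ d)) above i (subst (_< i) (sym index) N<i)))))
      (⊖-inverseʳ 𝟘))
  ... | s , r , e , br = s ⊞ m , r , (begin
      p                                       ≈⟨ P.solve 2 (λ p x → p P.:= (p P.:- x) P.:+ x) P.≈-refl p (m ⊠ q) ⟩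
      (p ⊞ neg (m ⊠ q)) ⊞ m ⊠ q               ≈⟨ P.⊕-congʳ {m ⊠ q} e ⟩
      (s ⊠ q ⊞ r) ⊞ m ⊠ q                     ≈⟨ P.solve 4 (λ s q r m → (s P.:* q P.:+ r) P.:+ m P.:* q P.:= (s P.:+ m) P.:* q P.:+ r) P.≈-refl s q r m ⟩
      (s ⊞ m) ⊠ q ⊞ r                         ∎) , br
    where
    open P.≈-Reasoning
    m = monomial (coef p N ⊗ l) (N ∸ d)

  record Bezout (a b : Poly) : Set where
    constructor bezout
    field
      {gcd u v} : Poly
      gcd∣a : gcd ∣ₚ a
      gcd∣b : gcd ∣ₚ b
      identity : gcd ≋ u ⊠ a ⊞ v ⊠ b

  -- The recursion is on the bound `N`, since the length of `b` says nothing about its degree `d`.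
  -- From `Below (suc N) b` follows `d ≤ N`, and the remainder has no coefficients from `d` on.
  gcdBelow : ∀ N a b → Below N b → Bezout a b
  gcdBelow N a b below with zeroDegree? b
  ... | inj₁ z = bezout {gcd = a} {𝟙 ∷ []} {[]} ∣-refl (quotient [] (P.≈-trans z (P.≈-sym (⊠-[] a))))
    (P.solve 1 (λ a → a P.:= P.:1 P.:* a P.:+ P.:0) P.≈-refl a)
  gcdBelow zero a b below | inj₂ (d , nz , above) = contradiction (below d z≤n) nz
  gcdBelow (suc N) a b below | inj₂ (d , nz , above) with divide b d nz above (length a) a (coef-beyond a)
  ... | s , r , e , br with gcdBelow N b r (λ i l → br i (ℕₚ.≤-trans d≤N l))
    where
    d≤N : d ≤ N
    d≤N = ℕₚ.≮⇒≥ λ l → nz (below d l)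
  ... | bezout {g} {u} {v} (quotient x ex) (quotient y ey) id = bezout {gcd = g} {v} {u ⊞ neg (v ⊠ s)}
    (quotient (s ⊠ x ⊞ y) (begin
      a                          ≈⟨ e ⟩
      s ⊠ b ⊞ r                  ≈⟨ P.⊕-cong (P.⊗-congˡ {s} ex) ey ⟩
      s ⊠ (g ⊠ x) ⊞ g ⊠ y        ≈⟨ P.solve 4 (λ s g x y → s P.:* (g P.:* x) P.:+ g P.:* y P.:= g P.:* (s P.:* x P.:+ y)) P.≈-refl s g x y ⟩
      g ⊠ (s ⊠ x ⊞ y)            ∎))
    (quotient x ex)
    (begin
      g                                   ≈⟨ id ⟩
      u ⊠ b ⊞ v ⊠ r                       ≈⟨ P.solve 5 (λ u b v r s → u P.:* b P.:+ v P.:* r P.:= v P.:* (s P.:* b P.:+ r) P.:+ (u P.:- v P.:* s) P.:* b) P.≈-refl u b v r s ⟩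
      v ⊠ (s ⊠ b ⊞ r) ⊞ (u ⊞ neg (v ⊠ s)) ⊠ b ≈⟨ P.⊕-congʳ {(u ⊞ neg (v ⊠ s)) ⊠ b} (P.⊗-congˡ {v} e) ⟨
      v ⊠ a ⊞ (u ⊞ neg (v ⊠ s)) ⊠ b       ∎)
    where open P.≈-Reasoning

  bezout-identity : ∀ a b → Bezout a b
  bezout-identity a b = gcdBelow (length b) a b (coef-beyond b)

  degree-nonunit : ∀ p d → ¬ (coef p (suc d) ≈ 𝟘) → (∀ i → suc d < i → coef p i ≈ 𝟘) → ¬ Unit p
  degree-nonunit p d nz above (h , e) with zeroDegree? h
  ... | inj₁ z = 𝟙≉𝟘 (≈-trans (≈-sym (at e 0)) (at (P.≈-trans (P.⊗-congˡ {p} z) (⊠-[] p)) 0))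
  ... | inj₂ (j , nzh , aboveh) = nonzero-product nz nzh
    (≈-trans (≈-sym (⊝≈𝟘⇒≈ _ _ (coef-⊠-top (zeroIdeal ring) p h (suc d) j above aboveh))) (at e (suc d + j)))

  constant-unit : ∀ p → ¬ (coef p 0 ≈ 𝟘) → (∀ i → 0 < i → coef p i ≈ 𝟘) → Unit p
  constant-unit p nz above with inverse (coef p 0) nz
  ... | y , e = y ∷ [] , P.≈-trans (P.⊗-congʳ {y ∷ []} constant) (P.≈-trans (P.≈-sym (Hom.⟦⟧-* constantHom _ y)) (∷-cong e ≋-refl))
    where
    constant : p ≋ coef p 0 ∷ []
    constant = pointwise λ { zero → ≈-refl ; (suc i) → above (suc i) (s≤s z≤n) }

  unit? : ∀ p → Dec (Unit p)
  unit? p with zeroDegree? p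
  ... | inj₁ z = no λ { (h , e) → 𝟙≉𝟘 (≈-trans (≈-sym (at e 0)) (at (P.⊗-congʳ {h} z) 0)) }
  ... | inj₂ (suc d , nz , above) = no (degree-nonunit p d nz above)
  ... | inj₂ (zero , nz , above) = yes (constant-unit p nz above)

  nonunit-nonconstant : ∀ p → ¬ Unit p → ¬ (p ≋ []) → ∃ λ i → 1 ≤ i × ¬ (coef p i ≈ 𝟘)
  nonunit-nonconstant p np nz with zeroDegree? p
  ... | inj₁ z = contradiction z nz
  ... | inj₂ (suc d , n , _) = suc d , s≤s z≤n , n
  ... | inj₂ (zero , n , above) = contradiction (constant-unit p n above) np

  -- An increasing exhaustion of `F[X]` by finite lists. With it an extension field is again a
  -- `DiscreteField`, so that a second root can be adjoined on top of a first one.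
  lists : ℕ → List Poly
  lists zero = [] ∷ []
  lists (suc n) = [] ∷ Data.List.cartesianProductWith _∷_ (elements (suc n)) (lists n)

  lists-covers : ∀ p → ∃ λ n → p ∈ lists n
  lists-monotone : ∀ {m n p} → m ≤ n → p ∈ lists m → p ∈ lists n

  lists-covers [] = 0 , here refl
  lists-covers (a ∷ p) with covers a | lists-covers p
  ... | m , i | n , j = suc (m ⊔ n) , there (∈ₚ.∈-cartesianProductWith⁺ _∷_
    (monotone (ℕₚ.≤-trans (ℕₚ.m≤m⊔n m n) (ℕₚ.n≤1+n _)) i) (lists-monotone (ℕₚ.m≤n⊔m m n) j))

  lists-monotone {n = zero} z≤n i = i
  lists-monotone {n = suc n} z≤n (here e) = here e
  lists-monotone (s≤s l) (here e) = here e
  lists-monotone (s≤s {m} {n} l) (there i) with ∈ₚ.∈-cartesianProductWith⁻ _∷_ (elements (suc m)) (lists m) i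
  ... | a , p , j , k , refl = there (∈ₚ.∈-cartesianProductWith⁺ _∷_ (monotone (s≤s l) j) (lists-monotone l k))

-- F[X] modulo a maximal ideal containing g₀: running through all polynomials r, replace g by
-- gcd(g , r) unless that is a unit. No factorisation of g₀ is needed.
module Extension (F : DiscreteField) (g₀ : List (DiscreteField.A F))
                 (g₀-nonunit : ¬ FieldPolynomials.Unit F g₀) where
  open FieldPolynomials F
  open DiscreteField F using (𝟘; 𝟙; elements) renaming (ring to F-ring)

  -- Divisible or coprime: both alternatives pass from `g` to a divisor of `g` (`decided-∣`), so a
  -- polynomial that has been decided at one stage remains decided when the generator shrinks later.
  Decided : Poly → Poly → Set
  Decided g r = g ∣ₚ r ⊎ ∃₂ λ u v → u ⊠ g ⊞ v ⊠ r ≋ 𝟙 ∷ []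

  decided-∣ : ∀ {g h r} → h ∣ₚ g → Decided g r → Decided h r
  decided-∣ d (inj₁ e) = inj₁ (∣-trans d e)
  decided-∣ {g} {h} {r} (quotient s e) (inj₂ (u , v , eq)) = inj₂ (u ⊠ s , v , (begin
    (u ⊠ s) ⊠ h ⊞ v ⊠ r   ≈⟨ P.⊕-congʳ {v ⊠ r} (P.solve 3 (λ u s h → (u P.:* s) P.:* h P.:= u P.:* (h P.:* s)) P.≈-refl u s h) ⟩
    u ⊠ (h ⊠ s) ⊞ v ⊠ r   ≈⟨ P.⊕-congʳ {v ⊠ r} (P.⊗-congˡ {u} e) ⟨
    u ⊠ g ⊞ v ⊠ r         ≈⟨ eq ⟩
    𝟙 ∷ []                ∎))
    where open P.≈-Reasoning

  record Refinement (g : Poly) (rs : List Poly) : Set where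
    field
      generator : Poly
      nonunit   : ¬ Unit generator
      divides   : generator ∣ₚ g
      decided   : ∀ {r} → r ∈ rs → Decided generator r

  refineOne : ∀ g → ¬ Unit g → ∀ r → Refinement g (r ∷ [])
  refineOne g ng r with bezout-identity g r
  ... | bezout {h} {u} {v} d e id with unit? h
  ... | no nh = record { generator = h ; nonunit = nh ; divides = d ; decided = λ { (here refl) → inj₁ e } }
  ... | yes (k , hk) = record { generator = g ; nonunit = ng ; divides = ∣-refl
    ; decided = λ { (here refl) → inj₂ (k ⊠ u , k ⊠ v , (begin
        (k ⊠ u) ⊠ g ⊞ (k ⊠ v) ⊠ r   ≈⟨ P.solve 5 (λ k u g v r → (k P.:* u) P.:* g P.:+ (k P.:* v) P.:* r P.:= (u P.:* g P.:+ v P.:* r) P.:* k) P.≈-refl k u g v r ⟩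
        (u ⊠ g ⊞ v ⊠ r) ⊠ k         ≈⟨ P.⊗-congʳ {k} id ⟨
        h ⊠ k                       ≈⟨ hk ⟩
        𝟙 ∷ []                      ∎)) } }
    where open P.≈-Reasoning

  refine : ∀ g → ¬ Unit g → ∀ rs → Refinement g rs
  refine g ng [] = record { generator = g ; nonunit = ng ; divides = ∣-refl ; decided = λ () }
  refine g ng (r ∷ rs) = record
    { generator = Refinement.generator rest
    ; nonunit = Refinement.nonunit rest
    ; divides = ∣-trans (Refinement.divides rest) (Refinement.divides one)
    ; decided = λ { (here refl) → decided-∣ (Refinement.divides rest) (Refinement.decided one (here refl))
                  ; (there i) → Refinement.decided rest i } }
    where
    one = refineOne g ng r
    rest = refine (Refinement.generator one) (Refinement.nonunit one) rs

  chain : ℕ → ∃ λ g → ¬ Unit g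
  refinement : ∀ n → Refinement (proj₁ (chain n)) (lists n)
  chain zero = g₀ , g₀-nonunit
  chain (suc n) = Refinement.generator (refinement n) , Refinement.nonunit (refinement n)
  refinement n = refine (proj₁ (chain n)) (proj₂ (chain n)) (lists n)

  generator : ℕ → Poly
  generator n = proj₁ (chain n)

  chain-∣ : ∀ {m n} → m ≤ n → generator n ∣ₚ generator m
  chain-∣ {m} {n} l with ℕₚ.m≤n⇒m<n∨m≡n l
  ... | inj₂ refl = ∣-refl
  chain-∣ {m} {suc n} l | inj₁ (s≤s l′) = ∣-trans (Refinement.divides (refinement n)) (chain-∣ l′)

  -- The union of the increasing principal ideals of the chain. The chain becomes stationary for
  -- reasons of degree, but the stage at which this happens is never determined.
  InMaximal : Poly → Set
  InMaximal r = ∃ λ n → generator n ∣ₚ r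

  maximalIdeal : Ideal polynomialRing
  maximalIdeal = record
    { member = InMaximal
    ; resp = λ { e (n , quotient s f) → n , quotient s (P.≈-trans (P.≈-sym e) f) }
    ; 0-closed = 0 , quotient [] (P.≈-sym (⊠-[] g₀))
    ; +-closed = λ { {x} {y} (m , d) (n , e) → m ⊔ n ,
        add (generator (m ⊔ n)) {x} {y} (∣-trans (chain-∣ (ℕₚ.m≤m⊔n m n)) d) (∣-trans (chain-∣ (ℕₚ.m≤n⊔m m n)) e) }
    ; *-closed = λ { r {x} (n , quotient s e) → n , quotient (s ⊠ r) (P.≈-trans (P.⊗-congˡ {r} e)
        (P.solve 3 (λ r g s → r P.:* (g P.:* s) P.:= g P.:* (s P.:* r)) P.≈-refl r (generator n) s)) } }
    where
    add : ∀ g {x y} → g ∣ₚ x → g ∣ₚ y → g ∣ₚ (x ⊞ y)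
    add g (quotient s e) (quotient t f) = quotient (s ⊞ t) (P.≈-trans (P.⊕-cong e f) (P.≈-sym (P.⊗-distribˡ g s t)))

  1∉maximal : ¬ InMaximal (𝟙 ∷ [])
  1∉maximal (n , quotient s e) = proj₂ (chain n) (s , P.≈-sym e)

  -- Each `r` occurs in some list `lists n`, and the generator of the next stage has decided it.
  -- This one alternative provides both the test for equality and the inverses in the quotient.
  decide : ∀ r → InMaximal r ⊎ ∃ λ v → InMaximal (v ⊠ r ⊞ neg (𝟙 ∷ []))
  decide r with lists-covers r
  ... | n , i with Refinement.decided (refinement n) i
  ... | inj₁ d = inj₁ (suc n , d)
  ... | inj₂ (u , v , e) = inj₂ (v , suc n , quotient (neg u) (begin
      v ⊠ r ⊞ neg (𝟙 ∷ [])                     ≈⟨ P.⊕-congˡ {v ⊠ r} (P.⊖-cong e) ⟨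
      v ⊠ r ⊞ neg (u ⊠ g ⊞ v ⊠ r)              ≈⟨ P.solve 4 (λ u v g r → v P.:* r P.:- (u P.:* g P.:+ v P.:* r) P.:= g P.:* (P.:- u)) P.≈-refl u v g r ⟩
      g ⊠ neg u                                ∎))
    where
    open P.≈-Reasoning
    g = generator (suc n)

  module Q = Quotient polynomialRing maximalIdeal
  module E = RingFacts Q.quotientRing

  member? : ∀ r → Dec (InMaximal r)
  member? r with decide r
  ... | inj₁ m = yes m
  ... | inj₂ (v , m) = no λ m′ → 1∉maximal
    (resp (P.solve 2 (λ x o → x P.:- (x P.:- o) P.:= o) P.≈-refl (v ⊠ r) (𝟙 ∷ []))
      (+-closed {v ⊠ r} {neg (v ⊠ r ⊞ neg (𝟙 ∷ []))} (*-closed v m′) (neg-closed m)))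
    where open Ideal maximalIdeal

  E-equal? : ∀ x y → Dec (x E.≈ y)
  E-equal? x y with member? (x P.⊝ y)
  ... | yes m = yes Q.⟨ m ⟩
  ... | no nm = no λ e → nm (Q.difference e)

  E-inverse : ∀ x → ¬ (x E.≈ E.𝟘) → ∃ λ y → x E.⊗ y E.≈ E.𝟙
  E-inverse x nx with decide x
  ... | inj₁ m = contradiction (Q.member⇒~𝟘 m) nx
  ... | inj₂ (v , m) = v , E.≈-trans (E.⊗-comm x v) Q.⟨ m ⟩

  extension : DiscreteField
  extension = record
    { ring = Q.quotientRing
    ; equal? = E-equal?
    ; 𝟙≉𝟘 = λ e → 1∉maximal (Q.~𝟘⇒member e)
    ; inverse = E-inverse
    ; elements = lists
    ; monotone = lists-monotone
    ; covers = lists-covers }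

  embedding : Hom F-ring Q.quotientRing
  embedding = composeHom Q.projection constantHom

  root : E.A
  root = X

  evalAt-embedding : ∀ p → Evaluation.evalAt embedding root p E.≈ p
  evalAt-embedding p = E.≈-trans (E.≈-sym (hom-evalAt constantHom Q.projection X p)) (Q.≈⇒~ (evalAt-generic F-ring p))

  root-g₀ : Evaluation.evalAt embedding root g₀ E.≈ E.𝟘
  root-g₀ = E.≈-trans (evalAt-embedding g₀) (Q.member⇒~𝟘 (0 , ∣-refl))

-- Fields of characteristic 0 and the rational numbers inside them

module CharZeroField (K : CommutativeRing 0ℓ 0ℓ) (isField : IsChar0Field K) where
  open RingFacts K public
  open IsChar0Field isField public

  cancel-nonzero : ∀ {x y} → ¬ (y ≈ 𝟘) → x ⊗ y ≈ 𝟘 → x ≈ 𝟘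
  cancel-nonzero {x} {y} ny e with inverse y ny
  ... | z , eq = begin
    x               ≈⟨ ≈-trans (⊗-comm _ _) (⊗-identityˡ x) ⟨
    x ⊗ 𝟙           ≈⟨ ⊗-congˡ eq ⟨
    x ⊗ (y ⊗ z)     ≈⟨ ⊗-assoc x y z ⟨
    (x ⊗ y) ⊗ z     ≈⟨ ⊗-congʳ e ⟩
    𝟘 ⊗ z           ≈⟨ ⊗-zeroˡ z ⟩
    𝟘               ∎
    where open ≈-Reasoning

  nonzero-⊗ : ∀ {x y} → ¬ (x ≈ 𝟘) → ¬ (y ≈ 𝟘) → ¬ (x ⊗ y ≈ 𝟘)
  nonzero-⊗ nx ny e = nx (cancel-nonzero ny e)

  nonzero-^ : ∀ {x} k → ¬ (x ≈ 𝟘) → ¬ (x ^^ k ≈ 𝟘)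
  nonzero-^ zero nx = 1≉0
  nonzero-^ (suc k) nx = nonzero-⊗ nx (nonzero-^ k nx)

  ι-nonzero : ∀ {a} → a ≢ + 0 → ¬ (ι a ≈ 𝟘)
  ι-nonzero {+ zero} na e = na refl
  ι-nonzero {+ suc n} na e = char0 n e
  ι-nonzero { -[1+ n ]} na e = char0 n (≈-trans (≈-sym (⊖-involutive _)) (≈-trans (⊖-cong e) ⊖𝟘))

  ι-zero : ∀ {a} → ι a ≈ 𝟘 → a ≡ + 0
  ι-zero {a} e with a ℤ.≟ + 0
  ... | yes z = z
  ... | no na = contradiction e (ι-nonzero na)

  ι-injective : ∀ {a b} → ι a ≈ ι b → a ≡ b
  ι-injective {a} {b} e = ℤₚ.i-j≡0⇒i≡j a b (ι-zero (≈-trans (ι-+ a (ℤ.- b))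
    (≈-trans (⊕-congˡ (ι-neg b)) (≈⇒⊝≈𝟘 e))))

ℚ-ring : CommutativeRing 0ℓ 0ℓ
ℚ-ring = ℚₚ.+-*-commutativeRing

ιℕ-ℚ : ∀ n → ιℕ ℚ-ring n ≡ + n ℚ./ 1
ιℕ-ℚ zero = refl
ιℕ-ℚ (suc n) = trans (cong (ℚ.1ℚ ℚ.+_) (ιℕ-ℚ n)) (ℚₚ.toℚᵘ-injective (begin
    ℚ.toℚᵘ (ℚ.1ℚ ℚ.+ + n ℚ./ 1)             ≈⟨ ℚₚ.toℚᵘ-homo-+ ℚ.1ℚ (+ n ℚ./ 1) ⟩
    ℚᵘ.mkℚᵘ (+ 1) 0 ℚᵘ.+ ℚ.toℚᵘ (+ n ℚ./ 1) ≈⟨ ℚᵘₚ.+-congʳ (ℚᵘ.mkℚᵘ (+ 1) 0) (ℚₚ.toℚᵘ-fromℚᵘ (ℚᵘ.mkℚᵘ (+ n) 0)) ⟩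
    ℚᵘ.mkℚᵘ (+ 1) 0 ℚᵘ.+ ℚᵘ.mkℚᵘ (+ n) 0    ≈⟨ ℚᵘ.*≡* (ℤSolver.solve 1
        (λ n → (con (+ 1) :* con (+ 1) :+ n :* con (+ 1)) :* con (+ 1) := (con (+ 1) :+ n) :* (con (+ 1) :* con (+ 1))) refl (+ n)) ⟩
    ℚᵘ.mkℚᵘ (+ suc n) 0                     ≈⟨ ℚₚ.toℚᵘ-fromℚᵘ (ℚᵘ.mkℚᵘ (+ suc n) 0) ⟨
    ℚ.toℚᵘ (+ suc n ℚ./ 1)                  ∎))
  where
  open ℤSolver
  open SetoidReasoning ℚᵘₚ.≃-setoid

ι-ℚ : ∀ a → ιℤ ℚ-ring a ≡ a ℚ./ 1
ι-ℚ (+ n) = ιℕ-ℚ n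
ι-ℚ -[1+ n ] = cong ℚ.-_ (ιℕ-ℚ (suc n))

ℚ-charZero : CharZero ℚ-ring
ℚ-charZero n e = ℚₚ.<-irrefl refl (ℚₚ.positive⁻¹ ℚ.0ℚ {{subst ℚ.Positive (trans (sym (ιℕ-ℚ (suc n))) e) (ℚₚ.normalize-pos (suc n) 1)}})

signedUpTo : ℕ → List ℤ
signedUpTo n = map +_ (upTo n) ++ map -[1+_] (upTo n)

ℚ-field : DiscreteField
ℚ-field = record
  { ring = ℚ-ring
  ; equal? = ℚ._≟_
  ; 𝟙≉𝟘 = λ ()
  ; inverse = λ x nx → let instance nz = ℚ.≢-nonZero nx in ℚ.1/ x , ℚₚ.*-inverseʳ x
  ; elements = elements
  ; monotone = monotone
  ; covers = covers }
  where
  elements : ℕ → List ℚ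
  elements n = Data.List.cartesianProductWith (λ i d → i ℚ./ suc d) (signedUpTo n) (upTo n)

  signed-monotone : ∀ {m n i} → m ≤ n → i ∈ signedUpTo m → i ∈ signedUpTo n
  signed-monotone {m} {n} l i with ∈ₚ.∈-++⁻ (map +_ (upTo m)) i
  ... | inj₁ j with ∈ₚ.∈-map⁻ +_ j
  ... | k , k∈ , refl = ∈ₚ.∈-++⁺ˡ (∈ₚ.∈-map⁺ +_ (∈ₚ.∈-upTo⁺ (ℕₚ.≤-trans (∈ₚ.∈-upTo⁻ k∈) l)))
  signed-monotone {m} {n} l i | inj₂ j with ∈ₚ.∈-map⁻ -[1+_] j
  ... | k , k∈ , refl = ∈ₚ.∈-++⁺ʳ (map +_ (upTo n)) (∈ₚ.∈-map⁺ -[1+_] (∈ₚ.∈-upTo⁺ (ℕₚ.≤-trans (∈ₚ.∈-upTo⁻ k∈) l)))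

  monotone : ∀ {m n x} → m ≤ n → x ∈ elements m → x ∈ elements n
  monotone {m} l i with ∈ₚ.∈-cartesianProductWith⁻ (λ i d → i ℚ./ suc d) (signedUpTo m) (upTo m) i
  ... | a , d , a∈ , d∈ , refl = ∈ₚ.∈-cartesianProductWith⁺ (λ i d → i ℚ./ suc d)
    (signed-monotone l a∈) (∈ₚ.∈-upTo⁺ (ℕₚ.≤-trans (∈ₚ.∈-upTo⁻ d∈) l))

  signed-∈ : ∀ a {n} → suc ℤ.∣ a ∣ ≤ n → a ∈ signedUpTo n
  signed-∈ (+ k) l = ∈ₚ.∈-++⁺ˡ (∈ₚ.∈-map⁺ +_ (∈ₚ.∈-upTo⁺ l))
  signed-∈ -[1+ k ] {n} l = ∈ₚ.∈-++⁺ʳ (map +_ (upTo n)) (∈ₚ.∈-map⁺ -[1+_] (∈ₚ.∈-upTo⁺ (ℕₚ.<⇒≤ l)))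

  covers : ∀ x → ∃ λ n → x ∈ elements n
  covers x@(ℚ.mkℚ a d c) = n , subst (_∈ elements n) (ℚₚ.↥p/↧p≡p x) (∈ₚ.∈-cartesianProductWith⁺ (λ i d → i ℚ./ suc d)
      (signed-∈ a (ℕₚ.m≤m⊔n (suc ℤ.∣ a ∣) (suc d))) (∈ₚ.∈-upTo⁺ (ℕₚ.m≤n⊔m (suc ℤ.∣ a ∣) (suc d))))
    where n = suc ℤ.∣ a ∣ ⊔ suc d

module ℚF = CharZeroField ℚ-ring (char0Field ℚ-field ℚ-charZero)

denominator : ∀ q → q ℚ.* ℚF.ι (ℚ.↧ q) ≡ ℚF.ι (ℚ.↥ q)
denominator q = trans (cong (q ℚ.*_) (ι-ℚ (ℚ.↧ q))) (trans (ℚₚ.toℚᵘ-injective (begin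
    ℚ.toℚᵘ (q ℚ.* (ℚ.↧ q ℚ./ 1))                       ≈⟨ ℚₚ.toℚᵘ-homo-* q (ℚ.↧ q ℚ./ 1) ⟩
    ℚ.toℚᵘ q ℚᵘ.* ℚ.toℚᵘ (ℚ.↧ q ℚ./ 1)                 ≈⟨ ℚᵘₚ.*-congˡ {ℚ.toℚᵘ q} (ℚₚ.toℚᵘ-fromℚᵘ (ℚᵘ.mkℚᵘ (ℚ.↧ q) 0)) ⟩
    ℚ.toℚᵘ q ℚᵘ.* ℚᵘ.mkℚᵘ (ℚ.↧ q) 0                    ≈⟨ cancel q ⟩
    ℚᵘ.mkℚᵘ (ℚ.↥ q) 0                                  ≈⟨ ℚₚ.toℚᵘ-fromℚᵘ (ℚᵘ.mkℚᵘ (ℚ.↥ q) 0) ⟨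
    ℚ.toℚᵘ (ℚ.↥ q ℚ./ 1)                               ∎)) (sym (ι-ℚ (ℚ.↥ q))))
  where
  open SetoidReasoning ℚᵘₚ.≃-setoid
  cancel : ∀ q → ℚ.toℚᵘ q ℚᵘ.* ℚᵘ.mkℚᵘ (ℚ.↧ q) 0 ℚᵘ.≃ ℚᵘ.mkℚᵘ (ℚ.↥ q) 0
  cancel (ℚ.mkℚ a d _) = ℚᵘ.*≡* (trans (ℤₚ.*-identityʳ _) (cong (a ℤ.*_) (cong +_ (sym (ℕₚ.*-identityʳ (suc d))))))

denominator-nonzero : ∀ q → ℚ.↧ q ≢ + 0
denominator-nonzero (ℚ.mkℚ _ _ _) ()

module _ (K : CommutativeRing 0ℓ 0ℓ) (isField : IsChar0Field K) where
  open CharZeroField K isField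
  open ≈-Reasoning

  private
    inv : ∀ q → ∃ λ y → ι (ℚ.↧ q) ⊗ y ≈ 𝟙
    inv q = inverse (ι (ℚ.↧ q)) (ι-nonzero (denominator-nonzero q))

    value : ℚ → A
    value q = ι (ℚ.↥ q) ⊗ proj₁ (inv q)

    cancel : ∀ {c x y} → c ≢ + 0 → x ⊗ ι c ≈ y ⊗ ι c → x ≈ y
    cancel {c} {x} {y} nc e = ⊝≈𝟘⇒≈ _ _ (cancel-nonzero (ι-nonzero nc) (begin
      (x ⊝ y) ⊗ ι c      ≈⟨ solve 3 (λ x y c → (x :- y) :* c := x :* c :- y :* c) ≈-refl x y (ι c) ⟩
      x ⊗ ι c ⊝ y ⊗ ι c  ≈⟨ ≈⇒⊝≈𝟘 e ⟩
      𝟘                  ∎))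

    value-den : ∀ q → value q ⊗ ι (ℚ.↧ q) ≈ ι (ℚ.↥ q)
    value-den q = begin
      (ι (ℚ.↥ q) ⊗ proj₁ (inv q)) ⊗ ι (ℚ.↧ q)  ≈⟨ solve 3 (λ n v d → (n :* v) :* d := n :* (d :* v)) ≈-refl _ _ _ ⟩
      ι (ℚ.↥ q) ⊗ (ι (ℚ.↧ q) ⊗ proj₁ (inv q))  ≈⟨ ⊗-congˡ (proj₂ (inv q)) ⟩
      ι (ℚ.↥ q) ⊗ 𝟙                            ≈⟨ ≈-trans (⊗-comm _ _) (⊗-identityˡ _) ⟩
      ι (ℚ.↥ q)                                ∎

    -- Rational numbers are stored in lowest terms, and a sum or product is reduced in an
    -- uncontrolled way. Any integral equation `q c = n` determines the value, so the unreduced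
    -- common denominator can be used instead.
    value-unique : ∀ q c n → c ≢ + 0 → q ℚ.* ℚF.ι c ≡ ℚF.ι n → value q ⊗ ι c ≈ ι n
    value-unique q c n nc e = cancel (denominator-nonzero q) (begin
      (value q ⊗ ι c) ⊗ ι d      ≈⟨ solve 3 (λ v c d → (v :* c) :* d := (v :* d) :* c) ≈-refl _ _ _ ⟩
      (value q ⊗ ι d) ⊗ ι c      ≈⟨ ⊗-congʳ (value-den q) ⟩
      ι (ℚ.↥ q) ⊗ ι c            ≈⟨ ι-* (ℚ.↥ q) c ⟨
      ι (ℚ.↥ q ℤ.* c)            ≡⟨ cong ι (ℚF.ι-injective {ℚ.↥ q ℤ.* c} {n ℤ.* d} identity) ⟩
      ι (n ℤ.* d)                ≈⟨ ι-* n d ⟩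
      ι n ⊗ ι d                  ∎)
      where
      d = ℚ.↧ q
      identity : ℚF.ι (ℚ.↥ q ℤ.* c) ≡ ℚF.ι (n ℤ.* d)
      identity = trans (ℚF.ι-* (ℚ.↥ q) c) (trans (cong (ℚ._* ℚF.ι c) (sym (denominator q)))
        (trans (ℚF.solve 3 (λ q d c → (q ℚF.:* d) ℚF.:* c ℚF.:= (q ℚF.:* c) ℚF.:* d) refl q (ℚF.ι d) (ℚF.ι c))
        (trans (cong (ℚ._* ℚF.ι d) e) (sym (ℚF.ι-* n d)))))

    nonzero-* : ∀ {a b} → a ≢ + 0 → b ≢ + 0 → a ℤ.* b ≢ + 0
    nonzero-* {a} na nb e = [ na , nb ]′ (ℤₚ.i*j≡0⇒i≡0∨j≡0 a e)

  ℚHom : Hom ℚ-ring K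
  ℚHom = record
    { ⟦_⟧ = value
    ; ⟦⟧-cong = λ { refl → ≈-refl }
    ; ⟦⟧-+ = λ p q → let c = ℚ.↧ p ℤ.* ℚ.↧ q; nc = nonzero-* (denominator-nonzero p) (denominator-nonzero q) in
        cancel nc (begin
          value (p ℚ.+ q) ⊗ ι c                           ≈⟨ value-unique (p ℚ.+ q) c (ℚ.↥ p ℤ.* ℚ.↧ q ℤ.+ ℚ.↥ q ℤ.* ℚ.↧ p) nc (sum p q) ⟩
          ι (ℚ.↥ p ℤ.* ℚ.↧ q ℤ.+ ℚ.↥ q ℤ.* ℚ.↧ p)          ≈⟨ ≈-trans (ι-+ (ℚ.↥ p ℤ.* ℚ.↧ q) (ℚ.↥ q ℤ.* ℚ.↧ p)) (⊕-cong (ι-* (ℚ.↥ p) (ℚ.↧ q)) (ι-* (ℚ.↥ q) (ℚ.↧ p))) ⟩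
          ι (ℚ.↥ p) ⊗ ι (ℚ.↧ q) ⊕ ι (ℚ.↥ q) ⊗ ι (ℚ.↧ p)    ≈⟨ ⊕-cong (⊗-congʳ (value-den p)) (⊗-congʳ (value-den q)) ⟨
          (value p ⊗ ι (ℚ.↧ p)) ⊗ ι (ℚ.↧ q) ⊕ (value q ⊗ ι (ℚ.↧ q)) ⊗ ι (ℚ.↧ p)
            ≈⟨ solve 4 (λ x y d e → (x :* d) :* e :+ (y :* e) :* d := (x :+ y) :* (d :* e)) ≈-refl _ _ _ _ ⟩
          (value p ⊕ value q) ⊗ (ι (ℚ.↧ p) ⊗ ι (ℚ.↧ q))    ≈⟨ ⊗-congˡ (ι-* (ℚ.↧ p) (ℚ.↧ q)) ⟨
          (value p ⊕ value q) ⊗ ι c                       ∎)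
    ; ⟦⟧-* = λ p q → let c = ℚ.↧ p ℤ.* ℚ.↧ q; nc = nonzero-* (denominator-nonzero p) (denominator-nonzero q) in
        cancel nc (begin
          value (p ℚ.* q) ⊗ ι c                           ≈⟨ value-unique (p ℚ.* q) c (ℚ.↥ p ℤ.* ℚ.↥ q) nc (prod p q) ⟩
          ι (ℚ.↥ p ℤ.* ℚ.↥ q)                             ≈⟨ ι-* (ℚ.↥ p) (ℚ.↥ q) ⟩
          ι (ℚ.↥ p) ⊗ ι (ℚ.↥ q)                           ≈⟨ ⊗-cong (value-den p) (value-den q) ⟨
          (value p ⊗ ι (ℚ.↧ p)) ⊗ (value q ⊗ ι (ℚ.↧ q))
            ≈⟨ solve 4 (λ x y d e → (x :* d) :* (y :* e) := (x :* y) :* (d :* e)) ≈-refl _ _ _ _ ⟩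
          (value p ⊗ value q) ⊗ (ι (ℚ.↧ p) ⊗ ι (ℚ.↧ q))    ≈⟨ ⊗-congˡ (ι-* (ℚ.↧ p) (ℚ.↧ q)) ⟨
          (value p ⊗ value q) ⊗ ι c                       ∎)
    ; ⟦⟧-1 = ≈-trans (≈-sym (≈-trans (⊗-comm _ _) (⊗-identityˡ _))) (≈-trans (⊗-congˡ (≈-sym ι-1)) (≈-trans (value-den ℚ.1ℚ) ι-1)) }
    where
    open ℚF using () renaming (solve to solve′; _:+_ to _:+′_; _:*_ to _:*′_; _:=_ to _:=′_)
    sum : ∀ p q → (p ℚ.+ q) ℚ.* ℚF.ι (ℚ.↧ p ℤ.* ℚ.↧ q) ≡ ℚF.ι (ℚ.↥ p ℤ.* ℚ.↧ q ℤ.+ ℚ.↥ q ℤ.* ℚ.↧ p)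
    sum p q = trans (cong ((p ℚ.+ q) ℚ.*_) (ℚF.ι-* (ℚ.↧ p) (ℚ.↧ q)))
      (trans (solve′ 4 (λ x y d e → (x :+′ y) :*′ (d :*′ e) :=′ (x :*′ d) :*′ e :+′ (y :*′ e) :*′ d) refl p q (ℚF.ι (ℚ.↧ p)) (ℚF.ι (ℚ.↧ q)))
      (trans (cong₂ ℚ._+_ (cong (ℚ._* ℚF.ι (ℚ.↧ q)) (denominator p)) (cong (ℚ._* ℚF.ι (ℚ.↧ p)) (denominator q)))
      (sym (trans (ℚF.ι-+ (ℚ.↥ p ℤ.* ℚ.↧ q) (ℚ.↥ q ℤ.* ℚ.↧ p)) (cong₂ ℚ._+_ (ℚF.ι-* (ℚ.↥ p) (ℚ.↧ q)) (ℚF.ι-* (ℚ.↥ q) (ℚ.↧ p)))))))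
    prod : ∀ p q → (p ℚ.* q) ℚ.* ℚF.ι (ℚ.↧ p ℤ.* ℚ.↧ q) ≡ ℚF.ι (ℚ.↥ p ℤ.* ℚ.↥ q)
    prod p q = trans (cong ((p ℚ.* q) ℚ.*_) (ℚF.ι-* (ℚ.↧ p) (ℚ.↧ q)))
      (trans (solve′ 4 (λ x y d e → (x :*′ y) :*′ (d :*′ e) :=′ (x :*′ d) :*′ (y :*′ e)) refl p q (ℚF.ι (ℚ.↧ p)) (ℚF.ι (ℚ.↧ q)))
      (trans (cong₂ ℚ._*_ (denominator p) (denominator q)) (sym (ℚF.ι-* (ℚ.↥ p) (ℚ.↥ q)))))

-- Change of coefficients, and the given definitions in terms of coefficient lists

module MapPolynomials {R S : CommutativeRing 0ℓ 0ℓ} (φ : Hom R S) where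
  open Hom φ
  private
    module RX = Polynomials R
    module R = RingFacts R
  open Polynomials S
  open RingFacts S

  mapPoly : RX.Poly → Poly
  mapPoly = map ⟦_⟧

  coef-map : ∀ p i → coef (mapPoly p) i ≈ ⟦ RX.coef p i ⟧
  coef-map [] i = ≈-sym ⟦⟧-0
  coef-map (a ∷ p) zero = ≈-refl
  coef-map (a ∷ p) (suc i) = coef-map p i

  map-≋ : ∀ {p q} → p RX.≋ q → mapPoly p ≋ mapPoly q
  map-≋ {p} {q} e = pointwise λ i → ≈-trans (coef-map p i) (≈-trans (⟦⟧-cong (RX.at e i)) (≈-sym (coef-map q i)))

  map-⊞ : ∀ p q → mapPoly (p RX.⊞ q) ≋ mapPoly p ⊞ mapPoly q
  map-⊞ [] q = ≋-refl
  map-⊞ (a ∷ p) [] = ≋-refl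
  map-⊞ (a ∷ p) (b ∷ q) = ∷-cong (⟦⟧-+ a b) (map-⊞ p q)

  map-scale : ∀ c p → mapPoly (RX.scale c p) ≋ scale ⟦ c ⟧ (mapPoly p)
  map-scale c [] = ≋-refl
  map-scale c (a ∷ p) = ∷-cong (⟦⟧-* c a) (map-scale c p)

  map-⊠ : ∀ p q → mapPoly (p RX.⊠ q) ≋ mapPoly p ⊠ mapPoly q
  map-⊠ [] q = ≋-refl
  map-⊠ (a ∷ p) q = ≋-trans (map-⊞ (RX.scale a q) (R.𝟘 ∷ p RX.⊠ q))
    (⊞-cong {mapPoly (RX.scale a q)} (map-scale a q) (∷-cong ⟦⟧-0 (map-⊠ p q)))

module _ {R S T : CommutativeRing 0ℓ 0ℓ} (φ : Hom R S) (ψ : Hom S T) (χ : Hom R T) (t : RingFacts.A T)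
         (agree : ∀ c → RingFacts._≈_ T (Hom.⟦ ψ ⟧ (Hom.⟦ φ ⟧ c)) (Hom.⟦ χ ⟧ c)) where
  open RingFacts T

  evalAt-map : ∀ p → Evaluation.evalAt ψ t (MapPolynomials.mapPoly φ p) ≈ Evaluation.evalAt χ t p
  evalAt-map [] = ≈-refl
  evalAt-map (a ∷ p) = ⊕-cong (agree a) (⊗-congˡ (evalAt-map p))

module ℤX = Polynomials ℤ-ring
module ℚX = Polynomials ℚ-ring

toℚX : List ℤ → List ℚ
toℚX = MapPolynomials.mapPoly (ιHom ℚ-ring)

lowFirst : ∀ {n} → IntPoly n → List ℤ
lowFirst a = Data.List.reverse (Vec.toList a)

module _ (K : CommutativeRing 0ℓ 0ℓ) where
  open RingFacts K
  open Evaluation (ιHom K)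

  -- Invariant of Horner's scheme: the accumulator is the value of the coefficients already read,
  -- which `reverseAcc` has collected lowest degree first.
  evalList-evalAt : ∀ x cs {acc} p → acc ≈ evalAt x p → evalList K cs acc x ≈ evalAt x (Data.List.reverseAcc p cs)
  evalList-evalAt x [] p e = e
  evalList-evalAt x (c ∷ cs) p e = evalList-evalAt x cs (c ∷ p)
    (≈-trans (⊕-comm _ _) (⊕-congˡ (≈-trans (⊗-comm _ _) (⊗-congˡ e))))

  eval-lowFirst : ∀ {n} (a : IntPoly n) x → eval K a x ≈ evalAt x (lowFirst a)
  eval-lowFirst a x = evalList-evalAt x (Vec.toList a) [] ≈-refl

toQPoly-lowFirst : ∀ {n} (a : IntPoly n) → toQPoly a ≡ toℚX (lowFirst a)
toQPoly-lowFirst a = trans (cong Data.List.reverse (Listₚ.map-cong (λ z → sym (ι-ℚ z)) (Vec.toList a)))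
  (sym (Listₚ.reverse-map (ℚF.ι) (Vec.toList a)))

coeff-coef : ∀ p i → coeff p i ≡ ℚX.coef p i
coeff-coef [] i = refl
coeff-coef (a ∷ p) zero = refl
coeff-coef (a ∷ p) (suc i) = coeff-coef p i

addQ-⊞ : ∀ p q → addQ p q ≡ p ℚX.⊞ q
addQ-⊞ [] q = refl
addQ-⊞ (a ∷ p) [] = refl
addQ-⊞ (a ∷ p) (b ∷ q) = cong (_ ∷_) (addQ-⊞ p q)

mulQ-⊠ : ∀ p q → mulQ p q ≡ p ℚX.⊠ q
mulQ-⊠ [] q = refl
mulQ-⊠ (a ∷ p) q = trans (addQ-⊞ (map (a ℚ.*_) q) (ℚ.0ℚ ∷ mulQ p q)) (cong (λ r → map (a ℚ.*_) q ℚX.⊞ (ℚ.0ℚ ∷ r)) (mulQ-⊠ p q))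

-- Gauss's lemma

multiples : ℕ → Ideal ℤ-ring
multiples p = record
  { member = + p ℤ∣.∣_
  ; resp = λ { refl m → m }
  ; 0-closed = ℤ∣.divides (+ 0) refl
  ; +-closed = ℤ∣.∣m∣n⇒∣m+n
  ; *-closed = λ r m → ℤ∣.∣n⇒∣m*n r m }

-- Otherwise both factors have a highest coefficient not divisible by `p`, in degrees `d` and `e`.
-- Modulo `p` the product of these two is the coefficient of degree `d + e`, and Euclid's lemma
-- gives a contradiction.
prime-content : ∀ {p} → Prime p → ∀ G H → (∀ i → + p ℤ∣.∣ ℤX.coef (G ℤX.⊠ H) i) →
  (∀ i → + p ℤ∣.∣ ℤX.coef G i) ⊎ (∀ i → + p ℤ∣.∣ ℤX.coef H i)
prime-content {p} pr G H all
  with ℤX.leading? (multiples p) (+ p ℤ∣.∣?_) G | ℤX.leading? (multiples p) (+ p ℤ∣.∣?_) H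
... | inj₁ divG | _ = inj₁ divG
... | inj₂ _ | inj₁ divH = inj₂ divH
... | inj₂ (d , nd , aboveG) | inj₂ (e , ne , aboveH) = ⊥-elim (absurd
    (euclidsLemma ℤ.∣ g ∣ ℤ.∣ h ∣ pr (subst (p ℕ∣.∣_) (ℤₚ.abs-* g h) (ℤ∣.∣⇒∣ᵤ gh))))
  where
  g = ℤX.coef G d
  h = ℤX.coef H e
  top = ℤX.coef (G ℤX.⊠ H) (d + e)
  gh : + p ℤ∣.∣ g ℤ.* h
  gh = subst (+ p ℤ∣.∣_) (ℤSolver.solve 2 (λ t x → t :- (t :- x) := x) refl top (g ℤ.* h))
    (ℤ∣.∣m∣n⇒∣m-n (all (d + e)) (ℤX.coef-⊠-top (multiples p) G H d e aboveG aboveH))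
    where open ℤSolver
  absurd : p ℕ∣.∣ ℤ.∣ g ∣ ⊎ p ℕ∣.∣ ℤ.∣ h ∣ → ⊥
  absurd (inj₁ m) = nd (ℤ∣.∣ᵤ⇒∣ m)
  absurd (inj₂ m) = ne (ℤ∣.∣ᵤ⇒∣ m)

divideOut : ∀ p G → (∀ i → + p ℤ∣.∣ ℤX.coef G i) → ∃ λ G′ → G ≡ ℤX.scale (+ p) G′
divideOut p [] m = [] , refl
divideOut p (a ∷ G) m with m 0 | divideOut p G (λ i → m (suc i))
... | ℤ∣.divides q eq | G′ , e = q ∷ G′ , cong₂ _∷_ (trans eq (ℤₚ.*-comm q (+ p))) e

scale-cancel : ∀ c → c ≢ + 0 → ∀ {F G} → ℤX.scale c F ℤX.≋ ℤX.scale c G → F ℤX.≋ G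
scale-cancel c nc {F} {G} e = ℤX.pointwise λ i →
  ℤₚ.*-cancelˡ-≡ c _ _ {{ℤ.≢-nonZero nc}} (trans (sym (ℤX.coef-scale c F i)) (trans (ℤX.at e i) (ℤX.coef-scale c G i)))

-- The last two components say that no coefficient of the original factors is lost.
gauss-primes : ∀ ps → All Prime ps → ∀ F G H → ℤX.scale (+ product ps) F ℤX.≋ G ℤX.⊠ H →
  ∃₂ λ G′ H′ → F ℤX.≋ G′ ℤX.⊠ H′ × (∀ i → ℤX.coef G i ≢ + 0 → ℤX.coef G′ i ≢ + 0) × (∀ i → ℤX.coef H i ≢ + 0 → ℤX.coef H′ i ≢ + 0)
gauss-primes [] [] F G H e = G , H ,
  ℤX.pointwise (λ i → trans (trans (sym (ℤₚ.*-identityˡ _)) (sym (ℤX.coef-scale (+ 1) F i))) (ℤX.at e i)) , (λ _ n → n) , (λ _ n → n)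
gauss-primes (p ∷ ps) (pr ∷ primes) F G H e = continue (prime-content pr G H divisible)
  where
  p≢0 : + p ≢ + 0
  p≢0 z = ℕ.≢-nonZero⁻¹ _ {{prime⇒nonZero pr}} (ℤₚ.+-injective z)

  pF : ℤX.scale (+ product (p ∷ ps)) F ℤX.≋ ℤX.scale (+ p) (ℤX.scale (+ product ps) F)
  pF = subst (λ c → ℤX.scale c F ℤX.≋ ℤX.scale (+ p) (ℤX.scale (+ product ps) F)) (sym (ℤₚ.pos-* p (product ps))) (ℤX.scale-scale (+ p) (+ product ps) F)

  divisible : ∀ i → + p ℤ∣.∣ ℤX.coef (G ℤX.⊠ H) i
  divisible i = ℤ∣.divides (ℤX.coef (ℤX.scale (+ product ps) F) i)
    (trans (trans (sym (ℤX.at e i)) (trans (ℤX.at pF i) (ℤX.coef-scale (+ p) (ℤX.scale (+ product ps) F) i)))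
      (ℤₚ.*-comm (+ p) (ℤX.coef (ℤX.scale (+ product ps) F) i)))

  scaled-nonzero : ∀ P′ i → ℤX.coef (ℤX.scale (+ p) P′) i ≢ + 0 → ℤX.coef P′ i ≢ + 0
  scaled-nonzero P′ i n z = n (trans (ℤX.coef-scale (+ p) P′ i) (trans (cong (+ p ℤ.*_) z) (ℤₚ.*-zeroʳ (+ p))))

  continue : _ → _
  continue (inj₁ m) with divideOut p G m
  ... | G₁ , refl with gauss-primes ps primes F G₁ H (scale-cancel (+ p) p≢0
        (ℤX.≋-trans (ℤX.≋-sym pF) (ℤX.≋-trans e (ℤX.scale-⊠ (+ p) G₁ H))))
  ... | G′ , H′ , eq , ng , nh = G′ , H′ , eq , (λ i n → ng i (scaled-nonzero G₁ i n)) , nh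
  continue (inj₂ m) with divideOut p H m
  ... | H₁ , refl with gauss-primes ps primes F G H₁ (scale-cancel (+ p) p≢0
        (ℤX.≋-trans (ℤX.≋-sym pF) (ℤX.≋-trans e (ℤX.≋-trans (ℤX.⊠-comm G (ℤX.scale (+ p) H₁))
          (ℤX.≋-trans (ℤX.scale-⊠ (+ p) H₁ G) (ℤX.scale-cong {+ p} refl (ℤX.⊠-comm H₁ G)))))))
  ... | G′ , H′ , eq , ng , nh = G′ , H′ , eq , ng , (λ i n → nh i (scaled-nonzero H₁ i n))

clear-denominators : ∀ g → ∃₂ λ d G → NonZero d × toℚX G ℚX.≋ ℚX.scale (ℚF.ι (+ d)) g
clear-denominators [] = 1 , [] , _ , ℚX.≋-refl
clear-denominators (q@(ℚ.mkℚ a k _) ∷ g) with clear-denominators g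
... | d , G , nz , e = suc k * d , (+ d ℤ.* a) ∷ ℤX.scale (+ suc k) G , ℕₚ.m*n≢0 (suc k) d {{_}} {{nz}} ,
  ℚX.∷-cong
    (trans (ℚF.ι-* (+ d) a) (trans (cong (ℚF.ι (+ d) ℚ.*_) (sym (denominator q)))
      (trans (ℚF.solve 3 (λ d q k → d ℚF.:* (q ℚF.:* k) ℚF.:= (k ℚF.:* d) ℚF.:* q) refl (ℚF.ι (+ d)) q (ℚF.ι (+ suc k)))
        (cong (ℚ._* q) (sym denominators)))))
    (ℚX.≋-trans (MapPolynomials.map-scale (ιHom ℚ-ring) (+ suc k) G)
      (ℚX.≋-trans (ℚX.scale-cong {ℚF.ι (+ suc k)} refl e) (ℚX.≋-trans (ℚX.≋-sym (ℚX.scale-scale (ℚF.ι (+ suc k)) (ℚF.ι (+ d)) g))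
        (ℚX.scale-cong {ℚF.ι (+ suc k) ℚ.* ℚF.ι (+ d)} (sym denominators) (ℚX.≋-refl {g})))))
  where
  denominators : ℚF.ι (+ (suc k * d)) ≡ ℚF.ι (+ suc k) ℚ.* ℚF.ι (+ d)
  denominators = trans (cong ℚF.ι (ℤₚ.pos-* (suc k) d)) (ℚF.ι-* (+ suc k) (+ d))

ℚ-coef-nonzero : ∀ d .{{_ : NonZero d}} g G → toℚX G ℚX.≋ ℚX.scale (ℚF.ι (+ d)) g →
  ∀ i → ℚX.coef g i ≢ ℚ.0ℚ → ℤX.coef G i ≢ + 0
ℚ-coef-nonzero (suc d) g G e i n z = n (ℚF.cancel-nonzero (ℚF.ι-nonzero {+ suc d} (λ ()))
  (trans (ℚₚ.*-comm (ℚX.coef g i) _) (trans (sym (ℚX.coef-scale (ℚF.ι (+ suc d)) g i)) (trans (sym (ℚX.at e i))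
    (trans (MapPolynomials.coef-map (ιHom ℚ-ring) G i) (cong ℚF.ι z))))))

toℚX-injective : ∀ {F G} → toℚX F ℚX.≋ toℚX G → F ℤX.≋ G
toℚX-injective {F} {G} e = ℤX.pointwise λ i → ℚF.ι-injective
  (trans (sym (MapPolynomials.coef-map (ιHom ℚ-ring) F i)) (trans (ℚX.at e i) (MapPolynomials.coef-map (ιHom ℚ-ring) G i)))

-- The product of the two denominators is removed prime by prime, each prime being cancelled from
-- one of the integral factors. Contents and primitive parts are never formed.
gauss : ∀ F g h → toℚX F ℚX.≋ g ℚX.⊠ h →
  ∃₂ λ G H → F ℤX.≋ G ℤX.⊠ H × (∀ i → ℚX.coef g i ≢ ℚ.0ℚ → ℤX.coef G i ≢ + 0) × (∀ i → ℚX.coef h i ≢ ℚ.0ℚ → ℤX.coef H i ≢ + 0)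
gauss F g h e = descend (clear-denominators g) (clear-denominators h)
  where
  Conclusion : Set
  Conclusion = ∃₂ λ G H → F ℤX.≋ G ℤX.⊠ H × (∀ i → ℚX.coef g i ≢ ℚ.0ℚ → ℤX.coef G i ≢ + 0) × (∀ i → ℚX.coef h i ≢ ℚ.0ℚ → ℤX.coef H i ≢ + 0)
  module P = RingFacts ℚX.polynomialRing
  descend : (∃₂ λ c G → NonZero c × toℚX G ℚX.≋ ℚX.scale (ℚF.ι (+ c)) g) → (∃₂ λ d H → NonZero d × toℚX H ℚX.≋ ℚX.scale (ℚF.ι (+ d)) h) → Conclusion
  descend (c , G , nc , eG) (d , H , nd , eH) = conclude (gauss-primes factors factorsPrime F G H integral)
    where
    instance
      nonZero : NonZero (c * d)
      nonZero = ℕₚ.m*n≢0 c d {{nc}} {{nd}}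
    open PrimeFactorisation (factorise (c * d))
    γ = ℚF.ι (+ c)
    δ = ℚF.ι (+ d)
    cd : ℚF.ι (+ (c * d)) ≡ γ ℚ.* δ
    cd = trans (cong ℚF.ι (ℤₚ.pos-* c d)) (ℚF.ι-* (+ c) (+ d))
    scaled : ℚX.scale (γ ℚ.* δ) (g ℚX.⊠ h) ℚX.≋ ℚX.scale γ g ℚX.⊠ ℚX.scale δ h
    scaled = begin
      ℚX.scale (γ ℚ.* δ) (g ℚX.⊠ h)          ≈⟨ ℚX.scale-scale γ δ (g ℚX.⊠ h) ⟩
      ℚX.scale γ (ℚX.scale δ (g ℚX.⊠ h))     ≈⟨ ℚX.scale-cong {γ} refl (ℚX.scale-cong {δ} refl (ℚX.⊠-comm g h)) ⟩
      ℚX.scale γ (ℚX.scale δ (h ℚX.⊠ g))     ≈⟨ ℚX.scale-cong {γ} refl (ℚX.scale-⊠ δ h g) ⟨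
      ℚX.scale γ (ℚX.scale δ h ℚX.⊠ g)       ≈⟨ ℚX.scale-cong {γ} refl (ℚX.⊠-comm (ℚX.scale δ h) g) ⟩
      ℚX.scale γ (g ℚX.⊠ ℚX.scale δ h)       ≈⟨ ℚX.scale-⊠ γ g (ℚX.scale δ h) ⟨
      ℚX.scale γ g ℚX.⊠ ℚX.scale δ h         ∎
      where open P.≈-Reasoning
    integral-ℚ : toℚX (ℤX.scale (+ (c * d)) F) ℚX.≋ toℚX (G ℤX.⊠ H)
    integral-ℚ = begin
      toℚX (ℤX.scale (+ (c * d)) F)                 ≈⟨ MapPolynomials.map-scale (ιHom ℚ-ring) (+ (c * d)) F ⟩
      ℚX.scale (ℚF.ι (+ (c * d))) (toℚX F)          ≈⟨ ℚX.scale-cong {ℚF.ι (+ (c * d))} cd e ⟩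
      ℚX.scale (γ ℚ.* δ) (g ℚX.⊠ h)                 ≈⟨ scaled ⟩
      ℚX.scale γ g ℚX.⊠ ℚX.scale δ h                ≈⟨ ℚX.⊠-cong eG eH ⟨
      toℚX G ℚX.⊠ toℚX H                            ≈⟨ MapPolynomials.map-⊠ (ιHom ℚ-ring) G H ⟨
      toℚX (G ℤX.⊠ H)                               ∎
      where open P.≈-Reasoning
    integral : ℤX.scale (+ product factors) F ℤX.≋ G ℤX.⊠ H
    integral = subst (λ k → ℤX.scale (+ k) F ℤX.≋ G ℤX.⊠ H) isFactorisation (toℚX-injective {ℤX.scale (+ (c * d)) F} {G ℤX.⊠ H} integral-ℚ)
    conclude : (∃₂ λ G′ H′ → F ℤX.≋ G′ ℤX.⊠ H′ × (∀ i → ℤX.coef G i ≢ + 0 → ℤX.coef G′ i ≢ + 0) × (∀ i → ℤX.coef H i ≢ + 0 → ℤX.coef H′ i ≢ + 0)) → Conclusion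
    conclude (G′ , H′ , eq , ng , nh) = G′ , H′ , eq , (λ i n → ng i (ℚ-coef-nonzero c {{nc}} g G eG i n)) , (λ i n → nh i (ℚ-coef-nonzero d {{nd}} h H eH i n))

-- Heights, interpolation, and the height of a product

open Evaluation (identityHom ℤ-ring) public using () renaming (evalAt to evaluate)

height : List ℤ → ℕ
height [] = 0
height (a ∷ F) = ℤ.∣ a ∣ ⊔ height F

coef-height : ∀ F i → ℤ.∣ ℤX.coef F i ∣ ≤ height F
coef-height [] i = z≤n
coef-height (a ∷ F) zero = ℕₚ.m≤m⊔n _ _
coef-height (a ∷ F) (suc i) = ℕₚ.≤-trans (coef-height F i) (ℕₚ.m≤n⊔m ℤ.∣ a ∣ _)

height-All : ∀ F → All (λ c → ℤ.∣ c ∣ ≤ height F) F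
height-All [] = []
height-All (a ∷ F) = ℕₚ.m≤m⊔n _ _ ∷ All.map (λ l → ℕₚ.≤-trans l (ℕₚ.m≤n⊔m ℤ.∣ a ∣ _)) (height-All F)

All-height : ∀ {B} F → All (λ c → ℤ.∣ c ∣ ≤ B) F → height F ≤ B
All-height [] [] = z≤n
All-height (a ∷ F) (l ∷ ls) = ℕₚ.⊔-lub l (All-height F ls)

height-positive : ∀ F i → ℤX.coef F i ≢ + 0 → 1 ≤ height F
height-positive F i n = ℕₚ.≤-trans (ℕₚ.n≢0⇒n>0 λ z → n (ℤₚ.∣i∣≡0⇒i≡0 z)) (coef-height F i)

-- The values at c of the tails of F: the quotient of a ∷ F by X - c.
synthetic : ℤ → List ℤ → List ℤ
synthetic c [] = []
synthetic c (b ∷ F) = evaluate c (b ∷ F) ∷ synthetic c F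

length-synthetic : ∀ c F → length (synthetic c F) ≡ length F
length-synthetic c [] = refl
length-synthetic c (b ∷ F) = cong suc (length-synthetic c F)

synthetic-division : ∀ c x a F → (x ℤ.- c) ℤ.* evaluate x (synthetic c F) ≡ evaluate x (a ∷ F) ℤ.- evaluate c (a ∷ F)
synthetic-division c x a [] = solve 3 (λ c x a → (x :- c) :* con (+ 0) := (a :+ x :* con (+ 0)) :- (a :+ c :* con (+ 0))) refl c x a
  where open ℤSolver
synthetic-division c x a (b ∷ F) = begin
  (x ℤ.- c) ℤ.* (v ℤ.+ x ℤ.* q)              ≡⟨ solve 4 (λ x c v q → (x :- c) :* (v :+ x :* q) := (x :- c) :* v :+ x :* ((x :- c) :* q)) refl x c v q ⟩
  (x ℤ.- c) ℤ.* v ℤ.+ x ℤ.* ((x ℤ.- c) ℤ.* q) ≡⟨ cong (λ y → (x ℤ.- c) ℤ.* v ℤ.+ x ℤ.* y) (synthetic-division c x b F) ⟩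
  (x ℤ.- c) ℤ.* v ℤ.+ x ℤ.* (w ℤ.- v)        ≡⟨ solve 5 (λ x c v w a → (x :- c) :* v :+ x :* (w :- v) := (a :+ x :* w) :- (a :+ c :* v)) refl x c v w a ⟩
  (a ℤ.+ x ℤ.* w) ℤ.- (a ℤ.+ c ℤ.* v)        ∎
  where
  open ≡-Reasoning
  open ℤSolver
  v = evaluate c (b ∷ F)
  w = evaluate x (b ∷ F)
  q = evaluate x (synthetic c F)

sub-≤ : ∀ {N} a c v → ℤ.∣ c ∣ ≤ N → ℤ.∣ a ∣ ≤ ℤ.∣ a ℤ.+ c ℤ.* v ∣ + N * ℤ.∣ v ∣
sub-≤ {N} a c v l = begin
  ℤ.∣ a ∣                                     ≡⟨ cong ℤ.∣_∣ (solve 2 (λ a y → a := (a :+ y) :- y) refl a (c ℤ.* v)) ⟩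
  ℤ.∣ (a ℤ.+ c ℤ.* v) ℤ.- c ℤ.* v ∣           ≤⟨ ℤₚ.∣i-j∣≤∣i∣+∣j∣ (a ℤ.+ c ℤ.* v) (c ℤ.* v) ⟩
  ℤ.∣ a ℤ.+ c ℤ.* v ∣ + ℤ.∣ c ℤ.* v ∣         ≡⟨ cong (λ y → ℤ.∣ a ℤ.+ c ℤ.* v ∣ + y) (ℤₚ.abs-* c v) ⟩
  ℤ.∣ a ℤ.+ c ℤ.* v ∣ + ℤ.∣ c ∣ * ℤ.∣ v ∣     ≤⟨ ℕₚ.+-monoʳ-≤ ℤ.∣ a ℤ.+ c ℤ.* v ∣ (ℕₚ.*-monoˡ-≤ ℤ.∣ v ∣ l) ⟩
  ℤ.∣ a ℤ.+ c ℤ.* v ∣ + N * ℤ.∣ v ∣           ∎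
  where
  open ℕₚ.≤-Reasoning
  open ℤSolver

head-synthetic : ∀ c F → ℤ.∣ evaluate c F ∣ ≤ height (synthetic c F)
head-synthetic c [] = z≤n
head-synthetic c (b ∷ F) = ℕₚ.m≤m⊔n _ _

height-tail-synthetic : ∀ {N} c → ℤ.∣ c ∣ ≤ N → ∀ F → height F ≤ suc N * height (synthetic c F)
height-tail-synthetic c l [] = z≤n
height-tail-synthetic {N} c l (b ∷ F) = ℕₚ.⊔-lub
  (ℕₚ.≤-trans (sub-≤ b c (evaluate c F) l) (ℕₚ.+-mono-≤ (ℕₚ.m≤m⊔n _ _)
    (ℕₚ.*-monoʳ-≤ N (ℕₚ.≤-trans (head-synthetic c F) (ℕₚ.m≤n⊔m ℤ.∣ evaluate c (b ∷ F) ∣ _)))))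
  (ℕₚ.≤-trans (height-tail-synthetic c l F) (ℕₚ.*-monoʳ-≤ (suc N) (ℕₚ.m≤n⊔m ℤ.∣ evaluate c (b ∷ F) ∣ _)))

height-synthetic : ∀ {N} c → ℤ.∣ c ∣ ≤ N → ∀ a F →
  height (a ∷ F) ≤ ℤ.∣ evaluate c (a ∷ F) ∣ + suc N * height (synthetic c F)
height-synthetic {N} c l a F = ℕₚ.⊔-lub
  (ℕₚ.≤-trans (sub-≤ a c (evaluate c F) l) (ℕₚ.+-monoʳ-≤ ℤ.∣ evaluate c (a ∷ F) ∣
    (ℕₚ.*-mono-≤ (ℕₚ.n≤1+n N) (head-synthetic c F))))
  (ℕₚ.≤-trans (height-tail-synthetic c l F) (ℕₚ.m≤n+m (suc N * height (synthetic c F)) ℤ.∣ evaluate c (a ∷ F) ∣))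

-- The recursion follows the induction in `interpolation`: removing one point doubles the bound for
-- the values, and returning from the quotient to the polynomial costs a factor `suc N` and one more
-- value.
interpolationConstant : ℕ → ℕ → ℕ
interpolationConstant N zero = 0
interpolationConstant N (suc m) = suc (suc N * (interpolationConstant N m * 2))

interpolationConstant-mono : ∀ N {l m} → l ≤ m → interpolationConstant N l ≤ interpolationConstant N m
interpolationConstant-mono N z≤n = z≤n
interpolationConstant-mono N (s≤s l) = s≤s (ℕₚ.*-monoʳ-≤ (suc N) (ℕₚ.*-monoˡ-≤ 2 (interpolationConstant-mono N l)))

-- Repeated division by `X - c` at the given points. Distinct integers differ by at least 1, so the
-- values of the quotient at the other points are at most twice as large. The factor `k` allows
-- hypotheses of the form `K |F(x)| < height F` to be used without fractions.
interpolation : ∀ N k b xs → Unique xs → All (λ x → ℤ.∣ x ∣ ≤ N) xs → ∀ F → length F ≤ length xs →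
  All (λ x → k * ℤ.∣ evaluate x F ∣ ≤ b) xs → k * height F ≤ interpolationConstant N (length xs) * b
interpolation N k b xs u small [] l v = ℕₚ.≤-trans (ℕₚ.≤-reflexive (ℕₚ.*-zeroʳ k)) z≤n
interpolation N k b (c ∷ xs) (c∉ ∷ u) (lc ∷ small) (a ∷ F) (s≤s l) (vc ∷ v) = begin
  k * height (a ∷ F)                                          ≤⟨ ℕₚ.*-monoʳ-≤ k (height-synthetic c lc a F) ⟩
  k * (ℤ.∣ evaluate c (a ∷ F) ∣ + suc N * height q)           ≡⟨ solve 4 (λ k e n h → k :* (e :+ n :* h) := k :* e :+ n :* (k :* h)) refl k ℤ.∣ evaluate c (a ∷ F) ∣ (suc N) (height q) ⟩
  k * ℤ.∣ evaluate c (a ∷ F) ∣ + suc N * (k * height q)       ≤⟨ ℕₚ.+-mono-≤ vc (ℕₚ.*-monoʳ-≤ (suc N) induction) ⟩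
  b + suc N * (A * (b * 2))                                   ≡⟨ solve 3 (λ b n a → b :+ n :* (a :* (b :* con 2)) := (con 1 :+ n :* (a :* con 2)) :* b) refl b (suc N) A ⟩
  interpolationConstant N (suc (length xs)) * b               ∎
  where
  open ℕₚ.≤-Reasoning
  open ℕSolver
  q = synthetic c F
  A = interpolationConstant N (length xs)
  bound : ∀ {x} → c ≢ x → k * ℤ.∣ evaluate x (a ∷ F) ∣ ≤ b → k * ℤ.∣ evaluate x q ∣ ≤ b * 2
  bound {x} c≢x vx = begin
    k * ℤ.∣ evaluate x q ∣                             ≤⟨ ℕₚ.*-monoʳ-≤ k (ℕₚ.m≤n*m ℤ.∣ evaluate x q ∣ ℤ.∣ x ℤ.- c ∣ {{ℕ.≢-nonZero λ z → c≢x (sym (ℤₚ.i-j≡0⇒i≡j x c (ℤₚ.∣i∣≡0⇒i≡0 z)))}}) ⟩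
    k * (ℤ.∣ x ℤ.- c ∣ * ℤ.∣ evaluate x q ∣)           ≡⟨ cong (k *_) (trans (sym (ℤₚ.abs-* (x ℤ.- c) (evaluate x q))) (cong ℤ.∣_∣ (synthetic-division c x a F))) ⟩
    k * ℤ.∣ evaluate x (a ∷ F) ℤ.- evaluate c (a ∷ F) ∣ ≤⟨ ℕₚ.*-monoʳ-≤ k (ℤₚ.∣i-j∣≤∣i∣+∣j∣ (evaluate x (a ∷ F)) (evaluate c (a ∷ F))) ⟩
    k * (ℤ.∣ evaluate x (a ∷ F) ∣ + ℤ.∣ evaluate c (a ∷ F) ∣) ≡⟨ ℕₚ.*-distribˡ-+ k _ _ ⟩
    k * ℤ.∣ evaluate x (a ∷ F) ∣ + k * ℤ.∣ evaluate c (a ∷ F) ∣ ≤⟨ ℕₚ.+-mono-≤ vx vc ⟩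
    b + b                                              ≡⟨ solve 1 (λ b → b :+ b := b :* con 2) refl b ⟩
    b * 2                                              ∎
  induction : k * height q ≤ A * (b * 2)
  induction = interpolation N k (b * 2) xs u small q (subst (_≤ length xs) (sym (length-synthetic c F)) l)
    (All.zipWith (λ { (n , vx) → bound n vx }) (c∉ , v))

vanishing : ∀ xs → Unique xs → ∀ F → length F ≤ length xs → All (λ x → evaluate x F ≡ + 0) xs → height F ≡ 0
vanishing xs u F l v = ℕₚ.n≤0⇒n≡0 (ℕₚ.≤-trans (ℕₚ.≤-reflexive (sym (ℕₚ.*-identityˡ (height F))))
  (ℕₚ.≤-trans (interpolation (height xs) 1 0 xs u (height-All xs) F l (All.map (λ e → ℕₚ.≤-reflexive (trans (ℕₚ.*-identityˡ _) (cong ℤ.∣_∣ e))) v))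
    (ℕₚ.≤-reflexive (ℕₚ.*-zeroʳ (interpolationConstant (height xs) (length xs))))))

evaluationConstant : ℕ → ℕ → ℕ
evaluationConstant N zero = 0
evaluationConstant N (suc l) = suc (N * evaluationConstant N l)

evaluate-bound : ∀ {N B} x → ℤ.∣ x ∣ ≤ N → ∀ F → All (λ c → ℤ.∣ c ∣ ≤ B) F → ℤ.∣ evaluate x F ∣ ≤ evaluationConstant N (length F) * B
evaluate-bound x l [] [] = z≤n
evaluate-bound {N} {B} x l (a ∷ F) (la ∷ ls) = begin
  ℤ.∣ a ℤ.+ x ℤ.* evaluate x F ∣                  ≤⟨ ℤₚ.∣i+j∣≤∣i∣+∣j∣ a (x ℤ.* evaluate x F) ⟩
  ℤ.∣ a ∣ + ℤ.∣ x ℤ.* evaluate x F ∣              ≡⟨ cong (λ y → ℤ.∣ a ∣ + y) (ℤₚ.abs-* x (evaluate x F)) ⟩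
  ℤ.∣ a ∣ + ℤ.∣ x ∣ * ℤ.∣ evaluate x F ∣          ≤⟨ ℕₚ.+-mono-≤ la (ℕₚ.*-mono-≤ l (evaluate-bound x l F ls)) ⟩
  B + N * (evaluationConstant N (length F) * B)   ≡⟨ cong (λ y → B + y) (ℕₚ.*-assoc N (evaluationConstant N (length F)) B) ⟨
  B + (N * evaluationConstant N (length F)) * B   ∎
  where open ℕₚ.≤-Reasoning

-- A nonzero polynomial is small at fewer points than its length, so among sufficiently many
-- points there is one where neither factor is small.
module _ (N : ℕ) where
  private
    K = interpolationConstant N N
    points = map +_ (upTo N)

    points-unique : Unique points
    points-unique = Uniqueₚ.map⁺ ℤₚ.+-injective (Uniqueₚ.upTo⁺ N)

    point-bound : ∀ {x} → x ∈ points → ℤ.∣ x ∣ ≤ N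
    point-bound i with ∈ₚ.∈-map⁻ +_ i
    ... | k , j , refl = ℕₚ.<⇒≤ (∈ₚ.∈-upTo⁻ j)

    Small : List ℤ → ℤ → Set
    Small F x = K * ℤ.∣ evaluate x F ∣ < height F

    pred-< : ∀ {m} → 1 ≤ m → ℕ.pred m < m
    pred-< {suc m} _ = ℕₚ.≤-refl

    -- If `F` were at most as long as the list of points, interpolation with the bound
    -- `height F - 1` would give `K * height F ≤ K * (height F - 1)`. This is why smallness is
    -- defined with the interpolation constant `K` itself.
    few-small : ∀ F → 1 ≤ height F → ∀ xs → (∀ {x} → x ∈ xs → x ∈ points) → Unique xs → length xs ≤ N →
      All (Small F) xs → length xs < length F
    few-small F pos xs sub u l small = ℕₚ.≰⇒> λ lF → ℕₚ.<⇒≱ (pred-< pos)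
      (ℕₚ.*-cancelˡ-≤ K {{K-nonzero lF}} (begin
        K * height F                                            ≤⟨ interpolation N K (ℕ.pred (height F)) xs u (All.tabulate (point-bound ∘ sub)) F lF (All.map ℕₚ.<⇒≤pred small) ⟩
        interpolationConstant N (length xs) * ℕ.pred (height F) ≤⟨ ℕₚ.*-monoˡ-≤ (ℕ.pred (height F)) (interpolationConstant-mono N l) ⟩
        K * ℕ.pred (height F)                                   ∎))
      where
      open ℕₚ.≤-Reasoning
      positive : ∀ F → 1 ≤ height F → 1 ≤ interpolationConstant N (length F)
      positive (a ∷ F) _ = s≤s z≤n
      K-nonzero : length F ≤ length xs → NonZero K
      K-nonzero lF = ℕ.>-nonZero (ℕₚ.≤-trans (positive F pos) (interpolationConstant-mono N (ℕₚ.≤-trans lF l)))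

    module _ {P Q : ℤ → Set} (P? : ∀ x → Dec (P x)) (Q? : ∀ x → Dec (Q x)) where
      cover : ∀ xs → (∃ λ x → x ∈ xs × ¬ P x × ¬ Q x) ⊎ length xs ≤ length (filter P? xs) + length (filter Q? xs)
      cover [] = inj₂ z≤n
      cover (x ∷ xs) with cover xs
      ... | inj₁ (y , i , np , nq) = inj₁ (y , there i , np , nq)
      ... | inj₂ l with P? x | Q? x
      ... | yes p | yes q = inj₂ (s≤s (ℕₚ.≤-trans l (ℕₚ.+-monoʳ-≤ (length (filter P? xs)) (ℕₚ.n≤1+n _))))
      ... | yes p | no nq = inj₂ (s≤s l)
      ... | no np | yes q = inj₂ (ℕₚ.≤-trans (s≤s l) (ℕₚ.≤-reflexive (sym (ℕₚ.+-suc _ _))))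
      ... | no np | no nq = inj₁ (x , here refl , np , nq)

    small? : ∀ F x → Dec (Small F x)
    small? F x = suc (K * ℤ.∣ evaluate x F ∣) ℕₚ.≤? height F

    few : ∀ F → 1 ≤ height F → length (filter (small? F) points) < length F
    few F pos = few-small F pos (filter (small? F) points) (λ i → proj₁ (∈ₚ.∈-filter⁻ (small? F) {xs = points} i)) (Uniqueₚ.filter⁺ (small? F) points-unique)
      (ℕₚ.≤-trans (Listₚ.length-filter (small? F) points) (ℕₚ.≤-reflexive length-points)) (Allₚ.all-filter (small? F) points)
      where
      length-points : length points ≡ N
      length-points = trans (Listₚ.length-map +_ (upTo N)) (Listₚ.length-upTo N)

  -- At most `length G - 1` of the `N` points are small for `G` and `length H - 1` for `H`, which
  -- are together fewer than `N`. At a remaining point `x` both heights are controlled by the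
  -- values, and the product of the values is the value of `F`.
  height-product : ∀ F G H → F ℤX.≋ G ℤX.⊠ H → 1 ≤ height G → 1 ≤ height H → length G + length H ≤ suc N →
    height G * height H ≤ (K * K * evaluationConstant N (length F)) * height F
  height-product F G H e pg ph l with cover (small? G) (small? H) points
  ... | inj₂ covered = contradiction (begin-strict
      suc N                                     ≡⟨ cong suc (trans (Listₚ.length-map +_ (upTo N)) (Listₚ.length-upTo N)) ⟨
      suc (length points)                       ≤⟨ s≤s covered ⟩
      suc (length (filter (small? G) points)) + length (filter (small? H) points) <⟨ ℕₚ.+-mono-≤-< (few G pg) (few H ph) ⟩
      length G + length H                       ≤⟨ l ⟩
      suc N                                     ∎) (ℕₚ.<-irrefl refl)
    where open ℕₚ.≤-Reasoning
  ... | inj₁ (x , i , ng , nh) = begin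
      height G * height H                                         ≤⟨ ℕₚ.*-mono-≤ (ℕₚ.≮⇒≥ ng) (ℕₚ.≮⇒≥ nh) ⟩
      (K * g) * (K * h)                                           ≡⟨ solve 3 (λ k g h → (k :* g) :* (k :* h) := (k :* k) :* (g :* h)) refl K g h ⟩
      (K * K) * (g * h)                                           ≡⟨ cong (K * K *_) product-value ⟨
      (K * K) * ℤ.∣ evaluate x F ∣                                ≤⟨ ℕₚ.*-monoʳ-≤ (K * K) (evaluate-bound x (point-bound i) F (height-All F)) ⟩
      (K * K) * (evaluationConstant N (length F) * height F)      ≡⟨ ℕₚ.*-assoc (K * K) _ (height F) ⟨
      (K * K * evaluationConstant N (length F)) * height F        ∎
    where
    open ℕₚ.≤-Reasoning
    open ℕSolver
    g = ℤ.∣ evaluate x G ∣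
    h = ℤ.∣ evaluate x H ∣
    product-value : ℤ.∣ evaluate x F ∣ ≡ g * h
    product-value = trans (cong ℤ.∣_∣ (trans (Evaluation.evalAt-cong (identityHom ℤ-ring) x {F} {G ℤX.⊠ H} e)
      (Evaluation.evalAt-⊠ (identityHom ℤ-ring) x G H))) (ℤₚ.abs-* (evaluate x G) (evaluate x H))

-- Factorisations over ℤ and their decidability

record Factorisation (F : List ℤ) (n : ℕ) : Set where
  field
    d e      : ℕ
    degrees  : suc d + suc e ≡ n
    G H      : List ℤ
    length-G : length G ≡ suc (suc d)
    length-H : length H ≡ suc (suc e)
    equation : F ℤX.≋ G ℤX.⊠ H

truncate : ℕ → List ℤ → List ℤ
truncate zero F = []
truncate (suc m) F = ℤX.coef F 0 ∷ truncate m (drop 1 F)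

length-truncate : ∀ m F → length (truncate m F) ≡ m
length-truncate zero F = refl
length-truncate (suc m) F = cong suc (length-truncate m (drop 1 F))

coef-drop : ∀ F i → ℤX.coef (drop 1 F) i ≡ ℤX.coef F (suc i)
coef-drop [] i = refl
coef-drop (a ∷ F) i = refl

truncate-≋ : ∀ m F → (∀ i → m ≤ i → ℤX.coef F i ≡ + 0) → truncate m F ℤX.≋ F
truncate-≋ zero F z = ℤX.pointwise λ i → sym (z i z≤n)
truncate-≋ (suc m) F z = ℤX.pointwise λ where
  zero → refl
  (suc i) → trans (ℤX.at (truncate-≋ m (drop 1 F) (λ i l → trans (coef-drop F i) (z (suc i) (s≤s l)))) i) (coef-drop F i)

ℤX-degree? : ∀ F → (∀ i → ℤX.coef F i ≡ + 0) ⊎ ∃ λ d → ℤX.coef F d ≢ + 0 × (∀ i → d < i → ℤX.coef F i ≡ + 0)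
ℤX-degree? = ℤX.leading? (zeroIdeal ℤ-ring) (λ a → a ℤ.≟ + 0)

ℤ-nonzero-* : ∀ {a b} → a ≢ + 0 → b ≢ + 0 → a ℤ.* b ≢ + 0
ℤ-nonzero-* {a} na nb e = [ na , nb ]′ (ℤₚ.i*j≡0⇒i≡0∨j≡0 a e)

degree-⊠ : ∀ F G H {n d e} → F ℤX.≋ G ℤX.⊠ H → ℤX.coef F n ≢ + 0 → (∀ i → n < i → ℤX.coef F i ≡ + 0) →
  ℤX.coef G d ≢ + 0 → (∀ i → d < i → ℤX.coef G i ≡ + 0) → ℤX.coef H e ≢ + 0 → (∀ i → e < i → ℤX.coef H i ≡ + 0) → d + e ≡ n
degree-⊠ F G H {n} {d} {e} eq nF aF nG aG nH aH = ℕₚ.≤-antisym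
  (ℕₚ.≮⇒≥ λ l → ℤ-nonzero-* nG nH (trans (sym top) (aF (d + e) l)))
  (ℕₚ.≮⇒≥ λ l → nF (trans (ℤX.at eq n) (ℤX.coef-⊠-above (zeroIdeal ℤ-ring) G H d e aG aH n l)))
  where
  top : ℤX.coef F (d + e) ≡ ℤX.coef G d ℤ.* ℤX.coef H e
  top = trans (ℤX.at eq (d + e)) (ℤₚ.i-j≡0⇒i≡j _ _ (ℤX.coef-⊠-top (zeroIdeal ℤ-ring) G H d e aG aH))

-- The lists are cut off at their degrees. Exact lengths are what the search through `words` and the
-- later counting of coefficients rely on.
factorisation : ∀ F {n} G H → F ℤX.≋ G ℤX.⊠ H → ℤX.coef F n ≢ + 0 → (∀ i → n < i → ℤX.coef F i ≡ + 0) →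
  (∃ λ i → 1 ≤ i × ℤX.coef G i ≢ + 0) → (∃ λ i → 1 ≤ i × ℤX.coef H i ≢ + 0) → Factorisation F n
factorisation F G H eq nF aF (i , li , ni) (j , lj , nj) with ℤX-degree? G | ℤX-degree? H
... | inj₁ z | _ = contradiction (z i) ni
... | inj₂ _ | inj₁ z = contradiction (z j) nj
... | inj₂ (zero , _ , aG) | inj₂ _ = contradiction (aG i li) ni
... | inj₂ (suc d , _ , _) | inj₂ (zero , _ , aH) = contradiction (aH j lj) nj
... | inj₂ (suc d , nG , aG) | inj₂ (suc e , nH , aH) = record
  { d = d ; e = e ; degrees = degree-⊠ F G H eq nF aF nG aG nH aH
  ; G = truncate (suc (suc d)) G ; H = truncate (suc (suc e)) H
  ; length-G = length-truncate (suc (suc d)) G ; length-H = length-truncate (suc (suc e)) H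
  ; equation = ℤX.≋-trans eq (ℤX.≋-sym (ℤX.⊠-cong (truncate-≋ (suc (suc d)) G aG) (truncate-≋ (suc (suc e)) H aH))) }

words : ℕ → ℕ → List (List ℤ)
words B zero = [] ∷ []
words B (suc k) = Data.List.cartesianProductWith _∷_ (signedUpTo (suc B)) (words B k)

∈-signedUpTo : ∀ {B} a → ℤ.∣ a ∣ ≤ B → a ∈ signedUpTo (suc B)
∈-signedUpTo (+ k) l = ∈ₚ.∈-++⁺ˡ (∈ₚ.∈-map⁺ +_ (∈ₚ.∈-upTo⁺ (s≤s l)))
∈-signedUpTo {B} -[1+ k ] l = ∈ₚ.∈-++⁺ʳ (map +_ (upTo (suc B))) (∈ₚ.∈-map⁺ -[1+_] (∈ₚ.∈-upTo⁺ (ℕₚ.≤-trans l (ℕₚ.n≤1+n B))))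

∈-words : ∀ {B} F → All (λ c → ℤ.∣ c ∣ ≤ B) F → F ∈ words B (length F)
∈-words [] [] = here refl
∈-words (a ∷ F) (l ∷ ls) = ∈ₚ.∈-cartesianProductWith⁺ _∷_ (∈-signedUpTo a l) (∈-words F ls)

words-length : ∀ {B} k {F} → F ∈ words B k → length F ≡ k
words-length zero (here refl) = refl
words-length {B} (suc k) i with ∈ₚ.∈-cartesianProductWith⁻ _∷_ (signedUpTo (suc B)) (words B k) i
... | a , F , _ , j , refl = cong suc (words-length k j)

zeroList? : ∀ F → Dec (F ℤX.≋ [])
zeroList? F with ℤX-degree? F
... | inj₁ z = yes (ℤX.pointwise z)
... | inj₂ (d , n , _) = no λ e → n (ℤX.at e d)

≋? : ∀ F G → Dec (F ℤX.≋ G)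
≋? F G with zeroList? (F ℤX.⊞ ℤX.neg G)
... | yes z = yes (P.⊝≈𝟘⇒≈ F G z)
  where module P = RingFacts ℤX.polynomialRing
... | no n = no λ e → n (P.≈⇒⊝≈𝟘 e)
  where module P = RingFacts ℤX.polynomialRing

factor-heights : ∀ F G H → F ℤX.≋ G ℤX.⊠ H → ∀ i → ℤX.coef F i ≢ + 0 → 1 ≤ height G × 1 ≤ height H
factor-heights F G H e i n = positive G (λ z → n (trans (ℤX.at e i) (ℤX.coef-⊠-member (zeroIdeal ℤ-ring) G H z i))) ,
  positive H (λ z → n (trans (ℤX.at e i) (trans (ℤX.at (ℤX.⊠-comm G H) i) (ℤX.coef-⊠-member (zeroIdeal ℤ-ring) H G z i))))
  where
  positive : ∀ P → ¬ (∀ i → ℤX.coef P i ≡ + 0) → 1 ≤ height P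
  positive P nz with ℤX-degree? P
  ... | inj₁ z = contradiction z nz
  ... | inj₂ (d , nd , _) = height-positive P d nd

abstract
  -- What interpolation at the points `0 , … , n` yields: one interpolation constant for each
  -- factor, and the cost of evaluating `F` at such a point. Any constant depending on `n` alone
  -- would do as well.
  heightConstant : ℕ → ℕ
  heightConstant n = interpolationConstant (suc n) (suc n) * interpolationConstant (suc n) (suc n) * evaluationConstant (suc n) (suc n)

  factorisation-heights : ∀ F {n} → length F ≡ suc n → (f : Factorisation F n) → ∀ i → ℤX.coef F i ≢ + 0 →
    height (Factorisation.G f) * height (Factorisation.H f) ≤ heightConstant n * height F
  factorisation-heights F {n} l f i nz = subst (λ k → height G * height H ≤ (interpolationConstant (suc n) (suc n) * interpolationConstant (suc n) (suc n) * evaluationConstant (suc n) k) * height F) l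
    (height-product (suc n) F G H equation (proj₁ hs) (proj₂ hs) (ℕₚ.≤-reflexive (trans (cong₂ _+_ length-G length-H)
      (trans (cong suc (ℕₚ.+-suc (suc d) (suc e))) (cong (λ k → suc (suc k)) degrees)))))
    where
    open Factorisation f
    hs : 1 ≤ height G × 1 ≤ height H
    hs = factor-heights F G H equation i nz

-- Both heights are at least 1 and their product is at most `heightConstant n * height F`, so each
-- factor lies in a finite box and can be searched for.
factorisation? : ∀ F n → length F ≡ suc n → ℤX.coef F n ≢ + 0 → Dec (Factorisation F n)
factorisation? F n l nz = Dec.map′ to from
  (Any.any? (λ d → Any.any? (λ e → Any.any? (λ G → Any.any? (λ H → (suc d + suc e ℕₚ.≟ n) Dec.×-dec ≋? F (G ℤX.⊠ H))
    (words B (suc (suc e)))) (words B (suc (suc d)))) (upTo n)) (upTo n))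
  where
  B = heightConstant n * height F
  Found : Set
  Found = Any (λ d → Any (λ e → Any (λ G → Any (λ H → (suc d + suc e ≡ n) × (F ℤX.≋ G ℤX.⊠ H))
    (words B (suc (suc e)))) (words B (suc (suc d)))) (upTo n)) (upTo n)
  to : Found → Factorisation F n
  to a with find a
  ... | d , _ , a₁ with find a₁
  ... | e , _ , a₂ with find a₂
  ... | G , iG , a₃ with find a₃
  ... | H , iH , deg , eq = record { d = d ; e = e ; degrees = deg ; G = G ; H = H
    ; length-G = words-length (suc (suc d)) iG ; length-H = words-length (suc (suc e)) iH ; equation = eq }
  from : Factorisation F n → Found
  from f = lose (∈ₚ.∈-upTo⁺ (ℕₚ.≤-trans (ℕₚ.m≤m+n (suc d) (suc e)) (ℕₚ.≤-reflexive degrees)))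
    (lose (∈ₚ.∈-upTo⁺ (ℕₚ.≤-trans (ℕₚ.m≤n+m (suc e) (suc d)) (ℕₚ.≤-reflexive degrees)))
    (lose (member G length-G boundG) (lose (member H length-H boundH) (degrees , equation))))
    where
    open Factorisation f
    hs = factor-heights F G H equation n nz
    bound = factorisation-heights F l f n nz
    boundG : height G ≤ B
    boundG = ℕₚ.≤-trans (ℕₚ.m≤m*n (height G) (height H) {{ℕ.>-nonZero (proj₂ hs)}}) bound
    boundH : height H ≤ B
    boundH = ℕₚ.≤-trans (ℕₚ.m≤n*m (height H) (height G) {{ℕ.>-nonZero (proj₁ hs)}}) bound
    member : ∀ P {k} → length P ≡ k → height P ≤ B → P ∈ words B k
    member P refl h = ∈-words P (All.map (λ c → ℕₚ.≤-trans c h) (height-All P))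

-- Roots of unity modulo 3 and the order of a ratio of roots

residue : ℤ → Fin 3
residue a = Data.Fin.fromℕ< (ℤDivMod.n%ℕd<d a 3)

residue-∣ : ∀ a → + 3 ℤ∣.∣ a ℤ.- + toℕ (residue a)
residue-∣ a = ℤ∣.divides q (begin
  a ℤ.- + toℕ (residue a)            ≡⟨ cong (λ k → a ℤ.- + k) (Finₚ.toℕ-fromℕ< (ℤDivMod.n%ℕd<d a 3)) ⟩
  a ℤ.- + r                          ≡⟨ cong (ℤ._- + r) (ℤDivMod.a≡a%ℕn+[a/ℕn]*n a 3) ⟩
  + r ℤ.+ q ℤ.* + 3 ℤ.- + r          ≡⟨ solve 2 (λ r q → r :+ q :- r := q) refl (+ r) (q ℤ.* + 3) ⟩
  q ℤ.* + 3                          ∎)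
  where
  open ≡-Reasoning
  open ℤSolver
  r = a ℤDivMod.%ℕ 3
  q = a ℤDivMod./ℕ 3

cancel-mod3 : ∀ c → ¬ + 3 ℤ∣.∣ c → ∀ t → ∃ λ k → + 3 ℤ∣.∣ t ℤ.+ k ℤ.* c
cancel-mod3 c n t with residue c | residue-∣ c
... | zero | div = contradiction (subst (+ 3 ℤ∣.∣_) (ℤₚ.+-identityʳ c) div) n
... | suc zero | ℤ∣.divides q eq = ℤ.- t , ℤ∣.divides (ℤ.- t ℤ.* q)
  (trans (cong (λ c → t ℤ.+ ℤ.- t ℤ.* c) (trans (solve 1 (λ c → c := (c :- con (+ 1)) :+ con (+ 1)) refl c) (cong (ℤ._+ + 1) eq)))
    (solve 2 (λ t q → t :+ (:- t) :* (q :* con (+ 3) :+ con (+ 1)) := ((:- t) :* q) :* con (+ 3)) refl t q))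
  where open ℤSolver
... | suc (suc zero) | ℤ∣.divides q eq = t , ℤ∣.divides (t ℤ.* q ℤ.+ t)
  (trans (cong (λ c → t ℤ.+ t ℤ.* c) (trans (solve 1 (λ c → c := (c :- con (+ 2)) :+ con (+ 2)) refl c) (cong (ℤ._+ + 2) eq)))
    (solve 2 (λ t q → t :+ t :* (q :* con (+ 3) :+ con (+ 2)) := (t :* q :+ t) :* con (+ 3)) refl t q))
  where open ℤSolver

module RootOfUnity (K : CommutativeRing 0ℓ 0ℓ) (isField : IsChar0Field K)
                   (ζ : RingFacts.A K) (m : ℕ) (1≤m : 1 ≤ m) (ζ^m≈1 : RingFacts._≈_ K (pow K ζ m) (RingFacts.𝟙 K)) where
  open CharZeroField K isField
  open Spans K
  open ≈-Reasoning

  private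
    es = powers ζ m
    three = ι (+ 3)

  one-∈ : 𝟙 ∈ es
  one-∈ = power-∈ ζ 1≤m

  Integral : A → Set
  Integral = Multiplier es

  ζ-integral : Integral ζ
  ζ-integral = powers-multiplier ζ m (span-resp es (≈-sym ζ^m≈1) (span-∈ one-∈))

  0-integral : Integral 𝟘
  0-integral = multiplier-ι (+ 0)

  neg-integral : ∀ {x} → Integral x → Integral (⊖ x)
  neg-integral {x} i = multiplier-resp (≈-trans (⊗-congʳ (⊖-cong ι-1)) (solve 1 (λ x → :- :1 :* x := :- x) ≈-refl x))
    (multiplier-* (multiplier-ι -[1+ 0 ]) i)

  -- If `3 a = 1` with `a` integral, every generator is 3 times an element of the module `ℤ[ζ]`.
  -- Then `nakayama` yields an integer congruent to 1 modulo 3 that annihilates 1, which is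
  -- impossible in characteristic 0.
  three-nonunit : ∀ {a} → Integral a → ¬ (𝟙 ≈ three ⊗ a)
  three-nonunit {a} i e with nakayama es (+ 1) oneMod3-1 (λ {x} x∈ → a ⊗ x , apply i x∈ ,
      ≈-trans (⊗-congʳ (≈-trans ι-1 e)) (⊗-assoc three a x))
  ... | N , oN , kills = ι-nonzero (oneMod3-≢0 oN) (≈-trans (≈-sym (≈-trans (⊗-comm _ _) (⊗-identityˡ _))) (kills one-∈))

  Congruent1 : A → Set
  Congruent1 w = ∃ λ z → Integral z × w ≈ 𝟙 ⊕ three ⊗ z

  congruent1-^ : ∀ {w} → Congruent1 w → ∀ j → Congruent1 (w ^^ j)
  congruent1-^ c zero = 𝟘 , 0-integral , solve 1 (λ d → :1 := :1 :+ d :* :0) ≈-refl three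
  congruent1-^ {w} c@(z , iz , e) (suc j) with congruent1-^ c j
  ... | y , iy , f = z ⊕ (y ⊕ three ⊗ (z ⊗ y)) , multiplier-+ iz (multiplier-+ iy (multiplier-* (multiplier-ι (+ 3)) (multiplier-* iz iy))) ,
    ≈-trans (⊗-cong e f) (solve 3 (λ d z y → (:1 :+ d :* z) :* (:1 :+ d :* y) := :1 :+ d :* (z :+ (y :+ d :* (z :* y)))) ≈-refl three z y)

  geometric : A → ℕ → A
  geometric w zero = 𝟘
  geometric w (suc j) = w ^^ j ⊕ geometric w j

  geometric-product : ∀ w j → (w ⊝ 𝟙) ⊗ geometric w j ≈ w ^^ j ⊝ 𝟙
  geometric-product w zero = solve 1 (λ w → (w :- :1) :* :0 := :1 :- :1) ≈-refl w
  geometric-product w (suc j) = begin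
    (w ⊝ 𝟙) ⊗ (w ^^ j ⊕ geometric w j)              ≈⟨ ⊗-distribˡ _ _ _ ⟩
    (w ⊝ 𝟙) ⊗ w ^^ j ⊕ (w ⊝ 𝟙) ⊗ geometric w j      ≈⟨ ⊕-congˡ (geometric-product w j) ⟩
    (w ⊝ 𝟙) ⊗ w ^^ j ⊕ (w ^^ j ⊝ 𝟙)                 ≈⟨ solve 2 (λ w p → (w :- :1) :* p :+ (p :- :1) := w :* p :- :1) ≈-refl w (w ^^ j) ⟩
    w ⊗ w ^^ j ⊝ 𝟙                                  ∎

  geometric-mod3 : ∀ {w} → Congruent1 w → ∀ j → ∃ λ y → Integral y × geometric w j ≈ ιℕ K j ⊕ three ⊗ y
  geometric-mod3 c zero = 𝟘 , 0-integral , solve 1 (λ d → :0 := :0 :+ d :* :0) ≈-refl three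
  geometric-mod3 c (suc j) with congruent1-^ c j | geometric-mod3 c j
  ... | z , iz , e | y , iy , f = z ⊕ y , multiplier-+ iz iy ,
    ≈-trans (⊕-cong e f) (solve 4 (λ d z n y → (:1 :+ d :* z) :+ (n :+ d :* y) := (:1 :+ n) :+ d :* (z :+ y)) ≈-refl three z (ιℕ K j) y)

  unit-nonzero : ∀ {y} → Integral y → ¬ (𝟙 ⊕ three ⊗ y ≈ 𝟘)
  unit-nonzero {y} iy e = three-nonunit (neg-integral iy) (begin
    𝟙                            ≈⟨ solve 2 (λ d y → :1 := (:1 :+ d :* y) :+ d :* (:- y)) ≈-refl three y ⟩
    (𝟙 ⊕ three ⊗ y) ⊕ three ⊗ ⊖ y ≈⟨ ⊕-congʳ e ⟩
    𝟘 ⊕ three ⊗ ⊖ y              ≈⟨ ⊕-identityˡ _ ⟩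
    three ⊗ ⊖ y                  ∎)

  -- If the sum vanished, `j` would be 3 times an integral element, and so would 1, being `j` or
  -- `-j` plus a multiple of 3.
  coprime-nonzero : ∀ {j k : ℤ} {y} → Integral y → + 1 ≡ j ℤ.+ + 3 ℤ.* k ⊎ + 1 ≡ ℤ.- j ℤ.+ + 3 ℤ.* k → ¬ (ι j ⊕ three ⊗ y ≈ 𝟘)
  coprime-nonzero {j} {k} {y} iy (inj₁ e) z = three-nonunit (multiplier-+ (multiplier-ι k) (neg-integral iy)) (begin
    𝟙                                       ≈⟨ ≈-trans (≈-sym ι-1) (≈-trans (≈-reflexive (cong ι e)) (≈-trans (ι-+ j (+ 3 ℤ.* k)) (⊕-congˡ (ι-* (+ 3) k)))) ⟩
    ι j ⊕ three ⊗ ι k                       ≈⟨ solve 4 (λ j d k y → j :+ d :* k := (j :+ d :* y) :+ d :* (k :- y)) ≈-refl (ι j) three (ι k) y ⟩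
    (ι j ⊕ three ⊗ y) ⊕ three ⊗ (ι k ⊝ y)   ≈⟨ ⊕-congʳ z ⟩
    𝟘 ⊕ three ⊗ (ι k ⊝ y)                   ≈⟨ ⊕-identityˡ _ ⟩
    three ⊗ (ι k ⊝ y)                       ∎)
  coprime-nonzero {j} {k} {y} iy (inj₂ e) z = three-nonunit (multiplier-+ (multiplier-ι k) iy) (begin
    𝟙                                       ≈⟨ ≈-trans (≈-sym ι-1) (≈-trans (≈-reflexive (cong ι e)) (≈-trans (ι-+ (ℤ.- j) (+ 3 ℤ.* k)) (⊕-cong (ι-neg j) (ι-* (+ 3) k)))) ⟩
    ⊖ ι j ⊕ three ⊗ ι k                     ≈⟨ solve 4 (λ j d k y → :- j :+ d :* k := :- (j :+ d :* y) :+ d :* (k :+ y)) ≈-refl (ι j) three (ι k) y ⟩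
    ⊖ (ι j ⊕ three ⊗ y) ⊕ three ⊗ (ι k ⊕ y) ≈⟨ ⊕-congʳ (≈-trans (⊖-cong z) ⊖𝟘) ⟩
    𝟘 ⊕ three ⊗ (ι k ⊕ y)                   ≈⟨ ⊕-identityˡ _ ⟩
    three ⊗ (ι k ⊕ y)                       ∎)

  -- For `w = 1 + 3 z` one has `w ^ 3 - 1 = 9 z (1 + 3 (z + z ^ 2))`, and the last factor is nonzero
  -- by `unit-nonzero`. The analogue for the prime 2 is false, as `w = -1` shows.
  cube : ∀ {w} → Congruent1 w → w ^^ 3 ≈ 𝟙 → w ≈ 𝟙
  cube {w} (z , iz , e) w³ = ≈-trans e (≈-trans (⊕-congˡ (≈-trans (⊗-congˡ z≈0) (⊗-zeroʳ three))) (⊕-identityʳ _))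
    where
    y = z ⊕ z ⊗ z
    nine : ¬ (three ⊗ three ≈ 𝟘)
    nine = nonzero-⊗ (ι-nonzero {+ 3} (λ ())) (ι-nonzero {+ 3} (λ ()))
    identity : z ⊗ ((three ⊗ three) ⊗ (𝟙 ⊕ three ⊗ y)) ≈ 𝟘
    identity = begin
      z ⊗ ((three ⊗ three) ⊗ (𝟙 ⊕ three ⊗ (z ⊕ z ⊗ z)))
        ≈⟨ ⊗-congˡ (⊗-cong (⊗-cong unfold unfold) (⊕-congˡ (⊗-congʳ unfold))) ⟩
      z ⊗ ((t ⊗ t) ⊗ (𝟙 ⊕ t ⊗ (z ⊕ z ⊗ z)))
        ≈⟨ solve 1 (λ z → let t = :1 :+ (:1 :+ (:1 :+ :0)) in z :* ((t :* t) :* (:1 :+ t :* (z :+ z :* z)))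
             := (:1 :+ t :* z) :* ((:1 :+ t :* z) :* ((:1 :+ t :* z) :* :1)) :- :1) ≈-refl z ⟩
      (𝟙 ⊕ t ⊗ z) ^^ 3 ⊝ 𝟙
        ≈⟨ ⊕-congʳ (^^-cong 3 (≈-trans (⊕-congˡ (⊗-congʳ (≈-sym unfold))) (≈-sym e))) ⟩
      w ^^ 3 ⊝ 𝟙   ≈⟨ ≈⇒⊝≈𝟘 w³ ⟩
      𝟘            ∎
      where
      t = 𝟙 ⊕ (𝟙 ⊕ (𝟙 ⊕ 𝟘))
      unfold : three ≈ t
      unfold = ≈-refl
    z≈0 : z ≈ 𝟘
    z≈0 = cancel-nonzero (nonzero-⊗ nine (unit-nonzero (multiplier-+ iz (multiplier-* iz iz)))) identity

  -- Serre's lemma for ℤ[ζ] modulo 3.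
  serre : ∀ fuel k → k ≤ fuel → 1 ≤ k → ∀ {w} → Congruent1 w → w ^^ k ≈ 𝟙 → w ≈ 𝟙
  serre zero k z≤n () c e
  serre (suc fuel) k l 1≤k {w} c e with k ℕDivMod.% 3 | ℕDivMod.m≡m%n+[m/n]*n k 3 | ℕDivMod.m%n<n k 3
  -- The power `w ^ q` is again 1 modulo 3 and its cube is 1, so `w ^ q = 1` with a smaller
  -- exponent.
  ... | 0 | eq | _ = serre fuel q q≤ 1≤q c (cube (congruent1-^ c q) (≈-trans (≈-sym (^^-* w 3 q))
      (≈-trans (≈-reflexive (cong (w ^^_) (trans (ℕₚ.*-comm 3 q) (sym k≡)))) e)))
    where
    q = k ℕDivMod./ 3
    k≡ : k ≡ q * 3
    k≡ = eq
    1≤q : 1 ≤ q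
    1≤q = ℕₚ.n≢0⇒n>0 λ z → ℕₚ.<⇒≱ 1≤k (ℕₚ.≤-reflexive (trans k≡ (cong (_* 3) z)))
    q≤ : q ≤ fuel
    q≤ = ℕₚ.≤-pred (ℕₚ.≤-trans (ℕₚ.≤-trans (ℕₚ.m<m*n q 3 {{ℕ.>-nonZero 1≤q}} (s≤s (s≤s z≤n))) (ℕₚ.≤-reflexive (sym k≡))) l)
  -- The sum `1 + w + ⋯ + w ^ (k - 1)` is `k` modulo 3, hence nonzero. As `w - 1` times this sum is
  -- `w ^ k - 1 = 0`, the first factor vanishes.
  ... | suc r′ | eq | lt with geometric-mod3 c k
  ... | y , iy , f = ⊝≈𝟘⇒≈ w 𝟙 (cancel-nonzero geometric≉0 (≈-trans (geometric-product w k) (≈⇒⊝≈𝟘 e)))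
    where
    q = k ℕDivMod./ 3
    k≡ : + k ≡ + suc r′ ℤ.+ + q ℤ.* + 3
    k≡ = trans (cong +_ eq) (cong (λ x → + suc r′ ℤ.+ x) (ℤₚ.pos-* q 3))
    mod3 : ∀ s → suc s < 3 → ∀ q → ∃ λ k → + 1 ≡ (+ suc s ℤ.+ q ℤ.* + 3) ℤ.+ + 3 ℤ.* k ⊎ + 1 ≡ ℤ.- (+ suc s ℤ.+ q ℤ.* + 3) ℤ.+ + 3 ℤ.* k
    mod3 0 _ q = ℤ.- q , inj₁ (ℤSolver.solve 1 (λ q → con (+ 1) ℤ:= (con (+ 1) ℤ:+ q ℤ:* con (+ 3)) ℤ:+ con (+ 3) ℤ:* (ℤ:- q)) refl q)
      where open ℤSolver using (con) renaming (_:+_ to _ℤ:+_; _:*_ to _ℤ:*_; :-_ to ℤ:-_; _:=_ to _ℤ:=_)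
    mod3 1 _ q = q ℤ.+ + 1 , inj₂ (ℤSolver.solve 1 (λ q → con (+ 1) ℤ:= ℤ:- (con (+ 2) ℤ:+ q ℤ:* con (+ 3)) ℤ:+ con (+ 3) ℤ:* (q ℤ:+ con (+ 1))) refl q)
      where open ℤSolver using (con) renaming (_:+_ to _ℤ:+_; _:*_ to _ℤ:*_; :-_ to ℤ:-_; _:=_ to _ℤ:=_)
    mod3 (suc (suc s)) (s≤s (s≤s (s≤s ()))) q
    geometric≉0 : ¬ (geometric w k ≈ 𝟘)
    geometric≉0 z with mod3 r′ lt (+ q)
    ... | x , d = coprime-nonzero {+ k} {x} iy (subst (λ j → + 1 ≡ j ℤ.+ + 3 ℤ.* x ⊎ + 1 ≡ ℤ.- j ℤ.+ + 3 ℤ.* x) (sym k≡) d) (≈-trans (≈-sym f) z)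

  serre-order : ∀ r → Congruent1 (ζ ^^ r) → ζ ^^ r ≈ 𝟙
  serre-order r c = serre m m ℕₚ.≤-refl 1≤m c (≈-trans (≈-sym (^^-* ζ m r)) (≈-trans (≈-reflexive (cong (ζ ^^_) (ℕₚ.*-comm m r)))
    (≈-trans (^^-* ζ r m) (≈-trans (^^-cong r ζ^m≈1) (𝟙^^ r)))))

  module _ (cs : List ℤ) (root : evalℤ ζ cs ≈ 𝟘) (d : ℕ) (top : ¬ + 3 ℤ∣.∣ ℤX.coef cs d)
           (above : ∀ i → d < i → + 3 ℤ∣.∣ ℤX.coef cs i) where

    private
      record _~_ (x y : A) : Set where
        constructor congruent
        field
          z        : A
          integral : Integral z
          equality : x ⊝ y ≈ three ⊗ z

      ~-trans : ∀ {x y z} → x ~ y → y ~ z → x ~ z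
      ~-trans {x} {y} {z} (congruent u iu e) (congruent v iv f) = congruent (u ⊕ v) (multiplier-+ iu iv) (begin
        x ⊝ z                    ≈⟨ solve 3 (λ x y z → x :- z := (x :- y) :+ (y :- z)) ≈-refl x y z ⟩
        (x ⊝ y) ⊕ (y ⊝ z)        ≈⟨ ⊕-cong e f ⟩
        three ⊗ u ⊕ three ⊗ v    ≈⟨ ⊗-distribˡ _ _ _ ⟨
        three ⊗ (u ⊕ v)          ∎)

      digits : ∀ {k} → Vec (Fin 3) k → List ℤ
      digits [] = []
      digits (x ∷ w) = + toℕ x ∷ digits w

      coef-digits : ∀ {k} (w : Vec (Fin 3) k) i → k ≤ i → ℤX.coef (digits w) i ≡ + 0
      coef-digits [] i l = refl
      coef-digits (x ∷ w) (suc i) (s≤s l) = coef-digits w i l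

      step-~ : ∀ a {x y} b → + 3 ℤ∣.∣ a ℤ.- b → x ~ y → (ι a ⊕ ζ ⊗ x) ~ (ι b ⊕ ζ ⊗ y)
      step-~ a {x} {y} b (ℤ∣.divides q eq) (congruent u iu e) = congruent (ι q ⊕ ζ ⊗ u) (multiplier-+ (multiplier-ι q) (multiplier-* ζ-integral iu)) (begin
        (ι a ⊕ ζ ⊗ x) ⊝ (ι b ⊕ ζ ⊗ y)   ≈⟨ solve 5 (λ a b z x y → (a :+ z :* x) :- (b :+ z :* y) := (a :- b) :+ z :* (x :- y)) ≈-refl (ι a) (ι b) ζ x y ⟩
        (ι a ⊝ ι b) ⊕ ζ ⊗ (x ⊝ y)       ≈⟨ ⊕-cong difference (⊗-congˡ e) ⟩
        three ⊗ ι q ⊕ ζ ⊗ (three ⊗ u)   ≈⟨ solve 4 (λ d q z u → d :* q :+ z :* (d :* u) := d :* (q :+ z :* u)) ≈-refl three (ι q) ζ u ⟩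
        three ⊗ (ι q ⊕ ζ ⊗ u)           ∎)
        where
        difference : ι a ⊝ ι b ≈ three ⊗ ι q
        difference = begin
          ι a ⊝ ι b         ≈⟨ ⊕-congˡ (ι-neg b) ⟨
          ι a ⊕ ι (ℤ.- b)   ≈⟨ ι-+ a (ℤ.- b) ⟨
          ι (a ℤ.- b)       ≡⟨ cong ι eq ⟩
          ι (q ℤ.* + 3)     ≈⟨ ι-* q (+ 3) ⟩
          ι q ⊗ three       ≈⟨ ⊗-comm _ _ ⟩
          three ⊗ ι q       ∎

      divisible-~ : ∀ G → (∀ i → + 3 ℤ∣.∣ ℤX.coef G i) → evalℤ ζ G ~ 𝟘
      divisible-~ [] all = congruent 𝟘 0-integral (solve 1 (λ d → :0 :- :0 := d :* :0) ≈-refl three)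
      divisible-~ (g ∷ G) all = ~-trans
        (step-~ g (+ 0) (subst (+ 3 ℤ∣.∣_) (sym (ℤₚ.+-identityʳ g)) (all 0)) (divisible-~ G (λ i → all (suc i))))
        (congruent 𝟘 0-integral (solve 2 (λ z d → (:0 :+ z :* :0) :- :0 := d :* :0) ≈-refl ζ three))

      reduceLow : ∀ k G → (∀ i → k ≤ i → + 3 ℤ∣.∣ ℤX.coef G i) → ∃ λ (w : Vec (Fin 3) k) → evalℤ ζ G ~ evalℤ ζ (digits w)
      reduceLow zero G all = [] , divisible-~ G (λ i → all i z≤n)
      reduceLow (suc k) [] all with reduceLow k [] (λ i _ → ℤ∣.divides (+ 0) refl)
      ... | w , congruent u iu e = zero ∷ w , congruent (ζ ⊗ u) (multiplier-* ζ-integral iu) (begin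
          𝟘 ⊝ (𝟘 ⊕ ζ ⊗ evalℤ ζ (digits w))     ≈⟨ solve 2 (λ z x → :0 :- (:0 :+ z :* x) := z :* (:0 :- x)) ≈-refl ζ _ ⟩
          ζ ⊗ (𝟘 ⊝ evalℤ ζ (digits w))         ≈⟨ ⊗-congˡ e ⟩
          ζ ⊗ (three ⊗ u)                      ≈⟨ solve 3 (λ z d u → z :* (d :* u) := d :* (z :* u)) ≈-refl ζ three u ⟩
          three ⊗ (ζ ⊗ u)                      ∎)
      reduceLow (suc k) (g ∷ G) all with reduceLow k G (λ i l → all (suc i) (s≤s l))
      ... | w , e = residue g ∷ w , step-~ g (+ toℕ (residue g)) (residue-∣ g) e

      -- Horner's scheme with a reduction after each step. If `w` has `d` digits, `g ∷ digits w` has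
      -- a coefficient in degree `d`; a suitable multiple of `cs`, which vanishes at `ζ`, makes it
      -- divisible by 3. It suffices that the coefficient of `cs` in degree `d` is prime to 3 and
      -- the higher ones are divisible by 3. So `3 ^ d` residues represent all of `ℤ[ζ]` modulo 3.
      reduction : ∀ G → ∃ λ (w : Vec (Fin 3) d) → evalℤ ζ G ~ evalℤ ζ (digits w)
      reduction [] = reduceLow d [] (λ i _ → ℤ∣.divides (+ 0) refl)
      reduction (g ∷ G) with reduction G
      ... | w , G~w with cancel-mod3 (ℤX.coef cs d) top (ℤX.coef (g ∷ digits w) d)
      ... | k , div with reduceLow d G′ low
        where
        G′ = (g ∷ digits w) ℤX.⊞ ℤX.scale k cs
        coef-G′ : ∀ i → ℤX.coef G′ i ≡ ℤX.coef (g ∷ digits w) i ℤ.+ k ℤ.* ℤX.coef cs i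
        coef-G′ i = trans (ℤX.coef-⊞ (g ∷ digits w) (ℤX.scale k cs) i) (cong (λ x → ℤX.coef (g ∷ digits w) i ℤ.+ x) (ℤX.coef-scale k cs i))
        low : ∀ i → d ≤ i → + 3 ℤ∣.∣ ℤX.coef G′ i
        low i l with ℕₚ.m≤n⇒m<n∨m≡n l
        ... | inj₂ refl = subst (+ 3 ℤ∣.∣_) (sym (coef-G′ d)) div
        low (suc i) l | inj₁ (s≤s l′) = subst (+ 3 ℤ∣.∣_)
          (sym (trans (coef-G′ (suc i)) (trans (cong (ℤ._+ k ℤ.* ℤX.coef cs (suc i)) (coef-digits w i l′)) (ℤₚ.+-identityˡ _))))
          (ℤ∣.∣n⇒∣m*n k (above (suc i) (s≤s l′)))
      ... | w′ , e = w′ , ~-trans (step-~ g g (subst (+ 3 ℤ∣.∣_) (sym (ℤₚ.+-inverseʳ g)) (ℤ∣.divides (+ 0) refl)) G~w)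
          (~-trans (congruent 𝟘 0-integral (begin
              x ⊝ y                ≈⟨ ⊕-congˡ (⊖-cong (Evaluation.evalAt-⊞ (ιHom K) ζ (g ∷ digits w) (ℤX.scale k cs))) ⟩
              x ⊝ (x ⊕ evalℤ ζ (ℤX.scale k cs)) ≈⟨ ⊕-congˡ (⊖-cong (⊕-congˡ (≈-trans (Evaluation.evalAt-scale (ιHom K) ζ k cs) (≈-trans (⊗-congˡ root) (⊗-zeroʳ _))))) ⟩
              x ⊝ (x ⊕ 𝟘)          ≈⟨ solve 2 (λ x d → x :- (x :+ :0) := d :* :0) ≈-refl x three ⟩
              three ⊗ 𝟘            ∎)) e)
        where
        x = evalℤ ζ (g ∷ digits w)
        y = evalℤ ζ ((g ∷ digits w) ℤX.⊞ ℤX.scale k cs)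

      abstract
        reduce : ∀ G → ∃ λ (w : Vec (Fin 3) d) → evalℤ ζ G ~ evalℤ ζ (digits w)
        reduce = reduction

      encode : ∀ {k} → Vec (Fin 3) k → Fin (3 ^ k)
      encode [] = zero
      encode (x ∷ w) = Data.Fin.combine x (encode w)

      encode-injective : ∀ {k} (v w : Vec (Fin 3) k) → encode v ≡ encode w → v ≡ w
      encode-injective [] [] e = refl
      encode-injective (x ∷ v) (y ∷ w) e with Finₚ.combine-injective x (encode v) y (encode w) e
      ... | refl , e′ = cong (x ∷_) (encode-injective v w e′)

      powerList : ℕ → List ℤ
      powerList zero = + 1 ∷ []
      powerList (suc j) = + 0 ∷ powerList j

      evaluate-powerList : ∀ j → evalℤ ζ (powerList j) ≈ ζ ^^ j
      evaluate-powerList zero = ≈-trans (⊕-cong ι-1 (⊗-zeroʳ ζ)) (⊕-identityʳ _)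
      evaluate-powerList (suc j) = ≈-trans (⊕-identityˡ _) (⊗-congˡ (evaluate-powerList j))

      code : ℕ → Vec (Fin 3) d
      code j = proj₁ (reduce (powerList j))

      ~-cancel : ∀ {x y z} → x ~ z → y ~ z → x ~ y
      ~-cancel {x} {y} {z} (congruent v iv ev) (congruent u iu eu) = congruent (v ⊝ u) (multiplier-+ iv (neg-integral iu)) (begin
        x ⊝ y                             ≈⟨ solve 3 (λ x y z → x :- y := (x :- z) :- (y :- z)) ≈-refl x y z ⟩
        (x ⊝ z) ⊝ (y ⊝ z)                 ≈⟨ ⊕-cong ev (⊖-cong eu) ⟩
        three ⊗ v ⊝ three ⊗ u             ≈⟨ solve 3 (λ d u v → d :* v :- d :* u := d :* (v :- u)) ≈-refl three u v ⟩
        three ⊗ (v ⊝ u)                   ∎)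

      equal-codes : ∀ i j → code i ≡ code j → (ζ ^^ j) ~ (ζ ^^ i)
      equal-codes i j e = ~-resp (evaluate-powerList j) (evaluate-powerList i) (~-cancel (proj₂ (reduce (powerList j)))
        (subst (λ w → evalℤ ζ (powerList i) ~ evalℤ ζ (digits w)) e (proj₂ (reduce (powerList i)))))
        where
        ~-resp : ∀ {x x′ y y′} → x ≈ x′ → y ≈ y′ → x ~ y → x′ ~ y′
        ~-resp e f (congruent z iz eq) = congruent z iz (≈-trans (⊕-cong (≈-sym e) (⊖-cong (≈-sym f))) eq)

      power-congruent : ∀ s j → s ≤ j → (ζ ^^ j) ~ (ζ ^^ s) → Congruent1 (ζ ^^ (j ∸ s))
      power-congruent s j s≤j (congruent z iz eq) = ζ ^^ k ⊗ z , multiplier-* (multiplier-^ k ζ-integral) iz ,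
        ≈-trans (solve 2 (λ x o → x := o :+ (x :- o)) ≈-refl (ζ ^^ r) 𝟙) (⊕-congˡ (begin
          ζ ^^ r ⊝ 𝟙                        ≈⟨ ≈-trans (⊗-congʳ inverse-power) (⊗-identityˡ _) ⟨
          (ζ ^^ k ⊗ ζ ^^ s) ⊗ (ζ ^^ r ⊝ 𝟙)   ≈⟨ solve 3 (λ k s r → (k :* s) :* (r :- :1) := k :* (s :* r :- s)) ≈-refl (ζ ^^ k) (ζ ^^ s) (ζ ^^ r) ⟩
          ζ ^^ k ⊗ (ζ ^^ s ⊗ ζ ^^ r ⊝ ζ ^^ s) ≈⟨ ⊗-congˡ (⊕-congʳ (≈-trans (≈-sym (^^-+ ζ s r)) (≈-reflexive (cong (ζ ^^_) (ℕₚ.m+[n∸m]≡n s≤j))))) ⟩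
          ζ ^^ k ⊗ (ζ ^^ j ⊝ ζ ^^ s)         ≈⟨ ⊗-congˡ eq ⟩
          ζ ^^ k ⊗ (three ⊗ z)              ≈⟨ solve 3 (λ k d z → k :* (d :* z) := d :* (k :* z)) ≈-refl (ζ ^^ k) three z ⟩
          three ⊗ (ζ ^^ k ⊗ z)              ∎))
        where
        r = j ∸ s
        -- The power `ζ ^ (s (m - 1))` is the inverse of `ζ ^ s`, so the congruence can be divided
        -- by `ζ ^ s` within the integral elements.
        k = s * (m ∸ 1)
        inverse-power : ζ ^^ k ⊗ ζ ^^ s ≈ 𝟙
        inverse-power = ≈-trans (≈-sym (^^-+ ζ k s)) (≈-trans (≈-reflexive (cong (ζ ^^_) index)) (≈-trans (^^-* ζ s m) (≈-trans (^^-cong s ζ^m≈1) (𝟙^^ s))))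
          where
          index : k + s ≡ s * m
          index = trans (ℕₚ.+-comm k s) (trans (sym (ℕₚ.*-suc s (m ∸ 1))) (cong (s *_) (ℕₚ.m+[n∸m]≡n 1≤m)))

      collision : (i j : Fin (suc (3 ^ d))) → toℕ i < toℕ j → encode (code (toℕ i)) ≡ encode (code (toℕ j)) → ∃ λ r → 1 ≤ r × r ≤ 3 ^ d × ζ ^^ r ≈ 𝟙
      collision i j i<j e = toℕ j ∸ toℕ i , ℕₚ.m<n⇒0<n∸m i<j , ℕₚ.≤-trans (ℕₚ.m∸n≤m (toℕ j) (toℕ i)) (ℕₚ.≤-pred (Finₚ.toℕ<n j)) ,
        serre-order (toℕ j ∸ toℕ i) (power-congruent (toℕ i) (toℕ j) (ℕₚ.<⇒≤ i<j)
          (equal-codes (toℕ i) (toℕ j) (encode-injective (code (toℕ i)) (code (toℕ j)) e)))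

    order-≤ : ∃ λ r → 1 ≤ r × r ≤ 3 ^ d × ζ ^^ r ≈ 𝟙
    order-≤ = let (i , j , i<j , e) = Finₚ.pigeonhole (ℕₚ.n<1+n (3 ^ d)) (λ i → encode (code (toℕ i))) in collision i j i<j e

evalAt-++ : ∀ {R S : CommutativeRing 0ℓ 0ℓ} (φ : Hom R S) s G H →
  RingFacts._≈_ S (Evaluation.evalAt φ s (G ++ H))
    (RingFacts._⊕_ S (Evaluation.evalAt φ s G) (RingFacts._⊗_ S (pow S s (length G)) (Evaluation.evalAt φ s H)))
evalAt-++ {S = S} φ s [] H = solve 1 (λ h → h := :0 :+ :1 :* h) ≈-refl _
  where open RingFacts S
evalAt-++ {S = S} φ s (g ∷ G) H = ≈-trans (⊕-congˡ (⊗-congˡ (evalAt-++ φ s G H)))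
  (solve 5 (λ g s x p h → g :+ s :* (x :+ p :* h) := (g :+ s :* x) :+ (s :* p) :* h) ≈-refl _ _ _ _ _)
  where open RingFacts S

snoc : ∀ n F → length F ≡ suc n → ∃ λ G → F ≡ G ++ ℤX.coef F n ∷ [] × length G ≡ n
snoc zero (a ∷ []) l = [] , refl , refl
snoc (suc n) (a ∷ F) l with snoc n F (ℕₚ.suc-injective l)
... | G , e , lG = a ∷ G , cong (a ∷_) e , cong suc lG

module Integrality (R : CommutativeRing 0ℓ 0ℓ) where
  open RingFacts R
  open Spans R
  open ≈-Reasoning

  -- Multiplying the equation of `α` by `a ^ k`, where `a` is its leading coefficient, makes it
  -- monic in `a α`: the term `g α ^ i` becomes `g a ^ (k - i) (a α) ^ i`.
  integral-power : ∀ k a G α → length G ≡ suc k → evalℤ α (G ++ a ∷ []) ≈ 𝟘 →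
    Span (powers (ι a ⊗ α) (suc k)) ((ι a ⊗ α) ^^ suc k)
  integral-power k a G α lG root = span-resp es top
    (span-ι es -[1+ 0 ] (scaled 0 G (ℕₚ.≤-reflexive lG)))
    where
    x = ι a ⊗ α
    es = powers x (suc k)

    low : ∀ i → i ≤ k → ι a ^^ k ⊗ α ^^ i ≈ ι (a ℤ.^ (k ∸ i)) ⊗ x ^^ i
    low i l = begin
      ι a ^^ k ⊗ α ^^ i                        ≡⟨ cong (λ j → ι a ^^ j ⊗ α ^^ i) (ℕₚ.m∸n+n≡m l) ⟨
      ι a ^^ (k ∸ i + i) ⊗ α ^^ i              ≈⟨ ⊗-congʳ (^^-+ (ι a) (k ∸ i) i) ⟩
      (ι a ^^ (k ∸ i) ⊗ ι a ^^ i) ⊗ α ^^ i     ≈⟨ ⊗-assoc _ _ _ ⟩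
      ι a ^^ (k ∸ i) ⊗ (ι a ^^ i ⊗ α ^^ i)     ≈⟨ ⊗-cong (≈-sym (ι-^ a (k ∸ i))) (≈-sym (⊗-^^ (ι a) α i)) ⟩
      ι (a ℤ.^ (k ∸ i)) ⊗ x ^^ i               ∎

    scaled : ∀ i G → i + length G ≤ suc k → Span es (ι a ^^ k ⊗ (α ^^ i ⊗ evalℤ α G))
    scaled i [] l = span-resp es (solve 2 (λ c p → :0 := c :* (p :* :0)) ≈-refl (ι a ^^ k) (α ^^ i)) (span-𝟘 es)
    scaled i (g ∷ G) l = span-resp es
      (begin
        ι g ⊗ (ι (a ℤ.^ (k ∸ i)) ⊗ x ^^ i) ⊕ c ⊗ ((α ⊗ α ^^ i) ⊗ evalℤ α G)
          ≈⟨ ⊕-congʳ (⊗-congˡ (low i (ℕₚ.≤-pred i<))) ⟨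
        ι g ⊗ (c ⊗ α ^^ i) ⊕ c ⊗ ((α ⊗ α ^^ i) ⊗ evalℤ α G)
          ≈⟨ solve 5 (λ g c p a e → g :* (c :* p) :+ c :* ((a :* p) :* e) := c :* (p :* (g :+ a :* e))) ≈-refl (ι g) c (α ^^ i) α (evalℤ α G) ⟩
        c ⊗ (α ^^ i ⊗ (ι g ⊕ α ⊗ evalℤ α G))   ∎)
      (span-+ es (span-ι es g (span-ι es (a ℤ.^ (k ∸ i)) (span-∈ (power-∈ x i<))))
                 (scaled (suc i) G (subst (_≤ suc k) (ℕₚ.+-suc i (length G)) l)))
      where
      c = ι a ^^ k
      i< : i < suc k
      i< = ℕₚ.≤-trans (s≤s (ℕₚ.m≤m+n i (length G))) (subst (_≤ suc k) (ℕₚ.+-suc i (length G)) l)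

    top : ι -[1+ 0 ] ⊗ (ι a ^^ k ⊗ (𝟙 ⊗ evalℤ α G)) ≈ x ^^ suc k
    top = begin
      ι -[1+ 0 ] ⊗ (c ⊗ (𝟙 ⊗ g))                         ≈⟨ ⊗-congʳ (⊖-cong ι-1) ⟩
      ⊖ 𝟙 ⊗ (c ⊗ (𝟙 ⊗ g))                                ≈⟨ solve 4 (λ c g p y → :- :1 :* (c :* (:1 :* g)) := c :* (p :* (y :+ :0)) :- c :* (g :+ p :* (y :+ :0))) ≈-refl c g p (ι a) ⟩
      c ⊗ (p ⊗ (ι a ⊕ 𝟘)) ⊝ c ⊗ (g ⊕ p ⊗ (ι a ⊕ 𝟘))     ≈⟨ ⊕-congˡ (⊖-cong (≈-trans (⊗-congˡ vanish) (⊗-zeroʳ c))) ⟩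
      c ⊗ (p ⊗ (ι a ⊕ 𝟘)) ⊝ 𝟘                            ≈⟨ solve 3 (λ c p y → c :* (p :* (y :+ :0)) :- :0 := (y :* c) :* p) ≈-refl c p (ι a) ⟩
      ι a ^^ suc k ⊗ p                                   ≈⟨ ⊗-^^ (ι a) α (suc k) ⟨
      x ^^ suc k                                         ∎
      where
      c = ι a ^^ k
      g = evalℤ α G
      p = α ^^ suc k
      vanish : g ⊕ p ⊗ (ι a ⊕ 𝟘) ≈ 𝟘
      vanish = begin
        g ⊕ p ⊗ (ι a ⊕ 𝟘)                             ≈⟨ ⊕-congˡ (⊗-congˡ (⊕-congˡ (⊗-zeroʳ α))) ⟨
        g ⊕ α ^^ suc k ⊗ evalℤ α (a ∷ [])             ≡⟨ cong (λ j → g ⊕ α ^^ j ⊗ evalℤ α (a ∷ [])) lG ⟨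
        g ⊕ α ^^ length G ⊗ evalℤ α (a ∷ [])          ≈⟨ evalAt-++ (ιHom R) α G (a ∷ []) ⟨
        evalℤ α (G ++ a ∷ [])                         ≈⟨ root ⟩
        𝟘                                             ∎

  root-multiplier : ∀ k F α → length F ≡ suc (suc k) → evalℤ α F ≈ 𝟘 →
    Multiplier (powers (ι (ℤX.coef F (suc k)) ⊗ α) (suc k)) (ι (ℤX.coef F (suc k)) ⊗ α)
  root-multiplier k F α l root with snoc (suc k) F l
  ... | G , e , lG = powers-multiplier _ (suc k) (integral-power k _ G α lG (subst (λ P → evalℤ α P ≈ 𝟘) e root))

height-scale : ∀ c F → height (ℤX.scale c F) ≡ ℤ.∣ c ∣ * height F
height-scale c [] = sym (ℕₚ.*-zeroʳ ℤ.∣ c ∣)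
height-scale c (a ∷ F) = trans (cong₂ _⊔_ (ℤₚ.abs-* c a) (height-scale c F)) (sym (ℕₚ.*-distribˡ-⊔ ℤ.∣ c ∣ ℤ.∣ a ∣ (height F)))

abstract
  -- A ratio of two roots of a polynomial of degree `n` satisfies a relation of degree at most
  -- `n * n`, whence its order divides some `r ≤ 3 ^ (n * n)`. The factorial is a common exponent
  -- for all these `r`. It is abstract because it must never be evaluated.
  orderBound : ℕ → ℕ
  orderBound n = (3 ^ (n * n)) ℕ.!

  orderBound-positive : ∀ n → 1 ≤ orderBound n
  orderBound-positive n = ℕₚ.1≤n! (3 ^ (n * n))

  orderBound-∣ : ∀ n {d r} → d ≤ n * n → 1 ≤ r → r ≤ 3 ^ d → r ℕ∣.∣ orderBound n
  orderBound-∣ n {r = suc r} d≤ _ r≤ = ℕ∣.∣-trans (ℕ∣.m∣m*n (r ℕ.!)) (ℕ∣.m≤n⇒m!∣n! (ℕₚ.≤-trans r≤ (ℕₚ.^-monoʳ-≤ 3 d≤)))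

module _ (K : CommutativeRing 0ℓ 0ℓ) (isField : IsChar0Field K) where
  open CharZeroField K isField
  open Spans K
  open Integrality K

  nonzeroList-height : ∀ cs → NonzeroList cs → 1 ≤ height cs
  nonzeroList-height (c ∷ cs) (here n) = ℕₚ.≤-trans (ℕₚ.n≢0⇒n>0 (λ z → n (ℤₚ.∣i∣≡0⇒i≡0 z))) (ℕₚ.m≤m⊔n _ _)
  nonzeroList-height (c ∷ cs) (there m) = ℕₚ.≤-trans (nonzeroList-height cs m) (ℕₚ.m≤n⊔m ℤ.∣ c ∣ _)

  -- Dividing all coefficients by 3 lowers the height and keeps the root, so after finitely many
  -- divisions some coefficient is prime to 3; `d` is the position of the highest one.
  primitive-mod3 : ∀ fuel ζ cs → height cs ≤ fuel → 1 ≤ height cs → evalℤ ζ cs ≈ 𝟘 →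
    ∃₂ λ cs′ d → evalℤ ζ cs′ ≈ 𝟘 × d < length cs × (¬ + 3 ℤ∣.∣ ℤX.coef cs′ d) × (∀ i → d < i → + 3 ℤ∣.∣ ℤX.coef cs′ i)
  primitive-mod3 zero ζ cs l pos root = contradiction (ℕₚ.≤-trans pos l) (λ ())
  primitive-mod3 (suc fuel) ζ cs l pos root with ℤX.leading? (multiples 3) (+ 3 ℤ∣.∣?_) cs
  ... | inj₂ (d , n , above) = cs , d , root ,
    ℕₚ.≰⇒> (λ l → n (subst (+ 3 ℤ∣.∣_) (sym (ℤX.coef-beyond cs d l)) (ℤ∣.divides (+ 0) refl))) , n , above
  ... | inj₁ all with divideOut 3 cs all
  ... | cs₁ , refl with primitive-mod3 fuel ζ cs₁ smaller pos₁ root₁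
    where
    heights : height (ℤX.scale (+ 3) cs₁) ≡ 3 * height cs₁
    heights = height-scale (+ 3) cs₁
    pos₁ : 1 ≤ height cs₁
    pos₁ = ℕₚ.n≢0⇒n>0 λ z → ℕₚ.<⇒≱ pos (ℕₚ.≤-reflexive (trans heights (cong (3 *_) z)))
    smaller : height cs₁ ≤ fuel
    smaller = ℕₚ.≤-pred (ℕₚ.≤-trans (ℕₚ.≤-trans (ℕₚ.m<m*n (height cs₁) 3 {{ℕ.>-nonZero pos₁}} (s≤s (s≤s z≤n))) (ℕₚ.≤-reflexive (trans (ℕₚ.*-comm (height cs₁) 3) (sym heights)))) l)
    root₁ : evalℤ ζ cs₁ ≈ 𝟘
    root₁ = cancel-nonzero (ι-nonzero {+ 3} (λ ())) (≈-trans (⊗-comm _ _) (≈-trans (≈-sym (Evaluation.evalAt-scale (ιHom K) ζ (+ 3) cs₁)) root))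
  ... | cs′ , d , r , d< , n , above = cs′ , d , r , subst (d <_) (sym (Listₚ.length-map (+ 3 ℤ.*_) cs₁)) d< , n , above

  root-of-unity-order : ∀ n ζ m cs → 1 ≤ m → ζ ^^ m ≈ 𝟙 → length cs ≡ suc (n * n) → NonzeroList cs → evalℤ ζ cs ≈ 𝟘 → ζ ^^ orderBound n ≈ 𝟙
  root-of-unity-order n ζ m cs 1≤m ζ^m lcs nz root = conclude (primitive-mod3 (height cs) ζ cs ℕₚ.≤-refl (nonzeroList-height cs nz) root)
    where
    power : ∀ {r N} → ζ ^^ r ≈ 𝟙 → r ℕ∣.∣ N → ζ ^^ N ≈ 𝟙
    power {r} ζ^r (ℕ∣.divides q refl) = ≈-trans (^^-* ζ q r) (≈-trans (^^-cong q ζ^r) (𝟙^^ q))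
    conclude : (∃₂ λ cs′ d → evalℤ ζ cs′ ≈ 𝟘 × d < length cs × (¬ + 3 ℤ∣.∣ ℤX.coef cs′ d) × (∀ i → d < i → + 3 ℤ∣.∣ ℤX.coef cs′ i)) →
      ζ ^^ orderBound n ≈ 𝟙
    conclude (cs′ , d , root′ , d< , top , above) =
      let (r , 1≤r , r≤ , ζ^r) = RootOfUnity.order-≤ K isField ζ m 1≤m ζ^m cs′ root′ d top above
      in power ζ^r (orderBound-∣ n (ℕₚ.≤-pred (subst (d <_) lcs d<)) 1≤r r≤)

  -- The obvious relation `Z ^ m - 1` for `ζ` has unbounded degree. The products
  -- `(a α) ^ i (a β) ^ j` with `i , j < n` generate a module stable under `a α` and `a β`, and
  -- `a α = ζ (a β)` then gives a relation with `n * n + 1` coefficients.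
  ratio-order : ∀ k F → length F ≡ suc (suc k) → ℤX.coef F (suc k) ≢ + 0 → ∀ ζ α β m → 1 ≤ m → ζ ^^ m ≈ 𝟙 →
    α ≈ ζ ⊗ β → ¬ (β ≈ 𝟘) → evalℤ α F ≈ 𝟘 → evalℤ β F ≈ 𝟘 → ζ ^^ orderBound (suc k) ≈ 𝟙
  ratio-order k F l nz ζ α β m 1≤m ζ^m e nβ rα rβ =
    let (cs , lcs , nzcs , eq) = ratio-algebraic es ζ x y
          (span-resp es (⊗-identityˡ 𝟙) (span-products {powers x n} {powers y n} (span-∈ (power-∈ x {n} (s≤s z≤n))) (span-∈ (power-∈ y {n} (s≤s z≤n)))))
          (multiplier-productsˡ {powers x n} {powers y n} (root-multiplier k F α l rα)) (multiplier-productsʳ {powers x n} {powers y n} (root-multiplier k F β l rβ)) ratio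
    in root-of-unity-order n ζ m cs 1≤m ζ^m (trans lcs (cong suc sizes)) nzcs
         (cancel-nonzero (nonzero-^ (length es) (nonzero-⊗ (ι-nonzero nz) nβ)) eq)
    where
    n = suc k
    a = ℤX.coef F n
    x = ι a ⊗ α
    y = ι a ⊗ β
    es = products (powers x n) (powers y n)
    ratio : x ≈ ζ ⊗ y
    ratio = ≈-trans (⊗-congˡ e) (solve 3 (λ a z b → a :* (z :* b) := z :* (a :* b)) ≈-refl (ι a) ζ β)
    sizes : length es ≡ n * n
    sizes = trans (length-products (powers x n) (powers y n)) (cong₂ _*_ (length-powers x n) (length-powers y n))

-- Degeneracy with a fixed exponent, and its decidability

record Twisted (F : List ℤ) (k : ℕ) : Set₁ where
  field
    K       : CommutativeRing 0ℓ 0ℓ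
    isField : IsChar0Field K
  open CharZeroField K isField public
  open Evaluation (ιHom K) public using () renaming (evalAt to evalℤ)
  field
    ζ β     : A
    order   : ζ ^^ k ≈ 𝟙
    ζ≉1     : ¬ (ζ ≈ 𝟙)
    β≉0     : ¬ (β ≈ 𝟘)
    root    : evalℤ β F ≈ 𝟘
    root-ζ  : evalℤ (ζ ⊗ β) F ≈ 𝟘

length-lowFirst : ∀ {n} (a : IntPoly n) → length (lowFirst a) ≡ suc n
length-lowFirst a = trans (Listₚ.length-reverse (Vec.toList a)) (Vecₚ.length-toList a)

coef-snoc : ∀ G a → ℤX.coef (G ++ a ∷ []) (length G) ≡ a
coef-snoc [] a = refl
coef-snoc (g ∷ G) a = coef-snoc G a

coef-lowFirst : ∀ {n} (a : IntPoly n) → ℤX.coef (lowFirst a) n ≡ Vec.head a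
coef-lowFirst {n} (c ∷ a) = trans (cong₂ ℤX.coef (Listₚ.unfold-reverse c (Vec.toList a))
    (sym (trans (Listₚ.length-reverse (Vec.toList a)) (Vecₚ.length-toList a))))
  (coef-snoc (Data.List.reverse (Vec.toList a)) c)

-- The unknown order of the root of unity is replaced by an exponent depending on the degree only.
-- This makes degeneracy decidable, and it makes the later bounds uniform in the polynomial.
degenerate⇒twisted : ∀ k (a : IntPoly (suc k)) → Vec.head a ≢ + 0 → Degenerate a → Twisted (lowFirst a) (orderBound (suc k))
degenerate⇒twisted k a nz (K , isField , α , β , β⁻¹ , rα , rβ , α≉β , ββ⁻¹ , m , 1≤m , e) = record
  { K = K ; isField = isField ; ζ = ζ ; β = β
  ; order = ratio-order K isField k (lowFirst a) (length-lowFirst a) (λ z → nz (trans (sym (coef-lowFirst a)) z))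
      ζ α β m 1≤m e α≈ζβ β≉0 rootα rootβ
  ; ζ≉1 = λ z → α≉β (≈-trans α≈ζβ (≈-trans (⊗-congʳ z) (⊗-identityˡ β)))
  ; β≉0 = β≉0
  ; root = rootβ
  ; root-ζ = ≈-trans (Evaluation-argument α≈ζβ) rootα }
  where
  open CharZeroField K isField
  open Spans K using (evalℤ)
  ζ = α ⊗ β⁻¹
  rootα : evalℤ α (lowFirst a) ≈ 𝟘
  rootα = ≈-trans (≈-sym (eval-lowFirst K a α)) rα
  rootβ : evalℤ β (lowFirst a) ≈ 𝟘
  rootβ = ≈-trans (≈-sym (eval-lowFirst K a β)) rβ
  α≈ζβ : α ≈ ζ ⊗ β
  α≈ζβ = ≈-sym (≈-trans (solve 3 (λ a i b → (a :* i) :* b := a :* (b :* i)) ≈-refl α β⁻¹ β) (≈-trans (⊗-congˡ ββ⁻¹) (≈-trans (⊗-comm _ _) (⊗-identityˡ α))))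
  β≉0 : ¬ (β ≈ 𝟘)
  β≉0 z = 1≉0 (≈-trans (≈-sym ββ⁻¹) (≈-trans (⊗-congʳ z) (⊗-zeroˡ β⁻¹)))
  Evaluation-argument : ∀ {x y} → x ≈ y → evalℤ y (lowFirst a) ≈ evalℤ x (lowFirst a)
  Evaluation-argument {x} {y} e = go (lowFirst a)
    where
    go : ∀ F → evalℤ y F ≈ evalℤ x F
    go [] = ≈-refl
    go (c ∷ F) = ⊕-congˡ (⊗-cong (≈-sym e) (go F))

twisted⇒degenerate : ∀ {n} (a : IntPoly n) {k} → 1 ≤ k → Twisted (lowFirst a) k → Degenerate a
twisted⇒degenerate a {k} 1≤k t with Twisted.inverse t (Twisted.β t) (Twisted.β≉0 t)
... | β⁻¹ , ββ⁻¹ = K , isField , ζ ⊗ β , β , β⁻¹ ,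
    ≈-trans (eval-lowFirst K a (ζ ⊗ β)) root-ζ , ≈-trans (eval-lowFirst K a β) root ,
    (λ e → ζ≉1 (⊝≈𝟘⇒≈ ζ 𝟙 (cancel-nonzero β≉0 (≈-trans (solve 2 (λ z b → (z :- :1) :* b := z :* b :- b) ≈-refl ζ β) (≈⇒⊝≈𝟘 e))))) ,
    ββ⁻¹ , k , 1≤k , ≈-trans (^^-cong k (≈-trans (⊗-assoc ζ β β⁻¹) (≈-trans (⊗-congˡ ββ⁻¹) (≈-trans (⊗-comm _ _) (⊗-identityˡ ζ))))) order
  where open Twisted t

module _ {R S : CommutativeRing 0ℓ 0ℓ} (ψ : Hom R S) where
  open RingFacts S
  open Evaluation (ιHom R) renaming (evalAt to evalR)
  open Evaluation (ιHom S) renaming (evalAt to evalS)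

  hom-evalℤ : ∀ x F → Hom.⟦ ψ ⟧ (evalR x F) ≈ evalS (Hom.⟦ ψ ⟧ x) F
  hom-evalℤ x [] = Hom.⟦⟧-0 ψ
  hom-evalℤ x (c ∷ F) = ≈-trans (Hom.⟦⟧-+ ψ _ _)
    (⊕-cong (Hom.⟦⟧-ι ψ c) (≈-trans (Hom.⟦⟧-* ψ _ _) (⊗-congˡ (hom-evalℤ x F))))

module _ (S : CommutativeRing 0ℓ 0ℓ) where
  open RingFacts S
  open Evaluation (ιHom S) renaming (evalAt to evalS)

  evalℤ-argument : ∀ F {x y} → x ≈ y → evalS x F ≈ evalS y F
  evalℤ-argument [] e = ≈-refl
  evalℤ-argument (c ∷ F) e = ⊕-congˡ (⊗-cong e (evalℤ-argument F e))

module _ (R : CommutativeRing 0ℓ 0ℓ) (I : Ideal R) (S : CommutativeRing 0ℓ 0ℓ) (φ : Hom R S)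
         (vanish : ∀ x → Ideal.member I x → RingFacts._≈_ S (Hom.⟦ φ ⟧ x) (RingFacts.𝟘 S)) where
  private
    module Q = Quotient R I
    module R = RingFacts R
  open RingFacts S

  quotientLift : Hom Q.quotientRing S
  quotientLift = record
    { ⟦_⟧ = Hom.⟦ φ ⟧
    ; ⟦⟧-cong = λ {x} {y} e → ⊝≈𝟘⇒≈ _ _ (≈-trans (≈-sym (≈-trans (Hom.⟦⟧-+ φ x (R.⊖ y)) (⊕-congˡ (Hom.⟦⟧-neg φ y)))) (vanish (x R.⊝ y) (Q.difference e)))
    ; ⟦⟧-+ = Hom.⟦⟧-+ φ
    ; ⟦⟧-* = Hom.⟦⟧-* φ
    ; ⟦⟧-1 = Hom.⟦⟧-1 φ }

evalℤ : (R : CommutativeRing 0ℓ 0ℓ) → RingFacts.A R → List ℤ → RingFacts.A R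
evalℤ R = Evaluation.evalAt (ιHom R)

-- The ring `S` is arbitrary: a Bézout identity for 1 evaluated at a common root gives `1 = 0` in
-- every ring, so one obstruction excludes all fields at once.
record CommonRoot (F : List ℤ) (R : CommutativeRing 0ℓ 0ℓ) (z : RingFacts.A R) (S : CommutativeRing 0ℓ 0ℓ) : Set where
  open RingFacts S
  field
    φ      : Hom R S
    y      : A
    root   : evalℤ S y F ≈ 𝟘
    root-z : evalℤ S (Hom.⟦ φ ⟧ z ⊗ y) F ≈ 𝟘

-- The gcd of F(Y) and F(zY) over the field is a unit or has a root in an extension.
module TwoRoots (E : DiscreteField) (char0 : CharZero (DiscreteField.ring E)) (F : List ℤ) (z : DiscreteField.A E) where
  private
    R = DiscreteField.ring E
    module EP = FieldPolynomials E
    EY = Polynomials.polynomialRing R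
    module Y = RingFacts EY
    p = evalℤ EY EP.X F
    q = evalℤ EY ((z ∷ []) Y.⊗ EP.X) F

  module _ (S : CommutativeRing 0ℓ 0ℓ) (φ : Hom R S) (y : RingFacts.A S) where
    open RingFacts S
    private
      module Ev = Evaluation φ y

    substituted : Hom.⟦ Ev.evaluation ⟧ p ≈ evalℤ S y F
    substituted = ≈-trans (hom-evalℤ Ev.evaluation EP.X F) (evalℤ-argument S F Ev.evalAt-X)

    substituted-z : Hom.⟦ Ev.evaluation ⟧ q ≈ evalℤ S (Hom.⟦ φ ⟧ z ⊗ y) F
    substituted-z = ≈-trans (hom-evalℤ Ev.evaluation ((z ∷ []) Y.⊗ EP.X) F)
      (evalℤ-argument S F (≈-trans (Ev.evalAt-⊠ (z ∷ []) EP.X) (⊗-cong (Ev.evalAt-constant z) Ev.evalAt-X)))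

  extend : ∀ g → ¬ EP.Unit g → g EP.∣ₚ p → g EP.∣ₚ q → Σ (CommutativeRing 0ℓ 0ℓ) λ K → IsChar0Field K × CommonRoot F R z K
  extend g ng (EP.quotient s es) (EP.quotient t et) = K , char0Field L.extension (hom-charZero E L.embedding (DiscreteField.𝟙≉𝟘 L.extension) char0) , record
    { φ = L.embedding
    ; y = L.root
    ; root = ≈-trans (≈-sym (substituted K L.embedding L.root)) (multiple s p es)
    ; root-z = ≈-trans (≈-sym (substituted-z K L.embedding L.root)) (multiple t q et) }
    where
    module L = Extension E g ng
    K = L.Q.quotientRing
    open RingFacts K
    module Ev = Evaluation L.embedding L.root
    multiple : ∀ s p → p EP.≋ g EP.⊠ s → Ev.evalAt p ≈ 𝟘
    multiple s p e = ≈-trans (Ev.evalAt-cong e) (≈-trans (Ev.evalAt-⊠ g s) (≈-trans (⊗-congʳ L.root-g₀) (⊗-zeroˡ (Ev.evalAt s))))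

  obstruct : ∀ {g} u v → EP.Unit g → g EP.≋ u EP.⊠ p EP.⊞ v EP.⊠ q →
    ∀ S → CommonRoot F R z S → RingFacts._≈_ S (RingFacts.𝟙 S) (RingFacts.𝟘 S)
  obstruct {g} u v (k , gk) id S c = begin
    𝟙                                                          ≈⟨ Hom.⟦⟧-1 Ev.evaluation ⟨
    Ev.evalAt (DiscreteField.𝟙 E ∷ [])                         ≈⟨ Ev.evalAt-cong gk ⟨
    Ev.evalAt (g EP.⊠ k)                                       ≈⟨ Ev.evalAt-⊠ g k ⟩
    Ev.evalAt g ⊗ Ev.evalAt k                                  ≈⟨ ⊗-congʳ (≈-trans (Ev.evalAt-cong id) (Ev.evalAt-⊞ (u EP.⊠ p) (v EP.⊠ q))) ⟩
    (Ev.evalAt (u EP.⊠ p) ⊕ Ev.evalAt (v EP.⊠ q)) ⊗ Ev.evalAt k ≈⟨ ⊗-congʳ (⊕-cong (zero-multiple u p (≈-trans (substituted S φ y) root)) (zero-multiple v q (≈-trans (substituted-z S φ y) root-z))) ⟩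
    (𝟘 ⊕ 𝟘) ⊗ Ev.evalAt k                                      ≈⟨ solve 1 (λ k → (:0 :+ :0) :* k := :0) ≈-refl _ ⟩
    𝟘                                                          ∎
    where
    open CommonRoot c
    open RingFacts S
    open ≈-Reasoning
    module Ev = Evaluation φ y
    zero-multiple : ∀ u p → Ev.evalAt p ≈ 𝟘 → Ev.evalAt (u EP.⊠ p) ≈ 𝟘
    zero-multiple u p e = ≈-trans (Ev.evalAt-⊠ u p) (≈-trans (⊗-congˡ e) (⊗-zeroʳ _))

  abstract
    twoRoots : (Σ (CommutativeRing 0ℓ 0ℓ) λ K → IsChar0Field K × CommonRoot F R z K) ⊎
      (∀ S → CommonRoot F R z S → RingFacts._≈_ S (RingFacts.𝟙 S) (RingFacts.𝟘 S))
    twoRoots with EP.bezout-identity p q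
    ... | EP.bezout {g} {u} {v} dp dq id with EP.unit? g
    ... | no ng = inj₁ (extend g ng dp dq)
    ... | yes unit = inj₂ (obstruct {g} u v unit id)

-- A form of `Twisted` by equations alone. That `ζ` is a `k`-th root of unity other than 1 will be
-- expressed by `P = 1 + Z + ⋯ + Z ^ (k - 1)`, and that `β` is nonzero by an `F` with nonzero
-- constant term.
record TwistedBy (P F : List ℤ) : Set₁ where
  field
    K       : CommutativeRing 0ℓ 0ℓ
    isField : IsChar0Field K
  open CharZeroField K isField public
  field
    ζ β     : A
    rootP   : evalℤ K ζ P ≈ 𝟘
    root    : evalℤ K β F ≈ 𝟘
    root-ζ  : evalℤ K (ζ ⊗ β) F ≈ 𝟘

module Irreducible (P : List ℤ) (m : ℕ) (lP : length P ≡ suc (suc m)) (top : ℤX.coef P (suc m) ≢ + 0)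
                   (irreducible : ¬ Factorisation P (suc m)) where
  private
    module QP = FieldPolynomials ℚ-field
    P′ = toℚX P

    aboveP : ∀ i → suc m < i → ℤX.coef P i ≡ + 0
    aboveP i l = ℤX.coef-beyond P i (ℕₚ.≤-trans (ℕₚ.≤-reflexive lP) l)

    nonunit : ¬ QP.Unit P′
    nonunit = QP.degree-nonunit P′ m (λ z → top (ℚF.ι-zero (trans (sym (MapPolynomials.coef-map (ιHom ℚ-ring) P (suc m))) z)))
      (λ i l → trans (MapPolynomials.coef-map (ιHom ℚ-ring) P i) (cong ℚF.ι (aboveP i l)))

  module E = Extension ℚ-field P′ nonunit

  E-charZero : CharZero E.Q.quotientRing
  E-charZero = hom-charZero ℚ-field E.embedding (DiscreteField.𝟙≉𝟘 E.extension) ℚ-charZero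

  P-nonzero : ¬ (P′ QP.≋ [])
  P-nonzero z = top (ℚF.ι-zero (trans (sym (MapPolynomials.coef-map (ιHom ℚ-ring) P (suc m))) (QP.at z (suc m))))

  no-factorisation : ∀ {g s} → (∃ λ i → 1 ≤ i × ℚX.coef g i ≢ ℚ.0ℚ) → (∃ λ i → 1 ≤ i × ℚX.coef s i ≢ ℚ.0ℚ) →
    (∃₂ λ G S → P ℤX.≋ G ℤX.⊠ S × (∀ i → ℚX.coef g i ≢ ℚ.0ℚ → ℤX.coef G i ≢ + 0) × (∀ i → ℚX.coef s i ≢ ℚ.0ℚ → ℤX.coef S i ≢ + 0)) → ⊥
  no-factorisation (i , li , ni) (j , lj , nj) (G , S , eq , keepG , keepS) =
    irreducible (factorisation P G S eq top aboveP (i , li , keepG i ni) (j , lj , keepS j nj))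

  -- Every generator in the chain of `E` is a nonunit divisor of `P`, so by irreducibility it
  -- differs from `P` by a unit and vanishes wherever `P` does. Hence `E` maps to every field that
  -- contains a root of `P`, and it is enough to test in `E`.
  cofactor-unit : ∀ g s → ¬ QP.Unit g → P′ QP.≋ g QP.⊠ s → QP.Unit s
  cofactor-unit g s ng e = Dec.decidable-stable (QP.unit? s) λ ns → no-factorisation {g} {s}
    (QP.nonunit-nonconstant g ng λ z → P-nonzero (QP.≋-trans e (QP.⊠-cong {g} {[]} {s} z (QP.≋-refl {s}))))
    (QP.nonunit-nonconstant s ns λ z → P-nonzero (QP.≋-trans e (QP.≋-trans (QP.⊠-congˡ g z) (QP.⊠-[] g))))
    (gauss P g s e)

  module _ (K : CommutativeRing 0ℓ 0ℓ) (isField : IsChar0Field K) (ζ : RingFacts.A K)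
           (root : RingFacts._≈_ K (evalℤ K ζ P) (RingFacts.𝟘 K)) where
    open RingFacts K
    private
      module Ev = Evaluation (ℚHom K isField) ζ

    divisor-root : ∀ g s → QP.Unit s → P′ QP.≋ g QP.⊠ s → Ev.evalAt g ≈ 𝟘
    divisor-root g s (k , sk) es = begin
      Ev.evalAt g                                     ≈⟨ ≈-trans (⊗-comm _ _) (⊗-identityˡ _) ⟨
      Ev.evalAt g ⊗ 𝟙                                 ≈⟨ ⊗-congˡ (≈-trans (Ev.evalAt-cong sk) (Hom.⟦⟧-1 Ev.evaluation)) ⟨
      Ev.evalAt g ⊗ Ev.evalAt (s ℚX.⊠ k)              ≈⟨ ⊗-congˡ (Ev.evalAt-⊠ s k) ⟩
      Ev.evalAt g ⊗ (Ev.evalAt s ⊗ Ev.evalAt k)       ≈⟨ ⊗-assoc _ _ _ ⟨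
      (Ev.evalAt g ⊗ Ev.evalAt s) ⊗ Ev.evalAt k       ≈⟨ ⊗-congʳ (≈-trans (Ev.evalAt-cong es) (Ev.evalAt-⊠ g s)) ⟨
      Ev.evalAt P′ ⊗ Ev.evalAt k                      ≈⟨ ⊗-congʳ (≈-trans (evalAt-map (ιHom ℚ-ring) (ℚHom K isField) (ιHom K) ζ (Hom.⟦⟧-ι (ℚHom K isField)) P) root) ⟩
      𝟘 ⊗ Ev.evalAt k                                 ≈⟨ ⊗-zeroˡ _ ⟩
      𝟘                                               ∎
      where open ≈-Reasoning

    multiple-root : ∀ g r → Ev.evalAt g ≈ 𝟘 → g QP.∣ₚ r → Ev.evalAt r ≈ 𝟘
    multiple-root g r e (QP.quotient t et) = ≈-trans (Ev.evalAt-cong et) (≈-trans (Ev.evalAt-⊠ g t) (≈-trans (⊗-congʳ e) (⊗-zeroˡ _)))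

    generator-root : ∀ g → ¬ QP.Unit g → g QP.∣ₚ P′ → Ev.evalAt g ≈ 𝟘
    generator-root g ng (QP.quotient s es) = divisor-root g s (cofactor-unit g s ng es) es

    vanish : ∀ r → E.InMaximal r → Ev.evalAt r ≈ 𝟘
    vanish r (n , d) = multiple-root (E.generator n) r (generator-root (E.generator n) (proj₂ (E.chain n)) (E.chain-∣ {0} {n} z≤n)) d

    lift : Hom E.Q.quotientRing K
    lift = quotientLift (Polynomials.polynomialRing ℚ-ring) E.maximalIdeal K Ev.evaluation vanish

    lift-root : Hom.⟦ lift ⟧ E.root ≈ ζ
    lift-root = Ev.evalAt-X

  root-P : RingFacts._≈_ E.Q.quotientRing (evalℤ (DiscreteField.ring E.extension) E.root P) (RingFacts.𝟘 E.Q.quotientRing)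
  root-P = E.E.≈-trans (E.E.≈-sym (evalAt-map (ιHom ℚ-ring) E.embedding (ιHom E.Q.quotientRing) E.root (Hom.⟦⟧-ι E.embedding) P)) E.root-g₀

  module _ (F : List ℤ) where
    private
      module T = TwoRoots E.extension E-charZero F E.root

    twisted : (Σ (CommutativeRing 0ℓ 0ℓ) λ K → IsChar0Field K × CommonRoot F (DiscreteField.ring E.extension) E.root K) → TwistedBy P F
    twisted (K , isField , c) = record
      { K = K ; isField = isField ; ζ = Hom.⟦ φ ⟧ E.root ; β = y
      ; rootP = K.≈-trans (K.≈-sym (hom-evalℤ φ E.root P)) (K.≈-trans (Hom.⟦⟧-cong φ root-P) (Hom.⟦⟧-0 φ))
      ; root = root ; root-ζ = root-z }
      where
      open CommonRoot c
      module K = RingFacts K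

    untwisted : (∀ S → CommonRoot F (DiscreteField.ring E.extension) E.root S → RingFacts._≈_ S (RingFacts.𝟙 S) (RingFacts.𝟘 S)) → ¬ TwistedBy P F
    untwisted none t = 1≉0 (none K (record { φ = lift K isField ζ rootP ; y = β ; root = root
      ; root-z = ≈-trans (evalℤ-argument K F (⊗-congʳ (lift-root K isField ζ rootP))) root-ζ }))
      where open TwistedBy t

    irreducible-twisted? : Dec (TwistedBy P F)
    irreducible-twisted? = [ (λ c → yes (twisted c)) , (λ n → no (untwisted n)) ]′ T.twoRoots

length-1-root : (K : CommutativeRing 0ℓ 0ℓ) → IsChar0Field K → ∀ ζ P → length P ≡ 1 → ℤX.coef P 0 ≢ + 0 →
  ¬ RingFacts._≈_ K (evalℤ K ζ P) (RingFacts.𝟘 K)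
length-1-root K isField ζ (c ∷ []) refl nz e = ι-nonzero nz (≈-trans (≈-sym (≈-trans (⊕-congˡ (⊗-zeroʳ ζ)) (⊕-identityʳ _))) e)
  where open CharZeroField K isField

module _ (F : List ℤ) where
  private
    Decision : List ℤ → Set₁
    Decision P = Dec (TwistedBy P F)

  twisted-factor : ∀ {P G} H → P ℤX.≋ G ℤX.⊠ H → TwistedBy G F → TwistedBy P F
  twisted-factor {P} {G} H e t = record
    { K = K ; isField = isField ; ζ = ζ ; β = β
    ; rootP = ≈-trans (Ev.evalAt-cong {P} {G ℤX.⊠ H} e) (≈-trans (Ev.evalAt-⊠ G H) (≈-trans (⊗-congʳ rootP) (⊗-zeroˡ _)))
    ; root = root ; root-ζ = root-ζ }
    where
    open TwistedBy t
    module Ev = Evaluation (ιHom K) ζ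

  untwisted-product : ∀ {P G H} → P ℤX.≋ G ℤX.⊠ H → ¬ TwistedBy G F → ¬ TwistedBy H F → ¬ TwistedBy P F
  untwisted-product {P} {G} {H} e ng nh t = nonzero-⊗
      (λ z → ng (record { K = K ; isField = isField ; ζ = ζ ; β = β ; rootP = z ; root = root ; root-ζ = root-ζ }))
      (λ z → nh (record { K = K ; isField = isField ; ζ = ζ ; β = β ; rootP = z ; root = root ; root-ζ = root-ζ }))
      (≈-trans (≈-sym (Ev.evalAt-⊠ G H)) (≈-trans (≈-sym (Ev.evalAt-cong {P} {G ℤX.⊠ H} e)) rootP))
    where
    open TwistedBy t
    module Ev = Evaluation (ιHom K) ζ

  product-decision : ∀ {P} G H → P ℤX.≋ G ℤX.⊠ H → Decision G → Decision H → Decision P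
  product-decision G H e (yes t) _ = yes (twisted-factor H e t)
  product-decision G H e (no _) (yes t) = yes (twisted-factor G (ℤX.≋-trans e (ℤX.⊠-comm G H)) t)
  product-decision G H e (no ng) (no nh) = no (untwisted-product e ng nh)

  factor-tops : ∀ {P m} (f : Factorisation P m) → ℤX.coef P m ≢ + 0 →
    ℤX.coef (Factorisation.G f) (suc (Factorisation.d f)) ≢ + 0 × ℤX.coef (Factorisation.H f) (suc (Factorisation.e f)) ≢ + 0
  factor-tops {P} {m} f nz = (λ z → nz (trans top (trans (cong (ℤ._* h) z) (ℤₚ.*-zeroˡ h)))) ,
                             (λ z → nz (trans top (trans (cong (g ℤ.*_) z) (ℤₚ.*-zeroʳ g))))
    where
    open Factorisation f
    g = ℤX.coef G (suc d)
    h = ℤX.coef H (suc e)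
    top : ℤX.coef P m ≡ g ℤ.* h
    top = trans (cong (ℤX.coef P) (sym degrees)) (trans (ℤX.at equation (suc d + suc e)) (ℤₚ.i-j≡0⇒i≡j _ _
      (ℤX.coef-⊠-top (zeroIdeal ℤ-ring) G H (suc d) (suc e)
        (λ i l → ℤX.coef-beyond G i (ℕₚ.≤-trans (ℕₚ.≤-reflexive length-G) l))
        (λ i l → ℤX.coef-beyond H i (ℕₚ.≤-trans (ℕₚ.≤-reflexive length-H) l)))))

  -- The single test field belongs to a maximal ideal above `P`. For reducible `P` it may see the
  -- roots of one factor only, so `P` is split until its factors are irreducible; `fuel` bounds the
  -- degree `m`.
  twistedBy? : ∀ fuel m P → m ≤ fuel → length P ≡ suc m → ℤX.coef P m ≢ + 0 → Decision P
  step : ∀ fuel m P → m ≤ fuel → length P ≡ suc (suc m) → ℤX.coef P (suc m) ≢ + 0 → Dec (Factorisation P (suc m)) → Decision P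
  twistedBy? fuel zero P _ l nz = no λ t → length-1-root (TwistedBy.K t) (TwistedBy.isField t) (TwistedBy.ζ t) P l nz (TwistedBy.rootP t)
  twistedBy? (suc fuel) (suc m) P (s≤s m≤) l nz = step fuel m P m≤ l nz (factorisation? P (suc m) l nz)
  step fuel m P m≤ l nz (no irr) = Irreducible.irreducible-twisted? P m l nz irr F
  step fuel m P m≤ l nz (yes f) = product-decision G H equation
      (twistedBy? fuel (suc d) G (ℕₚ.≤-trans d≤ m≤) length-G (proj₁ (factor-tops f nz)))
      (twistedBy? fuel (suc e) H (ℕₚ.≤-trans e≤ m≤) length-H (proj₂ (factor-tops f nz)))
    where
    open Factorisation f
    sum : d + suc e ≡ m
    sum = ℕₚ.suc-injective degrees
    d≤ : suc d ≤ m
    d≤ = ℕₚ.≤-trans (ℕₚ.≤-trans (ℕₚ.m≤m+n (suc d) e) (ℕₚ.≤-reflexive (sym (ℕₚ.+-suc d e)))) (ℕₚ.≤-reflexive sum)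
    e≤ : suc e ≤ m
    e≤ = ℕₚ.≤-trans (ℕₚ.m≤n+m (suc e) d) (ℕₚ.≤-reflexive sum)

-- 1 + Z + ⋯ + Z ᵏ⁻¹
ones : ℕ → List ℤ
ones k = replicate k (+ 1)

module _ (R : CommutativeRing 0ℓ 0ℓ) where
  open RingFacts R
  open ≈-Reasoning

  evalℤ-ones : ∀ ζ k → (ζ ⊝ 𝟙) ⊗ evalℤ R ζ (ones k) ≈ ζ ^^ k ⊝ 𝟙
  evalℤ-ones ζ zero = solve 1 (λ z → (z :- :1) :* :0 := :1 :- :1) ≈-refl ζ
  evalℤ-ones ζ (suc k) = begin
    (ζ ⊝ 𝟙) ⊗ (ι (+ 1) ⊕ ζ ⊗ s)         ≈⟨ ⊗-congˡ (⊕-congʳ ι-1) ⟩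
    (ζ ⊝ 𝟙) ⊗ (𝟙 ⊕ ζ ⊗ s)               ≈⟨ solve 2 (λ z s → (z :- :1) :* (:1 :+ z :* s) := (z :- :1) :+ z :* ((z :- :1) :* s)) ≈-refl ζ s ⟩
    (ζ ⊝ 𝟙) ⊕ ζ ⊗ ((ζ ⊝ 𝟙) ⊗ s)         ≈⟨ ⊕-congˡ (⊗-congˡ (evalℤ-ones ζ k)) ⟩
    (ζ ⊝ 𝟙) ⊕ ζ ⊗ (ζ ^^ k ⊝ 𝟙)          ≈⟨ solve 2 (λ z p → (z :- :1) :+ z :* (p :- :1) := z :* p :- :1) ≈-refl ζ (ζ ^^ k) ⟩
    ζ ⊗ ζ ^^ k ⊝ 𝟙                      ∎
    where s = evalℤ R ζ (ones k)

  evalℤ-ones-1 : ∀ {ζ} k → ζ ≈ 𝟙 → evalℤ R ζ (ones k) ≈ ιℕ R k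
  evalℤ-ones-1 zero e = ≈-refl
  evalℤ-ones-1 {ζ} (suc k) e = ⊕-cong ι-1 (≈-trans (⊗-cong e (evalℤ-ones-1 k e)) (⊗-identityˡ _))

  evalℤ-shift : ∀ x j F → evalℤ R x (replicate j (+ 0) ++ F) ≈ x ^^ j ⊗ evalℤ R x F
  evalℤ-shift x zero F = ≈-sym (⊗-identityˡ _)
  evalℤ-shift x (suc j) F = ≈-trans (⊕-identityˡ _) (≈-trans (⊗-congˡ (evalℤ-shift x j F)) (≈-sym (⊗-assoc _ _ _)))

strip : ∀ F i → ℤX.coef F i ≢ + 0 → ∃₂ λ j f → ℤX.coef f 0 ≢ + 0 × F ≡ replicate j (+ 0) ++ f
strip [] i nz = contradiction refl nz
strip (a ∷ F) i nz with a ℤ.≟ + 0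
... | no na = 0 , a ∷ F , na , refl
strip (a ∷ F) zero nz | yes z = contradiction z nz
strip (a ∷ F) (suc i) nz | yes refl with strip F i nz
... | j , f , n , e = suc j , f , n , cong (+ 0 ∷_) e

module _ (j : ℕ) (f : List ℤ) (nz : ℤX.coef f 0 ≢ + 0) (k : ℕ) where
  private F = replicate j (+ 0) ++ f

  twisted⇒by : Twisted F (suc k) → TwistedBy (ones (suc k)) f
  twisted⇒by t = record
    { K = K ; isField = isField ; ζ = ζ ; β = β
    ; rootP = cancel-nonzero (λ z → ζ≉1 (⊝≈𝟘⇒≈ ζ 𝟙 z)) (≈-trans (⊗-comm _ _) (≈-trans (evalℤ-ones K ζ (suc k)) (≈⇒⊝≈𝟘 order)))
    ; root = unshift β≉0 root
    ; root-ζ = unshift (nonzero-⊗ ζ≉0 β≉0) root-ζ }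
    where
    open Twisted t hiding (evalℤ)
    unshift : ∀ {x} → ¬ (x ≈ 𝟘) → evalℤ K x F ≈ 𝟘 → evalℤ K x f ≈ 𝟘
    unshift {x} nx e = cancel-nonzero (nonzero-^ j nx) (≈-trans (⊗-comm _ _) (≈-trans (≈-sym (evalℤ-shift K x j f)) e))
    ζ≉0 : ¬ (ζ ≈ 𝟘)
    ζ≉0 z = 1≉0 (≈-trans (≈-sym order) (≈-trans (⊗-congʳ z) (⊗-zeroˡ _)))

  -- If `ζ` were 1, the value of `ones (suc k)` would be `k + 1`, which is nonzero in characteristic
  -- 0; if `β` were 0, the constant term of `f` would vanish.
  by⇒twisted : TwistedBy (ones (suc k)) f → Twisted F (suc k)
  by⇒twisted t = record
    { K = K ; isField = isField ; ζ = ζ ; β = β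
    ; order = ⊝≈𝟘⇒≈ _ _ (≈-trans (≈-sym (evalℤ-ones K ζ (suc k))) (≈-trans (⊗-congˡ rootP) (⊗-zeroʳ _)))
    ; ζ≉1 = λ e → char0 k (≈-trans (≈-sym (evalℤ-ones-1 K (suc k) e)) rootP)
    ; β≉0 = β≉0
    ; root = shift root
    ; root-ζ = shift root-ζ }
    where
    open TwistedBy t
    shift : ∀ {x} → evalℤ K x f ≈ 𝟘 → evalℤ K x F ≈ 𝟘
    shift {x} e = ≈-trans (evalℤ-shift K x j f) (≈-trans (⊗-congˡ e) (⊗-zeroʳ _))
    β≉0 : ¬ (β ≈ 𝟘)
    β≉0 z = constant f nz root
      where
      constant : ∀ f → ℤX.coef f 0 ≢ + 0 → ¬ (evalℤ K β f ≈ 𝟘)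
      constant [] n _ = n refl
      constant (c ∷ f) n e = ι-nonzero n (≈-trans (≈-sym (≈-trans (⊕-congˡ (≈-trans (⊗-congʳ z) (⊗-zeroˡ _))) (⊕-identityʳ _))) e)

coef-ones : ∀ k → ℤX.coef (ones (suc k)) k ≡ + 1
coef-ones zero = refl
coef-ones (suc k) = coef-ones k

twisted? : ∀ F i → ℤX.coef F i ≢ + 0 → ∀ k → 1 ≤ k → Dec (Twisted F k)
twisted? F i nz (suc k) _ with strip F i nz
... | j , f , n , refl = Dec.map′ (by⇒twisted j f n k) (twisted⇒by j f n k)
  (twistedBy? f k k (ones (suc k)) ℕₚ.≤-refl (Listₚ.length-replicate (suc k)) (λ z → contradiction (trans (sym (coef-ones k)) z) (λ ())))

-- Bounding the number of constant terms of the cofactor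

module IntegralElements (R : CommutativeRing 0ℓ 0ℓ) where
  open RingFacts R
  open Spans R hiding (evalℤ)
  open ≈-Reasoning

  multiplier-𝟘 : ∀ {es} → Multiplier es 𝟘
  multiplier-𝟘 = multiplier-ι (+ 0)

  multiplier-neg : ∀ {es x} → Multiplier es x → Multiplier es (⊖ x)
  multiplier-neg {x = x} m = multiplier-resp (≈-trans (⊗-congʳ (⊖-cong ι-1)) (solve 1 (λ x → :- :1 :* x := :- x) ≈-refl x))
    (multiplier-* (multiplier-ι -[1+ 0 ]) m)

  multiplier-evalℤ : ∀ {es x} → Multiplier es x → ∀ F → Multiplier es (evalℤ R x F)
  multiplier-evalℤ m [] = multiplier-𝟘
  multiplier-evalℤ m (c ∷ F) = multiplier-+ (multiplier-ι c) (multiplier-* m (multiplier-evalℤ m F))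

  multiplier-homogenised : ∀ {es a α} → Multiplier es (ι a ⊗ α) → ∀ F → Multiplier es (ι a ^^ length F ⊗ evalℤ R α F)
  multiplier-homogenised m [] = multiplier-resp (≈-sym (⊗-zeroʳ _)) multiplier-𝟘
  multiplier-homogenised {a = a} {α} m (c ∷ F) = multiplier-resp
    (solve 5 (λ a p c x e → (a :* p) :* c :+ (a :* x) :* (p :* e) := (a :* p) :* (c :+ x :* e)) ≈-refl (ι a) (ι a ^^ length F) (ι c) α (evalℤ R α F))
    (multiplier-+ (multiplier-* (multiplier-^ (suc (length F)) (multiplier-ι a)) (multiplier-ι c)) (multiplier-* m (multiplier-homogenised {a = a} m F)))

  -- The weighted values Σ Tₜ (1 + ζ + ⋯ + ζ ʲ⁺ᵗ⁻¹) βᵗ, from which ζ - 1 has been cancelled.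
  weighted : A → A → ℕ → List ℤ → A
  weighted ζ β j [] = 𝟘
  weighted ζ β j (a ∷ T) = ι a ⊗ evalℤ R ζ (ones j) ⊕ β ⊗ weighted ζ β (suc j) T

  -- For `j = 1` and `T` the coefficients of `h` without the constant term, `β` times the right-hand
  -- side is `h(ζ β) - h(β)`. The constant term of `h` has dropped out.
  weighted-difference : ∀ ζ β j T → (ζ ⊝ 𝟙) ⊗ weighted ζ β j T ≈ ζ ^^ j ⊗ evalℤ R (ζ ⊗ β) T ⊝ evalℤ R β T
  weighted-difference ζ β j [] = solve 2 (λ z p → (z :- :1) :* :0 := p :* :0 :- :0) ≈-refl ζ (ζ ^^ j)
  weighted-difference ζ β j (a ∷ T) = begin
    (ζ ⊝ 𝟙) ⊗ (ι a ⊗ s ⊕ β ⊗ w)                   ≈⟨ solve 5 (λ z a s b w → (z :- :1) :* (a :* s :+ b :* w) := a :* ((z :- :1) :* s) :+ b :* ((z :- :1) :* w)) ≈-refl ζ (ι a) s β w ⟩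
    ι a ⊗ ((ζ ⊝ 𝟙) ⊗ s) ⊕ β ⊗ ((ζ ⊝ 𝟙) ⊗ w)       ≈⟨ ⊕-cong (⊗-congˡ (evalℤ-ones R ζ j)) (⊗-congˡ (weighted-difference ζ β (suc j) T)) ⟩
    ι a ⊗ (ζ ^^ j ⊝ 𝟙) ⊕ β ⊗ (ζ ⊗ ζ ^^ j ⊗ x ⊝ y)
      ≈⟨ solve 6 (λ z a b p x y → a :* (p :- :1) :+ b :* (z :* p :* x :- y) := p :* (a :+ (z :* b) :* x) :- (a :+ b :* y)) ≈-refl ζ (ι a) β (ζ ^^ j) x y ⟩
    ζ ^^ j ⊗ (ι a ⊕ (ζ ⊗ β) ⊗ x) ⊝ (ι a ⊕ β ⊗ y)  ∎
    where
    s = evalℤ R ζ (ones j)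
    w = weighted ζ β (suc j) T
    x = evalℤ R (ζ ⊗ β) T
    y = evalℤ R β T

  unit-power : ∀ {ζ k} → 1 ≤ k → ζ ^^ k ≈ 𝟙 → Multiplier (powers ζ k) ζ
  unit-power {ζ} {k} 1≤k e = powers-multiplier ζ k (span-resp (powers ζ k) (≈-sym e) (span-∈ (power-∈ ζ {k} 1≤k)))

  module _ {ζ β y : A} {k : ℕ} (1≤k : 1 ≤ k) (ζ^k : ζ ^^ k ≈ 𝟙) (βy : β ⊗ y ≈ 𝟙)
           (h₁ : ℤ) (m : ℕ) (T : List ℤ) (lT : length T ≡ suc m) (vanish : weighted ζ β 1 (h₁ ∷ T) ≈ 𝟘) where
    private
      x = ι h₁ ⊗ y
      es = products (powers ζ k) (powers x (suc m))
      xβ : x ⊗ β ≈ ι h₁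
      xβ = ≈-trans (solve 3 (λ h y b → (h :* y) :* b := h :* (b :* y)) ≈-refl (ι h₁) y β) (≈-trans (⊗-congˡ βy) (≈-trans (⊗-comm _ _) (⊗-identityˡ _)))

      ζ-multiplier : Multiplier es ζ
      ζ-multiplier = multiplier-productsˡ {powers ζ k} {powers x (suc m)} (unit-power {ζ} {k} 1≤k ζ^k)

      -- Since `x β = h₁`, multiplication by `x ^ l` turns each power `β ^ t` with `t ≤ l` into
      -- `h₁ ^ t x ^ (l - t)`, so no power of `β` remains.
      weighted-span : ∀ l j T → length T ≡ suc l → l < suc m → Span es (x ^^ l ⊗ weighted ζ β j T)
      weighted-span zero j (a ∷ []) e l< = span-resp es
        (solve 4 (λ s p a b → s :* (a :* p) := p :* (a :* s :+ b :* :0)) ≈-refl (evalℤ R ζ (ones j)) 𝟙 (ι a) β)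
        (multiplier-span (multiplier-evalℤ ζ-multiplier (ones j)) (span-ι es a (span-resp es (⊗-identityˡ 𝟙)
          (span-products {powers ζ k} {powers x (suc m)} (span-∈ (power-∈ ζ {k} 1≤k)) (span-∈ (power-∈ x {suc m} (s≤s z≤n)))))))
      weighted-span (suc l) j (a ∷ T) e l< = span-resp es
        (begin
          evalℤ R ζ (ones j) ⊗ (ι a ⊗ (𝟙 ⊗ p)) ⊕ ι h₁ ⊗ (x ^^ l ⊗ w)  ≈⟨ ⊕-congˡ (⊗-congʳ xβ) ⟨
          evalℤ R ζ (ones j) ⊗ (ι a ⊗ (𝟙 ⊗ (x ⊗ x ^^ l))) ⊕ (x ⊗ β) ⊗ (x ^^ l ⊗ w)
            ≈⟨ solve 6 (λ s a x p b w → s :* (a :* (:1 :* (x :* p))) :+ (x :* b) :* (p :* w) := (x :* p) :* (a :* s :+ b :* w)) ≈-refl (evalℤ R ζ (ones j)) (ι a) x (x ^^ l) β w ⟩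
          p ⊗ (ι a ⊗ evalℤ R ζ (ones j) ⊕ β ⊗ w)                     ∎)
        (span-+ es
          (multiplier-span (multiplier-evalℤ ζ-multiplier (ones j)) (span-ι es a
            (span-products {powers ζ k} {powers x (suc m)} (span-∈ (power-∈ ζ {k} 1≤k)) (span-∈ (power-∈ x {suc m} l<)))))
          (span-ι es h₁ (weighted-span l (suc j) T (ℕₚ.suc-injective e) (ℕₚ.<-trans (ℕₚ.n<1+n l) l<))))
        where
        p = x ^^ suc l
        w = weighted ζ β (suc j) T

      -- The first weight is 1, so the vanishing sum reads `h₁ + β w = 0`, an equation for the
      -- inverse `y` of `β` with leading coefficient `h₁`, in which the unknown constant term does
      -- not occur.
      x-value : x ≈ ⊖ weighted ζ β 2 T
      x-value = begin
        ι h₁ ⊗ y                                     ≈⟨ solve 4 (λ h y b w → h :* y := (h :+ b :* w) :* y :- w :* (b :* y)) ≈-refl (ι h₁) y β w ⟩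
        (ι h₁ ⊕ β ⊗ w) ⊗ y ⊝ w ⊗ (β ⊗ y)             ≈⟨ ⊕-cong (⊗-congʳ relation) (⊖-cong (⊗-congˡ βy)) ⟩
        𝟘 ⊗ y ⊝ w ⊗ 𝟙                                ≈⟨ solve 2 (λ y w → :0 :* y :- w :* :1 := :- w) ≈-refl y w ⟩
        ⊖ w                                          ∎
        where
        w = weighted ζ β 2 T
        relation : ι h₁ ⊕ β ⊗ w ≈ 𝟘
        relation = ≈-trans (⊕-congʳ (≈-trans (≈-sym (≈-trans (⊗-comm _ _) (⊗-identityˡ _))) (⊗-congˡ (≈-sym (≈-trans (⊕-cong ι-1 (⊗-zeroʳ ζ)) (⊕-identityʳ 𝟙)))))) vanish

      -- By `x = -w` the power `x ^ (m + 1)` equals `-(x ^ m w)`, and `weighted-span` expresses this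
      -- by lower powers of `x` over `ℤ[ζ]`. So `h₁` divided by `β` is integral.
      x-multiplier : Multiplier es x
      x-multiplier = multiplier λ i → apply-x (∈-products {powers ζ k} {powers x (suc m)} i)
        where
        top : Span es (x ^^ suc m)
        top = span-resp es (≈-trans (≈-trans (⊗-congʳ (⊖-cong ι-1)) (solve 2 (λ p w → :- :1 :* (p :* w) := (:- w) :* p) ≈-refl (x ^^ m) _))
            (⊗-congʳ (≈-sym x-value)))
          (span-ι es -[1+ 0 ] (weighted-span m 2 T lT ℕₚ.≤-refl))
        apply-x : ∀ {g} → (∃₂ λ e f → e ∈ powers ζ k × f ∈ powers x (suc m) × g ≡ e ⊗ f) → Span es (x ⊗ g)
        apply-x (e , f , e∈ , f∈ , refl) with ∈-powers ζ {k} e∈ | ∈-powers x {suc m} f∈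
        ... | i , _ , refl | j , j< , refl with ℕₚ.m≤n⇒m<n∨m≡n j<
        ... | inj₁ j<′ = span-resp es (solve 3 (λ z x p → z :* (x :* p) := x :* (z :* p)) ≈-refl (ζ ^^ i) x (x ^^ j))
          (span-products {powers ζ k} {powers x (suc m)} (span-∈ e∈) (span-∈ (power-∈ x {suc m} j<′)))
        ... | inj₂ refl = span-resp es (solve 3 (λ z x p → z :* (x :* p) := x :* (z :* p)) ≈-refl (ζ ^^ i) x (x ^^ j))
          (multiplier-span (multiplier-^ i ζ-multiplier) top)

      reciprocal-value : ∀ l F → length F ≡ suc l → Multiplier es (x ^^ l ⊗ evalℤ R β F)
      reciprocal-value zero (a ∷ []) e = multiplier-resp (solve 2 (λ a b → a := :1 :* (a :+ b :* :0)) ≈-refl (ι a) β) (multiplier-ι a)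
      reciprocal-value (suc l) (a ∷ F) e = multiplier-resp
        (begin
          x ^^ suc l ⊗ ι a ⊕ ι h₁ ⊗ (x ^^ l ⊗ v)      ≈⟨ ⊕-congˡ (⊗-congʳ xβ) ⟨
          (x ⊗ x ^^ l) ⊗ ι a ⊕ (x ⊗ β) ⊗ (x ^^ l ⊗ v) ≈⟨ solve 5 (λ x p a b v → (x :* p) :* a :+ (x :* b) :* (p :* v) := (x :* p) :* (a :+ b :* v)) ≈-refl x (x ^^ l) (ι a) β v ⟩
          (x ⊗ x ^^ l) ⊗ (ι a ⊕ β ⊗ v)               ∎)
        (multiplier-+ (multiplier-* (multiplier-^ (suc l) x-multiplier) (multiplier-ι a))
          (multiplier-* (multiplier-ι h₁) (reciprocal-value l F (ℕₚ.suc-injective e))))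
        where v = evalℤ R β F

    generators : List A
    generators = es

    length-generators : length generators ≡ k * suc m
    length-generators = trans (length-products (powers ζ k) (powers x (suc m))) (cong₂ _*_ (length-powers ζ k) (length-powers x (suc m)))

    generators-one : Span generators 𝟙
    generators-one = span-resp es (⊗-identityˡ 𝟙) (span-products {powers ζ k} {powers x (suc m)} (span-∈ (power-∈ ζ {k} 1≤k)) (span-∈ (power-∈ x {suc m} (s≤s z≤n))))

    denominator-multiplier : Multiplier generators ((ι h₁ ⊗ y) ^^ suc (suc m))
    denominator-multiplier = multiplier-^ (suc (suc m)) x-multiplier

    -- The constant term is minus a polynomial in `β` of degree `m + 2`, and `β = h₁ / x`. Hence
    -- `x ^ (m + 2)` is a common denominator, for which `t x ^ (m + 2)` is integral.
    numerator-multiplier : ∀ t → t ⊕ β ⊗ evalℤ R β (h₁ ∷ T) ≈ 𝟘 → Multiplier generators (t ⊗ (ι h₁ ⊗ y) ^^ suc (suc m))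
    numerator-multiplier t e = multiplier-resp
      (begin
        ⊖ (x ^^ suc (suc m) ⊗ (𝟘 ⊕ β ⊗ v))            ≈⟨ solve 4 (λ p b v t → :- (p :* (:0 :+ b :* v)) := t :* p :- p :* (t :+ b :* v)) ≈-refl (x ^^ suc (suc m)) β v t ⟩
        t ⊗ x ^^ suc (suc m) ⊝ x ^^ suc (suc m) ⊗ (t ⊕ β ⊗ v) ≈⟨ ⊕-congˡ (⊖-cong (≈-trans (⊗-congˡ e) (⊗-zeroʳ _))) ⟩
        t ⊗ x ^^ suc (suc m) ⊝ 𝟘                      ≈⟨ solve 1 (λ x → x :- :0 := x) ≈-refl _ ⟩
        t ⊗ x ^^ suc (suc m)                          ∎)
      (multiplier-neg (reciprocal-value (suc (suc m)) (+ 0 ∷ h₁ ∷ T) (cong (λ l → suc (suc l)) lT)))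
      where v = evalℤ R β (h₁ ∷ T)

evalℤ-ι : (R : CommutativeRing 0ℓ 0ℓ) → ∀ c F → RingFacts._≈_ R (evalℤ R (RingFacts.ι R c) F) (RingFacts.ι R (evaluate c F))
evalℤ-ι R c [] = ≈-refl
  where open RingFacts R
evalℤ-ι R c (a ∷ F) = ≈-trans (⊕-congˡ (≈-trans (⊗-congˡ (evalℤ-ι R c F)) (≈-sym (ι-* c (evaluate c F))))) (≈-sym (ι-+ a (c ℤ.* evaluate c F)))
  where open RingFacts R

-- Distinct integers that are, in fields of their own, uniformly algebraic: their number is bounded
-- because all of them are roots of one polynomial, found in the product of the fields.
module BoundedValues {I : Set} (K : I → CommutativeRing 0ℓ 0ℓ) (isField : ∀ i → IsChar0Field (K i)) (c : I → ℤ) where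
  R = Product.productRing K
  open RingFacts R
  open Spans R hiding (evalℤ)
  private module F i = CharZeroField (K i) (isField i)

  bounded : ∀ es u v → Span es 𝟙 → Multiplier es u → Multiplier es v → u ≈ (λ i → F.ι i (c i)) ⊗ v →
    (∀ i → ¬ F._≈_ i (v i) (F.𝟘 i)) → (is : List I) → Unique (map c is) → length is ≤ length es
  bounded es u v one mu mv e nonzero is unique = conclude (ratio-algebraic es t u v one mu mv e)
    where
    t : A
    t i = F.ι i (c i)
    conclude : (∃ λ cs → length cs ≡ suc (length es) × NonzeroList cs × evalℤ R t cs ⊗ v ^^ length es ≈ 𝟘) → length is ≤ length es
    conclude (cs , l , nz , eq) = ℕₚ.≮⇒≥ λ long → ℕₚ.<⇒≢ (positive cs nz) (sym (vanishing (map c is) unique cs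
        (ℕₚ.≤-trans (ℕₚ.≤-reflexive l) (ℕₚ.≤-trans long (ℕₚ.≤-reflexive (sym (Listₚ.length-map c is))))) (Allₚ.map⁺ (All.universal root is))))
      where
      positive : ∀ cs → NonzeroList cs → 0 < height cs
      positive (c ∷ cs) (here n) = ℕₚ.≤-trans (ℕₚ.n≢0⇒n>0 (λ z → n (ℤₚ.∣i∣≡0⇒i≡0 z))) (ℕₚ.m≤m⊔n _ _)
      positive (c ∷ cs) (there m) = ℕₚ.≤-trans (positive cs m) (ℕₚ.m≤n⊔m ℤ.∣ c ∣ _)
      root : ∀ i → evaluate (c i) cs ≡ + 0
      root i = F.ι-zero i (F.≈-trans i (F.≈-sym i (evalℤ-ι (K i) (c i) cs)) (F.≈-trans i (F.≈-sym i (hom-evalℤ (Product.component K i) t cs))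
        (F.cancel-nonzero i (F.nonzero-^ i (length es) (nonzero i))
          (F.≈-trans i (F.⊗-congˡ i (F.≈-sym i (Hom.⟦⟧-^ (Product.component K i) v (length es)))) (eq i)))))

record RootsInDifferentFactors (k : ℕ) (G H : List ℤ) : Set₁ where
  field
    K       : CommutativeRing 0ℓ 0ℓ
    isField : IsChar0Field K
  open CharZeroField K isField public
  field
    ζ β     : A
    order   : ζ ^^ k ≈ 𝟙
    root-G  : evalℤ K β G ≈ 𝟘
    root-H  : evalℤ K (ζ ⊗ β) H ≈ 𝟘

record RootsInSameFactor (k : ℕ) (H : List ℤ) : Set₁ where
  field
    K       : CommutativeRing 0ℓ 0ℓ
    isField : IsChar0Field K
  open CharZeroField K isField public
  field
    ζ β     : A
    order   : ζ ^^ k ≈ 𝟙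
    ζ≉1     : ¬ (ζ ≈ 𝟙)
    β≉0     : ¬ (β ≈ 𝟘)
    root    : evalℤ K β H ≈ 𝟘
    root-ζ  : evalℤ K (ζ ⊗ β) H ≈ 𝟘

-- With `a` the leading coefficient of the fixed factor `G`, `a β` is integral, and
-- `c = - ζ β T(ζ β)`; so `c` becomes integral after multiplication by a power of `a`. The roots
-- depend on `c`, but in the product of the fields the `suc d * k` elements `(a β) ^ i ζ ^ j` serve
-- all `c` simultaneously.
different-factors-bound : ∀ k → 1 ≤ k → ∀ d G → length G ≡ suc (suc d) → ℤX.coef G (suc d) ≢ + 0 → ∀ T (cs : List ℤ) → Unique cs →
  All (λ c → RootsInDifferentFactors k G (c ∷ T)) cs → length cs ≤ suc d * k
different-factors-bound k 1≤k d G lG top T cs unique ws = subst₂ _≤_ (Listₚ.length-tabulate {n = length cs} id) sizes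
    (B.bounded es u v one u-multiplier v-multiplier ≈-refl v-nonzero (Data.List.allFin (length cs)) (subst Unique (sym (trans (Listₚ.map-tabulate id c) (Listₚ.tabulate-lookup cs))) unique))
  where
  I = Fin (length cs)
  c = Data.List.lookup cs
  w : (i : I) → RootsInDifferentFactors k G (c i ∷ T)
  w i = All.lookup ws (∈ₚ.∈-lookup i)
  module W i = RootsInDifferentFactors (w i)
  module B = BoundedValues W.K W.isField c
  open RingFacts B.R
  open Spans B.R hiding (evalℤ)
  open IntegralElements B.R
  a = ℤX.coef G (suc d)
  β ζ : A
  β i = W.β i
  ζ i = W.ζ i
  x = ι a ⊗ β
  componentwise : ∀ {x F} → (∀ i → W._≈_ i (evalℤ (W.K i) (x i) F) (W.𝟘 i)) → evalℤ B.R x F ≈ 𝟘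
  componentwise {x} {F} e i = W.≈-trans i (hom-evalℤ (Product.component W.K i) x F) (e i)
  ζ^k : ζ ^^ k ≈ 𝟙
  ζ^k i = W.≈-trans i (Hom.⟦⟧-^ (Product.component W.K i) ζ k) (W.order i)
  es = products (powers x (suc d)) (powers ζ k)
  sizes : length es ≡ suc d * k
  sizes = trans (length-products (powers x (suc d)) (powers ζ k)) (cong₂ _*_ (length-powers x (suc d)) (length-powers ζ k))
  one : Span es 𝟙
  one = span-resp es (⊗-identityˡ 𝟙) (span-products {powers x (suc d)} {powers ζ k} (span-∈ (power-∈ x {suc d} (s≤s z≤n))) (span-∈ (power-∈ ζ {k} 1≤k)))
  t : A
  t i = W.ι i (c i)
  N = suc (length T)
  v = ι a ^^ N
  u = t ⊗ v
  v-multiplier : Multiplier es v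
  v-multiplier = multiplier-^ N (multiplier-ι a)
  y-multiplier : Multiplier es (ι a ⊗ (ζ ⊗ β))
  y-multiplier = multiplier-resp (solve 3 (λ z a b → z :* (a :* b) := a :* (z :* b)) ≈-refl ζ (ι a) β)
    (multiplier-* (multiplier-productsʳ {powers x (suc d)} {powers ζ k} (unit-power {ζ} {k} 1≤k ζ^k))
      (multiplier-productsˡ {powers x (suc d)} {powers ζ k} (Integrality.root-multiplier B.R d G β lG (componentwise {β} {G} W.root-G))))
  u-multiplier : Multiplier es u
  u-multiplier = multiplier-resp
    (≈-trans (solve 4 (λ p z s t → :- (p :* (:0 :+ z :* s)) := t :* p :- p :* (t :+ z :* s)) ≈-refl v (ζ ⊗ β) (evalℤ B.R (ζ ⊗ β) T) t)
      (≈-trans (⊕-congˡ (⊖-cong (≈-trans (⊗-congˡ relation) (⊗-zeroʳ v)))) (solve 1 (λ x → x :- :0 := x) ≈-refl u)))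
    (multiplier-neg (multiplier-homogenised {a = a} {ζ ⊗ β} y-multiplier (+ 0 ∷ T)))
    where
    relation : t ⊕ (ζ ⊗ β) ⊗ evalℤ B.R (ζ ⊗ β) T ≈ 𝟘
    relation i = W.≈-trans i (W.⊕-congˡ i (W.⊗-congˡ i (hom-evalℤ (Product.component W.K i) (ζ ⊗ β) T))) (W.root-H i)
  v-nonzero : ∀ i → ¬ W._≈_ i (v i) (W.𝟘 i)
  v-nonzero i e = W.nonzero-^ i N (W.ι-nonzero i top)
    (W.≈-trans i (W.≈-sym i (W.≈-trans i (Hom.⟦⟧-^ (Product.component W.K i) (ι a) N) (W.^^-cong i N (Hom.⟦⟧-ι (Product.component W.K i) a)))) e)

-- The two root equations are subtracted to eliminate `c` and the difference is divided by
-- `(ζ - 1) β`. What remains determines `β` algebraically from `ζ` and the fixed coefficients,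
-- because `h₁` is nonzero; either root equation then gives `c`.
same-factor-bound : ∀ k → 1 ≤ k → ∀ m h₁ T → length T ≡ suc m → h₁ ≢ + 0 → (cs : List ℤ) → Unique cs →
  All (λ c → RootsInSameFactor k (c ∷ h₁ ∷ T)) cs → length cs ≤ k * suc m
same-factor-bound k 1≤k m h₁ T lT nz cs unique ws = subst₂ _≤_ (Listₚ.length-tabulate {n = length cs} id)
    (length-generators {ζ} {β} {y} 1≤k ζ^k βy h₁ m T lT weighted-zero)
    (B.bounded (generators {ζ} {β} {y} 1≤k ζ^k βy h₁ m T lT weighted-zero) (t ⊗ v) v
      (generators-one {ζ} {β} {y} 1≤k ζ^k βy h₁ m T lT weighted-zero)
      (numerator-multiplier {ζ} {β} {y} 1≤k ζ^k βy h₁ m T lT weighted-zero t relation)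
      (denominator-multiplier {ζ} {β} {y} 1≤k ζ^k βy h₁ m T lT weighted-zero)
      ≈-refl v-nonzero (Data.List.allFin (length cs)) (subst Unique (sym (trans (Listₚ.map-tabulate id c) (Listₚ.tabulate-lookup cs))) unique))
  where
  I = Fin (length cs)
  c = Data.List.lookup cs
  w : (i : I) → RootsInSameFactor k (c i ∷ h₁ ∷ T)
  w i = All.lookup ws (∈ₚ.∈-lookup i)
  module W i = RootsInSameFactor (w i)
  module B = BoundedValues W.K W.isField c
  open RingFacts B.R
  open IntegralElements B.R
  β ζ y t : A
  β i = W.β i
  ζ i = W.ζ i
  y i = proj₁ (W.inverse i (W.β i) (W.β≉0 i))
  t i = W.ι i (c i)
  v = (ι h₁ ⊗ y) ^^ suc (suc m)
  βy : β ⊗ y ≈ 𝟙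
  βy i = proj₂ (W.inverse i (W.β i) (W.β≉0 i))
  ζ^k : ζ ^^ k ≈ 𝟙
  ζ^k i = W.≈-trans i (Hom.⟦⟧-^ (Product.component W.K i) ζ k) (W.order i)
  relation : t ⊕ β ⊗ evalℤ B.R β (h₁ ∷ T) ≈ 𝟘
  relation i = W.≈-trans i (W.⊕-congˡ i (W.⊗-congˡ i (hom-evalℤ (Product.component W.K i) β (h₁ ∷ T)))) (W.root i)
  relation-ζ : t ⊕ (ζ ⊗ β) ⊗ evalℤ B.R (ζ ⊗ β) (h₁ ∷ T) ≈ 𝟘
  relation-ζ i = W.≈-trans i (W.⊕-congˡ i (W.⊗-congˡ i (hom-evalℤ (Product.component W.K i) (ζ ⊗ β) (h₁ ∷ T)))) (W.root-ζ i)
  difference : weighted ζ β 1 (h₁ ∷ T) ⊗ ((ζ ⊝ 𝟙) ⊗ β) ≈ 𝟘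
  difference = begin
    s ⊗ ((ζ ⊝ 𝟙) ⊗ β)                      ≈⟨ solve 3 (λ s z b → s :* (z :* b) := b :* (z :* s)) ≈-refl s (ζ ⊝ 𝟙) β ⟩
    β ⊗ ((ζ ⊝ 𝟙) ⊗ s)                      ≈⟨ ⊗-congˡ (weighted-difference ζ β 1 (h₁ ∷ T)) ⟩
    β ⊗ ((ζ ⊗ 𝟙) ⊗ p ⊝ q)                  ≈⟨ solve 5 (λ b z p q t → b :* ((z :* :1) :* p :- q) := (t :+ (z :* b) :* p) :- (t :+ b :* q)) ≈-refl β ζ p q t ⟩
    (t ⊕ (ζ ⊗ β) ⊗ p) ⊝ (t ⊕ β ⊗ q)        ≈⟨ ⊕-cong relation-ζ (⊖-cong relation) ⟩
    𝟘 ⊝ 𝟘                                  ≈⟨ ⊖-inverseʳ 𝟘 ⟩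
    𝟘                                      ∎
    where
    open ≈-Reasoning
    s = weighted ζ β 1 (h₁ ∷ T)
    p = evalℤ B.R (ζ ⊗ β) (h₁ ∷ T)
    q = evalℤ B.R β (h₁ ∷ T)
  weighted-zero : weighted ζ β 1 (h₁ ∷ T) ≈ 𝟘
  -- The factor `(ζ - 1) β` is cancelled in each field separately; in the product being nonzero
  -- would not be enough.
  weighted-zero i = W.cancel-nonzero i (W.nonzero-⊗ i (λ e → W.ζ≉1 i (W.⊝≈𝟘⇒≈ i (W.ζ i) (W.𝟙 i) e)) (W.β≉0 i)) (difference i)
  y-nonzero : ∀ i → ¬ W._≈_ i (y i) (W.𝟘 i)
  y-nonzero i e = W.1≉0 i (W.≈-trans i (W.≈-sym i (βy i)) (W.≈-trans i (W.⊗-congˡ i e) (W.⊗-zeroʳ i _)))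
  v-nonzero : ∀ i → ¬ W._≈_ i (v i) (W.𝟘 i)
  v-nonzero i e = W.nonzero-^ i (suc (suc m)) (W.nonzero-⊗ i (W.ι-nonzero i nz) (y-nonzero i))
    (W.≈-trans i (W.≈-sym i (W.≈-trans i (Hom.⟦⟧-^ (Product.component W.K i) (ι h₁ ⊗ y) (suc (suc m)))
      (W.^^-cong i (suc (suc m)) (W.⊗-congʳ i (Hom.⟦⟧-ι (Product.component W.K i) h₁))))) e)

-- The finite list of all members

signedUpTo-unique : ∀ n → Unique (signedUpTo n)
signedUpTo-unique n = Uniqueₚ.++⁺ (Uniqueₚ.map⁺ ℤₚ.+-injective (Uniqueₚ.upTo⁺ n)) (Uniqueₚ.map⁺ ℤₚ.-[1+-injective (Uniqueₚ.upTo⁺ n)) disjoint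
  where
  disjoint : ∀ {x} → ¬ (x ∈ map +_ (upTo n) × x ∈ map -[1+_] (upTo n))
  disjoint (i , j) with ∈ₚ.∈-map⁻ +_ i | ∈ₚ.∈-map⁻ -[1+_] j
  ... | _ , _ , refl | _ , _ , ()

signedUpTo-bound : ∀ {B a} → a ∈ signedUpTo (suc B) → ℤ.∣ a ∣ ≤ suc B
signedUpTo-bound {B} i with ∈ₚ.∈-++⁻ (map +_ (upTo (suc B))) i
... | inj₁ j with ∈ₚ.∈-map⁻ +_ j
... | k , k∈ , refl = ℕₚ.<⇒≤ (∈ₚ.∈-upTo⁻ k∈)
signedUpTo-bound {B} i | inj₂ j with ∈ₚ.∈-map⁻ -[1+_] j
... | k , k∈ , refl = ∈ₚ.∈-upTo⁻ k∈

vectors : ℕ → (k : ℕ) → List (Vec ℤ k)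
vectors B zero = [] ∷ []
vectors B (suc k) = Data.List.cartesianProductWith _∷_ (signedUpTo (suc B)) (vectors B k)

vectors-unique : ∀ B k → Unique (vectors B k)
vectors-unique B zero = [] ∷ []
vectors-unique B (suc k) = Uniqueₚ.cartesianProductWith⁺ _∷_ Vecₚ.∷-injective (signedUpTo-unique (suc B)) (vectors-unique B k)

∈-vectors : ∀ {B k} {a : Vec ℤ k} → VecAll.All (λ c → ℤ.∣ c ∣ ≤ B) a → a ∈ vectors B k
∈-vectors VecAll.[] = here refl
∈-vectors (l VecAll.∷ ls) = ∈ₚ.∈-cartesianProductWith⁺ _∷_ (∈-signedUpTo _ l) (∈-vectors ls)

lowFirst-above : ∀ {n} (a : IntPoly n) i → n < i → ℤX.coef (lowFirst a) i ≡ + 0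
lowFirst-above a i l = ℤX.coef-beyond (lowFirst a) i (ℕₚ.≤-trans (ℕₚ.≤-reflexive (length-lowFirst a)) l)

reducible⇒factorisation : ∀ {n} (a : IntPoly n) → Vec.head a ≢ + 0 → Reducible a → Factorisation (lowFirst a) n
reducible⇒factorisation {n} a nz (g , h , (i , 1≤i , gi) , (j , 1≤j , hj) , e) = conclude (gauss (lowFirst a) g h equation)
  where
  equation : toℚX (lowFirst a) ℚX.≋ g ℚX.⊠ h
  equation = ℚX.pointwise λ i → trans (sym (coeff-coef (toℚX (lowFirst a)) i)) (trans (cong (λ p → coeff p i) (sym (toQPoly-lowFirst a)))
    (trans (e i) (trans (coeff-coef (mulQ g h) i) (cong (λ p → ℚX.coef p i) (mulQ-⊠ g h)))))
  conclude : (∃₂ λ G H → lowFirst a ℤX.≋ G ℤX.⊠ H × (∀ i → ℚX.coef g i ≢ ℚ.0ℚ → ℤX.coef G i ≢ + 0) × (∀ i → ℚX.coef h i ≢ ℚ.0ℚ → ℤX.coef H i ≢ + 0)) →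
    Factorisation (lowFirst a) n
  conclude (G , H , eq , keepG , keepH) = factorisation (lowFirst a) G H eq (λ z → nz (trans (sym (coef-lowFirst a)) z)) (lowFirst-above a)
    (i , 1≤i , keepG i (λ z → gi (trans (coeff-coef g i) z))) (j , 1≤j , keepH j (λ z → hj (trans (coeff-coef h j) z)))

factors⇒reducible : ∀ {n} (a : IntPoly n) G H → lowFirst a ℤX.≋ G ℤX.⊠ H →
  (∃ λ i → 1 ≤ i × ℤX.coef G i ≢ + 0) → (∃ λ i → 1 ≤ i × ℤX.coef H i ≢ + 0) → Reducible a
factors⇒reducible a G H e (i , 1≤i , gi) (j , 1≤j , hj) = toℚX G , toℚX H , (i , 1≤i , nonzero G i gi) , (j , 1≤j , nonzero H j hj) , λ i →
    trans (cong (λ p → coeff p i) (toQPoly-lowFirst a)) (trans (coeff-coef (toℚX (lowFirst a)) i)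
    (trans (ℚX.at (MapPolynomials.map-≋ (ιHom ℚ-ring) {lowFirst a} {G ℤX.⊠ H} e) i) (trans (ℚX.at (MapPolynomials.map-⊠ (ιHom ℚ-ring) G H) i)
    (sym (trans (coeff-coef (mulQ (toℚX G) (toℚX H)) i) (cong (λ p → ℚX.coef p i) (mulQ-⊠ (toℚX G) (toℚX H))))))))
  where
  nonzero : ∀ P i → ℤX.coef P i ≢ + 0 → ¬ (coeff (toℚX P) i ≡ ℚ.0ℚ)
  nonzero P i n z = n (ℚF.ι-zero (trans (sym (MapPolynomials.coef-map (ιHom ℚ-ring) P i)) (trans (sym (coeff-coef (toℚX P) i)) z)))

factorisation⇒reducible : ∀ {n} (a : IntPoly n) → Vec.head a ≢ + 0 → Factorisation (lowFirst a) n → Reducible a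
factorisation⇒reducible a nz f = factors⇒reducible a G H equation
    (suc d , s≤s z≤n , proj₁ tops) (suc e , s≤s z≤n , proj₂ tops)
  where
  open Factorisation f
  tops = factor-tops (lowFirst a) f (λ z → nz (trans (sym (coef-lowFirst a)) z))

inRStar? : ∀ k H (a : IntPoly (suc k)) → Dec (InRStar (suc k) H a)
inRStar? k H a with Vec.head a ℤ.≟ + 0 | VecAll.all? (λ c → ℤ.∣ c ∣ ℕₚ.≤? H) a
... | yes z | _ = no λ r → proj₁ (proj₁ r) z
... | no _ | no nb = no λ r → nb (proj₂ (proj₁ r))
... | no nz | yes b = Dec.map′ (λ { (t , f) → (nz , b) , twisted⇒degenerate a (orderBound-positive (suc k)) t , factorisation⇒reducible a nz f })
    (λ { (_ , d , r) → degenerate⇒twisted k a nz d , reducible⇒factorisation a nz r })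
    (twisted? (lowFirst a) (suc k) top (orderBound (suc k)) (orderBound-positive (suc k))
      Dec.×-dec factorisation? (lowFirst a) (suc k) (length-lowFirst a) top)
  where
  top : ℤX.coef (lowFirst a) (suc k) ≢ + 0
  top z = nz (trans (sym (coef-lowFirst a)) z)

rStar : ∀ k H → List (IntPoly (suc k))
rStar k H = filter (inRStar? k H) (vectors H (suc (suc k)))

rStar-unique : ∀ k H → Unique (rStar k H)
rStar-unique k H = Uniqueₚ.filter⁺ (inRStar? k H) (vectors-unique H (suc (suc k)))

∈-rStar : ∀ k H {a} → InRStar (suc k) H a → a ∈ rStar k H
∈-rStar k H r = ∈ₚ.∈-filter⁺ (inRStar? k H) (∈-vectors (proj₂ (proj₁ r))) r

rStar-∈ : ∀ k H {a} → a ∈ rStar k H → InRStar (suc k) H a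
rStar-∈ k H i = proj₂ (∈ₚ.∈-filter⁻ (inRStar? k H) {xs = vectors H (suc (suc k))} i)

rStar-count : ∀ k H → RStarIs (suc k) H (length (rStar k H))
rStar-count k H = rStar k H , rStar-unique k H , refl , λ a → mk⇔ (rStar-∈ k H) (∈-rStar k H)

-- Tools for counting

module _ {a b c} {A : Set a} {C : Set b} (R : A → C → Set c) where

  private
    split : ∀ {κ Cs} (L : List A) → Unique L → All (λ x → Any (R x) (κ ∷ Cs)) L →
      ∃₂ λ L₁ L₂ → length L ≡ length L₁ + length L₂ × Unique L₁ × Unique L₂ × All (λ x → R x κ) L₁ × All (λ x → Any (R x) Cs) L₂ ×
        (∀ x → All (x ≢_) L → All (x ≢_) L₁ × All (x ≢_) L₂)
    split [] [] [] = [] , [] , refl , [] , [] , [] , [] , λ _ _ → [] , []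
    split (x ∷ L) (x∉ ∷ u) (r ∷ rs) with split L u rs
    ... | L₁ , L₂ , l , u₁ , u₂ , r₁ , r₂ , keep with r
    ... | here e = x ∷ L₁ , L₂ , cong suc l , proj₁ (keep x x∉) ∷ u₁ , u₂ , e ∷ r₁ , r₂ ,
      λ { y (n ∷ ns) → n ∷ proj₁ (keep y ns) , proj₂ (keep y ns) }
    ... | there e = L₁ , x ∷ L₂ , trans (cong suc l) (sym (ℕₚ.+-suc _ _)) , u₁ , proj₂ (keep x x∉) ∷ u₂ , r₁ , e ∷ r₂ ,
      λ { y (n ∷ ns) → proj₁ (keep y ns) , n ∷ proj₂ (keep y ns) }

  -- An element may be related to several codes and a code may be listed repeatedly; `split` assigns
  -- each element to the first code that fits.
  fibre-bound : ∀ M (Cs : List C) → (∀ κ (L : List A) → Unique L → All (λ x → R x κ) L → length L ≤ M) →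
    ∀ L → Unique L → All (λ x → Any (R x) Cs) L → length L ≤ M * length Cs
  fibre-bound M [] fibre [] u r = z≤n
  fibre-bound M [] fibre (x ∷ L) u (() ∷ _)
  fibre-bound M (κ ∷ Cs) fibre L u r with split L u r
  ... | L₁ , L₂ , l , u₁ , u₂ , r₁ , r₂ , _ = begin
    length L                      ≡⟨ l ⟩
    length L₁ + length L₂         ≤⟨ ℕₚ.+-mono-≤ (fibre κ L₁ u₁ r₁) (fibre-bound M Cs fibre L₂ u₂ r₂) ⟩
    M + M * length Cs             ≡⟨ ℕₚ.*-suc M (length Cs) ⟨
    M * suc (length Cs)           ∎
    where open ℕₚ.≤-Reasoning

-- Codes of degenerate polynomials exist only up to double negation, because equality in the field
-- of a `Twisted` cannot be decided. All of them may nevertheless be assumed together when the goal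
-- is an inequality of natural numbers, which is decidable.
¬¬-All : ∀ {a p} {A : Set a} {P : A → Set p} (L : List A) → (∀ {x} → x ∈ L → ¬ ¬ P x) → ¬ ¬ All P L
¬¬-All [] f k = k []
¬¬-All (x ∷ L) f k = f (here refl) λ p → ¬¬-All L (λ i → f (there i)) λ ps → k (p ∷ ps)

injection-length : ∀ {a b} {A : Set a} {B : Set b} (xs : List A) (ys : List B) (f : A → B) → Unique xs →
  (∀ {x} → x ∈ xs → f x ∈ ys) → (∀ {x y} → x ∈ xs → y ∈ xs → f x ≡ f y → x ≡ y) → length xs ≤ length ys
injection-length xs ys f u into inj = ℕₚ.≤-trans
  (fibre-bound (λ x y → x ∈ xs × f x ≡ y) 1 ys fibre xs u (All.tabulate λ {x} i → lose (into i) (i , refl)))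
  (ℕₚ.≤-reflexive (ℕₚ.*-identityˡ (length ys)))
  where
  fibre : ∀ y L → Unique L → All (λ x → x ∈ xs × f x ≡ y) L → length L ≤ 1
  fibre y [] _ _ = z≤n
  fibre y (x ∷ []) _ _ = s≤s z≤n
  fibre y (x ∷ x′ ∷ L) ((n ∷ _) ∷ _) ((i , e) ∷ (i′ , e′) ∷ _) = contradiction (inj i i′ (trans e (sym e′))) n

length-concatMap-≤ : ∀ {a b} {A : Set a} {B : Set b} (f : A → List B) M xs → (∀ {x} → x ∈ xs → length (f x) ≤ M) → length (concatMap f xs) ≤ length xs * M
length-concatMap-≤ f M [] h = z≤n
length-concatMap-≤ f M (x ∷ xs) h = ℕₚ.≤-trans (ℕₚ.≤-reflexive (Listₚ.length-++ (f x))) (ℕₚ.+-mono-≤ (h (here refl)) (length-concatMap-≤ f M xs (h ∘ there)))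

length-cartesianProductWith : ∀ {a b c} {A : Set a} {B : Set b} {C : Set c} (f : A → B → C) xs ys → length (Data.List.cartesianProductWith f xs ys) ≡ length xs * length ys
length-cartesianProductWith f [] ys = refl
length-cartesianProductWith f (x ∷ xs) ys = trans (Listₚ.length-++ (map (f x) ys)) (cong₂ _+_ (Listₚ.length-map (f x) ys) (length-cartesianProductWith f xs ys))

length-words : ∀ B k → length (words B k) ≡ (suc B + suc B) ^ k
length-words B zero = refl
length-words B (suc k) = trans (length-cartesianProductWith _∷_ (signedUpTo (suc B)) (words B k)) (cong₂ _*_
  (trans (Listₚ.length-++ (map +_ (upTo (suc B)))) (cong₂ _+_ (trans (Listₚ.length-map +_ (upTo (suc B))) (Listₚ.length-upTo (suc B))) (trans (Listₚ.length-map -[1+_] (upTo (suc B))) (Listₚ.length-upTo (suc B)))))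
  (length-words B k))

2^-positive : ∀ k → 1 ≤ 2 ^ k
2^-positive k = ℕₚ.m^n>0 2 k

n<2^n : ∀ n → n < 2 ^ n
n<2^n zero = s≤s z≤n
n<2^n (suc n) = ℕₚ.≤-trans (ℕₚ.+-mono-≤ (2^-positive n) (n<2^n n)) (ℕₚ.≤-reflexive (cong (λ x → 2 ^ n + x) (sym (ℕₚ.+-identityʳ _))))

log₂-< : ∀ H → H < 2 ^ suc ⌊log₂ H ⌋
log₂-< H = ℕₚ.≰⇒> λ l → ℕₚ.<⇒≱ (ℕₚ.n<1+n ⌊log₂ H ⌋)
  (ℕₚ.≤-trans (ℕₚ.≤-reflexive (sym (⌊log₂[2^n]⌋≡n (suc ⌊log₂ H ⌋)))) (⌊log₂⌋-mono-≤ l))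

log₂-positive : ∀ H → 2 ≤ H → 1 ≤ ⌊log₂ H ⌋
log₂-positive H l = ⌊log₂⌋-mono-≤ l

log₂-≤ : ∀ H → 1 ≤ H → 2 ^ ⌊log₂ H ⌋ ≤ H
log₂-≤ H 1≤H = go H H ℕₚ.≤-refl 1≤H
  where
  go : ∀ fuel H → H ≤ fuel → 1 ≤ H → 2 ^ ⌊log₂ H ⌋ ≤ H
  go fuel 1 _ _ = s≤s z≤n
  go (suc fuel) H@(suc (suc h)) (s≤s l) _ = begin
    2 ^ ⌊log₂ H ⌋                       ≡⟨ cong (2 ^_) (ℕₚ.m+[n∸m]≡n (log₂-positive H (s≤s (s≤s z≤n)))) ⟨
    2 * 2 ^ (⌊log₂ H ⌋ ∸ 1)             ≡⟨ cong (λ k → 2 * 2 ^ k) (⌊log₂⌊n/2⌋⌋≡⌊log₂n⌋∸1 H) ⟨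
    2 * 2 ^ ⌊log₂ half ⌋                ≤⟨ ℕₚ.*-monoʳ-≤ 2 (go fuel half (ℕₚ.≤-trans (s≤s (ℕₚ.⌊n/2⌋≤n h)) l) (s≤s z≤n)) ⟩
    2 * half                            ≡⟨ cong (λ x → half + x) (ℕₚ.+-identityʳ half) ⟩
    half + half                         ≤⟨ ℕₚ.+-monoʳ-≤ half (ℕₚ.⌊n/2⌋≤⌈n/2⌉ H) ⟩
    half + ℕ.⌈ H /2⌉                    ≡⟨ ℕₚ.⌊n/2⌋+⌈n/2⌉≡n H ⟩
    H                                   ∎
    where
    open ℕₚ.≤-Reasoning
    half = ℕ.⌊ H /2⌋

list-extensional : ∀ F G → length F ≡ length G → F ℤX.≋ G → F ≡ G
list-extensional [] [] l e = refl
list-extensional (a ∷ F) (b ∷ G) l e = cong₂ _∷_ (ℤX.at e 0) (list-extensional F G (ℕₚ.suc-injective l) (ℤX.tail-≋ e))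

toList-injective′ : ∀ {k} (a b : Vec ℤ k) → Vec.toList a ≡ Vec.toList b → a ≡ b
toList-injective′ [] [] e = refl
toList-injective′ (x ∷ a) (y ∷ b) e = cong₂ _∷_ (Listₚ.∷-injectiveˡ e) (toList-injective′ a b (Listₚ.∷-injectiveʳ e))

lowFirst-injective : ∀ {n} (a b : IntPoly n) → lowFirst a ℤX.≋ lowFirst b → a ≡ b
lowFirst-injective a b e = toList-injective′ a b (Listₚ.reverse-injective
  (list-extensional (lowFirst a) (lowFirst b) (trans (length-lowFirst a) (sym (length-lowFirst b))) e))

All-reverse : ∀ {P : ℤ → Set} {F} → All P F → All P (Data.List.reverse F)
All-reverse [] = []
All-reverse {P} {c ∷ F} (p ∷ ps) = subst (All P) (sym (Listₚ.unfold-reverse c F)) (Allₚ.++⁺ (All-reverse ps) (p ∷ []))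

height-lowFirst : ∀ {n H} (a : IntPoly n) → VecAll.All (λ c → ℤ.∣ c ∣ ≤ H) a → height (lowFirst a) ≤ H
height-lowFirst a b = All-height (lowFirst a) (All-reverse (toListAll b))
  where
  toListAll : ∀ {k} {P : ℤ → Set} {a : Vec ℤ k} → VecAll.All P a → All P (Vec.toList a)
  toListAll VecAll.[] = []
  toListAll (p VecAll.∷ ps) = p ∷ toListAll ps

module _ {A : Set} {Q : A → ℤ → Set₁} (determined : ∀ {x y c} → Q x c → Q y c → x ≡ y) where

  -- Distinct polynomials with the same code differ in their constant terms, so the bounds on
  -- algebraic constant terms become bounds on fibres. Each constant remembers a polynomial it comes
  -- from.
  distinct-constants : (L : List A) → Unique L → All (λ x → ∃ λ c → Q x c) L →
    ∃ λ cs → length L ≡ length cs × Unique cs × All (λ c → ∃ λ x → x ∈ L × Q x c) cs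
  distinct-constants [] [] [] = [] , refl , [] , []
  distinct-constants (x ∷ L) (x∉ ∷ u) ((c , q) ∷ qs) with distinct-constants L u qs
  ... | cs , l , u′ , ws = c ∷ cs , cong suc l ,
    All.map (λ { (y , i , q′) refl → All.lookup x∉ i (determined q q′) }) ws ∷ u′ ,
    (x , here refl , q) ∷ All.map (λ { (y , i , q′) → y , there i , q′ }) ws

-- Upper bound for degree at least 3

data Case : Set where
  different same zeroLinear : Case

-- A code consists of the case, the degrees and the dyadic size of the factor g, the factor g itself, and all
-- coefficients but one of its cofactor.
Code : Set
Code = Case × ℕ × ℕ × List ℤ × List ℤ

sumTo : ℕ → (ℕ → ℕ) → ℕ
sumTo zero f = 0
sumTo (suc N) f = f 0 + sumTo N (f ∘ suc)

sumTo-mono : ∀ N {f g} → (∀ i → i < N → f i ≤ g i) → sumTo N f ≤ sumTo N g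
sumTo-mono zero h = z≤n
sumTo-mono (suc N) h = ℕₚ.+-mono-≤ (h 0 (s≤s z≤n)) (sumTo-mono N (λ i l → h (suc i) (s≤s l)))

sumTo-* : ∀ N c f → sumTo N (λ i → c * f i) ≡ c * sumTo N f
sumTo-* zero c f = sym (ℕₚ.*-zeroʳ c)
sumTo-* (suc N) c f = trans (cong (λ x → c * f 0 + x) (sumTo-* N c (f ∘ suc))) (sym (ℕₚ.*-distribˡ-+ c (f 0) _))

sumTo-constant : ∀ N c → sumTo N (λ _ → c) ≡ N * c
sumTo-constant zero c = refl
sumTo-constant (suc N) c = cong (λ x → c + x) (sumTo-constant N c)

length-concatMap-upTo : ∀ {b} {B : Set b} N (f : ℕ → List B) (g : ℕ → ℕ) → (∀ i → i < N → length (f i) ≤ g i) → length (concatMap f (upTo N)) ≤ sumTo N g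
length-concatMap-upTo N f = go N id
  where
  go : ∀ N (h : ℕ → ℕ) g → (∀ i → i < N → length (f (h i)) ≤ g i) → length (concatMap f (Data.List.applyUpTo h N)) ≤ sumTo N g
  go zero h g bound = z≤n
  go (suc N) h g bound = ℕₚ.≤-trans (ℕₚ.≤-reflexive (Listₚ.length-++ (f (h 0))))
    (ℕₚ.+-mono-≤ (bound 0 (s≤s z≤n)) (go N (h ∘ suc) (g ∘ suc) (λ i l → bound (suc i) (s≤s l))))

geometric-decreasing : ∀ N X → N ≤ suc X → sumTo N (λ i → 2 ^ (X ∸ i)) ≤ 2 ^ suc X
geometric-decreasing zero X l = z≤n
geometric-decreasing (suc zero) X l = ℕₚ.≤-trans (ℕₚ.≤-reflexive (ℕₚ.+-identityʳ _)) (ℕₚ.m≤m+n _ _)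
geometric-decreasing (suc (suc N)) (suc X) (s≤s l) = ℕₚ.+-mono-≤ (ℕₚ.≤-refl {2 ^ suc X})
  (ℕₚ.≤-trans (geometric-decreasing (suc N) X l) (ℕₚ.≤-reflexive (sym (ℕₚ.+-identityʳ _))))

geometric-increasing : ∀ N Y → sumTo N (λ i → 2 ^ (Y + i)) + 2 ^ Y ≤ 2 ^ (Y + N)
geometric-increasing zero Y = ℕₚ.≤-reflexive (cong (2 ^_) (sym (ℕₚ.+-identityʳ Y)))
geometric-increasing (suc N) Y = begin
  (2 ^ (Y + 0) + sumTo N (λ i → 2 ^ (Y + suc i))) + 2 ^ Y  ≤⟨ ℕₚ.+-monoˡ-≤ (2 ^ Y) (ℕₚ.+-mono-≤ (ℕₚ.≤-reflexive (cong (2 ^_) (ℕₚ.+-identityʳ Y)))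
                                                                (sumTo-mono N (λ i _ → ℕₚ.≤-reflexive (cong (2 ^_) (ℕₚ.+-suc Y i))))) ⟩
  (2 ^ Y + S) + 2 ^ Y                                      ≡⟨ solve 2 (λ p s → (p :+ s) :+ p := s :+ (p :+ (p :+ con 0))) refl (2 ^ Y) S ⟩
  S + 2 ^ suc Y                                            ≤⟨ geometric-increasing N (suc Y) ⟩
  2 ^ (suc Y + N)                                          ≡⟨ cong (2 ^_) (sym (ℕₚ.+-suc Y N)) ⟩
  2 ^ (Y + suc N)                                          ∎
  where
  open ℕₚ.≤-Reasoning
  open ℕSolver
  S = sumTo N (λ i → 2 ^ (suc Y + i))

length-words-≤ : ∀ j w → length (words (2 ^ j) w) ≤ 2 ^ ((2 + j) * w)
length-words-≤ j w = begin
  length (words (2 ^ j) w)                 ≡⟨ length-words (2 ^ j) w ⟩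
  (suc (2 ^ j) + suc (2 ^ j)) ^ w          ≤⟨ ℕₚ.^-monoˡ-≤ w (ℕₚ.+-mono-≤ l l) ⟩
  ((2 ^ j + 2 ^ j) + (2 ^ j + 2 ^ j)) ^ w  ≡⟨ cong (_^ w) (solve 1 (λ p → (p :+ p) :+ (p :+ p) := con 2 :* (con 2 :* p)) refl (2 ^ j)) ⟩
  (2 ^ (2 + j)) ^ w                        ≡⟨ ℕₚ.^-*-assoc 2 (2 + j) w ⟩
  2 ^ ((2 + j) * w)                        ∎
  where
  open ℕₚ.≤-Reasoning
  open ℕSolver
  l : suc (2 ^ j) ≤ 2 ^ j + 2 ^ j
  l = ℕₚ.+-monoˡ-≤ (2 ^ j) (2^-positive j)

module Degree≥3 (m : ℕ) where
  n k : ℕ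
  n = suc (suc (suc m))
  k = orderBound n

  codesOfSize : ℕ → Case → ℕ → ℕ → List Code
  codesOfSize l κ d i = Data.List.cartesianProductWith (λ g T → κ , d , i , g , T) (words (2 ^ suc i) (suc (suc d))) (words (2 ^ (l ∸ i)) (n ∸ suc d))

  codesOfDegree : ℕ → Case → ℕ → List Code
  codesOfDegree l κ d = concatMap (codesOfSize l κ d) (upTo (suc l))

  -- The range `d ≤ m` means that `g` has degree at most `n - 2`, so the cofactor has degree at
  -- least 2. With a linear cofactor, `g` alone would have `n` free coefficients, too many when `g`
  -- is large.
  codesOfCase : ℕ → Case → List Code
  codesOfCase l κ = concatMap (codesOfDegree l κ) (upTo (suc m))

  cases : List Case
  cases = different ∷ same ∷ zeroLinear ∷ []

  codes : ℕ → List Code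
  codes l = concatMap (codesOfCase l) cases

  ∈-codes : ∀ {l} κ {d i g T} → κ ∈ cases → d < suc m → i ≤ l →
    g ∈ words (2 ^ suc i) (suc (suc d)) → T ∈ words (2 ^ (l ∸ i)) (n ∸ suc d) → (κ , d , i , g , T) ∈ codes l
  ∈-codes {l} κ {d} {i} κ∈ d< i≤ g∈ T∈ =
    ∈ₚ.∈-concatMap⁺ (codesOfCase l) (lose κ∈ (∈ₚ.∈-concatMap⁺ (codesOfDegree l κ) (lose (∈ₚ.∈-upTo⁺ d<) (∈ₚ.∈-concatMap⁺ (codesOfSize l κ d) (lose (∈ₚ.∈-upTo⁺ (s≤s i≤))
      (∈ₚ.∈-cartesianProductWith⁺ (λ g T → κ , d , i , g , T) g∈ T∈))))))

  record DifferentCode (d : ℕ) (g T : List ℤ) (a : IntPoly n) : Set₁ where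
    field
      length-g : length g ≡ suc (suc d)
      top-g    : ℤX.coef g (suc d) ≢ + 0
      d≤       : suc d ≤ n
      c        : ℤ
      equation : lowFirst a ℤX.≋ g ℤX.⊠ (c ∷ T)
      roots    : RootsInDifferentFactors k g (c ∷ T)

  record SameCode (g T : List ℤ) (a : IntPoly n) : Set₁ where
    field
      j        : ℕ
      h₁       : ℤ
      T′       : List ℤ
      T≡       : T ≡ h₁ ∷ T′
      length-T : length T′ ≡ suc j
      h₁≢0     : h₁ ≢ + 0
      j≤       : suc j ≤ n
      c        : ℤ
      equation : lowFirst a ℤX.≋ g ℤX.⊠ (c ∷ T)
      roots    : RootsInSameFactor k (c ∷ T)

  ZeroLinearCode : List ℤ → List ℤ → IntPoly n → Set
  ZeroLinearCode g T a = ∃₂ λ c T′ → T ≡ c ∷ T′ × lowFirst a ℤX.≋ g ℤX.⊠ (c ∷ + 0 ∷ T′)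

  data Coded (a : IntPoly n) : Code → Set₁ where
    different  : ∀ {d i g T} → DifferentCode d g T a → Coded a (different , d , i , g , T)
    same       : ∀ {d i g T} → SameCode g T a → Coded a (same , d , i , g , T)
    zeroLinear : ∀ {d i g T} → ZeroLinearCode g T a → Coded a (zeroLinear , d , i , g , T)

  k≤ : k ≤ n * k
  k≤ = ℕₚ.m≤n*m k n

  determined : ∀ {P : ℤ → Set₁} {g T : List ℤ} {a b : IntPoly n} {c} →
    (lowFirst a ℤX.≋ g ℤX.⊠ (c ∷ T)) × P c → (lowFirst b ℤX.≋ g ℤX.⊠ (c ∷ T)) × P c → a ≡ b
  determined {a = a} {b} (e , _) (f , _) = lowFirst-injective a b (ℤX.≋-trans e (ℤX.≋-sym f))

  different-fibre : ∀ d g T (L : List (IntPoly n)) → Unique L → All (DifferentCode d g T) L → length L ≤ n * k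
  different-fibre d g T [] u ws = z≤n
  different-fibre d g T L@(_ ∷ _) u ws@(w ∷ _) = bounded (distinct-constants (determined {P = λ c → RootsInDifferentFactors k g (c ∷ T)} {g} {T}) L u
      (All.map (λ w → DifferentCode.c w , DifferentCode.equation w , DifferentCode.roots w) ws))
    where
    open DifferentCode w
    bounded : (∃ λ cs → length L ≡ length cs × Unique cs × All (λ c → ∃ λ x → x ∈ L × ((lowFirst x ℤX.≋ g ℤX.⊠ (c ∷ T)) × RootsInDifferentFactors k g (c ∷ T))) cs) →
      length L ≤ n * k
    bounded (cs , l , u′ , rs) = ℕₚ.≤-trans (ℕₚ.≤-reflexive l) (ℕₚ.≤-trans
      (different-factors-bound k (orderBound-positive n) d g length-g top-g T cs u′ (All.map (λ { (_ , _ , _ , r) → r }) rs))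
      (ℕₚ.*-monoˡ-≤ k d≤))

  same-fibre : ∀ g T (L : List (IntPoly n)) → Unique L → All (SameCode g T) L → length L ≤ n * k
  same-fibre g T [] u ws = z≤n
  same-fibre g T L@(_ ∷ _) u ws@(w ∷ _) = bounded (distinct-constants (determined {P = λ c → RootsInSameFactor k (c ∷ T)} {g} {T}) L u
      (All.map (λ w → SameCode.c w , SameCode.equation w , SameCode.roots w) ws))
    where
    open SameCode w
    bounded : (∃ λ cs → length L ≡ length cs × Unique cs × All (λ c → ∃ λ x → x ∈ L × ((lowFirst x ℤX.≋ g ℤX.⊠ (c ∷ T)) × RootsInSameFactor k (c ∷ T))) cs) →
      length L ≤ n * k
    bounded (cs , l , u′ , rs) = ℕₚ.≤-trans (ℕₚ.≤-reflexive l) (ℕₚ.≤-trans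
      (same-factor-bound k (orderBound-positive n) j h₁ T′ length-T h₁≢0 cs u′
        (All.map (λ { {c} (_ , _ , _ , r) → subst (λ T → RootsInSameFactor k (c ∷ T)) T≡ r }) rs))
      (ℕₚ.≤-trans (ℕₚ.≤-reflexive (ℕₚ.*-comm k (suc j))) (ℕₚ.*-monoˡ-≤ k j≤)))

  zeroLinear-fibre : ∀ g T (L : List (IntPoly n)) → Unique L → All (ZeroLinearCode g T) L → length L ≤ n * k
  zeroLinear-fibre g T [] u ws = z≤n
  zeroLinear-fibre g T (a ∷ []) u ws = ℕₚ.≤-trans (orderBound-positive n) k≤
  zeroLinear-fibre g T (a ∷ b ∷ L) ((a≢b ∷ _) ∷ _) ((c , T′ , refl , e) ∷ (_ , _ , refl , f) ∷ _) =
    contradiction (lowFirst-injective a b (ℤX.≋-trans e (ℤX.≋-sym f))) a≢b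

  fibre : ∀ κ (L : List (IntPoly n)) → Unique L → All (λ a → Coded a κ) L → length L ≤ n * k
  fibre (different , d , i , g , T) L u ws = different-fibre d g T L u (All.map (λ { (different w) → w }) ws)
  fibre (same , d , i , g , T) L u ws = same-fibre g T L u (All.map (λ { (same w) → w }) ws)
  fibre (zeroLinear , d , i , g , T) L u ws = zeroLinear-fibre g T L u (All.map (λ { (zeroLinear w) → w }) ws)

  record Split (l : ℕ) (a : IntPoly n) : Set where
    field
      d e      : ℕ
      degrees  : suc d + suc e ≡ n
      G H      : List ℤ
      length-G : length G ≡ suc (suc d)
      length-H : length H ≡ suc (suc e)
      top-G    : ℤX.coef G (suc d) ≢ + 0
      top-H    : ℤX.coef H (suc e) ≢ + 0
      equation : lowFirst a ℤX.≋ G ℤX.⊠ H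
      heights  : height G * height H ≤ 2 ^ l

  swap : ∀ {l a} → Split l a → Split l a
  swap {l} s = record { d = e ; e = d ; degrees = trans (ℕₚ.+-comm (suc e) (suc d)) degrees ; G = H ; H = G
    ; length-G = length-H ; length-H = length-G ; top-G = top-H ; top-H = top-G
    ; equation = ℤX.≋-trans equation (ℤX.⊠-comm G H) ; heights = subst (_≤ 2 ^ l) (ℕₚ.*-comm (height G) (height H)) heights }
    where open Split s

  module _ {l a} (s : Split l a) where
    open Split s

    positive-G : 1 ≤ height G
    positive-G = height-positive G (suc d) top-G

    positive-H : 1 ≤ height H
    positive-H = height-positive H (suc e) top-H

    size : ℕ
    size = ⌊log₂ height G ⌋

    size-bound : 2 ^ size * height H ≤ 2 ^ l
    size-bound = ℕₚ.≤-trans (ℕₚ.*-monoˡ-≤ (height H) (log₂-≤ (height G) positive-G)) heights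

    size≤l : size ≤ l
    size≤l = ℕₚ.≮⇒≥ λ l< → ℕₚ.<⇒≱ (ℕₚ.^-monoʳ-< 2 (s≤s (s≤s z≤n)) l<)
      (ℕₚ.≤-trans (ℕₚ.m≤m*n (2 ^ size) (height H) {{ℕ.>-nonZero positive-H}}) size-bound)

    cofactor-height : height H ≤ 2 ^ (l ∸ size)
    cofactor-height = ℕₚ.*-cancelˡ-≤ (2 ^ size) {{ℕ.>-nonZero (2^-positive size)}} (ℕₚ.≤-trans size-bound
      (ℕₚ.≤-reflexive (trans (cong (2 ^_) (sym (ℕₚ.m+[n∸m]≡n size≤l))) (ℕₚ.^-distribˡ-+-* 2 size (l ∸ size)))))

    place : ∀ κ → κ ∈ cases → 1 ≤ e → ∀ T → length T ≡ suc e → height T ≤ height H → (κ , d , size , G , T) ∈ codes l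
    place κ κ∈ 1≤e T lT hT = ∈-codes κ κ∈ d<
        size≤l (subst (λ w → G ∈ words (2 ^ suc size) w) length-G (∈-words G (All.map (λ c≤ → ℕₚ.≤-trans c≤ (ℕₚ.<⇒≤ (log₂-< (height G)))) (height-All G))))
        (subst (λ w → T ∈ words (2 ^ (l ∸ size)) w) (trans lT e≡) (∈-words T (All.map (λ c≤ → ℕₚ.≤-trans c≤ (ℕₚ.≤-trans hT cofactor-height)) (height-All T))))
      where
      e≡ : suc e ≡ n ∸ suc d
      e≡ = sym (trans (cong (_∸ suc d) (sym degrees)) (ℕₚ.m+n∸m≡n (suc d) (suc e)))
      d< : d < suc m
      d< = ℕₚ.+-cancelʳ-≤ 2 (suc d) (suc m) (ℕₚ.≤-trans (ℕₚ.+-monoʳ-≤ (suc d) (s≤s 1≤e)) (ℕₚ.≤-reflexive (trans degrees (ℕₚ.+-comm 2 (suc m)))))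

    different-code : 1 ≤ e → RootsInDifferentFactors k G H → Any (Coded a) (codes l)
    different-code 1≤e = go H length-H refl
      where
      go : ∀ H′ → length H′ ≡ suc (suc e) → H′ ≡ H → RootsInDifferentFactors k G H′ → Any (Coded a) (codes l)
      go (c ∷ T) lH refl r = lose (place different (here refl) 1≤e T (ℕₚ.suc-injective lH) (ℕₚ.m≤n⊔m ℤ.∣ c ∣ (height T))) (different record
        { length-g = length-G ; top-g = top-G ; d≤ = ℕₚ.≤-trans (ℕₚ.m≤m+n (suc d) (suc e)) (ℕₚ.≤-reflexive degrees)
        ; c = c ; equation = equation ; roots = r })

    same-code : RootsInSameFactor k H → Any (Coded a) (codes l)
    same-code r = go e refl H length-H refl r
      where
      go : ∀ e′ → e′ ≡ e → ∀ H′ → length H′ ≡ suc (suc e′) → H′ ≡ H → RootsInSameFactor k H′ → Any (Coded a) (codes l)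
      -- A linear polynomial with nonzero leading coefficient has a single root, whereas `β` and
      -- `ζ β` are different.
      go zero refl (c ∷ h₁ ∷ []) lH refl r = contradiction linear (nonzero-⊗ (nonzero-⊗ (λ e → ζ≉1 (⊝≈𝟘⇒≈ ζ 𝟙 e)) β≉0) (ι-nonzero {h₁} top-H))
        where
        open RootsInSameFactor r
        open ≈-Reasoning
        linear : ((ζ ⊝ 𝟙) ⊗ β) ⊗ ι h₁ ≈ 𝟘
        linear = begin
          ((ζ ⊝ 𝟙) ⊗ β) ⊗ ι h₁
            ≈⟨ solve 4 (λ z b h c → ((z :- :1) :* b) :* h := (c :+ (z :* b) :* (h :+ (z :* b) :* :0)) :- (c :+ b :* (h :+ b :* :0))) ≈-refl ζ β (ι h₁) (ι c) ⟩
          evalℤ K (ζ ⊗ β) (c ∷ h₁ ∷ []) ⊝ evalℤ K β (c ∷ h₁ ∷ [])   ≈⟨ ⊕-cong root-ζ (⊖-cong root) ⟩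
          𝟘 ⊝ 𝟘                                                     ≈⟨ ⊖-inverseʳ 𝟘 ⟩
          𝟘                                                         ∎
      go (suc j) refl (c ∷ h₁ ∷ T) lH refl r with h₁ ℤ.≟ + 0
      -- Here the coefficient left out of the code is the one known to be 0, and the constant term
      -- is kept. The code then determines the polynomial.
      ... | yes refl = lose (place zeroLinear (there (there (here refl))) (s≤s z≤n) (c ∷ T) (ℕₚ.suc-injective lH) ℕₚ.≤-refl)
        (zeroLinear (c , T , refl , equation))
      ... | no nz = lose (place same (there (here refl)) (s≤s z≤n) (h₁ ∷ T) (ℕₚ.suc-injective lH) (ℕₚ.m≤n⊔m ℤ.∣ c ∣ _)) (same record
        { j = j ; h₁ = h₁ ; T′ = T ; T≡ = refl ; length-T = ℕₚ.suc-injective (ℕₚ.suc-injective lH) ; h₁≢0 = nz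
        ; j≤ = ℕₚ.≤-trans (ℕₚ.n≤1+n (suc j)) (ℕₚ.≤-trans (ℕₚ.m≤n+m (suc (suc j)) (suc d)) (ℕₚ.≤-reflexive degrees))
        ; c = c ; equation = equation ; roots = r })

  reverse-roots : ∀ {G H} → RootsInDifferentFactors k G H → RootsInDifferentFactors k H G
  reverse-roots {G} r = record
    { K = K ; isField = isField ; ζ = ζ⁻¹ ; β = ζ ⊗ β
    ; order = ≈-trans (≈-sym (^^-* ζ k (k ∸ 1))) (≈-trans (≈-reflexive (cong (ζ ^^_) (ℕₚ.*-comm k (k ∸ 1)))) (≈-trans (^^-* ζ (k ∸ 1) k) (≈-trans (^^-cong (k ∸ 1) order) (𝟙^^ (k ∸ 1)))))
    ; root-G = root-H
    ; root-H = ≈-trans (evalℤ-argument K G (≈-trans (≈-sym (⊗-assoc ζ⁻¹ ζ β)) (≈-trans (⊗-congʳ inverse-ζ) (⊗-identityˡ β)))) root-G }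
    where
    open RootsInDifferentFactors r
    ζ⁻¹ = ζ ^^ (k ∸ 1)
    inverse-ζ : ζ⁻¹ ⊗ ζ ≈ 𝟙
    inverse-ζ = ≈-trans (⊗-comm _ _) (≈-trans (≈-reflexive (cong (ζ ^^_) (ℕₚ.m+[n∸m]≡n (orderBound-positive n)))) order)

  mixed-code : ∀ {l a} (s : Split l a) → RootsInDifferentFactors k (Split.G s) (Split.H s) → Any (Coded a) (codes l)
  mixed-code s r = go (Split.e s) refl
    where
    open Split s
    go : ∀ e′ → e′ ≡ e → _
    go (suc j) refl = different-code s (s≤s z≤n) r
    go zero refl = different-code (swap s) 1≤d (reverse-roots {G} {H} r)
      where
      1≤d : 1 ≤ d
      1≤d = ℕₚ.≤-pred (ℕₚ.+-cancelʳ-≤ 1 2 (suc d) (ℕₚ.≤-trans (s≤s (s≤s (s≤s z≤n))) (ℕₚ.≤-reflexive (sym degrees))))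

  -- A vanishing product only excludes that both factors are nonzero, which is the content of
  -- `either`. Applied to both roots it leaves four combinations: two with both roots in one factor
  -- and two with the roots separated.
  coded : ∀ {l a} → Split l a → Twisted (lowFirst a) k → ¬ ¬ Any (Coded a) (codes l)
  coded {l} {a} s t none = β-G (λ βG → ζβ-G (λ ζG → none (same-code (swap s) (same-roots βG ζG))) (λ ζH → none (mixed-code s (different-roots βG ζH))))
                               (λ βH → ζβ-G (λ ζG → none (mixed-code (swap s) (different-roots βH ζG))) (λ ζH → none (same-code s (same-roots βH ζH))))
    where
    open Split s
    open Twisted t hiding (evalℤ)
    either : ∀ {x} → evalℤ K x (lowFirst a) ≈ 𝟘 → (evalℤ K x G ≈ 𝟘 → ⊥) → (evalℤ K x H ≈ 𝟘 → ⊥) → ⊥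
    either {x} e ng nh = nonzero-⊗ ng nh (≈-trans (≈-sym (Evaluation.evalAt-⊠ (ιHom K) x G H)) (≈-trans (≈-sym (Evaluation.evalAt-cong (ιHom K) x {lowFirst a} {G ℤX.⊠ H} equation)) e))
    β-G : (evalℤ K β G ≈ 𝟘 → ⊥) → (evalℤ K β H ≈ 𝟘 → ⊥) → ⊥
    β-G = either root
    ζβ-G : (evalℤ K (ζ ⊗ β) G ≈ 𝟘 → ⊥) → (evalℤ K (ζ ⊗ β) H ≈ 𝟘 → ⊥) → ⊥
    ζβ-G = either root-ζ
    same-roots : ∀ {P} → evalℤ K β P ≈ 𝟘 → evalℤ K (ζ ⊗ β) P ≈ 𝟘 → RootsInSameFactor k P
    same-roots p q = record { K = K ; isField = isField ; ζ = ζ ; β = β ; order = order ; ζ≉1 = ζ≉1 ; β≉0 = β≉0 ; root = p ; root-ζ = q }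
    different-roots : ∀ {P Q} → evalℤ K β P ≈ 𝟘 → evalℤ K (ζ ⊗ β) Q ≈ 𝟘 → RootsInDifferentFactors k P Q
    different-roots p q = record { K = K ; isField = isField ; ζ = ζ ; β = β ; order = order ; root-G = p ; root-H = q }

  C : ℕ
  C = heightConstant n

  -- Chosen so that `C * H ≤ 2 ^ level H`. With the height bound a power of 2, a factor of size
  -- `2 ^ i` has a cofactor of height at most `2 ^ (l - i)`.
  level : ℕ → ℕ
  level H = C + suc ⌊log₂ H ⌋

  level-bound : ∀ H → C * H ≤ 2 ^ level H
  level-bound H = ℕₚ.≤-trans (ℕₚ.*-mono-≤ (ℕₚ.<⇒≤ (n<2^n C)) (ℕₚ.<⇒≤ (log₂-< H))) (ℕₚ.≤-reflexive (sym (ℕₚ.^-distribˡ-+-* 2 C (suc ⌊log₂ H ⌋))))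

  splitting : ∀ H a → InRStar n H a → Split (level H) a
  splitting H a ((nz , box) , _ , r) = record
    { d = d ; e = e ; degrees = degrees ; G = G ; H = Factorisation.H f ; length-G = length-G ; length-H = length-H
    ; top-G = proj₁ tops ; top-H = proj₂ tops ; equation = equation
    ; heights = ℕₚ.≤-trans (factorisation-heights (lowFirst a) (length-lowFirst a) f n top)
        (ℕₚ.≤-trans (ℕₚ.*-monoʳ-≤ C (height-lowFirst a box)) (level-bound H)) }
    where
    f = reducible⇒factorisation a nz r
    open Factorisation f hiding (H)
    top : ℤX.coef (lowFirst a) n ≢ + 0
    top z = nz (trans (sym (coef-lowFirst a)) z)
    tops = factor-tops (lowFirst a) f top

  rStar-≤-codes : ∀ H → length (rStar (suc (suc m)) H) ≤ (n * k) * length (codes (level H))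
  rStar-≤-codes H = Dec.decidable-stable (length L ℕₚ.≤? _) λ no → ¬¬-All L
      (λ {a} i → coded (splitting H a (rStar-∈ (suc (suc m)) H i)) (degenerate⇒twisted (suc (suc m)) a (proj₁ (proj₁ (rStar-∈ (suc (suc m)) H i))) (proj₁ (proj₂ (rStar-∈ (suc (suc m)) H i)))))
      λ all → no (fibre-bound Coded (n * k) (codes (level H)) fibre L (rStar-unique (suc (suc m)) H) all)
    where L = rStar (suc (suc m)) H

  exponent : ℕ → ℕ → ℕ → ℕ
  exponent l d i = i * suc (suc d) + (l ∸ i) * (n ∸ suc d)

  -- A coefficient bounded by `2 ^ j` is listed with at most `2 ^ (2 + j)` values, where `j` is
  -- `1 + i` or `l - i`. So each of the `n + 1` coefficients in a code costs at most a factor 8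
  -- beyond the pure power. The factors 3 and `suc m` count the cases and the degrees.
  length-codes : ∀ l B → (∀ d → d < suc m → sumTo (suc l) (λ i → 2 ^ exponent l d i) ≤ B) → length (codes l) ≤ 3 * (suc m * (2 ^ (3 * suc n) * B))
  length-codes l B bound = length-concatMap-≤ (codesOfCase l) (suc m * (2 ^ (3 * suc n) * B)) cases λ {κ} _ →
    ℕₚ.≤-trans (length-concatMap-upTo (suc m) (codesOfDegree l κ) (λ _ → 2 ^ (3 * suc n) * B) (λ d d< →
      ℕₚ.≤-trans (length-concatMap-upTo (suc l) (codesOfSize l κ d) (λ i → 2 ^ (3 * suc n) * 2 ^ exponent l d i) (λ i _ → piece κ d i d<))
        (ℕₚ.≤-trans (ℕₚ.≤-reflexive (sumTo-* (suc l) (2 ^ (3 * suc n)) (λ i → 2 ^ exponent l d i))) (ℕₚ.*-monoʳ-≤ (2 ^ (3 * suc n)) (bound d d<)))))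
      (ℕₚ.≤-reflexive (sumTo-constant (suc m) (2 ^ (3 * suc n) * B)))
    where
    piece : ∀ κ d i → d < suc m → length (codesOfSize l κ d i)
      ≤ 2 ^ (3 * suc n) * 2 ^ exponent l d i
    piece κ d i d< = begin
      length (codesOfSize l κ d i)                                  ≡⟨ length-cartesianProductWith (λ g T → κ , d , i , g , T) (words (2 ^ suc i) (suc (suc d))) (words (2 ^ (l ∸ i)) (n ∸ suc d)) ⟩
      length (words (2 ^ suc i) w) * length (words (2 ^ (l ∸ i)) e) ≤⟨ ℕₚ.*-mono-≤ (length-words-≤ (suc i) w) (length-words-≤ (l ∸ i) e) ⟩
      2 ^ ((3 + i) * w) * 2 ^ ((2 + (l ∸ i)) * e)                   ≡⟨ ℕₚ.^-distribˡ-+-* 2 ((3 + i) * w) _ ⟨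
      2 ^ ((3 + i) * w + (2 + (l ∸ i)) * e)                         ≤⟨ ℕₚ.^-monoʳ-≤ 2 exponents ⟩
      2 ^ (3 * suc n + exponent l d i)                              ≡⟨ ℕₚ.^-distribˡ-+-* 2 (3 * suc n) _ ⟩
      2 ^ (3 * suc n) * 2 ^ exponent l d i                          ∎
      where
      open ℕₚ.≤-Reasoning
      open ℕSolver
      w = suc (suc d)
      e = n ∸ suc d
      w+e : w + e ≡ suc n
      w+e = cong suc (ℕₚ.m+[n∸m]≡n (ℕₚ.≤-trans d< (ℕₚ.≤-trans (ℕₚ.n≤1+n _) (ℕₚ.n≤1+n _))))
      exponents : (3 + i) * w + (2 + (l ∸ i)) * e ≤ 3 * suc n + exponent l d i
      exponents = begin
        (3 + i) * w + (2 + (l ∸ i)) * e              ≤⟨ ℕₚ.+-monoʳ-≤ ((3 + i) * w) (ℕₚ.*-monoˡ-≤ e (ℕₚ.n≤1+n (2 + (l ∸ i)))) ⟩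
        (3 + i) * w + (3 + (l ∸ i)) * e              ≡⟨ solve 4 (λ i w j e → (con 3 :+ i) :* w :+ (con 3 :+ j) :* e := con 3 :* (w :+ e) :+ (i :* w :+ j :* e)) refl i w (l ∸ i) e ⟩
        3 * (w + e) + exponent l d i                 ≡⟨ cong (λ x → 3 * x + exponent l d i) w+e ⟩
        3 * suc n + exponent l d i                   ∎

  abstract
    constant scale : ℕ
    constant = (n * k) * (3 * (suc m * 2 ^ (3 * suc n)))
    scale = 2 ^ suc C

    rStar-bound : ∀ H B → (∀ d → d < suc m → sumTo (suc (level H)) (λ i → 2 ^ exponent (level H) d i) ≤ B) →
      length (rStar (suc (suc m)) H) ≤ constant * B
    rStar-bound H B pieces = begin
      length (rStar (suc (suc m)) H)                        ≤⟨ rStar-≤-codes H ⟩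
      (n * k) * length (codes (level H))                    ≤⟨ ℕₚ.*-monoʳ-≤ (n * k) (length-codes (level H) B pieces) ⟩
      (n * k) * (3 * (suc m * (2 ^ (3 * suc n) * B)))       ≡⟨ regroup (n * k) (suc m) (2 ^ (3 * suc n)) B ⟩
      constant * B                                          ∎
      where
      open ℕₚ.≤-Reasoning
      open ℕSolver
      regroup : ∀ x y z b → x * (3 * (y * (z * b))) ≡ (x * (3 * (y * z))) * b
      regroup = solve 4 (λ x y z b → x :* (con 3 :* (y :* (z :* b))) := (x :* (con 3 :* (y :* z))) :* b) refl

    level-power : ∀ H → 2 ≤ H → 2 ^ level H ≤ scale * H
    level-power H 2≤H = begin
      2 ^ (C + suc ⌊log₂ H ⌋)       ≡⟨ cong (2 ^_) (ℕₚ.+-suc C ⌊log₂ H ⌋) ⟩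
      2 ^ (suc C + ⌊log₂ H ⌋)       ≡⟨ ℕₚ.^-distribˡ-+-* 2 (suc C) ⌊log₂ H ⌋ ⟩
      2 ^ suc C * 2 ^ ⌊log₂ H ⌋     ≤⟨ ℕₚ.*-monoʳ-≤ (2 ^ suc C) (log₂-≤ H (ℕₚ.<⇒≤ 2≤H)) ⟩
      2 ^ suc C * H                 ∎
      where open ℕₚ.≤-Reasoning

-- The sum for linear `g`: increasing `i` by one gains the 2 coefficients of `g` and loses `N ≥ 3`
-- of the cofactor, so the terms at least halve and the first one dominates.
sum-decreasing : ∀ l N → 3 ≤ N → sumTo (suc l) (λ i → 2 ^ (i * 2 + (l ∸ i) * N)) ≤ 2 ^ suc (l * N)
sum-decreasing l N 3≤N = ℕₚ.≤-trans
  (sumTo-mono (suc l) {λ i → 2 ^ (i * 2 + (l ∸ i) * N)} {λ i → 2 ^ (l * N ∸ i)} (λ i i< → ℕₚ.^-monoʳ-≤ 2 (exponents i (ℕₚ.≤-pred i<))))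
  (geometric-decreasing (suc l) (l * N) (s≤s (ℕₚ.m≤m*n l N {{ℕ.>-nonZero (ℕₚ.≤-trans (s≤s z≤n) 3≤N)}})))
  where
  open ℕₚ.≤-Reasoning
  open ℕSolver
  exponents : ∀ i → i ≤ l → i * 2 + (l ∸ i) * N ≤ l * N ∸ i
  exponents i i≤l = ℕₚ.m+n≤o⇒m≤o∸n (i * 2 + (l ∸ i) * N) (begin
    i * 2 + (l ∸ i) * N + i         ≡⟨ solve 3 (λ i j n → i :* con 2 :+ j :* n :+ i := i :* con 3 :+ j :* n) refl i (l ∸ i) N ⟩
    i * 3 + (l ∸ i) * N             ≤⟨ ℕₚ.+-monoˡ-≤ ((l ∸ i) * N) (ℕₚ.*-monoʳ-≤ i 3≤N) ⟩
    i * N + (l ∸ i) * N             ≡⟨ ℕₚ.*-distribʳ-+ N i (l ∸ i) ⟨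
    (i + (l ∸ i)) * N               ≡⟨ cong (_* N) (ℕₚ.m+[n∸m]≡n i≤l) ⟩
    l * N                           ∎)

-- The sum for `g` of degree at least 2. Replacing `w` and `e` by their largest values `suc M` and
-- `M` makes the terms double exactly, so the last one dominates.
sum-increasing : ∀ l M w e → w ≤ suc M → e ≤ M → sumTo (suc l) (λ i → 2 ^ (i * w + (l ∸ i) * e)) ≤ 2 ^ suc (l * suc M)
sum-increasing l M w e w≤ e≤ = ℕₚ.≤-trans
  (sumTo-mono (suc l) {λ i → 2 ^ (i * w + (l ∸ i) * e)} {λ i → 2 ^ (l * M + i)} (λ i i< → ℕₚ.^-monoʳ-≤ 2 (exponents i (ℕₚ.≤-pred i<))))
  (ℕₚ.≤-trans (ℕₚ.≤-trans (ℕₚ.m≤m+n (sumTo (suc l) (λ i → 2 ^ (l * M + i))) (2 ^ (l * M))) (geometric-increasing (suc l) (l * M)))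
    (ℕₚ.≤-reflexive (cong (2 ^_) (solve 2 (λ l m → l :* m :+ (con 1 :+ l) := con 1 :+ l :* (con 1 :+ m)) refl l M))))
  where
  open ℕₚ.≤-Reasoning
  open ℕSolver
  exponents : ∀ i → i ≤ l → i * w + (l ∸ i) * e ≤ l * M + i
  exponents i i≤l = begin
    i * w + (l ∸ i) * e         ≤⟨ ℕₚ.+-mono-≤ (ℕₚ.*-monoʳ-≤ i w≤) (ℕₚ.*-monoʳ-≤ (l ∸ i) e≤) ⟩
    i * suc M + (l ∸ i) * M     ≡⟨ solve 3 (λ i j m → i :* (con 1 :+ m) :+ j :* m := (i :+ j) :* m :+ i) refl i (l ∸ i) M ⟩
    (i + (l ∸ i)) * M + i       ≡⟨ cong (λ x → x * M + i) (ℕₚ.m+[n∸m]≡n i≤l) ⟩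
    l * M + i                   ∎

*-^ : ∀ k a b → (a * b) ^ k ≡ a ^ k * b ^ k
*-^ zero a b = refl
*-^ (suc k) a b = trans (cong (λ x → a * b * x) (*-^ k a b)) (ℕSolver.solve 4 (λ a b x y → (a :* b) :* (x :* y) := (a :* x) :* (b :* y)) refl a b (a ^ k) (b ^ k))
  where open ℕSolver

upper-cubic : ∃ λ C → ∀ H → 2 ≤ H → length (rStar 2 H) ≤ C * growth 3 H
upper-cubic = constant * ((3 + C) * (scale * scale)) , bound
  where
  C = Degree≥3.C 0
  constant = Degree≥3.constant 0
  scale = Degree≥3.scale 0
  level = Degree≥3.level 0
  exponent = Degree≥3.exponent 0
  level-power = Degree≥3.level-power 0
  regroup : ∀ k c l a h → k * ((c * l) * ((a * h) * (a * h))) ≡ (k * (c * (a * a))) * ((h * (h * 1)) * l)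
  regroup = solve 5 (λ k c l a h → k :* ((c :* l) :* ((a :* h) :* (a :* h))) := (k :* (c :* (a :* a))) :* ((h :* (h :* con 1)) :* l)) refl
    where open ℕSolver
  bound : ∀ H → 2 ≤ H → length (rStar 2 H) ≤ constant * ((3 + C) * (scale * scale)) * (H ^ 2 * ⌊log₂ H ⌋)
  bound H 2≤H = begin
    length (rStar 2 H)                                      ≤⟨ Degree≥3.rStar-bound 0 H (suc l * 2 ^ (l * 2)) pieces ⟩
    constant * (suc l * 2 ^ (l * 2))                        ≤⟨ ℕₚ.*-monoʳ-≤ constant (ℕₚ.*-mono-≤ levels squares) ⟩
    constant * (((3 + C) * L) * ((scale * H) * (scale * H))) ≡⟨ regroup constant (3 + C) L scale H ⟩
    constant * ((3 + C) * (scale * scale)) * (H ^ 2 * L)    ∎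
    where
    open ℕₚ.≤-Reasoning
    l = level H
    L = ⌊log₂ H ⌋
    pieces : ∀ d → d < 1 → sumTo (suc l) (λ i → 2 ^ exponent l d i) ≤ suc l * 2 ^ (l * 2)
    pieces zero _ = ℕₚ.≤-trans (sumTo-mono (suc l) {g = λ _ → 2 ^ (l * 2)} (λ i i< → ℕₚ.≤-reflexive (cong (2 ^_)
      (trans (sym (ℕₚ.*-distribʳ-+ 2 i (l ∸ i))) (cong (_* 2) (ℕₚ.m+[n∸m]≡n (ℕₚ.≤-pred i<))))))) (ℕₚ.≤-reflexive (sumTo-constant (suc l) _))
    pieces (suc d) (s≤s ())
    levels : suc l ≤ (3 + C) * L
    levels = begin
      suc (C + suc L)        ≡⟨ ℕSolver.solve 2 (λ c l → con 1 :+ (c :+ (con 1 :+ l)) := l :+ (con 2 :+ c) :* con 1) refl C L ⟩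
      L + (2 + C) * 1        ≤⟨ ℕₚ.+-monoʳ-≤ L (ℕₚ.*-monoʳ-≤ (2 + C) (log₂-positive H 2≤H)) ⟩
      L + (2 + C) * L        ∎
      where open ℕSolver
    squares : 2 ^ (l * 2) ≤ (scale * H) * (scale * H)
    squares = ℕₚ.≤-trans (ℕₚ.≤-reflexive (trans (sym (ℕₚ.^-*-assoc 2 l 2)) (cong (2 ^ l *_) (ℕₚ.*-identityʳ (2 ^ l)))))
      (ℕₚ.*-mono-≤ (level-power H 2≤H) (level-power H 2≤H))

pieces-higher : ∀ m l d → d < suc (suc m) → sumTo (suc l) (λ i → 2 ^ Degree≥3.exponent (suc m) l d i) ≤ 2 ^ suc (l * suc (suc (suc m)))
pieces-higher m l zero _ = sum-decreasing l (suc (suc (suc m))) (s≤s (s≤s (s≤s z≤n)))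
pieces-higher m l (suc d) (s≤s d<) = sum-increasing l (suc (suc m)) (suc (suc (suc d))) (suc (suc m) ∸ d) (s≤s (s≤s d<)) (ℕₚ.m∸n≤m (suc (suc m)) d)

power-mono : ∀ l s H N → 2 ^ l ≤ s * H → 2 ^ (l * N) ≤ s ^ N * H ^ N
power-mono l s H N h = ℕₚ.≤-trans (ℕₚ.≤-reflexive (sym (ℕₚ.^-*-assoc 2 l N))) (ℕₚ.≤-trans (ℕₚ.^-monoˡ-≤ N h) (ℕₚ.≤-reflexive (*-^ N s H)))

bound-higher : ∀ R c l s H N → R ≤ c * 2 ^ suc (l * N) → 2 ^ l ≤ s * H → R ≤ (c * 2 * s ^ N) * H ^ N
bound-higher R c l s H N r h = begin
  R                               ≤⟨ r ⟩
  c * (2 * 2 ^ (l * N))           ≤⟨ ℕₚ.*-monoʳ-≤ c (ℕₚ.*-monoʳ-≤ 2 (power-mono l s H N h)) ⟩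
  c * (2 * (s ^ N * H ^ N))       ≡⟨ solve 3 (λ c a h → c :* (con 2 :* (a :* h)) := (c :* con 2 :* a) :* h) refl c (s ^ N) (H ^ N) ⟩
  (c * 2 * s ^ N) * H ^ N         ∎
  where
  open ℕₚ.≤-Reasoning
  open ℕSolver

upper-higher : ∀ m → ∃ λ C → ∀ H → 2 ≤ H → length (rStar (suc (suc (suc m))) H) ≤ C * H ^ suc (suc (suc m))
upper-higher m = Degree≥3.constant (suc m) * 2 * Degree≥3.scale (suc m) ^ suc (suc (suc m)) , λ H 2≤H →
  bound-higher (length (rStar (suc (suc (suc m))) H)) (Degree≥3.constant (suc m)) (Degree≥3.level (suc m) H) (Degree≥3.scale (suc m)) H (suc (suc (suc m)))
    (Degree≥3.rStar-bound (suc m) H (2 ^ suc (Degree≥3.level (suc m) H * suc (suc (suc m)))) (pieces-higher m (Degree≥3.level (suc m) H)))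
    (Degree≥3.level-power (suc m) H 2≤H)

-- Upper bound for degree 2

^-injective : ∀ k → 1 ≤ k → ∀ {x y} → x ^ k ≡ y ^ k → x ≡ y
^-injective k 1≤k {x} {y} e = ℕₚ.≤-antisym (ℕₚ.≮⇒≥ λ l → ℕₚ.<⇒≢ (ℕₚ.^-monoˡ-< k {{ℕ.>-nonZero 1≤k}} l) (sym e))
                                          (ℕₚ.≮⇒≥ λ l → ℕₚ.<⇒≢ (ℕₚ.^-monoˡ-< k {{ℕ.>-nonZero 1≤k}} l) e)

abs-^ : ∀ a k → ℤ.∣ a ℤ.^ k ∣ ≡ ℤ.∣ a ∣ ^ k
abs-^ a zero = refl
abs-^ a (suc k) = trans (ℤₚ.abs-* a (a ℤ.^ k)) (cong (ℤ.∣ a ∣ *_) (abs-^ a k))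

abs-≡ : ∀ a b → ℤ.∣ a ∣ ≡ ℤ.∣ b ∣ → a ≡ b ⊎ a ≡ ℤ.- b
abs-≡ (+ m) (+ n) e = inj₁ (cong +_ e)
abs-≡ (+ m) -[1+ n ] e = inj₂ (cong +_ e)
abs-≡ -[1+ m ] (+ suc n) e = inj₂ (cong -[1+_] (ℕₚ.suc-injective e))
abs-≡ -[1+ m ] -[1+ n ] e = inj₁ (cong -[1+_] (ℕₚ.suc-injective e))

module _ (K : CommutativeRing 0ℓ 0ℓ) (isField : IsChar0Field K) where
  open CharZeroField K isField
  open ≈-Reasoning

  linear-root-unique : ∀ {ζ β} b a → a ≢ + 0 → ¬ (ζ ≈ 𝟙) → ¬ (β ≈ 𝟘) →
    evalℤ K β (b ∷ a ∷ []) ≈ 𝟘 → ¬ (evalℤ K (ζ ⊗ β) (b ∷ a ∷ []) ≈ 𝟘)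
  linear-root-unique {ζ} {β} b a na ζ≉1 β≉0 r s = nonzero-⊗ (nonzero-⊗ (λ e → ζ≉1 (⊝≈𝟘⇒≈ ζ 𝟙 e)) β≉0) (ι-nonzero na) (begin
    ((ζ ⊝ 𝟙) ⊗ β) ⊗ ι a
      ≈⟨ solve 4 (λ z b h c → ((z :- :1) :* b) :* h := (c :+ (z :* b) :* (h :+ (z :* b) :* :0)) :- (c :+ b :* (h :+ b :* :0))) ≈-refl ζ β (ι a) (ι b) ⟩
    evalℤ K (ζ ⊗ β) (b ∷ a ∷ []) ⊝ evalℤ K β (b ∷ a ∷ [])   ≈⟨ ⊕-cong s (⊖-cong r) ⟩
    𝟘 ⊝ 𝟘                                                   ≈⟨ ⊖-inverseʳ 𝟘 ⟩
    𝟘                                                       ∎)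

  constant-nonzero : ∀ {β} b a → a ≢ + 0 → ¬ (β ≈ 𝟘) → evalℤ K β (b ∷ a ∷ []) ≈ 𝟘 → b ≢ + 0
  constant-nonzero {β} _ a na β≉0 r refl = nonzero-⊗ β≉0 (ι-nonzero na)
    (≈-trans (solve 2 (λ b a → b :* a := :0 :+ b :* (a :+ b :* :0)) ≈-refl β (ι a)) r)

  -- A rational root of unity other than 1 is -1.
  opposite-roots : ∀ k → 1 ≤ k → ∀ {ζ β} b a d c → a ≢ + 0 → c ≢ + 0 → ζ ^^ k ≈ 𝟙 → ¬ (ζ ≈ 𝟙) → ¬ (β ≈ 𝟘) →
    evalℤ K β (b ∷ a ∷ []) ≈ 𝟘 → evalℤ K (ζ ⊗ β) (d ∷ c ∷ []) ≈ 𝟘 → c ℤ.* b ≡ ℤ.- (d ℤ.* a)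
  opposite-roots k 1≤k {ζ} {β} b a d c na nc ζ^k ζ≉1 β≉0 r s = [ (λ e → contradiction (equal-roots e) ζb≉) , id ]′ (abs-≡ (c ℤ.* b) (d ℤ.* a) absolute)
    where
    -- The roots are `β = -b/a` and `ζ β = -d/c`, hence `ζ = d a / (c b)`. The `k`-th power of this
    -- is an equation of integers, so `c b` and `d a` agree up to sign.
    ratio : ζ ⊗ ι (c ℤ.* b) ≈ ι (d ℤ.* a)
    ratio = ⊝≈𝟘⇒≈ _ _ (begin
      ζ ⊗ ι (c ℤ.* b) ⊝ ι (d ℤ.* a)        ≈⟨ ⊕-cong (⊗-congˡ (ι-* c b)) (⊖-cong (ι-* d a)) ⟩
      ζ ⊗ (ι c ⊗ ι b) ⊝ ι d ⊗ ι a
        ≈⟨ solve 6 (λ z x a b c d → z :* (c :* b) :- d :* a := (z :* c) :* (b :+ x :* (a :+ x :* :0)) :- a :* (d :+ (z :* x) :* (c :+ (z :* x) :* :0))) ≈-refl ζ β (ι a) (ι b) (ι c) (ι d) ⟩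
      (ζ ⊗ ι c) ⊗ evalℤ K β (b ∷ a ∷ []) ⊝ ι a ⊗ evalℤ K (ζ ⊗ β) (d ∷ c ∷ [])  ≈⟨ ⊕-cong (⊗-congˡ r) (⊖-cong (⊗-congˡ s)) ⟩
      (ζ ⊗ ι c) ⊗ 𝟘 ⊝ ι a ⊗ 𝟘              ≈⟨ solve 2 (λ x y → x :* :0 :- y :* :0 := :0) ≈-refl (ζ ⊗ ι c) (ι a) ⟩
      𝟘                                    ∎)
    powers : ι ((c ℤ.* b) ℤ.^ k) ≈ ι ((d ℤ.* a) ℤ.^ k)
    powers = begin
      ι ((c ℤ.* b) ℤ.^ k)                  ≈⟨ ι-^ (c ℤ.* b) k ⟩
      ι (c ℤ.* b) ^^ k                     ≈⟨ ≈-trans (⊗-congʳ ζ^k) (⊗-identityˡ _) ⟨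
      ζ ^^ k ⊗ ι (c ℤ.* b) ^^ k            ≈⟨ ⊗-^^ ζ (ι (c ℤ.* b)) k ⟨
      (ζ ⊗ ι (c ℤ.* b)) ^^ k               ≈⟨ ^^-cong k ratio ⟩
      ι (d ℤ.* a) ^^ k                     ≈⟨ ι-^ (d ℤ.* a) k ⟨
      ι ((d ℤ.* a) ℤ.^ k)                  ∎
    absolute : ℤ.∣ c ℤ.* b ∣ ≡ ℤ.∣ d ℤ.* a ∣
    absolute = ^-injective k 1≤k (trans (sym (abs-^ (c ℤ.* b) k)) (trans (cong ℤ.∣_∣ (ι-injective {(c ℤ.* b) ℤ.^ k} {(d ℤ.* a) ℤ.^ k} powers)) (abs-^ (d ℤ.* a) k)))
    equal-roots : c ℤ.* b ≡ d ℤ.* a → (ζ ⊝ 𝟙) ⊗ ι (c ℤ.* b) ≈ 𝟘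
    equal-roots e = ≈-trans (solve 2 (λ z x → (z :- :1) :* x := z :* x :- x) ≈-refl ζ (ι (c ℤ.* b)))
      (≈⇒⊝≈𝟘 (≈-trans ratio (≈-reflexive (cong ι (sym e)))))
    ζb≉ : ¬ ((ζ ⊝ 𝟙) ⊗ ι (c ℤ.* b) ≈ 𝟘)
    ζb≉ = nonzero-⊗ (λ z → ζ≉1 (⊝≈𝟘⇒≈ ζ 𝟙 z)) (ι-nonzero {c ℤ.* b} (ℤ-nonzero-* nc (constant-nonzero b a na β≉0 r)))

coprime-parts : ∀ a b → 1 ≤ a → ∃ λ g → ∃₂ λ x y → a ≡ x * g × b ≡ y * g × Coprime x y
coprime-parts a b 1≤a = g , a ℕDivMod./ g , b ℕDivMod./ g , sym (ℕDivMod.m/n*n≡m (GCD.gcd[m,n]∣m a b)) , sym (ℕDivMod.m/n*n≡m (GCD.gcd[m,n]∣n a b)) , coprime-/gcd a b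
  where
  g = GCD.gcd a b
  instance
    g≢0 : NonZero g
    g≢0 = ℕ.≢-nonZero (GCD.gcd[m,n]≢0 a b (inj₁ (ℕₚ.>⇒≢ 1≤a)))

-- Write `a = x g` and `b = y g` with `x` and `y` coprime. Then `c y = d x` forces `c = s x` and
-- `d = s y`, and `E = g s`. This is the normal form of `(a X + b) (c X - d)`.
square-parts : ∀ a b c d → 1 ≤ a → 1 ≤ b → 1 ≤ c → c * b ≡ d * a →
  ∃ λ E → ∃₂ λ x y → 1 ≤ E × 1 ≤ x × 1 ≤ y × a * c ≡ E * (x * x) × b * d ≡ E * (y * y)
square-parts a b c d 1≤a 1≤b 1≤c e with coprime-parts a b 1≤a
... | g , x , y , refl , refl , coprime = conclude (coprime-divisor coprime (ℕ∣.divides d (trans (ℕₚ.*-comm y c) cy≡dx)))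
  where
  open ℕSolver
  positiveʳ : ∀ {x g} → 1 ≤ x * g → NonZero g
  positiveʳ {x} {g} l = ℕ.≢-nonZero λ { refl → ℕₚ.<⇒≢ l (sym (ℕₚ.*-zeroʳ x)) }
  positiveˡ : ∀ {x g} → 1 ≤ x * g → 1 ≤ x
  positiveˡ {zero} ()
  positiveˡ {suc x} _ = s≤s z≤n
  instance
    g≢0 : NonZero g
    g≢0 = positiveʳ {x} 1≤a
    x≢0 : NonZero x
    x≢0 = ℕ.>-nonZero (positiveˡ {x} 1≤a)
  cy≡dx : c * y ≡ d * x
  cy≡dx = ℕₚ.*-cancelʳ-≡ (c * y) (d * x) g (trans (ℕₚ.*-assoc c y g) (trans e (sym (ℕₚ.*-assoc d x g))))
  conclude : x ℕ∣.∣ c → ∃ λ E → ∃₂ λ x′ y′ → 1 ≤ E × 1 ≤ x′ × 1 ≤ y′ × (x * g) * c ≡ E * (x′ * x′) × (y * g) * d ≡ E * (y′ * y′)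
  conclude (ℕ∣.divides s refl) = g * s , x , y , ℕₚ.*-mono-≤ (ℕ.>-nonZero⁻¹ g) (positiveˡ {s} 1≤c) , positiveˡ {x} 1≤a , positiveˡ {y} 1≤b ,
    solve 3 (λ x g s → (x :* g) :* (s :* x) := (g :* s) :* (x :* x)) refl x g s ,
    trans (cong ((y * g) *_) d≡) (solve 3 (λ y g s → (y :* g) :* (s :* y) := (g :* s) :* (y :* y)) refl y g s)
    where
    d≡ : d ≡ s * y
    d≡ = ℕₚ.*-cancelʳ-≡ d (s * y) x (trans (sym cy≡dx) (solve 3 (λ s x y → (s :* x) :* y := (s :* y) :* x) refl s x y))

pairs : {A B : Set} → List A → List B → List (A × B)
pairs = Data.List.cartesianProductWith _,_

length-pairs : {A B : Set} (xs : List A) (ys : List B) → length (pairs xs ys) ≡ length xs * length ys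
length-pairs = length-cartesianProductWith _,_

pair-∈ : {A B : Set} {x : A} {y : B} (xs : List A) (ys : List B) → x ∈ xs → y ∈ ys → (x , y) ∈ pairs xs ys
pair-∈ xs ys = ∈ₚ.∈-cartesianProductWith⁺ _,_

module Degree2 where
  Code₂ : Set
  Code₂ = ℕ × ℕ × ℕ × ℕ

  Coded₂ : IntPoly 2 → Code₂ → Set
  Coded₂ (u ∷ v ∷ w ∷ []) (i , E , x , y) = ℤ.∣ u ∣ ≡ E * (x * x) × v ≡ + 0 × ℤ.∣ w ∣ ≡ E * (y * y)

  fibre₂ : ∀ κ (L : List (IntPoly 2)) → Unique L → All (λ a → Coded₂ a κ) L → length L ≤ 4
  fibre₂ (i , E , x , y) L u ws = injection-length L candidates id u (λ i → member _ (All.lookup ws i)) (λ _ _ e → e)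
    where
    U = + (E * (x * x))
    W = + (E * (y * y))
    candidates = (U ∷ + 0 ∷ W ∷ []) ∷ (U ∷ + 0 ∷ (ℤ.- W) ∷ []) ∷ ((ℤ.- U) ∷ + 0 ∷ W ∷ []) ∷ ((ℤ.- U) ∷ + 0 ∷ (ℤ.- W) ∷ []) ∷ []
    member : ∀ a → Coded₂ a (i , E , x , y) → a ∈ candidates
    member (u ∷ v ∷ w ∷ []) (eu , refl , ew) with abs-≡ u U eu | abs-≡ w W ew
    ... | inj₁ refl | inj₁ refl = here refl
    ... | inj₁ refl | inj₂ refl = there (here refl)
    ... | inj₂ refl | inj₁ refl = there (there (here refl))
    ... | inj₂ refl | inj₂ refl = there (there (there (here refl)))

  abstract
    share : ℕ → ℕ → ℕ
    share H i = ℕDivMod._/_ H (4 ^ i) {{ℕₚ.m^n≢0 4 i}}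

    share-≤ : ∀ H i → share H i * 4 ^ i ≤ H
    share-≤ H i = ℕDivMod.m/n*n≤m H (4 ^ i) {{ℕₚ.m^n≢0 4 i}}

    share-≥ : ∀ H i E → E * 4 ^ i ≤ H → E ≤ share H i
    share-≥ H i E l = ℕₚ.≤-trans (ℕₚ.≤-reflexive (sym (ℕDivMod.m*n/n≡m E (4 ^ i) {{ℕₚ.m^n≢0 4 i}}))) (ℕDivMod./-monoˡ-≤ (4 ^ i) {{ℕₚ.m^n≢0 4 i}} l)

  triples : ℕ → ℕ → List Code₂
  triples H i = pairs (i ∷ []) (pairs (upTo (suc (share H i))) (pairs (upTo (2 ^ suc i)) (upTo (2 ^ suc i))))

  codesAt : ℕ → ℕ → List Code₂
  codesAt H i with 4 ^ i ℕₚ.≤? H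
  ... | yes _ = triples H i
  ... | no _ = []

  codes₂ : ℕ → List Code₂
  codes₂ H = concatMap (codesAt H) (upTo (suc ⌊log₂ H ⌋))

  4^ : ∀ i → 4 ^ i ≡ 2 ^ i * 2 ^ i
  4^ i = *-^ i 2 2

  length-codesAt : ∀ H i → length (codesAt H i) ≤ 8 * H
  length-codesAt H i with 4 ^ i ℕₚ.≤? H
  ... | no _ = z≤n
  ... | yes l = begin
      length (triples H i)                          ≡⟨ trans (length-pairs (i ∷ []) (pairs (upTo (suc q)) R)) (ℕₚ.*-identityˡ (length (pairs (upTo (suc q)) R))) ⟩
      length (pairs (upTo (suc q)) R)               ≡⟨ trans (length-pairs (upTo (suc q)) R) (cong₂ _*_ (Listₚ.length-upTo (suc q))
                                                         (trans (length-pairs (upTo (2 ^ suc i)) (upTo (2 ^ suc i))) (cong₂ _*_ (Listₚ.length-upTo (2 ^ suc i)) (Listₚ.length-upTo (2 ^ suc i))))) ⟩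
      suc q * (2 ^ suc i * 2 ^ suc i)               ≡⟨ solve 2 (λ q p → (con 1 :+ q) :* ((con 2 :* p) :* (con 2 :* p)) := con 4 :* (p :* p :+ q :* (p :* p))) refl q (2 ^ i) ⟩
      4 * (2 ^ i * 2 ^ i + q * (2 ^ i * 2 ^ i))     ≡⟨ cong (λ x → 4 * (x + q * x)) (sym (4^ i)) ⟩
      4 * (4 ^ i + q * 4 ^ i)                       ≤⟨ ℕₚ.*-monoʳ-≤ 4 (ℕₚ.+-mono-≤ l (share-≤ H i)) ⟩
      4 * (H + H)                                   ≡⟨ solve 1 (λ h → con 4 :* (h :+ h) := con 8 :* h) refl H ⟩
      8 * H                                         ∎
    where
    open ℕₚ.≤-Reasoning
    open ℕSolver
    q = share H i
    R = pairs (upTo (2 ^ suc i)) (upTo (2 ^ suc i))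

  length-codes₂ : ∀ H → 2 ≤ H → length (codes₂ H) ≤ 16 * (H * ⌊log₂ H ⌋)
  length-codes₂ H 2≤H = begin
    length (codes₂ H)                ≤⟨ length-concatMap-upTo (suc L) (codesAt H) (λ _ → 8 * H) (λ i _ → length-codesAt H i) ⟩
    sumTo (suc L) (λ _ → 8 * H)      ≡⟨ sumTo-constant (suc L) (8 * H) ⟩
    suc L * (8 * H)                  ≤⟨ ℕₚ.*-monoˡ-≤ (8 * H) (ℕₚ.+-monoˡ-≤ L (log₂-positive H 2≤H)) ⟩
    (L + L) * (8 * H)                ≡⟨ solve 2 (λ l h → (l :+ l) :* (con 8 :* h) := con 16 :* (h :* l)) refl L H ⟩
    16 * (H * L)                     ∎
    where
    open ℕₚ.≤-Reasoning
    open ℕSolver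
    L = ⌊log₂ H ⌋

  ∈-codes₂ : ∀ H E x y → 1 ≤ E → 1 ≤ x → E * (x * x) ≤ H → E * (y * y) ≤ H → (⌊log₂ (x ⊔ y) ⌋ , E , x , y) ∈ codes₂ H
  ∈-codes₂ H E x y 1≤E 1≤x hx hy = ∈ₚ.∈-concatMap⁺ (codesAt H) (lose (∈ₚ.∈-upTo⁺ i<) ∈-codesAt)
    where
    open ℕₚ.≤-Reasoning
    z = x ⊔ y
    i = ⌊log₂ z ⌋
    hz : E * (z * z) ≤ H
    hz with ℕₚ.⊔-sel x y
    ... | inj₁ e = subst (λ z → E * (z * z) ≤ H) (sym e) hx
    ... | inj₂ e = subst (λ z → E * (z * z) ≤ H) (sym e) hy
    2^i≤z : 2 ^ i ≤ z
    2^i≤z = log₂-≤ z (ℕₚ.≤-trans 1≤x (ℕₚ.m≤m⊔n x y))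
    E4^i : E * 4 ^ i ≤ H
    E4^i = ℕₚ.≤-trans (ℕₚ.*-monoʳ-≤ E (ℕₚ.≤-trans (ℕₚ.≤-reflexive (4^ i)) (ℕₚ.*-mono-≤ 2^i≤z 2^i≤z))) hz
    4^i≤H : 4 ^ i ≤ H
    4^i≤H = ℕₚ.≤-trans (ℕₚ.m≤n*m (4 ^ i) E {{ℕ.>-nonZero 1≤E}}) E4^i
    i< : i < suc ⌊log₂ H ⌋
    i< = ℕₚ.≰⇒> λ l → ℕₚ.<⇒≱ (log₂-< H) (ℕₚ.≤-trans (ℕₚ.^-monoʳ-≤ 2 l) (ℕₚ.≤-trans (ℕₚ.≤-trans (ℕₚ.m≤m*n (2 ^ i) (2 ^ i) {{ℕ.>-nonZero (2^-positive i)}}) (ℕₚ.≤-reflexive (sym (4^ i)))) 4^i≤H))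
    E< : E < suc (share H i)
    E< = s≤s (share-≥ H i E E4^i)
    ∈-triples : (i , E , x , y) ∈ triples H i
    ∈-triples = pair-∈ (i ∷ []) (pairs (upTo (suc (share H i))) (pairs (upTo (2 ^ suc i)) (upTo (2 ^ suc i)))) (here refl)
      (pair-∈ (upTo (suc (share H i))) (pairs (upTo (2 ^ suc i)) (upTo (2 ^ suc i))) (∈ₚ.∈-upTo⁺ E<)
      (pair-∈ (upTo (2 ^ suc i)) (upTo (2 ^ suc i)) (∈ₚ.∈-upTo⁺ (ℕₚ.≤-<-trans (ℕₚ.m≤m⊔n x y) (log₂-< z))) (∈ₚ.∈-upTo⁺ (ℕₚ.≤-<-trans (ℕₚ.m≤n⊔m x y) (log₂-< z)))))
    ∈-codesAt : (i , E , x , y) ∈ codesAt H i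
    ∈-codesAt with 4 ^ i ℕₚ.≤? H
    ... | yes _ = ∈-triples
    ... | no n = contradiction 4^i≤H n

  module _ (H : ℕ) (u v w : ℤ) (u≤ : ℤ.∣ u ∣ ≤ H) (w≤ : ℤ.∣ w ∣ ≤ H) (b a d c : ℤ)
           (eq : (w ∷ v ∷ u ∷ []) ℤX.≋ (b ∷ a ∷ []) ℤX.⊠ (d ∷ c ∷ [])) (na : a ≢ + 0) (nc : c ≢ + 0) where

    opposite-code : b ≢ + 0 → c ℤ.* b ≡ ℤ.- (d ℤ.* a) → Any (Coded₂ (u ∷ v ∷ w ∷ [])) (codes₂ H)
    opposite-code nb e = conclude (square-parts ℤ.∣ a ∣ ℤ.∣ b ∣ ℤ.∣ c ∣ ℤ.∣ d ∣ (positive na) (positive nb) (positive nc)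
        (trans (sym (ℤₚ.abs-* c b)) (trans (cong ℤ.∣_∣ e) (trans (ℤₚ.∣-i∣≡∣i∣ (d ℤ.* a)) (ℤₚ.abs-* d a)))))
      where
      positive : ∀ {a} → a ≢ + 0 → 1 ≤ ℤ.∣ a ∣
      positive n = ℕₚ.n≢0⇒n>0 (λ z → n (ℤₚ.∣i∣≡0⇒i≡0 z))
      v≡0 : v ≡ + 0
      v≡0 = trans (ℤX.at eq 1) (trans (solve 4 (λ a b c d → b :* c :+ (a :* d :+ con (+ 0)) := c :* b :+ d :* a) refl a b c d)
        (trans (cong (ℤ._+ d ℤ.* a) e) (ℤₚ.+-inverseˡ (d ℤ.* a))))
        where open ℤSolver
      u≡ : ℤ.∣ u ∣ ≡ ℤ.∣ a ∣ * ℤ.∣ c ∣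
      u≡ = trans (cong ℤ.∣_∣ (ℤX.at eq 2)) (ℤₚ.abs-* a c)
      w≡ : ℤ.∣ w ∣ ≡ ℤ.∣ b ∣ * ℤ.∣ d ∣
      w≡ = trans (cong ℤ.∣_∣ (trans (ℤX.at eq 0) (ℤₚ.+-identityʳ (b ℤ.* d)))) (ℤₚ.abs-* b d)
      conclude : (∃ λ E → ∃₂ λ x y → 1 ≤ E × 1 ≤ x × 1 ≤ y × ℤ.∣ a ∣ * ℤ.∣ c ∣ ≡ E * (x * x) × ℤ.∣ b ∣ * ℤ.∣ d ∣ ≡ E * (y * y)) →
        Any (Coded₂ (u ∷ v ∷ w ∷ [])) (codes₂ H)
      conclude (E , x , y , 1≤E , 1≤x , 1≤y , ex , ey) = lose (∈-codes₂ H E x y 1≤E 1≤x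
          (subst (_≤ H) (trans u≡ ex) u≤) (subst (_≤ H) (trans w≡ ey) w≤))
        (trans u≡ ex , v≡0 , trans w≡ ey)

  -- Both factors are linear, so neither contains both roots of the degenerate pair. The roots lie
  -- in different factors and are opposite to each other, whence the middle coefficient vanishes.
  coded₂ : ∀ H a → InRStar 2 H a → ¬ ¬ Any (Coded₂ a) (codes₂ H)
  coded₂ H p@(u ∷ v ∷ w ∷ []) ((nz , u≤ VecAll.∷ _ VecAll.∷ w≤ VecAll.∷ VecAll.[]) , deg , red) =
      linear G H′ (trans length-G (cong (λ x → suc (suc x)) d≡0)) (trans length-H (cong (λ x → suc (suc x)) e≡0))
        (subst (λ d → ℤX.coef G (suc d) ≢ + 0) d≡0 (proj₁ tops)) (subst (λ e → ℤX.coef H′ (suc e) ≢ + 0) e≡0 (proj₂ tops)) equation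
    where
    f = reducible⇒factorisation p nz red
    open Factorisation f renaming (H to H′)
    tops = factor-tops (lowFirst p) f nz
    d≡0 : d ≡ 0
    d≡0 = ℕₚ.n≤0⇒n≡0 (ℕₚ.+-cancelʳ-≤ 2 d 0 (ℕₚ.≤-trans (ℕₚ.≤-reflexive (ℕₚ.+-comm d 2)) (ℕₚ.≤-trans (s≤s (ℕₚ.≤-trans (s≤s (ℕₚ.m≤m+n d e)) (ℕₚ.≤-reflexive (sym (ℕₚ.+-suc d e))))) (ℕₚ.≤-reflexive degrees))))
    e≡0 : e ≡ 0
    e≡0 = ℕₚ.suc-injective (ℕₚ.suc-injective (trans (cong (λ x → suc x + suc e) (sym d≡0)) degrees))
    t = degenerate⇒twisted 1 p nz deg
    open Twisted t hiding (evalℤ)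
    linear : ∀ G H″ → length G ≡ 2 → length H″ ≡ 2 → ℤX.coef G 1 ≢ + 0 → ℤX.coef H″ 1 ≢ + 0 →
      lowFirst p ℤX.≋ G ℤX.⊠ H″ → ¬ ¬ Any (Coded₂ p) (codes₂ H)
    linear G@(b ∷ a ∷ []) H″@(d ∷ c ∷ []) refl refl na nc eq none = either root
        (λ βG → either root-ζ (linear-root-unique K isField b a na ζ≉1 β≉0 βG)
          (λ ζH → none (opposite-code H u v w u≤ w≤ b a d c eq na nc (constant-nonzero K isField b a na β≉0 βG)
            (opposite-roots K isField (orderBound 2) (orderBound-positive 2) b a d c na nc order ζ≉1 β≉0 βG ζH))))
        (λ βH → either root-ζ
          (λ ζG → none (opposite-code H u v w u≤ w≤ d c b a (ℤX.≋-trans eq (ℤX.⊠-comm G H″)) nc na (constant-nonzero K isField d c nc β≉0 βH)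
            (opposite-roots K isField (orderBound 2) (orderBound-positive 2) d c b a nc na order ζ≉1 β≉0 βH ζG)))
          (linear-root-unique K isField d c nc ζ≉1 β≉0 βH))
      where
      either : ∀ {x} → evalℤ K x (lowFirst p) ≈ 𝟘 → (evalℤ K x G ≈ 𝟘 → ⊥) → (evalℤ K x H″ ≈ 𝟘 → ⊥) → ⊥
      either {x} e ng nh = nonzero-⊗ ng nh (≈-trans (≈-sym (Evaluation.evalAt-⊠ (ιHom K) x G H″)) (≈-trans (≈-sym (Evaluation.evalAt-cong (ιHom K) x {lowFirst p} {G ℤX.⊠ H″} eq)) e))

  upper-quadratic : ∀ H → 2 ≤ H → length (rStar 1 H) ≤ 64 * growth 2 H
  upper-quadratic H 2≤H = Dec.decidable-stable (length L ℕₚ.≤? _) λ no → ¬¬-All L (λ {a} i → coded₂ H a (rStar-∈ 1 H i)) λ all →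
      no (ℕₚ.≤-trans (fibre-bound Coded₂ 4 (codes₂ H) fibre₂ L (rStar-unique 1 H) all)
        (ℕₚ.≤-trans (ℕₚ.*-monoʳ-≤ 4 (length-codes₂ H 2≤H)) (ℕₚ.≤-reflexive (sym (ℕₚ.*-assoc 4 16 (H * ⌊log₂ H ⌋))))))
    where L = rStar 1 H

-- Counting coprime pairs

sumTo-snoc : ∀ N f → sumTo (suc N) f ≡ sumTo N f + f N
sumTo-snoc zero f = ℕₚ.+-identityʳ (f 0)
sumTo-snoc (suc N) f = trans (cong (λ x → f 0 + x) (sumTo-snoc N (f ∘ suc))) (sym (ℕₚ.+-assoc (f 0) _ _))

quotient-square : ∀ M p .{{_ : NonZero p}} → (p * (M ℕDivMod./ p)) * (p * (M ℕDivMod./ p)) ≤ M * M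
quotient-square M p = ℕₚ.*-mono-≤ l l
  where
  l : p * (M ℕDivMod./ p) ≤ M
  l = ℕₚ.≤-trans (ℕₚ.≤-reflexive (ℕₚ.*-comm p _)) (ℕDivMod.m/n*n≤m M p)

-- The sum of 1/p² over 3 ≤ p ≤ T + 2 telescopes to at most 1/2 - 1/(T + 2).
square-quotients : ∀ M T → 2 * (2 + T) * sumTo T (λ t → (M ℕDivMod./ (3 + t)) * (M ℕDivMod./ (3 + t))) ≤ T * (M * M)
square-quotients M zero = ℕₚ.≤-refl
square-quotients M (suc T) = ℕₚ.*-cancelˡ-≤ (2 + T) (begin
  (2 + T) * (2 * (3 + T) * sumTo (suc T) f)               ≡⟨ cong (λ s → (2 + T) * (2 * (3 + T) * s)) (sumTo-snoc T f) ⟩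
  (2 + T) * (2 * (3 + T) * (S + q * q))                   ≡⟨ solve 3 (λ t s q → (con 2 :+ t) :* (con 2 :* (con 3 :+ t) :* (s :+ q)) :=
                                                               (con 3 :+ t) :* (con 2 :* (con 2 :+ t) :* s) :+ con 2 :* ((con 2 :+ t) :* ((con 3 :+ t) :* q))) refl T S (q * q) ⟩
  (3 + T) * (2 * (2 + T) * S) + 2 * ((2 + T) * ((3 + T) * (q * q)))
    ≤⟨ ℕₚ.+-mono-≤ (ℕₚ.*-monoʳ-≤ (3 + T) (square-quotients M T)) (ℕₚ.*-monoʳ-≤ 2 (ℕₚ.*-monoˡ-≤ ((3 + T) * (q * q)) (ℕₚ.n≤1+n (2 + T)))) ⟩
  (3 + T) * (T * (M * M)) + 2 * ((3 + T) * ((3 + T) * (q * q)))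
    ≡⟨ cong (λ x → (3 + T) * (T * (M * M)) + 2 * x) (solve 2 (λ a q → a :* (a :* (q :* q)) := (a :* q) :* (a :* q)) refl (3 + T) q) ⟩
  (3 + T) * (T * (M * M)) + 2 * (((3 + T) * q) * ((3 + T) * q))
    ≤⟨ ℕₚ.+-monoʳ-≤ ((3 + T) * (T * (M * M))) (ℕₚ.*-monoʳ-≤ 2 (quotient-square M (3 + T))) ⟩
  (3 + T) * (T * (M * M)) + 2 * (M * M)                   ≡⟨ solve 2 (λ t m → (con 3 :+ t) :* (t :* m) :+ con 2 :* m := (con 2 :+ t) :* ((con 1 :+ t) :* m)) refl T (M * M) ⟩
  (2 + T) * (suc T * (M * M))                             ∎)
  where
  open ℕₚ.≤-Reasoning
  open ℕSolver
  f : ℕ → ℕ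
  f t = (M ℕDivMod./ (3 + t)) * (M ℕDivMod./ (3 + t))
  S = sumTo T f
  q = M ℕDivMod./ (3 + T)

-- The share 1/4 of `p = 2` is kept exact and the telescoping bound 1/2 is used for the rest.
-- Telescoping from `p = 2` on would give only the useless bound 1.
all-square-quotients : ∀ M T → 4 * sumTo T (λ t → (M ℕDivMod./ (2 + t)) * (M ℕDivMod./ (2 + t))) ≤ 3 * (M * M)
all-square-quotients M zero = z≤n
all-square-quotients M (suc T) = begin
  4 * (h * h + S)                     ≡⟨ solve 2 (λ h s → con 4 :* (h :* h :+ s) := (con 2 :* h) :* (con 2 :* h) :+ con 2 :* (con 2 :* s)) refl h S ⟩
  (2 * h) * (2 * h) + 2 * (2 * S)     ≤⟨ ℕₚ.+-mono-≤ (quotient-square M 2) (ℕₚ.*-monoʳ-≤ 2 twice) ⟩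
  M * M + 2 * (M * M)                 ≡⟨ solve 1 (λ m → m :+ con 2 :* m := con 3 :* m) refl (M * M) ⟩
  3 * (M * M)                         ∎
  where
  open ℕₚ.≤-Reasoning
  open ℕSolver
  h = M ℕDivMod./ 2
  S = sumTo T (λ t → (M ℕDivMod./ (3 + t)) * (M ℕDivMod./ (3 + t)))
  twice : 2 * S ≤ M * M
  twice = ℕₚ.*-cancelˡ-≤ (2 + T) (begin
    (2 + T) * (2 * S)      ≡⟨ solve 2 (λ t s → (con 2 :+ t) :* (con 2 :* s) := con 2 :* (con 2 :+ t) :* s) refl T S ⟩
    2 * (2 + T) * S        ≤⟨ square-quotients M T ⟩
    T * (M * M)            ≤⟨ ℕₚ.*-monoˡ-≤ (M * M) (ℕₚ.m≤n+m T 2) ⟩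
    (2 + T) * (M * M)      ∎)

from1To : ℕ → List ℕ
from1To M = map suc (upTo M)

from1To-unique : ∀ M → Unique (from1To M)
from1To-unique M = Uniqueₚ.map⁺ ℕₚ.suc-injective (Uniqueₚ.upTo⁺ M)

length-from1To : ∀ M → length (from1To M) ≡ M
length-from1To M = trans (Listₚ.length-map suc (upTo M)) (Listₚ.length-upTo M)

∈-from1To : ∀ {M x} → 1 ≤ x → x ≤ M → x ∈ from1To M
∈-from1To {x = suc x} _ l = ∈ₚ.∈-map⁺ suc (∈ₚ.∈-upTo⁺ l)

from1To-∈ : ∀ {M x} → x ∈ from1To M → 1 ≤ x × x ≤ M
from1To-∈ i with ∈ₚ.∈-map⁻ suc i
... | y , j , refl = s≤s z≤n , ∈ₚ.∈-upTo⁻ j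

squareList : ℕ → List (ℕ × ℕ)
squareList M = pairs (from1To M) (from1To M)

,-injective : ∀ {A B : Set} {w x : A} {y z : B} → (w , y) ≡ (x , z) → w ≡ x × y ≡ z
,-injective refl = refl , refl

squareList-unique : ∀ M → Unique (squareList M)
squareList-unique M = Uniqueₚ.cartesianProductWith⁺ _,_ ,-injective (from1To-unique M) (from1To-unique M)

length-squareList : ∀ M → length (squareList M) ≡ M * M
length-squareList M = trans (length-pairs (from1To M) (from1To M)) (cong₂ _*_ (length-from1To M) (length-from1To M))

∈-squareList : ∀ {M a b} → 1 ≤ a → a ≤ M → 1 ≤ b → b ≤ M → (a , b) ∈ squareList M
∈-squareList {M} 1≤a a≤ 1≤b b≤ = pair-∈ (from1To M) (from1To M) (∈-from1To 1≤a a≤) (∈-from1To 1≤b b≤)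

squareList-∈ : ∀ {M a b} → (a , b) ∈ squareList M → (1 ≤ a × a ≤ M) × (1 ≤ b × b ≤ M)
squareList-∈ {M} i with ∈ₚ.∈-cartesianProductWith⁻ _,_ (from1To M) (from1To M) i
... | a , b , ia , ib , refl = from1To-∈ ia , from1To-∈ ib

module _ {a p} {A : Set a} {P : A → Set p} (P? : ∀ x → Dec (P x)) where

  not? : ∀ x → Dec (¬ P x)
  not? x = Dec.¬? (P? x)

  length-split : ∀ xs → length xs ≡ length (filter P? xs) + length (filter not? xs)
  length-split [] = refl
  length-split (x ∷ xs) with P? x
  ... | yes _ = cong suc (length-split xs)
  ... | no _ = trans (cong suc (length-split xs)) (sym (ℕₚ.+-suc _ _))

isCoprime? : (x : ℕ × ℕ) → Dec (Coprime (proj₁ x) (proj₂ x))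
isCoprime? (a , b) = Coprimality.coprime? a b

coprimePairs : ℕ → List (ℕ × ℕ)
coprimePairs M = filter isCoprime? (squareList M)

multiplesOf : ℕ → ℕ → List (ℕ × ℕ × ℕ)
multiplesOf M t = pairs (2 + t ∷ []) (squareList (M ℕDivMod./ (2 + t)))

-- A pair that is not coprime is its gcd `p ≥ 2` times a pair with entries up to `M / p`. Summing
-- over all `p`, not only over primes, is good enough, since the sum of `1 / p ^ 2` stays below 3/4.
few-noncoprime : ∀ M → 4 * length (filter (not? isCoprime?) (squareList M)) ≤ 3 * (M * M)
few-noncoprime M = ℕₚ.≤-trans (ℕₚ.*-monoʳ-≤ 4 (ℕₚ.≤-trans (fibre-bound R 1 codes fibre L unique (All.tabulate coded))
    (ℕₚ.≤-trans (ℕₚ.≤-reflexive (ℕₚ.*-identityˡ (length codes))) (length-concatMap-upTo M (multiplesOf M) (λ t → (M ℕDivMod./ (2 + t)) * (M ℕDivMod./ (2 + t)))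
      (λ t _ → ℕₚ.≤-reflexive (trans (length-pairs (2 + t ∷ []) (squareList (M ℕDivMod./ (2 + t)))) (trans (ℕₚ.*-identityˡ _) (length-squareList (M ℕDivMod./ (2 + t))))))))))
    (all-square-quotients M M)
  where
  L = filter (not? isCoprime?) (squareList M)
  unique : Unique L
  unique = Uniqueₚ.filter⁺ (not? isCoprime?) (squareList-unique M)
  codes = concatMap (multiplesOf M) (upTo M)
  R : ℕ × ℕ → ℕ × ℕ × ℕ → Set
  R (a , b) (p , i , j) = a ≡ i * p × b ≡ j * p
  fibre : ∀ κ (L : List (ℕ × ℕ)) → Unique L → All (λ x → R x κ) L → length L ≤ 1
  fibre κ [] _ _ = z≤n
  fibre κ (x ∷ []) _ _ = s≤s z≤n
  fibre κ (x ∷ y ∷ L) ((n ∷ _) ∷ _) ((refl , refl) ∷ (refl , refl) ∷ _) = contradiction refl n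
  coded : ∀ {x} → x ∈ L → Any (R x) codes
  coded {a , b} i with ∈ₚ.∈-filter⁻ (not? isCoprime?) {xs = squareList M} i
  ... | i′ , nc with squareList-∈ {M} i′
  ... | (1≤a , a≤) , (1≤b , b≤) with coprime-parts a b 1≤a
  ... | 0 , x , y , refl , refl , c = contradiction (ℕₚ.≤-trans 1≤a (ℕₚ.≤-reflexive (ℕₚ.*-zeroʳ x))) (λ ())
  ... | 1 , x , y , refl , refl , c = contradiction (λ {d} → subst₂ Coprime (sym (ℕₚ.*-identityʳ x)) (sym (ℕₚ.*-identityʳ y)) c {d}) nc
  ... | suc (suc t) , x , y , refl , refl , c = lose (∈ₚ.∈-concatMap⁺ (multiplesOf M) (lose (∈ₚ.∈-upTo⁺ t<)
      (pair-∈ (2 + t ∷ []) (squareList (M ℕDivMod./ (2 + t))) (here refl) (∈-squareList (positive x 1≤a) (below x a≤) (positive y 1≤b) (below y b≤))))) (refl , refl)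
    where
    positive : ∀ x {g} → 1 ≤ x * g → 1 ≤ x
    positive (suc x) _ = s≤s z≤n
    below : ∀ x → x * (2 + t) ≤ M → x ≤ M ℕDivMod./ (2 + t)
    below x l = ℕₚ.≤-trans (ℕₚ.≤-reflexive (sym (ℕDivMod.m*n/n≡m x (2 + t)))) (ℕDivMod./-monoˡ-≤ (2 + t) l)
    t< : t < M
    t< = ℕₚ.≤-trans (ℕₚ.n≤1+n (suc t)) (ℕₚ.≤-trans (ℕₚ.m≤n*m (2 + t) x {{ℕ.>-nonZero (positive x 1≤a)}}) a≤)

many-coprime : ∀ M → M * M ≤ 4 * length (coprimePairs M)
many-coprime M = ℕₚ.+-cancelʳ-≤ (3 * (M * M)) (M * M) (4 * c) (begin
  M * M + 3 * (M * M)   ≡⟨ cong (4 *_) (trans (sym (length-squareList M)) (length-split isCoprime? (squareList M))) ⟩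
  4 * (c + r)           ≡⟨ ℕₚ.*-distribˡ-+ 4 c r ⟩
  4 * c + 4 * r         ≤⟨ ℕₚ.+-monoʳ-≤ (4 * c) (few-noncoprime M) ⟩
  4 * c + 3 * (M * M)   ∎)
  where
  open ℕₚ.≤-Reasoning
  c = length (coprimePairs M)
  r = length (filter (not? isCoprime?) (squareList M))

small? : (A : ℕ) (x : ℕ × ℕ) → Dec (proj₁ x ⊔ proj₂ x ≤ A)
small? A x = proj₁ x ⊔ proj₂ x ℕₚ.≤? A

-- Powers of 4 match the density 1/4. With `A = 4 ^ j` there are at least `4 A ^ 2` coprime pairs up
-- to `4 A`, of which at most `A ^ 2` are discarded. Between `A` and `2 A` the same estimate would
-- leave nothing.
layer : ℕ → List (ℕ × ℕ)
layer j = filter (not? (small? (4 ^ j))) (coprimePairs (4 ^ suc j))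

layer-unique : ∀ j → Unique (layer j)
layer-unique j = Uniqueₚ.filter⁺ (not? (small? (4 ^ j))) (Uniqueₚ.filter⁺ isCoprime? (squareList-unique (4 ^ suc j)))

record InLayer (j a b : ℕ) : Set where
  field
    1≤a     : 1 ≤ a
    1≤b     : 1 ≤ b
    a≤      : a ≤ 4 ^ suc j
    b≤      : b ≤ 4 ^ suc j
    coprime : Coprime a b
    large   : 4 ^ j < a ⊔ b

layer-∈ : ∀ {j a b} → (a , b) ∈ layer j → InLayer j a b
layer-∈ {j} i with ∈ₚ.∈-filter⁻ (not? (small? (4 ^ j))) {xs = coprimePairs (4 ^ suc j)} i
... | i′ , large with ∈ₚ.∈-filter⁻ isCoprime? {xs = squareList (4 ^ suc j)} i′
... | i″ , coprime with squareList-∈ {4 ^ suc j} i″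
... | (1≤a , a≤) , (1≤b , b≤) = record { 1≤a = 1≤a ; 1≤b = 1≤b ; a≤ = a≤ ; b≤ = b≤ ; coprime = coprime ; large = ℕₚ.≰⇒> large }

layer-unique-index : ∀ {i j a b} → InLayer i a b → InLayer j a b → i ≡ j
layer-unique-index {i} {j} p q = ℕₚ.≤-antisym (below p q) (below q p)
  where
  below : ∀ {i j a b} → InLayer i a b → InLayer j a b → i ≤ j
  below {i} {j} p q = ℕₚ.≮⇒≥ λ l → ℕₚ.<⇒≱ (InLayer.large p) (ℕₚ.≤-trans (ℕₚ.⊔-lub (InLayer.a≤ q) (InLayer.b≤ q)) (ℕₚ.^-monoʳ-≤ 4 l))

length-layer : ∀ j → 3 * (4 ^ j * 4 ^ j) ≤ length (layer j)
length-layer j = ℕₚ.+-cancelʳ-≤ (A * A) (3 * (A * A)) (length (layer j)) (begin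
  3 * (A * A) + A * A                  ≡⟨ solve 1 (λ a → con 3 :* (a :* a) :+ a :* a := con 4 :* (a :* a)) refl A ⟩
  4 * (A * A)                          ≤⟨ ℕₚ.*-cancelˡ-≤ 4 (ℕₚ.≤-trans (ℕₚ.≤-reflexive (solve 1 (λ a → con 4 :* (con 4 :* (a :* a)) := (con 4 :* a) :* (con 4 :* a)) refl A)) (many-coprime (4 ^ suc j))) ⟩
  length (coprimePairs (4 ^ suc j))    ≡⟨ length-split (small? A) (coprimePairs (4 ^ suc j)) ⟩
  length inner + length (layer j)      ≤⟨ ℕₚ.+-monoˡ-≤ (length (layer j)) inner≤ ⟩
  A * A + length (layer j)             ≡⟨ ℕₚ.+-comm (A * A) _ ⟩
  length (layer j) + A * A             ∎)
  where
  open ℕₚ.≤-Reasoning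
  open ℕSolver
  A = 4 ^ j
  inner = filter (small? A) (coprimePairs (4 ^ suc j))
  inner≤ : length inner ≤ A * A
  inner≤ = ℕₚ.≤-trans (injection-length inner (squareList A) id
      (Uniqueₚ.filter⁺ (small? A) (Uniqueₚ.filter⁺ isCoprime? (squareList-unique (4 ^ suc j)))) into (λ _ _ e → e))
    (ℕₚ.≤-reflexive (length-squareList A))
    where
    into : ∀ {x} → x ∈ inner → x ∈ squareList A
    into {a , b} i with ∈ₚ.∈-filter⁻ (small? A) {xs = coprimePairs (4 ^ suc j)} i
    ... | i′ , small with squareList-∈ {4 ^ suc j} (proj₁ (∈ₚ.∈-filter⁻ isCoprime? {xs = squareList (4 ^ suc j)} i′))
    ... | (1≤a , _) , (1≤b , _) = ∈-squareList 1≤a (ℕₚ.m⊔n≤o⇒m≤o a b small) 1≤b (ℕₚ.m⊔n≤o⇒n≤o a b small)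

coprime-ratio : ∀ {a b a′ b′} → 1 ≤ a → Coprime a b → Coprime a′ b′ → a * b′ ≡ a′ * b → a ≡ a′ × b ≡ b′
coprime-ratio {a} {b} {a′} {b′} 1≤a c c′ e = a≡a′ , ℕₚ.*-cancelˡ-≡ b b′ a {{ℕ.>-nonZero 1≤a}} (trans (cong (_* b) a≡a′) (sym e))
  where
  a≡a′ : a ≡ a′
  a≡a′ = ℕ∣.∣-antisym (coprime-divisor c (ℕ∣.divides b′ (trans (ℕₚ.*-comm b a′) (trans (sym e) (ℕₚ.*-comm a b′)))))
                     (coprime-divisor c′ (ℕ∣.divides b (trans (ℕₚ.*-comm b′ a) (trans e (ℕₚ.*-comm a′ b)))))

-- Lower bounds by explicit families

vectorOf : ∀ k G → length G ≡ k → ∃ λ (v : Vec ℤ k) → Vec.toList v ≡ G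
vectorOf zero [] l = [] , refl
vectorOf (suc k) (c ∷ G) l with vectorOf k G (ℕₚ.suc-injective l)
... | v , e = c ∷ v , cong (c ∷_) e

fromLowFirst : ∀ {n} F → length F ≡ suc n → ∃ λ (a : IntPoly n) → lowFirst a ≡ F
fromLowFirst {n} F l with vectorOf (suc n) (Data.List.reverse F) (trans (Listₚ.length-reverse F) l)
... | a , e = a , trans (cong Data.List.reverse e) (Listₚ.reverse-involutive F)

box-lowFirst : ∀ {n H} (a : IntPoly n) → height (lowFirst a) ≤ H → VecAll.All (λ c → ℤ.∣ c ∣ ≤ H) a
box-lowFirst {H = H} a l = fromList a (subst (All (λ c → ℤ.∣ c ∣ ≤ H)) (Listₚ.reverse-involutive (Vec.toList a))
    (All-reverse (All.map (λ c≤ → ℕₚ.≤-trans c≤ l) (height-All (lowFirst a)))))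
  where
  fromList : ∀ {k} (a : Vec ℤ k) → All (λ c → ℤ.∣ c ∣ ≤ H) (Vec.toList a) → VecAll.All (λ c → ℤ.∣ c ∣ ≤ H) a
  fromList [] [] = VecAll.[]
  fromList (c ∷ a) (p ∷ ps) = p VecAll.∷ fromList a ps

-- The exponent is 2 because all families contain a factor `A X ^ 2 + B`, whose roots `r` and `-r`
-- have the quotient -1.
record Member (n H : ℕ) (F : List ℤ) : Set₁ where
  field
    length-F : length F ≡ suc n
    top      : ℤX.coef F n ≢ + 0
    bounded  : height F ≤ H
    twisted  : Twisted F 2
    G S      : List ℤ
    equation : F ℤX.≋ G ℤX.⊠ S
    degree-G : ∃ λ i → 1 ≤ i × ℤX.coef G i ≢ + 0
    degree-S : ∃ λ i → 1 ≤ i × ℤX.coef S i ≢ + 0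

member-inRStar : ∀ {n H} (a : IntPoly n) → Member n H (lowFirst a) → InRStar n H a
member-inRStar a m = ((λ z → top (trans (coef-lowFirst a) z)) , box-lowFirst a bounded) , twisted⇒degenerate a (s≤s z≤n) twisted ,
    factors⇒reducible a G S equation degree-G degree-S
  where open Member m

lower-count : ∀ k H {X : Set} (xs : List X) (F : X → List ℤ) → Unique xs → (∀ {x} → x ∈ xs → Member (suc k) H (F x)) →
  (∀ {x y} → x ∈ xs → y ∈ xs → F x ≡ F y → x ≡ y) → length xs ≤ length (rStar k H)
lower-count k H {X} xs F unique member injective = ℕₚ.≤-trans (fibre-bound R 1 (rStar k H) fibre xs unique (All.tabulate λ i → represent i))
    (ℕₚ.≤-reflexive (ℕₚ.*-identityˡ _))
  where
  R : X → IntPoly (suc k) → Set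
  R x a = x ∈ xs × lowFirst a ≡ F x
  fibre : ∀ a L → Unique L → All (λ x → R x a) L → length L ≤ 1
  fibre a [] _ _ = z≤n
  fibre a (x ∷ []) _ _ = s≤s z≤n
  fibre a (x ∷ y ∷ L) ((n ∷ _) ∷ _) ((i , e) ∷ (j , f) ∷ _) = contradiction (injective i j (trans (sym e) f)) n
  represent : ∀ {x} → x ∈ xs → Any (R x) (rStar k H)
  represent {x} i with fromLowFirst (F x) (Member.length-F (member i))
  ... | a , e = lose (∈-rStar k H (member-inRStar a (subst (Member (suc k) H) (sym e) (member i)))) (i , e)

quadratic : ℤ → ℤ → List ℤ
quadratic A B = B ∷ + 0 ∷ A ∷ []

module _ (K : CommutativeRing 0ℓ 0ℓ) (isField : IsChar0Field K) where
  open CharZeroField K isField renaming (A to Carrier)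
  open ≈-Reasoning

  opposite-twisted : ∀ {A B} → B ≢ + 0 → ∀ F h → F ℤX.≋ quadratic A B ℤX.⊠ h → ∀ r → evalℤ K r (quadratic A B) ≈ 𝟘 → Twisted F 2
  opposite-twisted {A} {B} nB F h e r root-Q = record
    { K = K ; isField = isField ; ζ = ⊖ 𝟙 ; β = r
    ; order = solve 0 (:- :1 :* (:- :1 :* :1) := :1) ≈-refl
    ; ζ≉1 = λ z → char0 1 (begin
        𝟙 ⊕ (𝟙 ⊕ 𝟘)       ≈⟨ solve 0 (:1 :+ (:1 :+ :0) := :1 :- :- :1) ≈-refl ⟩
        𝟙 ⊝ ⊖ 𝟙           ≈⟨ ⊕-congˡ (⊖-cong z) ⟩
        𝟙 ⊝ 𝟙             ≈⟨ ⊖-inverseʳ 𝟙 ⟩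
        𝟘                 ∎)
    ; β≉0 = λ z → ι-nonzero nB (begin
        ι B                                       ≈⟨ solve 3 (λ b r a → b := (b :+ r :* (:0 :+ r :* (a :+ r :* :0))) :- r :* (r :* a)) ≈-refl (ι B) r (ι A) ⟩
        evalℤ K r (quadratic A B) ⊝ r ⊗ (r ⊗ ι A) ≈⟨ ⊕-cong root-Q (⊖-cong (≈-trans (⊗-congʳ z) (⊗-zeroˡ _))) ⟩
        𝟘 ⊝ 𝟘                                     ≈⟨ ⊖-inverseʳ 𝟘 ⟩
        𝟘                                         ∎)
    ; root = multiple r root-Q
    ; root-ζ = multiple (⊖ 𝟙 ⊗ r) (≈-trans (solve 3 (λ b r a →
        b :+ (:- :1 :* r) :* (:0 :+ (:- :1 :* r) :* (a :+ (:- :1 :* r) :* :0)) := b :+ r :* (:0 :+ r :* (a :+ r :* :0))) ≈-refl (ι B) r (ι A)) root-Q) }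
    where
    multiple : ∀ x → evalℤ K x (quadratic A B) ≈ 𝟘 → evalℤ K x F ≈ 𝟘
    multiple x z = ≈-trans (Evaluation.evalAt-cong (ιHom K) x {F} {quadratic A B ℤX.⊠ h} e)
      (≈-trans (Evaluation.evalAt-⊠ (ιHom K) x (quadratic A B) h) (≈-trans (⊗-congʳ z) (⊗-zeroˡ _)))

-- `Extension` accepts any nonunit, so the same construction of a root covers `a ^ 2 X ^ 2 + b` and
-- the polynomials `a ^ 2 X ^ 2 - b ^ 2`, which split over ℚ.
quadratic-twisted : ∀ {A B} → A ≢ + 0 → B ≢ + 0 → ∀ F h → F ℤX.≋ quadratic A B ℤX.⊠ h → Twisted F 2
quadratic-twisted {A} {B} nA nB F h e = opposite-twisted E.Q.quotientRing
    (char0Field E.extension (hom-charZero ℚ-field E.embedding (DiscreteField.𝟙≉𝟘 E.extension) ℚ-charZero)) {A} {B} nB F h e E.root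
    (E.E.≈-trans (E.E.≈-sym (evalAt-map (ιHom ℚ-ring) E.embedding (ιHom E.Q.quotientRing) E.root (Hom.⟦⟧-ι E.embedding) (quadratic A B))) E.root-g₀)
  where
  module QP = FieldPolynomials ℚ-field
  coef-Q : ∀ i → ℚX.coef (toℚX (quadratic A B)) i ≡ ℚF.ι (ℤX.coef (quadratic A B) i)
  coef-Q = MapPolynomials.coef-map (ιHom ℚ-ring) (quadratic A B)
  nonunit : ¬ QP.Unit (toℚX (quadratic A B))
  nonunit = QP.degree-nonunit (toℚX (quadratic A B)) 1 (λ z → nA (ℚF.ι-zero (trans (sym (coef-Q 2)) z)))
    (λ { (suc (suc (suc i))) _ → refl ; (suc (suc zero)) (s≤s (s≤s ())) ; (suc zero) (s≤s ()) })
  module E = Extension ℚ-field (toℚX (quadratic A B)) nonunit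

ℤ-+-cancelʳ : ∀ z x y → x ℤ.+ z ≡ y ℤ.+ z → x ≡ y
ℤ-+-cancelʳ z x y e = trans (solve 2 (λ x z → x := (x :+ z) :- z) refl x z) (trans (cong (ℤ._- z) e) (solve 2 (λ y z → (y :+ z) :- z := y) refl y z))
  where open ℤSolver

module _ (A B : ℤ) where
  family : List ℤ → List ℤ
  family h = quadratic A B ℤX.⊠ h

  family-≋ : ∀ h → family h ℤX.≋ ℤX.scale B h ℤX.⊞ (+ 0 ∷ + 0 ∷ ℤX.scale A h)
  family-≋ h = ℤX.⊞-cong {ℤX.scale B h} ℤX.≋-refl (ℤX.∷-cong refl (ℤX.≋-trans (ℤX.shift-⊠ (A ∷ []) h) (ℤX.∷-cong refl (ℤX.const-⊠ A h))))

  coef-family : ∀ h i → ℤX.coef (family h) i ≡ B ℤ.* ℤX.coef h i ℤ.+ ℤX.coef (+ 0 ∷ + 0 ∷ ℤX.scale A h) i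
  coef-family h i = trans (ℤX.at (family-≋ h) i) (trans (ℤX.coef-⊞ (ℤX.scale B h) _ i) (cong (ℤ._+ ℤX.coef (+ 0 ∷ + 0 ∷ ℤX.scale A h) i) (ℤX.coef-scale B h i)))

  coef-family-0 : ∀ h → ℤX.coef (family h) 0 ≡ B ℤ.* ℤX.coef h 0
  coef-family-0 h = trans (coef-family h 0) (ℤₚ.+-identityʳ _)

  coef-family-1 : ∀ h → ℤX.coef (family h) 1 ≡ B ℤ.* ℤX.coef h 1
  coef-family-1 h = trans (coef-family h 1) (ℤₚ.+-identityʳ _)

  coef-family-2+ : ∀ h i → ℤX.coef (family h) (suc (suc i)) ≡ B ℤ.* ℤX.coef h (suc (suc i)) ℤ.+ A ℤ.* ℤX.coef h i
  coef-family-2+ h i = trans (coef-family h (suc (suc i))) (cong (λ x → B ℤ.* ℤX.coef h (suc (suc i)) ℤ.+ x) (ℤX.coef-scale A h i))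

  length-⊞ : ∀ p q → length (p ℤX.⊞ q) ≡ length p ⊔ length q
  length-⊞ [] q = refl
  length-⊞ (a ∷ p) [] = refl
  length-⊞ (a ∷ p) (b ∷ q) = cong suc (length-⊞ p q)

  length-family : ∀ k h → length h ≡ suc k → length (family h) ≡ suc (suc (suc k))
  length-family k h refl′ = begin
    length (ℤX.scale B h ℤX.⊞ (+ 0 ∷ (ℤX.scale (+ 0) h ℤX.⊞ (+ 0 ∷ (ℤX.scale A h ℤX.⊞ (+ 0 ∷ []))))))  ≡⟨ length-⊞ (ℤX.scale B h) _ ⟩
    length (ℤX.scale B h) ⊔ suc (length (ℤX.scale (+ 0) h ℤX.⊞ (+ 0 ∷ (ℤX.scale A h ℤX.⊞ (+ 0 ∷ [])))))  ≡⟨ cong (λ x → length (ℤX.scale B h) ⊔ suc x) (length-⊞ (ℤX.scale (+ 0) h) _) ⟩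
    length (ℤX.scale B h) ⊔ suc (length (ℤX.scale (+ 0) h) ⊔ suc (length (ℤX.scale A h ℤX.⊞ (+ 0 ∷ []))))
      ≡⟨ cong₂ (λ x y → x ⊔ suc y) (scaled B) (cong₂ (λ x y → x ⊔ suc y) (scaled (+ 0)) (trans (length-⊞ (ℤX.scale A h) _) (trans (cong (_⊔ 1) (scaled A)) (cong suc (ℕₚ.⊔-identityʳ k))))) ⟩
    suc k ⊔ suc (suc k ⊔ suc (suc k))   ≡⟨ cong (λ x → suc k ⊔ suc x) (ℕₚ.m≤n⇒m⊔n≡n (ℕₚ.n≤1+n (suc k))) ⟩
    suc k ⊔ suc (suc (suc k))           ≡⟨ ℕₚ.m≤n⇒m⊔n≡n (ℕₚ.≤-trans (ℕₚ.n≤1+n (suc k)) (ℕₚ.n≤1+n (suc (suc k)))) ⟩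
    suc (suc (suc k))                   ∎
    where
    open ≡-Reasoning
    scaled : ∀ c → length (ℤX.scale c h) ≡ suc k
    scaled c = trans (Listₚ.length-map (c ℤ.*_) h) refl′

  height-family : ∀ h → height (family h) ≤ (ℤ.∣ A ∣ + ℤ.∣ B ∣) * height h
  height-family h = coefs-height (family h) bound
    where
    open ℕₚ.≤-Reasoning
    coefs-height : ∀ {M} F → (∀ i → ℤ.∣ ℤX.coef F i ∣ ≤ M) → height F ≤ M
    coefs-height [] b = z≤n
    coefs-height (c ∷ F) b = ℕₚ.⊔-lub (b 0) (coefs-height F (b ∘ suc))
    second : ∀ i → ℤ.∣ ℤX.coef (+ 0 ∷ + 0 ∷ ℤX.scale A h) i ∣ ≤ ℤ.∣ A ∣ * height h
    second zero = z≤n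
    second (suc zero) = z≤n
    second (suc (suc i)) = ℕₚ.≤-trans (ℕₚ.≤-reflexive (trans (cong ℤ.∣_∣ (ℤX.coef-scale A h i)) (ℤₚ.abs-* A _))) (ℕₚ.*-monoʳ-≤ ℤ.∣ A ∣ (coef-height h i))
    bound : ∀ i → ℤ.∣ ℤX.coef (family h) i ∣ ≤ (ℤ.∣ A ∣ + ℤ.∣ B ∣) * height h
    bound i = begin
      ℤ.∣ ℤX.coef (family h) i ∣                    ≡⟨ cong ℤ.∣_∣ (coef-family h i) ⟩
      ℤ.∣ B ℤ.* ℤX.coef h i ℤ.+ s ∣                  ≤⟨ ℤₚ.∣i+j∣≤∣i∣+∣j∣ (B ℤ.* ℤX.coef h i) s ⟩
      ℤ.∣ B ℤ.* ℤX.coef h i ∣ + ℤ.∣ s ∣              ≤⟨ ℕₚ.+-mono-≤ (ℕₚ.≤-trans (ℕₚ.≤-reflexive (ℤₚ.abs-* B (ℤX.coef h i))) (ℕₚ.*-monoʳ-≤ ℤ.∣ B ∣ (coef-height h i))) (second i) ⟩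
      ℤ.∣ B ∣ * height h + ℤ.∣ A ∣ * height h        ≡⟨ trans (ℕₚ.+-comm (ℤ.∣ B ∣ * height h) _) (sym (ℕₚ.*-distribʳ-+ (height h) ℤ.∣ A ∣ ℤ.∣ B ∣)) ⟩
      (ℤ.∣ A ∣ + ℤ.∣ B ∣) * height h                 ∎
      where s = ℤX.coef (+ 0 ∷ + 0 ∷ ℤX.scale A h) i

  -- The coefficients of `h` are recovered from the constant term upwards, dividing by `B` each
  -- time. The recursion reaches back two places, so two neighbouring coefficients are carried
  -- along.
  family-injective : B ≢ + 0 → ∀ h g → family h ≡ family g → h ℤX.≋ g
  family-injective nB h g e = ℤX.pointwise λ i → proj₁ (both i)
    where
    cancel : ∀ {x y} → B ℤ.* x ≡ B ℤ.* y → x ≡ y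
    cancel {x} {y} = ℤₚ.*-cancelˡ-≡ B x y {{ℤ.≢-nonZero nB}}
    at : ∀ i → ℤX.coef (family h) i ≡ ℤX.coef (family g) i
    at i = cong (λ F → ℤX.coef F i) e
    both : ∀ i → ℤX.coef h i ≡ ℤX.coef g i × ℤX.coef h (suc i) ≡ ℤX.coef g (suc i)
    both zero = cancel (trans (sym (coef-family-0 h)) (trans (at 0) (coef-family-0 g))) , cancel (trans (sym (coef-family-1 h)) (trans (at 1) (coef-family-1 g)))
    both (suc i) with both i
    ... | p , q = q , cancel (ℤ-+-cancelʳ (A ℤ.* ℤX.coef h i) _ _ (trans (sym (coef-family-2+ h i)) (trans (at (suc (suc i)))
      (trans (coef-family-2+ g i) (cong (λ x → B ℤ.* ℤX.coef g (suc (suc i)) ℤ.+ A ℤ.* x) (sym p))))))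

  module _ (nA : A ≢ + 0) (nB : B ≢ + 0) (k H : ℕ) (h : List ℤ) (lh : length h ≡ suc k) (top-h : ℤX.coef h k ≢ + 0)
           (bound : (ℤ.∣ A ∣ + ℤ.∣ B ∣) * height h ≤ H) where

    family-top : ℤX.coef (family h) (suc (suc k)) ≢ + 0
    family-top z = ℤ-nonzero-* nA top-h (trans (sym (trans (coef-family-2+ h k) (trans (cong (λ x → B ℤ.* x ℤ.+ A ℤ.* ℤX.coef h k)
        (ℤX.coef-beyond h (suc (suc k)) (ℕₚ.≤-trans (ℕₚ.≤-reflexive lh) (ℕₚ.n≤1+n (suc k))))) (trans (cong (ℤ._+ A ℤ.* ℤX.coef h k) (ℤₚ.*-zeroʳ B)) (ℤₚ.+-identityˡ _))))) z)

    memberWith : ∀ G S → family h ℤX.≋ G ℤX.⊠ S → (∃ λ i → 1 ≤ i × ℤX.coef G i ≢ + 0) → (∃ λ i → 1 ≤ i × ℤX.coef S i ≢ + 0) →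
      Member (suc (suc k)) H (family h)
    memberWith G S e dG dS = record
      { length-F = length-family k h lh ; top = family-top ; bounded = ℕₚ.≤-trans (height-family h) bound
      ; twisted = quadratic-twisted nA nB (family h) h ℤX.≋-refl ; G = G ; S = S ; equation = e ; degree-G = dG ; degree-S = dS }

    family-member : 1 ≤ k → Member (suc (suc k)) H (family h)
    family-member 1≤k = memberWith (quadratic A B) h ℤX.≋-refl (2 , s≤s z≤n , nA) (k , 1≤k , top-h)

module _ {A B : Set} (f : A → List B) (tag : B → A) (tagged : ∀ x {y} → y ∈ f x → tag y ≡ x) where

  unique-concatMap : (∀ x → Unique (f x)) → ∀ xs → Unique xs → Unique (concatMap f xs)
  unique-concatMap u [] [] = []
  unique-concatMap u (x ∷ xs) (x∉ ∷ uxs) = Uniqueₚ.++⁺ (u x) (unique-concatMap u xs uxs) disjoint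
    where
    disjoint : ∀ {y} → ¬ (y ∈ f x × y ∈ concatMap f xs)
    disjoint (i , j) with find (∈ₚ.∈-concatMap⁻ f {xs = xs} j)
    ... | x′ , x′∈ , k = All.lookup x∉ x′∈ (trans (sym (tagged x i)) (tagged x′ k))

concatMap-upTo-≥ : {B : Set} (f : ℕ → List B) (X κ N : ℕ) → (∀ i → i < N → X ≤ κ * length (f i)) → N * X ≤ κ * length (concatMap f (upTo N))
concatMap-upTo-≥ f X κ N = go N id
  where
  go : ∀ N (h : ℕ → ℕ) → (∀ i → i < N → X ≤ κ * length (f (h i))) → N * X ≤ κ * length (concatMap f (Data.List.applyUpTo h N))
  go zero h b = z≤n
  go (suc N) h b = ℕₚ.≤-trans (ℕₚ.+-mono-≤ (b 0 (s≤s z≤n)) (go N (h ∘ suc) (λ i l → b (suc i) (s≤s l))))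
    (ℕₚ.≤-reflexive (trans (sym (ℕₚ.*-distribˡ-+ κ (length (f (h 0))) _)) (cong (κ *_) (sym (Listₚ.length-++ (f (h 0)))))))

abstract
  part : (D : ℕ) .{{_ : NonZero D}} → ℕ → ℕ
  part D H = H ℕDivMod./ D

  part-≤ : ∀ D .{{_ : NonZero D}} H → D * part D H ≤ H
  part-≤ D H = ℕₚ.≤-trans (ℕₚ.≤-reflexive (ℕₚ.*-comm D _)) (ℕDivMod.m/n*n≤m H D)

  part-≥ : ∀ D .{{_ : NonZero D}} H → D ≤ H → H ≤ 2 * D * part D H
  part-≥ D H D≤H = begin
    H                                        ≡⟨ ℕDivMod.m≡m%n+[m/n]*n H D ⟩
    H ℕDivMod.% D + part D H * D             ≤⟨ ℕₚ.+-monoˡ-≤ (part D H * D) (ℕₚ.≤-trans (ℕₚ.<⇒≤ (ℕDivMod.m%n<n H D)) (ℕₚ.m≤n*m D (part D H) {{ℕ.>-nonZero (ℕDivMod.m≥n⇒m/n>0 D≤H)}})) ⟩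
    part D H * D + part D H * D              ≡⟨ solve 2 (λ p d → p :* d :+ p :* d := con 2 :* d :* p) refl (part D H) D ⟩
    2 * D * part D H                         ∎
    where
    open ℕₚ.≤-Reasoning
    open ℕSolver

module Layered {Y : Set} (E : ℕ → List Y) (E-unique : ∀ j → Unique (E j)) where

  -- The index `j` is stored in each element as a tag, by which `unique-concatMap` recognises that
  -- different blocks are disjoint.
  block : ℕ → List (ℕ × (ℕ × ℕ) × Y)
  block j = pairs (j ∷ []) (pairs (layer j) (E j))

  blocks : ℕ → List (ℕ × (ℕ × ℕ) × Y)
  blocks J = concatMap block (upTo J)

  ∈-block : ∀ j {i a b y} → (i , (a , b) , y) ∈ block j → i ≡ j × InLayer j a b × y ∈ E j
  ∈-block j m with ∈ₚ.∈-cartesianProductWith⁻ _,_ (j ∷ []) (pairs (layer j) (E j)) m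
  ... | _ , _ , here refl , m′ , refl with ∈ₚ.∈-cartesianProductWith⁻ _,_ (layer j) (E j) m′
  ... | _ , _ , ab∈ , y∈ , refl = refl , layer-∈ {j} ab∈ , y∈

  blocks-unique : ∀ J → Unique (blocks J)
  blocks-unique J = unique-concatMap block proj₁ (λ j {y} m → proj₁ (∈-block j m))
    (λ j → Uniqueₚ.cartesianProductWith⁺ _,_ ,-injective ([] ∷ []) (Uniqueₚ.cartesianProductWith⁺ _,_ ,-injective (layer-unique j) (E-unique j)))
    (upTo J) (Uniqueₚ.upTo⁺ J)

  ∈-blocks : ∀ {J j a b y} → (j , (a , b) , y) ∈ blocks J → InLayer j a b × y ∈ E j
  ∈-blocks {J} m with find (∈ₚ.∈-concatMap⁻ block {xs = upTo J} m)
  ... | i , _ , m′ with ∈-block i m′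
  ... | refl , l , y∈ = l , y∈

  length-blocks : ∀ X κ J → (∀ j → j < J → X ≤ κ * (3 * (4 ^ j * 4 ^ j) * length (E j))) → J * X ≤ κ * length (blocks J)
  length-blocks X κ J b = concatMap-upTo-≥ block X κ J (λ j l → ℕₚ.≤-trans (b j l) (ℕₚ.*-monoʳ-≤ κ (ℕₚ.≤-trans
    (ℕₚ.*-monoˡ-≤ (length (E j)) (length-layer j))
    (ℕₚ.≤-reflexive (sym (trans (length-pairs (j ∷ []) (pairs (layer j) (E j))) (trans (ℕₚ.*-identityˡ (length (pairs (layer j) (E j)))) (length-pairs (layer j) (E j)))))))))

+-nonzero : ∀ {a} → 1 ≤ a → + a ≢ + 0
+-nonzero {suc a} _ ()

ratio-from-products : ∀ {a b a′ b′ c c′} → 1 ≤ a → 1 ≤ c → 1 ≤ c′ → Coprime a b → Coprime a′ b′ → a * c ≡ a′ * c′ → b * c ≡ b′ * c′ → a ≡ a′ × b ≡ b′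
ratio-from-products {a} {b} {a′} {b′} {c} {c′} 1≤a 1≤c 1≤c′ p q e f = coprime-ratio 1≤a p q
    (ℕₚ.*-cancelʳ-≡ (a * b′) (a′ * b) (c * c′) {{ℕ.>-nonZero (ℕₚ.*-mono-≤ 1≤c 1≤c′)}} (begin
      (a * b′) * (c * c′)     ≡⟨ solve 4 (λ a b c d → (a :* b) :* (c :* d) := (a :* c) :* (b :* d)) refl a b′ c c′ ⟩
      (a * c) * (b′ * c′)     ≡⟨ cong₂ _*_ e (sym f) ⟩
      (a′ * c′) * (b * c)     ≡⟨ solve 4 (λ a b c d → (a :* d) :* (b :* c) := (a :* b) :* (c :* d)) refl a′ b c c′ ⟩
      (a′ * b) * (c * c′)     ∎))
  where
  open ≡-Reasoning
  open ℕSolver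

module CubicFamily (H : ℕ) where
  -- A bound for `a + b` in layer `j`. With `c` and `d` at most `H / D j`, the product
  -- `(a X ^ 2 + b) (c X + d)` has height at most `H`.
  D : ℕ → ℕ
  D j = 2 * 4 ^ suc j

  D-nonZero : ∀ j → NonZero (D j)
  D-nonZero j = ℕₚ.m*n≢0 2 (4 ^ suc j) {{_}} {{ℕₚ.m^n≢0 4 (suc j)}}

  q : ℕ → ℕ
  q j = part (D j) {{D-nonZero j}} H

  open Layered (λ j → squareList (q j)) (λ j → squareList-unique (q j)) public

  F : ℕ × (ℕ × ℕ) × (ℕ × ℕ) → List ℤ
  F (j , (a , b) , (c , d)) = family (+ a) (+ b) (+ d ∷ + c ∷ [])

  member : ∀ {J x} → x ∈ blocks J → Member 3 H (F x)
  member {J} {j , (a , b) , (c , d)} m with ∈-blocks {J} m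
  ... | l , cd∈ with squareList-∈ {q j} cd∈
  ... | (1≤c , c≤) , (1≤d , d≤) = family-member (+ a) (+ b) (+-nonzero 1≤a) (+-nonzero 1≤b) 1 H (+ d ∷ + c ∷ []) refl (+-nonzero 1≤c) bound (s≤s z≤n)
    where
    open InLayer l
    bound : (a + b) * height (+ d ∷ + c ∷ []) ≤ H
    bound = ℕₚ.≤-trans (ℕₚ.*-mono-≤ (ℕₚ.≤-trans (ℕₚ.+-mono-≤ a≤ b≤) (ℕₚ.≤-reflexive (cong (λ x → 4 ^ suc j + x) (sym (ℕₚ.+-identityʳ _)))))
      (ℕₚ.⊔-lub d≤ (ℕₚ.⊔-lub c≤ z≤n))) (part-≤ (D j) {{D-nonZero j}} H)

  cubic-coef : ∀ a b c d → ℤ.∣ ℤX.coef (family (+ a) (+ b) (+ d ∷ + c ∷ [])) 3 ∣ ≡ a * c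
  cubic-coef a b c d = trans (cong ℤ.∣_∣ (trans (coef-family-2+ (+ a) (+ b) (+ d ∷ + c ∷ []) 1)
    (trans (cong (ℤ._+ + a ℤ.* + c) (ℤₚ.*-zeroʳ (+ b))) (ℤₚ.+-identityˡ (+ a ℤ.* + c))))) (ℤₚ.abs-* (+ a) (+ c))

  linear-coef : ∀ a b c d → ℤ.∣ ℤX.coef (family (+ a) (+ b) (+ d ∷ + c ∷ [])) 1 ∣ ≡ b * c
  linear-coef a b c d = trans (cong ℤ.∣_∣ (coef-family-1 (+ a) (+ b) (+ d ∷ + c ∷ []))) (ℤₚ.abs-* (+ b) (+ c))

  same-pair : ∀ {j j′ a b a′ b′ c c′ d d′} → InLayer j a b → InLayer j′ a′ b′ → family (+ a) (+ b) (+ d ∷ + c ∷ []) ≡ family (+ a′) (+ b′) (+ d′ ∷ + c′ ∷ []) →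
    a ≡ a′ → b ≡ b′ → (j , (a , b) , (c , d)) ≡ (j′ , (a′ , b′) , (c′ , d′))
  same-pair {j} {j′} {a} {b} {c = c} {c′} {d} {d′} l l′ e refl refl = same-rest (layer-unique-index l l′) (family-injective (+ a) (+ b) (+-nonzero (InLayer.1≤b l)) (+ d ∷ + c ∷ []) (+ d′ ∷ + c′ ∷ []) e)
    where
    same-rest : j ≡ j′ → (+ d ∷ + c ∷ []) ℤX.≋ (+ d′ ∷ + c′ ∷ []) → (j , (a , b) , (c , d)) ≡ (j′ , (a , b) , (c′ , d′))
    same-rest refl h = cong₂ (λ c d → j , (a , b) , (c , d)) (ℤₚ.+-injective (ℤX.at h 1)) (ℤₚ.+-injective (ℤX.at h 0))

  -- The coefficients `a c` of `X ^ 3` and `b c` of `X` determine the ratio of `a` and `b`, hence by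
  -- coprimality both numbers; these determine the layer, and `family-injective` the rest.
  separated : ∀ {j j′ a b a′ b′ c c′ d d′} → InLayer j a b → InLayer j′ a′ b′ → 1 ≤ c → 1 ≤ c′ →
    family (+ a) (+ b) (+ d ∷ + c ∷ []) ≡ family (+ a′) (+ b′) (+ d′ ∷ + c′ ∷ []) → (j , (a , b) , (c , d)) ≡ (j′ , (a′ , b′) , (c′ , d′))
  separated {a = a} {b} {a′} {b′} {c} {c′} {d} {d′} l l′ 1≤c 1≤c′ e = same-pair {c = c} {c′} {d} {d′} l l′ e (proj₁ ratio) (proj₂ ratio)
    where
    ratio : a ≡ a′ × b ≡ b′
    ratio = ratio-from-products (InLayer.1≤a l) 1≤c 1≤c′ (InLayer.coprime l) (InLayer.coprime l′)
      (trans (sym (cubic-coef a b c d)) (trans (cong (λ P → ℤ.∣ ℤX.coef P 3 ∣) e) (cubic-coef a′ b′ c′ d′)))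
      (trans (sym (linear-coef a b c d)) (trans (cong (λ P → ℤ.∣ ℤX.coef P 1 ∣) e) (linear-coef a′ b′ c′ d′)))

  injective : ∀ {J x y} → x ∈ blocks J → y ∈ blocks J → F x ≡ F y → x ≡ y
  injective {J} {j , (a , b) , (c , d)} {j′ , (a′ , b′) , (c′ , d′)} m m′ e =
    separated {c = c} {c′} {d} {d′} (proj₁ (∈-blocks {J} m)) (proj₁ (∈-blocks {J} m′))
      (proj₁ (proj₁ (squareList-∈ {q j} {c} {d} (proj₂ (∈-blocks {J} m))))) (proj₁ (proj₁ (squareList-∈ {q j′} {c′} {d′} (proj₂ (∈-blocks {J} m′))))) e

  -- Counts the `j` with `2 j + 3 ≤ ⌊log₂ H ⌋`, that is with `8 * 4 ^ j ≤ H`. These are the layers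
  -- in which `q j` is at least 1.
  J : ℕ
  J = (⌊log₂ H ⌋ ∸ 1) ℕDivMod./ 2

  many : ∀ j → 8 * 4 ^ j ≤ H → H * H ≤ 256 * (3 * (4 ^ j * 4 ^ j) * length (squareList (q j)))
  many j l = begin
    H * H                                            ≤⟨ ℕₚ.*-mono-≤ h h ⟩
    (2 * D j * q j) * (2 * D j * q j)                ≡⟨ solve 2 (λ p q → (con 2 :* (con 2 :* (con 4 :* p)) :* q) :* (con 2 :* (con 2 :* (con 4 :* p)) :* q) := con 256 :* ((p :* p) :* (q :* q))) refl (4 ^ j) (q j) ⟩
    256 * ((4 ^ j * 4 ^ j) * (q j * q j))            ≤⟨ ℕₚ.*-monoʳ-≤ 256 (ℕₚ.*-monoˡ-≤ (q j * q j) (ℕₚ.m≤n*m (4 ^ j * 4 ^ j) 3)) ⟩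
    256 * (3 * (4 ^ j * 4 ^ j) * (q j * q j))        ≡⟨ cong (λ x → 256 * (3 * (4 ^ j * 4 ^ j) * x)) (length-squareList (q j)) ⟨
    256 * (3 * (4 ^ j * 4 ^ j) * length (squareList (q j))) ∎
    where
    open ℕₚ.≤-Reasoning
    open ℕSolver
    h : H ≤ 2 * D j * q j
    h = part-≥ (D j) {{D-nonZero j}} H (ℕₚ.≤-trans (ℕₚ.≤-reflexive (solve 1 (λ p → con 2 :* (con 4 :* p) := con 8 :* p) refl (4 ^ j))) l)

module _ (s L : ℕ) .{{_ : NonZero s}} where
  range-< : ∀ {j} → j < (L ∸ 1) ℕDivMod./ s → s * suc j < L
  range-< {j} l = below L (ℕₚ.≤-trans (ℕₚ.*-monoʳ-≤ s l) (ℕₚ.≤-trans (ℕₚ.≤-reflexive (ℕₚ.*-comm s _)) (ℕDivMod.m/n*n≤m (L ∸ 1) s)))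
    where
    below : ∀ L → s * suc j ≤ L ∸ 1 → s * suc j < L
    below zero l = contradiction l (ℕₚ.<⇒≱ (ℕₚ.*-mono-≤ (ℕ.>-nonZero⁻¹ s) (s≤s (z≤n {j}))))
    below (suc L) l = s≤s l

  range-≥ : L ≤ s * suc ((L ∸ 1) ℕDivMod./ s)
  range-≥ = above L
    where
    above : ∀ L → L ≤ s * suc ((L ∸ 1) ℕDivMod./ s)
    above zero = z≤n
    above (suc L) = ℕₚ.≤-trans (s≤s (ℕₚ.≤-reflexive (ℕDivMod.m≡m%n+[m/n]*n L s))) (ℕₚ.≤-trans (ℕₚ.+-monoˡ-≤ _ (ℕDivMod.m%n<n L s))
      (ℕₚ.≤-reflexive (trans (cong (λ x → s + x) (ℕₚ.*-comm _ s)) (sym (ℕₚ.*-suc s _)))))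

  range-double : 1 ≤ (L ∸ 1) ℕDivMod./ s → L ≤ 2 * s * ((L ∸ 1) ℕDivMod./ s)
  range-double 1≤J = begin
    L                ≤⟨ range-≥ ⟩
    s * suc J        ≤⟨ ℕₚ.*-monoʳ-≤ s (ℕₚ.+-monoˡ-≤ J 1≤J) ⟩
    s * (J + J)      ≡⟨ solve 2 (λ s j → s :* (j :+ j) := con 2 :* s :* j) refl s J ⟩
    2 * s * J        ∎
    where
    open ℕₚ.≤-Reasoning
    open ℕSolver
    J = (L ∸ 1) ℕDivMod./ s

power-≤ : ∀ H e → 1 ≤ H → e ≤ ⌊log₂ H ⌋ → 2 ^ e ≤ H
power-≤ H e 1≤H l = ℕₚ.≤-trans (ℕₚ.^-monoʳ-≤ 2 l) (log₂-≤ H 1≤H)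

small-log : ∀ H m → ⌊log₂ H ⌋ ≤ m → H ≤ 2 ^ suc m
small-log H m l = ℕₚ.≤-trans (ℕₚ.<⇒≤ (log₂-< H)) (ℕₚ.^-monoʳ-≤ 2 (s≤s l))

4^-2^ : ∀ j → 4 ^ j ≡ 2 ^ (j + j)
4^-2^ j = trans (*-^ j 2 2) (sym (ℕₚ.^-distribˡ-+-* 2 j j))

some-cubic : ∀ H → 2 ≤ H → 1 ≤ length (rStar 2 H)
some-cubic H 2≤H = lower-count 2 H (tt ∷ []) (λ _ → family (+ 1) (+ 1) (+ 1 ∷ + 1 ∷ [])) ([] ∷ [])
  (λ _ → family-member (+ 1) (+ 1) (λ ()) (λ ()) 1 H (+ 1 ∷ + 1 ∷ []) refl (λ ()) 2≤H (s≤s z≤n)) (λ _ _ _ → refl)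

lower-cubic : ∀ H → 2 ≤ H → growth 3 H ≤ 1024 * length (rStar 2 H)
lower-cubic H 2≤H = go J refl
  where
  open CubicFamily H
  open ℕₚ.≤-Reasoning
  open ℕSolver
  L = ⌊log₂ H ⌋
  N = length (rStar 2 H)
  1≤H = ℕₚ.≤-trans (s≤s z≤n) 2≤H
  count : length (blocks J) ≤ N
  count = lower-count 2 H (blocks J) F (blocks-unique J) (member {J}) (injective {J})
  fits : ∀ j → j < J → 8 * 4 ^ j ≤ H
  fits j l = ℕₚ.≤-trans (ℕₚ.≤-reflexive (trans (cong (8 *_) (4^-2^ j)) (sym (ℕₚ.^-distribˡ-+-* 2 3 (j + j)))))
    (power-≤ H (3 + (j + j)) 1≤H (ℕₚ.≤-trans (ℕₚ.≤-reflexive (solve 1 (λ j → con 3 :+ (j :+ j) := con 1 :+ con 2 :* (con 1 :+ j)) refl j)) (range-< 2 L l)))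
  total : J * (H * H) ≤ 256 * N
  total = ℕₚ.≤-trans (length-blocks (H * H) 256 J (λ j l → many j (fits j l))) (ℕₚ.*-monoʳ-≤ 256 count)
  go : ∀ J′ → J′ ≡ J → H ^ 2 * L ≤ 1024 * N
  -- Without any layer `⌊log₂ H ⌋` is at most 2 and `H` at most 8, so the growth function is at most
  -- 128 and a single member suffices.
  go zero e = begin
    H ^ 2 * L         ≤⟨ ℕₚ.*-mono-≤ (ℕₚ.^-monoˡ-≤ 2 (small-log H 2 L≤2)) L≤2 ⟩
    128               ≤⟨ ℕₚ.m≤m+n 128 896 ⟩
    1024 * 1          ≤⟨ ℕₚ.*-monoʳ-≤ 1024 (some-cubic H 2≤H) ⟩
    1024 * N          ∎
    where
    L≤2 : L ≤ 2
    L≤2 = subst (λ x → L ≤ 2 * suc x) (sym e) (range-≥ 2 L)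
  go (suc j) e = begin
    -- At least a quarter of `L` layers are available. Each contributes at least `H * H / 256`
    -- members, which gives `1024 = 4 * 256`.
    H ^ 2 * L               ≤⟨ ℕₚ.*-monoʳ-≤ (H ^ 2) (range-double 2 L (ℕₚ.≤-trans (s≤s z≤n) (ℕₚ.≤-reflexive e))) ⟩
    H ^ 2 * (2 * 2 * J)     ≡⟨ solve 2 (λ h j → (h :* (h :* con 1)) :* (con 2 :* con 2 :* j) := con 4 :* (j :* (h :* h))) refl H J ⟩
    4 * (J * (H * H))       ≤⟨ ℕₚ.*-monoʳ-≤ 4 total ⟩
    4 * (256 * N)           ≡⟨ ℕₚ.*-assoc 4 256 N ⟨
    1024 * N                ∎

-- The cofactor of `a ^ 2 X ^ 2 - b ^ 2` is the constant `c`, which does not show reducibility. The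
-- factorisation used is `(a X - b) (a c X + b c)`.
quadratic-member : ∀ H a b c → 1 ≤ a → 1 ≤ b → 1 ≤ c → (a * a + b * b) * c ≤ H →
  Member 2 H (family (+ a ℤ.* + a) (ℤ.- (+ b ℤ.* + b)) (+ c ∷ []))
quadratic-member H a b c 1≤a 1≤b 1≤c bound = memberWith A B (ℤ-nonzero-* (+-nonzero 1≤a) (+-nonzero 1≤a)) nB 0 H (+ c ∷ []) refl (+-nonzero 1≤c) bound′
    (ℤ.- + b ∷ + a ∷ []) (+ b ℤ.* + c ∷ + a ℤ.* + c ∷ []) (ℤX.pointwise equal)
    (1 , s≤s z≤n , +-nonzero 1≤a) (1 , s≤s z≤n , ℤ-nonzero-* (+-nonzero 1≤a) (+-nonzero 1≤c))
  where
  A = + a ℤ.* + a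
  B = ℤ.- (+ b ℤ.* + b)
  open ℤSolver
  nB : B ≢ + 0
  nB z = ℤ-nonzero-* (+-nonzero 1≤b) (+-nonzero 1≤b) (trans (sym (ℤₚ.neg-involutive (+ b ℤ.* + b))) (cong ℤ.-_ z))
  bound′ : (ℤ.∣ A ∣ + ℤ.∣ B ∣) * (c ⊔ 0) ≤ H
  bound′ = ℕₚ.≤-trans (ℕₚ.≤-reflexive (cong₂ _*_ (cong₂ _+_ (ℤₚ.abs-* (+ a) (+ a)) (trans (ℤₚ.∣-i∣≡∣i∣ (+ b ℤ.* + b)) (ℤₚ.abs-* (+ b) (+ b)))) (ℕₚ.⊔-identityʳ c))) bound
  equal : ∀ i → ℤX.coef (family A B (+ c ∷ [])) i ≡ ℤX.coef ((ℤ.- + b ∷ + a ∷ []) ℤX.⊠ (+ b ℤ.* + c ∷ + a ℤ.* + c ∷ [])) i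
  equal 0 = trans (coef-family-0 A B (+ c ∷ [])) (solve 2 (λ b c → (:- (b :* b)) :* c := (:- b) :* (b :* c) :+ con (+ 0)) refl (+ b) (+ c))
  equal 1 = trans (coef-family-1 A B (+ c ∷ [])) (solve 3 (λ a b c → (:- (b :* b)) :* con (+ 0) := (:- b) :* (a :* c) :+ (a :* (b :* c) :+ con (+ 0))) refl (+ a) (+ b) (+ c))
  equal 2 = trans (coef-family-2+ A B (+ c ∷ []) 0) (solve 3 (λ a b c → (:- (b :* b)) :* con (+ 0) :+ (a :* a) :* c := a :* (a :* c)) refl (+ a) (+ b) (+ c))
  equal (suc (suc (suc i))) = trans (coef-family-2+ A B (+ c ∷ []) (suc i)) (solve 2 (λ a b → (:- (b :* b)) :* con (+ 0) :+ (a :* a) :* con (+ 0) := con (+ 0)) refl (+ a) (+ b))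

module QuadraticFamily (H : ℕ) where
  D : ℕ → ℕ
  D j = 2 * (4 ^ suc j * 4 ^ suc j)

  D-nonZero : ∀ j → NonZero (D j)
  D-nonZero j = ℕₚ.m*n≢0 2 (4 ^ suc j * 4 ^ suc j) {{_}} {{ℕₚ.m*n≢0 (4 ^ suc j) (4 ^ suc j) {{ℕₚ.m^n≢0 4 (suc j)}} {{ℕₚ.m^n≢0 4 (suc j)}}}}

  q : ℕ → ℕ
  q j = part (D j) {{D-nonZero j}} H

  open Layered (λ j → from1To (q j)) (λ j → from1To-unique (q j)) public

  F : ℕ × (ℕ × ℕ) × ℕ → List ℤ
  F (j , (a , b) , c) = family (+ a ℤ.* + a) (ℤ.- (+ b ℤ.* + b)) (+ c ∷ [])

  member : ∀ {J x} → x ∈ blocks J → Member 2 H (F x)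
  member {J} {j , (a , b) , c} m with ∈-blocks {J} m
  ... | l , c∈ with from1To-∈ {q j} c∈
  ... | 1≤c , c≤ = quadratic-member H a b c 1≤a 1≤b 1≤c
      (ℕₚ.≤-trans (ℕₚ.*-mono-≤ (ℕₚ.≤-trans (ℕₚ.+-mono-≤ (ℕₚ.*-mono-≤ a≤ a≤) (ℕₚ.*-mono-≤ b≤ b≤)) (ℕₚ.≤-reflexive (cong (λ x → 4 ^ suc j * 4 ^ suc j + x) (sym (ℕₚ.+-identityʳ _))))) c≤)
        (part-≤ (D j) {{D-nonZero j}} H))
    where open InLayer l

  top-coef : ∀ a b c → ℤ.∣ ℤX.coef (family (+ a ℤ.* + a) (ℤ.- (+ b ℤ.* + b)) (+ c ∷ [])) 2 ∣ ≡ (a * a) * c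
  top-coef a b c = trans (cong ℤ.∣_∣ (trans (coef-family-2+ (+ a ℤ.* + a) (ℤ.- (+ b ℤ.* + b)) (+ c ∷ []) 0)
      (trans (cong (ℤ._+ (+ a ℤ.* + a) ℤ.* + c) (ℤₚ.*-zeroʳ (ℤ.- (+ b ℤ.* + b)))) (ℤₚ.+-identityˡ ((+ a ℤ.* + a) ℤ.* + c)))))
    (trans (ℤₚ.abs-* (+ a ℤ.* + a) (+ c)) (cong (_* c) (ℤₚ.abs-* (+ a) (+ a))))

  constant-coef : ∀ a b c → ℤ.∣ ℤX.coef (family (+ a ℤ.* + a) (ℤ.- (+ b ℤ.* + b)) (+ c ∷ [])) 0 ∣ ≡ (b * b) * c
  constant-coef a b c = trans (cong ℤ.∣_∣ (coef-family-0 (+ a ℤ.* + a) (ℤ.- (+ b ℤ.* + b)) (+ c ∷ [])))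
    (trans (ℤₚ.abs-* (ℤ.- (+ b ℤ.* + b)) (+ c)) (cong (_* c) (trans (ℤₚ.∣-i∣≡∣i∣ (+ b ℤ.* + b)) (ℤₚ.abs-* (+ b) (+ b)))))

  ratio-from-squares : ∀ {a b a′ b′ c c′} → 1 ≤ c → 1 ≤ c′ → (a * a) * c ≡ (a′ * a′) * c′ → (b * b) * c ≡ (b′ * b′) * c′ → a * b′ ≡ a′ * b
  ratio-from-squares {a} {b} {a′} {b′} {c} {c′} 1≤c 1≤c′ e₂ e₀ = ^-injective 2 (s≤s z≤n) (trans (cong ((a * b′) *_) (ℕₚ.*-identityʳ (a * b′))) (trans
      (ℕₚ.*-cancelʳ-≡ ((a * b′) * (a * b′)) ((a′ * b) * (a′ * b)) (c * c′) {{ℕ.>-nonZero (ℕₚ.*-mono-≤ 1≤c 1≤c′)}} squares)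
      (cong ((a′ * b) *_) (sym (ℕₚ.*-identityʳ (a′ * b))))))
    where
    open ℕSolver
    squares : ((a * b′) * (a * b′)) * (c * c′) ≡ ((a′ * b) * (a′ * b)) * (c * c′)
    squares = trans (solve 4 (λ a b c d → ((a :* b) :* (a :* b)) :* (c :* d) := ((a :* a) :* c) :* ((b :* b) :* d)) refl a b′ c c′)
      (trans (cong₂ _*_ e₂ (sym e₀)) (solve 4 (λ a b c d → ((a :* a) :* d) :* ((b :* b) :* c) := ((a :* b) :* (a :* b)) :* (c :* d)) refl a′ b c c′))

  same-pair : ∀ {j j′ a b a′ b′ c c′} → InLayer j a b → InLayer j′ a′ b′ →
    family (+ a ℤ.* + a) (ℤ.- (+ b ℤ.* + b)) (+ c ∷ []) ≡ family (+ a′ ℤ.* + a′) (ℤ.- (+ b′ ℤ.* + b′)) (+ c′ ∷ []) →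
    a ≡ a′ → b ≡ b′ → (j , (a , b) , c) ≡ (j′ , (a′ , b′) , c′)
  same-pair {j} {j′} {a} {b} {c = c} {c′} l l′ e refl refl = same-rest (layer-unique-index l l′)
      (family-injective (+ a ℤ.* + a) (ℤ.- (+ b ℤ.* + b)) nB (+ c ∷ []) (+ c′ ∷ []) e)
    where
    nB : ℤ.- (+ b ℤ.* + b) ≢ + 0
    nB z = ℤ-nonzero-* (+-nonzero (InLayer.1≤b l)) (+-nonzero (InLayer.1≤b l)) (trans (sym (ℤₚ.neg-involutive (+ b ℤ.* + b))) (cong ℤ.-_ z))
    same-rest : j ≡ j′ → (+ c ∷ []) ℤX.≋ (+ c′ ∷ []) → (j , (a , b) , c) ≡ (j′ , (a , b) , c′)
    same-rest refl h = cong (λ c → j , (a , b) , c) (ℤₚ.+-injective (ℤX.at h 0))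

  separated : ∀ {j j′ a b a′ b′ c c′} → InLayer j a b → InLayer j′ a′ b′ → 1 ≤ c → 1 ≤ c′ →
    family (+ a ℤ.* + a) (ℤ.- (+ b ℤ.* + b)) (+ c ∷ []) ≡ family (+ a′ ℤ.* + a′) (ℤ.- (+ b′ ℤ.* + b′)) (+ c′ ∷ []) → (j , (a , b) , c) ≡ (j′ , (a′ , b′) , c′)
  separated {a = a} {b} {a′} {b′} {c} {c′} l l′ 1≤c 1≤c′ e = same-pair {c = c} {c′} l l′ e (proj₁ ratio) (proj₂ ratio)
    where
    ratio : a ≡ a′ × b ≡ b′
    ratio = coprime-ratio (InLayer.1≤a l) (InLayer.coprime l) (InLayer.coprime l′) (ratio-from-squares {a} {b} {a′} {b′} 1≤c 1≤c′
      (trans (sym (top-coef a b c)) (trans (cong (λ P → ℤ.∣ ℤX.coef P 2 ∣) e) (top-coef a′ b′ c′)))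
      (trans (sym (constant-coef a b c)) (trans (cong (λ P → ℤ.∣ ℤX.coef P 0 ∣) e) (constant-coef a′ b′ c′))))

  injective : ∀ {J x y} → x ∈ blocks J → y ∈ blocks J → F x ≡ F y → x ≡ y
  injective {J} {j , (a , b) , c} {j′ , (a′ , b′) , c′} m m′ e =
    separated {c = c} {c′} (proj₁ (∈-blocks {J} m)) (proj₁ (∈-blocks {J} m′)) (proj₁ (from1To-∈ {q j} {c} (proj₂ (∈-blocks {J} m)))) (proj₁ (from1To-∈ {q j′} {c′} (proj₂ (∈-blocks {J} m′)))) e

  -- Now the squares of `a` and `b` enter, so the condition `D j ≤ H` reads `2 ^ (4 j + 5) ≤ H`, and
  -- only about a quarter of `⌊log₂ H ⌋` layers can be used.
  J : ℕ
  J = (⌊log₂ H ⌋ ∸ 1) ℕDivMod./ 4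

  many : ∀ j → 32 * (4 ^ j * 4 ^ j) ≤ H → H ≤ 64 * (3 * (4 ^ j * 4 ^ j) * length (from1To (q j)))
  many j l = begin
    H                                                ≤⟨ part-≥ (D j) {{D-nonZero j}} H (ℕₚ.≤-trans (ℕₚ.≤-reflexive (solve 1 (λ p → con 2 :* ((con 4 :* p) :* (con 4 :* p)) := con 32 :* (p :* p)) refl (4 ^ j))) l) ⟩
    2 * D j * q j                                    ≡⟨ solve 2 (λ p q → con 2 :* (con 2 :* ((con 4 :* p) :* (con 4 :* p))) :* q := con 64 :* ((p :* p) :* q)) refl (4 ^ j) (q j) ⟩
    64 * ((4 ^ j * 4 ^ j) * q j)                     ≤⟨ ℕₚ.*-monoʳ-≤ 64 (ℕₚ.*-monoˡ-≤ (q j) (ℕₚ.m≤n*m (4 ^ j * 4 ^ j) 3)) ⟩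
    64 * (3 * (4 ^ j * 4 ^ j) * q j)                 ≡⟨ cong (λ x → 64 * (3 * (4 ^ j * 4 ^ j) * x)) (length-from1To (q j)) ⟨
    64 * (3 * (4 ^ j * 4 ^ j) * length (from1To (q j))) ∎
    where
    open ℕₚ.≤-Reasoning
    open ℕSolver

some-quadratic : ∀ H → 2 ≤ H → 1 ≤ length (rStar 1 H)
some-quadratic H 2≤H = lower-count 1 H (tt ∷ []) (λ _ → family (+ 1 ℤ.* + 1) (ℤ.- (+ 1 ℤ.* + 1)) (+ 1 ∷ [])) ([] ∷ [])
  (λ _ → quadratic-member H 1 1 1 (s≤s z≤n) (s≤s z≤n) (s≤s z≤n) 2≤H) (λ _ _ _ → refl)

lower-quadratic : ∀ H → 2 ≤ H → growth 2 H ≤ 512 * length (rStar 1 H)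
lower-quadratic H 2≤H = go J refl
  where
  open QuadraticFamily H
  open ℕₚ.≤-Reasoning
  open ℕSolver
  L = ⌊log₂ H ⌋
  N = length (rStar 1 H)
  1≤H = ℕₚ.≤-trans (s≤s z≤n) 2≤H
  count : length (blocks J) ≤ N
  count = lower-count 1 H (blocks J) F (blocks-unique J) (member {J}) (injective {J})
  fits : ∀ j → j < J → 32 * (4 ^ j * 4 ^ j) ≤ H
  fits j l = ℕₚ.≤-trans (ℕₚ.≤-reflexive (trans (cong (λ x → 32 * (x * x)) (4^-2^ j)) (trans (cong (32 *_) (sym (ℕₚ.^-distribˡ-+-* 2 (j + j) (j + j)))) (sym (ℕₚ.^-distribˡ-+-* 2 5 ((j + j) + (j + j)))))))
    (power-≤ H (5 + ((j + j) + (j + j))) 1≤H (ℕₚ.≤-trans (ℕₚ.≤-reflexive (solve 1 (λ j → con 5 :+ ((j :+ j) :+ (j :+ j)) := con 1 :+ con 4 :* (con 1 :+ j)) refl j)) (range-< 4 L l)))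
  total : J * H ≤ 64 * N
  total = ℕₚ.≤-trans (length-blocks H 64 J (λ j l → many j (fits j l))) (ℕₚ.*-monoʳ-≤ 64 count)
  go : ∀ J′ → J′ ≡ J → H * L ≤ 512 * N
  -- No layer means `⌊log₂ H ⌋ ≤ 4` and `H ≤ 32`, where the polynomial `X ^ 2 - 1` alone is enough.
  go zero e = begin
    H * L             ≤⟨ ℕₚ.*-mono-≤ (small-log H 4 L≤4) L≤4 ⟩
    128               ≤⟨ ℕₚ.m≤m+n 128 384 ⟩
    512 * 1           ≤⟨ ℕₚ.*-monoʳ-≤ 512 (some-quadratic H 2≤H) ⟩
    512 * N           ∎
    where
    L≤4 : L ≤ 4
    L≤4 = subst (λ x → L ≤ 4 * suc x) (sym e) (range-≥ 4 L)
  go (suc j) e = begin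
    H * L                   ≤⟨ ℕₚ.*-monoʳ-≤ H (range-double 4 L (ℕₚ.≤-trans (s≤s z≤n) (ℕₚ.≤-reflexive e))) ⟩
    H * (2 * 4 * J)         ≡⟨ solve 2 (λ h j → h :* (con 2 :* con 4 :* j) := con 8 :* (j :* h)) refl H J ⟩
    8 * (J * H)             ≤⟨ ℕₚ.*-monoʳ-≤ 8 total ⟩
    8 * (64 * N)            ≡⟨ ℕₚ.*-assoc 8 64 N ⟨
    512 * N                 ∎

positiveWords : ℕ → ℕ → List (List ℤ)
positiveWords q zero = [] ∷ []
positiveWords q (suc w) = Data.List.cartesianProductWith _∷_ (map +_ (from1To q)) (positiveWords q w)

positiveWords-unique : ∀ q w → Unique (positiveWords q w)
positiveWords-unique q zero = [] ∷ []
positiveWords-unique q (suc w) = Uniqueₚ.cartesianProductWith⁺ _∷_ Listₚ.∷-injective (Uniqueₚ.map⁺ ℤₚ.+-injective (from1To-unique q)) (positiveWords-unique q w)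

length-positiveWords : ∀ q w → length (positiveWords q w) ≡ q ^ w
length-positiveWords q zero = refl
length-positiveWords q (suc w) = trans (length-cartesianProductWith _∷_ (map +_ (from1To q)) (positiveWords q w))
  (cong₂ _*_ (trans (Listₚ.length-map +_ (from1To q)) (length-from1To q)) (length-positiveWords q w))

positiveWords-∈ : ∀ q w {h} → h ∈ positiveWords q w → length h ≡ w × height h ≤ q × (∀ i → i < w → ℤX.coef h i ≢ + 0)
positiveWords-∈ q zero (here refl) = refl , z≤n , λ _ ()
positiveWords-∈ q (suc w) m with ∈ₚ.∈-cartesianProductWith⁻ _∷_ (map +_ (from1To q)) (positiveWords q w) m
... | _ , h , c∈ , h∈ , refl with ∈ₚ.∈-map⁻ +_ c∈ | positiveWords-∈ q w h∈
... | c , c∈′ , refl | l , b , nz with from1To-∈ {q} c∈′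
... | 1≤c , c≤ = cong suc l , ℕₚ.⊔-lub c≤ b , λ { zero _ → +-nonzero 1≤c ; (suc i) (s≤s l) → nz i l }

-- Multiplication by `X ^ 2 + 1` at most doubles the height, so the `n - 1` coefficients of the
-- cofactor may range up to `H / 2`. Rounding costs another factor 2, hence the base 4 of the
-- constant.
lower-higher : ∀ m H → 2 ≤ H → H ^ suc (suc (suc m)) ≤ 4 ^ suc (suc (suc m)) * length (rStar (suc (suc (suc m))) H)
lower-higher m H 2≤H = begin
  H ^ w                               ≤⟨ ℕₚ.^-monoˡ-≤ w (part-≥ 2 H 2≤H) ⟩
  (4 * q) ^ w                         ≡⟨ *-^ w 4 q ⟩
  4 ^ w * q ^ w                       ≡⟨ cong (4 ^ w *_) (length-positiveWords q w) ⟨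
  4 ^ w * length (positiveWords q w)  ≤⟨ ℕₚ.*-monoʳ-≤ (4 ^ w) (lower-count (suc (suc (suc m))) H (positiveWords q w) (family (+ 1) (+ 1)) (positiveWords-unique q w) member injective) ⟩
  4 ^ w * length (rStar w H)          ∎
  where
  open ℕₚ.≤-Reasoning
  w = suc (suc (suc m))
  q = part 2 H
  member : ∀ {h} → h ∈ positiveWords q w → Member (suc w) H (family (+ 1) (+ 1) h)
  member {h} i with positiveWords-∈ q w i
  ... | l , b , nz = family-member (+ 1) (+ 1) (λ ()) (λ ()) (suc (suc m)) H h l (nz (suc (suc m)) ℕₚ.≤-refl)
    (ℕₚ.≤-trans (ℕₚ.*-monoʳ-≤ 2 b) (part-≤ 2 H)) (s≤s z≤n)
  injective : ∀ {h g} → h ∈ positiveWords q w → g ∈ positiveWords q w → family (+ 1) (+ 1) h ≡ family (+ 1) (+ 1) g → h ≡ g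
  injective {h} {g} i j e = list-extensional h g (trans (proj₁ (positiveWords-∈ q w i)) (sym (proj₁ (positiveWords-∈ q w j)))) (family-injective (+ 1) (+ 1) (λ ()) h g e)

two-sided : ∀ k (g : ℕ → ℕ) c C → 1 ≤ c →
  (∀ H → 2 ≤ H → g H ≤ c * length (rStar k H)) → (∀ H → 2 ≤ H → length (rStar k H) ≤ C * g H) →
  Σ ℕ λ c → Σ ℕ λ C → NonZero c × NonZero C ×
    ((H : ℕ) → 2 ≤ H → Σ ℕ λ N → RStarIs (suc k) H N × (g H ≤ c * N) × (N ≤ C * g H))
two-sided k g c C 1≤c lower upper = c , suc C , ℕ.>-nonZero 1≤c , _ , λ H 2≤H →
  length (rStar k H) , rStar-count k H , lower H 2≤H , ℕₚ.≤-trans (upper H 2≤H) (ℕₚ.m≤n+m (C * g H) (g H))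

theorem5p2 : (n : ℕ) → 2 ≤ n →
    Σ ℕ λ c → Σ ℕ λ C → NonZero c × NonZero C ×
    ((H : ℕ) → 2 ≤ H →
    Σ ℕ λ N → RStarIs n H N ×
    (growth n H ≤ c * N) × (N ≤ C * growth n H))
theorem5p2 1 (s≤s ())
theorem5p2 2 _ = two-sided 1 (growth 2) 512 64 (s≤s z≤n) lower-quadratic Degree2.upper-quadratic
theorem5p2 3 _ = two-sided 2 (growth 3) 1024 (proj₁ upper-cubic) (s≤s z≤n) lower-cubic (proj₂ upper-cubic)
theorem5p2 (suc (suc (suc (suc m)))) _ = two-sided (suc (suc (suc m))) (growth (suc (suc (suc (suc m)))))
  (4 ^ suc (suc (suc m))) (proj₁ (upper-higher m)) (ℕₚ.m^n>0 4 (suc (suc (suc m)))) (lower-higher m) (proj₂ (upper-higher m))
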